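{- Let $m\ge 2$ be an even integer and let $r$ be a positive integer with $r<m/2$ and $\gcd(r,m)=1$. For $b,c\in\mathbb{F}_{2^m}$ define $f_{b,c,r}:\mathbb{F}_{2^m}\times\mathbb{F}_{2^m}\to\mathbb{F}_{2^m}\times\mathbb{F}_{2^m}$ by \[ f_{b,c,r}(x,y)=\big(xy,\; x^{2^r+1}+x^{2^{r+m/2}}y^{2^{m/2}}+bxy^{2^r}+cy^{2^r+1}\big). \] Then: (1) for any $b\in\mathbb{F}_{2^m}$, any $c\in\mathbb{F}_{2^m}^*$, and any such $r$ with $r<m/8-1$, the function $f_{b,c,r}$ is not APN; (2) for any $b\in\mathbb{F}_{2^m}^*$ and any such $r$ (i.e. $r<m/2$, $\gcd(r,m)=1$), the function $f_{b,0,r}$ is not APN.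
   Context: A function $f:V\to V$, where $V=\mathbb{F}_{2^m}\times\mathbb{F}_{2^m}$ (a vector space over $\mathbb{F}_2$, addition componentwise), is called almost perfect nonlinear (APN) if for every nonzero $a\in V$ and every $\beta\in V$ the equation $f(z+a)+f(z)=\beta$ has at most two solutions $z\in V$. -}

module Defs where

open import Level using (Level; _⊔_) renaming (suc to lsuc)
open import Data.Nat using (ℕ; zero; suc)
import Data.Nat as ℕ
open import Data.Fin using (Fin)
open import Data.Product using (_×_; _,_; ∃)
open import Data.Sum using (_⊎_)
open import Relation.Nullary using (¬_)
open import Relation.Binary.PropositionalEquality as ≡ using (_≡_)
open import Function.Bundles using (Inverse)
open import Algebra.Bundles using (CommutativeRing)

-- A finite field with exactly q elements: a commutative ring in which
-- 0 ≉ 1 and every nonzero element has a multiplicative inverse, together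
-- with a bijection (setoid inverse) between Fin q and the carrier.
-- A field with 2 ^ m elements is (a copy of) F_{2^m}.
record FiniteField (c ℓ : Level) (q : ℕ) : Set (lsuc (c ⊔ ℓ)) where
  field
    commRing : CommutativeRing c ℓ
  open CommutativeRing commRing public
  field
    0≉1     : ¬ (0# ≈ 1#)
    inverse : ∀ x → ¬ (x ≈ 0#) → ∃ λ y → (x * y) ≈ 1#
    card    : Inverse (≡.setoid (Fin q)) setoid

  pow : Carrier → ℕ → Carrier
  pow x zero    = 1#
  pow x (suc n) = x * pow x n

  V : Set c
  V = Carrier × Carrier

  _≈V_ : V → V → Set ℓ
  (x₁ , y₁) ≈V (x₂ , y₂) = (x₁ ≈ x₂) × (y₁ ≈ y₂)

  _+V_ : V → V → V
  (x₁ , y₁) +V (x₂ , y₂) = (x₁ + x₂ , y₁ + y₂)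

  0V : V
  0V = (0# , 0#)

  -- f is APN: for every nonzero a and every β, the equation
  -- f (z + a) + f z = β has at most two solutions z, i.e. among any
  -- three solutions two coincide.
  APN : (V → V) → Set (c ⊔ ℓ)
  APN f = ∀ (a : V) → ¬ (a ≈V 0V) → ∀ (β z₁ z₂ z₃ : V)
        → (f (z₁ +V a) +V f z₁) ≈V β
        → (f (z₂ +V a) +V f z₂) ≈V β
        → (f (z₃ +V a) +V f z₃) ≈V β
        → (z₁ ≈V z₂) ⊎ (z₁ ≈V z₃) ⊎ (z₂ ≈V z₃)

  -- f_{b,c,r}(x,y) = (xy, x^{2^r+1} + x^{2^{r+k}} y^{2^k} + b x y^{2^r} + c y^{2^r+1})
  -- where k = m/2.
  fbcr : (k : ℕ) (b c' : Carrier) (r : ℕ) → V → V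
  fbcr k b c' r (x , y) =
    ( x * y
    , pow x (2 ℕ.^ r ℕ.+ 1) + pow x (2 ℕ.^ (r ℕ.+ k)) * pow y (2 ℕ.^ k)
      + b * x * pow y (2 ℕ.^ r) + c' * pow y (2 ℕ.^ r ℕ.+ 1) )

{-# OPTIONS --safe #-}
-- Put q = 2^r, Q = 2^k, P(u) = u^(q+1) + b·u + c, let P̄ be the conjugate of P under x ↦ x^Q, and f(u,v) = P(u)·P̄(v) + u^q·v^q.
-- For c = 0 the function vanishes on {0} × F. For c ≠ 0, a zero u of f(u,u^Q) yields three multiples of (u,1) that violate
-- the APN property, so it remains to find such a u, a Weil-type statement about the curve f = 0.
-- Suppose that h(v) = f(v^Q,v) has no zero in F, and write Q = R·R′ with R = 4q². Linear algebra among the functions on the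
-- conjugate curve with coordinates (u^R′,v^R′) gives a nonzero W(u,v) = ∑ w_ijβα·u^(R′i+β)·v^(R′α+j) of small bidegree with
-- (v + v^(Q²))·W(v^Q,v) ≡ 0 modulo h. Some T ≠ 0 of u-degree at most q makes T·W ≡ ρ(v) modulo f; comparing the degree of the
-- cofactor of h with its number of zeros forces ρ = 0, so W vanishes on the curve, in particular on the branch
-- u = π + t^q·(…), v = t at a root π of P. There W is a combination ∑ γ_jβ^R′·u^β·t^j of R′-th powers, and descent on the order
-- in t makes all γ_jβ, hence all coefficients of W, vanish.
module Submission where

open import Defs
open import Level using (Level; _⊔_) renaming (suc to lsuc)
open import Algebra.Bundles using (CommutativeRing; RawRing)
open import Algebra.Solver.Ring.AlmostCommutativeRing using (fromCommutativeRing; _-Raw-AlmostCommutative⟶_)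
open import Data.Bool using (Bool; true; false; _xor_; _∧_)
open import Data.Empty using (⊥; ⊥-elim)
open import Data.Fin as Fin using (Fin; punchIn; finToFun; funToFin; combine; fromℕ<; toℕ)
open import Data.Fin.Permutation using (permutation)
open import Data.List using (List; []; _∷_; length; map)
open import Data.Maybe using (Maybe; just; nothing)
open import Data.Nat as ℕ using (ℕ; zero; suc; _<_; _≤_; z≤n; s≤s; s<s; z<s)
open import Data.Nat.DivMod using (_/_; _%_; [m+kn]%n≡m%n; m<n⇒m%n≡m; +-distrib-/-∣ˡ; m*n/n≡m; m<n⇒m/n≡0)
open import Data.Nat.Divisibility using (n∣m*n)
open import Data.Nat.GCD using (gcd; gcd-GCD; module Bézout)
open import Data.Nat.Induction using (<-rec)
open import Data.Nat.Solver using (module +-*-Solver)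
open import Data.Product using (_×_; _,_; proj₁; proj₂; ∃; ∃₂)
open import Data.Sum using (_⊎_; inj₁; inj₂; [_,_]′)
open import Data.Vec.Functional using (replicate)
open import Function using (id; _∘_; _$_; Inverse)
open import Relation.Binary using (Rel; IsEquivalence; tri<; tri≈; tri>)
open import Relation.Binary.PropositionalEquality as ≡ using (_≡_)
open import Relation.Nullary using (¬_; yes; no; Dec)
open import Relation.Nullary.Decidable using (map′)
import Algebra.Properties.CommutativeMonoid.Sum
import Algebra.Properties.CommutativeSemiring.Exp
import Algebra.Properties.Semiring.Mult
import Algebra.Solver.Ring
import Data.Fin.Properties as Fin
import Data.Nat.Properties as ℕ
import Relation.Binary.Reasoning.Setoid

-- `W` comes from a division. On h = 0 put u = v^Q. The polynomial f(u,X) in X has the root v and,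
-- by conjugating that equation, the root u^Q = v^(Q²). Its quotient by X - u^Q, evaluated at v, is
-- therefore killed by v + v^(Q²). The coefficients of this quotient contain powers of u^(-Q) =
-- (u^R′)^(-R); multiplied by powers of P they stay polynomial on the conjugate curve, and a free
-- factor on that curve supplies the unknowns. In place of irreducibility, the argument rests on the
-- fact that a nonzero polynomial of degree at most q in u, or at most q in v, does not vanish on
-- the branch. The constants: the count of unknowns needs (q+1)(2q+1) < R and the descent needs R′ ≥
-- 5q² + 2q. The choices R = 4q² and R′ ≥ 8q² ask for k ≥ 4r + 5, which is the hypothesis r < m/8 -
-- 1. The root π lives in a quotient K[u]/ϖ whose equality is doubly negated, so equality is only
-- stable and inverses exist up to double negation; the goal is a negation, so nothing is lost.

record CR2 (c ℓ : Level) : Set (lsuc (c ⊔ ℓ)) where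
  field
    ring₀ : CommutativeRing c ℓ
  open CommutativeRing ring₀ public using
    ( Carrier; _≈_; _+_; _*_; -_; 0#; 1#; refl; sym; trans; reflexive; isEquivalence; setoid
    ; +-cong; +-congˡ; +-congʳ; +-assoc; +-comm; +-identityˡ; +-identityʳ; -‿inverseˡ
    ; *-cong; *-congˡ; *-congʳ; *-assoc; *-comm; *-identityˡ; *-identityʳ; zeroˡ; zeroʳ
    ; distribˡ; distribʳ; commutativeSemiring )
  field
    two : 1# + 1# ≈ 0#

-- Negation is taken to be the identity, so both inverse laws and 1 + 1 = 0 become instances of x +
-- x = 0, and commutativity halves the remaining laws.
mkCR2 : ∀ {c ℓ} (A : Set c) (_≈_ : Rel A ℓ) (_+_ _*_ : A → A → A) (0# 1# : A) →
  IsEquivalence _≈_ →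
  (∀ {x y u v} → x ≈ y → u ≈ v → (x + u) ≈ (y + v)) →
  (∀ {x y u v} → x ≈ y → u ≈ v → (x * u) ≈ (y * v)) →
  (∀ x y z → ((x + y) + z) ≈ (x + (y + z))) → (∀ x y → (x + y) ≈ (y + x)) →
  (∀ x → (0# + x) ≈ x) → (∀ x → (x + x) ≈ 0#) →
  (∀ x y z → ((x * y) * z) ≈ (x * (y * z))) → (∀ x y → (x * y) ≈ (y * x)) →
  (∀ x → (1# * x) ≈ x) → (∀ x y z → (x * (y + z)) ≈ ((x * y) + (x * z))) →
  CR2 c ℓ
mkCR2 A _≈_ _+_ _*_ 0# 1# eq +c *c +a +m +i self *a *m *i dl = record
  { ring₀ = record { Carrier = A ; _≈_ = _≈_ ; _+_ = _+_ ; _*_ = _*_ ; -_ = id ; 0# = 0# ; 1# = 1#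
    ; isCommutativeRing = record
      { isRing = record
        { +-isAbelianGroup = record
          { isGroup = record
            { isMonoid = record
              { isSemigroup = record
                { isMagma = record { isEquivalence = eq ; ∙-cong = +c } ; assoc = +a }
              ; identity = +i , λ x → trans (+m x 0#) (+i x) }
            ; inverse = self , self ; ⁻¹-cong = id }
          ; comm = +m }
        ; *-cong = *c ; *-assoc = *a
        ; *-identity = *i , λ x → trans (*m x 1#) (*i x)
        ; distrib = dl , λ x y z → trans (*m (y + z) x) (trans (dl x y z) (+c (*m x y) (*m x z))) }
      ; *-comm = *m } }
  ; two = self 1# }
  where open IsEquivalence eq

-- A solver for identities over 𝔽₂, and the identities themselves

Bool-raw : RawRing _ _
Bool-raw = record { Carrier = Bool ; _≈_ = _≡_ ; _+_ = _xor_ ; _*_ = _∧_ ; -_ = id ; 0# = false ; 1# = true }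

module Solver {c ℓ} (R : CR2 c ℓ) where
  open CR2 R

  private
    self : ∀ x → x + x ≈ 0#
    self x = trans (+-cong (sym (*-identityʳ x)) (sym (*-identityʳ x)))
               (trans (sym (distribˡ x 1# 1#)) (trans (*-congˡ two) (zeroʳ x)))

    neg : ∀ x → - x ≈ x
    neg x = trans (sym (+-identityʳ (- x))) (trans (+-congˡ (sym (self x)))
              (trans (sym (+-assoc (- x) x x)) (trans (+-congʳ (-‿inverseˡ x)) (+-identityˡ x))))

  -- the solver with coefficients in 𝔽₂, so that x + x = 0 is built in
  private
    ⟦_⟧b : Bool → Carrier
    ⟦ false ⟧b = 0#
    ⟦ true ⟧b = 1#

    +-h : ∀ a b → ⟦ a xor b ⟧b ≈ ⟦ a ⟧b + ⟦ b ⟧b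
    +-h false b = sym (+-identityˡ _)
    +-h true false = sym (+-identityʳ _)
    +-h true true = sym two

    *-h : ∀ a b → ⟦ a ∧ b ⟧b ≈ ⟦ a ⟧b * ⟦ b ⟧b
    *-h false b = sym (zeroˡ _)
    *-h true b = sym (*-identityˡ _)

    mor : Bool-raw -Raw-AlmostCommutative⟶ fromCommutativeRing ring₀
    mor = record { ⟦_⟧ = ⟦_⟧b ; +-homo = +-h ; *-homo = *-h
                 ; -‿homo = λ a → sym (neg _) ; 0-homo = refl ; 1-homo = refl }

  private
    _≟b_ : ∀ a b → Maybe (⟦ a ⟧b ≈ ⟦ b ⟧b)
    false ≟b false = just refl
    true ≟b true = just refl
    _ ≟b _ = nothing

    module Sol = Algebra.Solver.Ring Bool-raw (fromCommutativeRing ring₀) mor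
      _≟b_
  open Sol public using (Polynomial; solve; _:=_; _:+_; _:*_)

  :0 :1 : ∀ {n} → Polynomial n
  :0 = Sol.con false
  :1 = Sol.con true

-- Stated over an arbitrary ring of characteristic two, because the same identities are wanted in K,
-- in K[u], in K[u][v], in power series and in quotients.
module Ids {κ ℓ} (R : CR2 κ ℓ) where
  open CR2 R
  open Solver R

  id1 : ∀ x0 x1 x2 x3 x4 → x0 * (x1 * x2) + x3 * (x0 * x4) ≈ x0 * (x1 * x2 + x3 * x4)
  id1 = solve 5 (λ x0 x1 x2 x3 x4 → x0 :* (x1 :* x2) :+ x3 :* (x0 :* x4) := x0 :* (x1 :* x2 :+ x3 :* x4)) refl

  id2 : ∀ x0 x1 x2 x3 → (x0 * x1 + (x2 * x0 + x3)) + x0 * (x1 + x2) ≈ x3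
  id2 = solve 4 (λ x0 x1 x2 x3 → (x0 :* x1 :+ (x2 :* x0 :+ x3)) :+ x0 :* (x1 :+ x2) := x3) refl

  id5 : ∀ x0 x1 x2 x3 → x0 * (x0 * (x1 + x2 * x3)) ≈ x0 * x0 * x1 + x2 * (x0 * x0 * x3)
  id5 = solve 4 (λ x0 x1 x2 x3 → x0 :* (x0 :* (x1 :+ x2 :* x3)) := x0 :* x0 :* x1 :+ x2 :* (x0 :* x0 :* x3)) refl

  id6 : ∀ x0 x1 x2 x3 → x0 + (x1 + (x2 + x3)) ≈ x3 + (x0 + (x1 + x2))
  id6 = solve 4 (λ x0 x1 x2 x3 → x0 :+ (x1 :+ (x2 :+ x3)) := x3 :+ (x0 :+ (x1 :+ x2))) refl

  id7 : ∀ x0 x1 x2 x3 → x0 * (x1 * x2 + x3) ≈ x1 * (x2 * x0) + x3 * x0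
  id7 = solve 4 (λ x0 x1 x2 x3 → x0 :* (x1 :* x2 :+ x3) := x1 :* (x2 :* x0) :+ x3 :* x0) refl

  id8 : ∀ x0 x1 x2 x3 → (x0 * x1 * x3 + (x0 * x2 + x1 * x3) * x0) + x0 * x0 * x2 ≈ 0#
  id8 = solve 4 (λ x0 x1 x2 x3 → (x0 :* x1 :* x3 :+ (x0 :* x2 :+ x1 :* x3) :* x0) :+ x0 :* x0 :* x2 := :0) refl

  id9 : ∀ x0 x1 x2 → (x0 * x1 * x0 + x2 * 0#) + x0 * x0 * x1 ≈ 0#
  id9 = solve 3 (λ x0 x1 x2 → (x0 :* x1 :* x0 :+ x2 :* :0) :+ x0 :* x0 :* x1 := :0) refl

  id10 : ∀ x0 x1 x2 → x0 * (x1 * x2) ≈ (x0 * x1) * x2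
  id10 = solve 3 (λ x0 x1 x2 → x0 :* (x1 :* x2) := (x0 :* x1) :* x2) refl

  id11 : ∀ x0 x1 x2 → (x0 * x1) * x2 ≈ x1 * (x0 * x2)
  id11 = solve 3 (λ x0 x1 x2 → (x0 :* x1) :* x2 := x1 :* (x0 :* x2)) refl

  id12 : ∀ x0 x1 x2 x3 x4 x5 x6 x7 x8 → x0 * x0 * (x1 * (x2 * (x2 * (x2 * x3))) + (x4 * (x2 * (x2 * x3) * x5) + (x6 * (x1 * (x2 * (x5 * (x5 * x8)))) + x7 * (x1 * (x5 * (x5 * (x5 * x8))))))) ≈ x0 * (x0 * x1) * (x2 * (x2 * (x2 * x3))) + ((x0 * x0 * x4) * (x2 * (x2 * x3) * x5) + ((x0 * x0 * (x6 * x1)) * (x2 * (x5 * (x5 * x8))) + (x0 * x0 * (x7 * x1)) * (x5 * (x5 * (x5 * x8)))))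
  id12 = solve 9 (λ x0 x1 x2 x3 x4 x5 x6 x7 x8 → x0 :* x0 :* (x1 :* (x2 :* (x2 :* (x2 :* x3))) :+ (x4 :* (x2 :* (x2 :* x3) :* x5) :+ (x6 :* (x1 :* (x2 :* (x5 :* (x5 :* x8)))) :+ x7 :* (x1 :* (x5 :* (x5 :* (x5 :* x8))))))) := x0 :* (x0 :* x1) :* (x2 :* (x2 :* (x2 :* x3))) :+ ((x0 :* x0 :* x4) :* (x2 :* (x2 :* x3) :* x5) :+ ((x0 :* x0 :* (x6 :* x1)) :* (x2 :* (x5 :* (x5 :* x8))) :+ (x0 :* x0 :* (x7 :* x1)) :* (x5 :* (x5 :* (x5 :* x8)))))) refl

  id13 : ∀ x0 x1 x2 x3 x4 x5 x6 x7 → x0 * x1 * (x2 * (x2 * (x2 * x3))) + ((x1 * x5 + x2 * x0) * (x2 * (x2 * x3) * x1) + ((x1 * x6 + x2 * x7) * (x2 * (x1 * (x1 * x4))) + (x2 * x6) * (x1 * (x1 * (x1 * x4))))) ≈ x2 * x2 * (x1 * x1) * (x7 * x4 + x5 * x3)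
  id13 = solve 8 (λ x0 x1 x2 x3 x4 x5 x6 x7 → x0 :* x1 :* (x2 :* (x2 :* (x2 :* x3))) :+ ((x1 :* x5 :+ x2 :* x0) :* (x2 :* (x2 :* x3) :* x1) :+ ((x1 :* x6 :+ x2 :* x7) :* (x2 :* (x1 :* (x1 :* x4))) :+ (x2 :* x6) :* (x1 :* (x1 :* (x1 :* x4))))) := x2 :* x2 :* (x1 :* x1) :* (x7 :* x4 :+ x5 :* x3)) refl

  id14 : ∀ x0 x1 x2 x3 x4 x5 x6 x7 x8 x9 → x0 * (x1 * x2 * (x3 * x4)) + (x5 * (x2 * x4 * (x1 * x6)) + (x7 * (x0 * (x1 * x3 * (x2 * x8))) + x9 * (x0 * (x1 * x2 * (x6 * x8))))) ≈ x1 * x2 * (x0 * (x3 * x4) + (x5 * (x4 * x6) + (x7 * (x0 * (x3 * x8)) + x9 * (x0 * (x6 * x8)))))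
  id14 = solve 10 (λ x0 x1 x2 x3 x4 x5 x6 x7 x8 x9 → x0 :* (x1 :* x2 :* (x3 :* x4)) :+ (x5 :* (x2 :* x4 :* (x1 :* x6)) :+ (x7 :* (x0 :* (x1 :* x3 :* (x2 :* x8))) :+ x9 :* (x0 :* (x1 :* x2 :* (x6 :* x8))))) := x1 :* x2 :* (x0 :* (x3 :* x4) :+ (x5 :* (x4 :* x6) :+ (x7 :* (x0 :* (x3 :* x8)) :+ x9 :* (x0 :* (x6 :* x8)))))) refl

  id15 : ∀ x0 x1 x2 → x0 * x1 * x2 ≈ x0 * x2 * x1
  id15 = solve 3 (λ x0 x1 x2 → x0 :* x1 :* x2 := x0 :* x2 :* x1) refl

  id17 : ∀ x0 x1 x2 x3 → (x0 * x1 + x2) + x0 * x3 ≈ x0 * (x1 + x3) + x2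
  id17 = solve 4 (λ x0 x1 x2 x3 → (x0 :* x1 :+ x2) :+ x0 :* x3 := x0 :* (x1 :+ x3) :+ x2) refl

  id18 : ∀ x0 x1 x2 x3 → x0 * (x1 + x2) ≈ (x0 * x1 + (x2 * x0 + x3)) + x3
  id18 = solve 4 (λ x0 x1 x2 x3 → x0 :* (x1 :+ x2) := (x0 :* x1 :+ (x2 :* x0 :+ x3)) :+ x3) refl

  id19 : ∀ x0 x1 → x1 ≈ x0 + (x0 + x1)
  id19 = solve 2 (λ x0 x1 → x1 := x0 :+ (x0 :+ x1)) refl

  id23 : ∀ x0 x1 → x1 ≈ (x0 + x1) + x0
  id23 = solve 2 (λ x0 x1 → x1 := (x0 :+ x1) :+ x0) refl

  id24 : ∀ x0 x1 x2 x3 → x0 * (x1 * x2 * x3) ≈ (x1 * x0) * (x2 * x3)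
  id24 = solve 4 (λ x0 x1 x2 x3 → x0 :* (x1 :* x2 :* x3) := (x1 :* x0) :* (x2 :* x3)) refl

  id25 : ∀ x0 x1 x2 x3 → (x0 + x1) * x2 + x1 * (x2 + x3) ≈ x0 * x2 + x1 * x3
  id25 = solve 4 (λ x0 x1 x2 x3 → (x0 :+ x1) :* x2 :+ x1 :* (x2 :+ x3) := x0 :* x2 :+ x1 :* x3) refl

  id26 : ∀ x0 x1 x2 x3 x4 x5 x6 x7 x8 → (x0 * x1 + x2 * x3 * x4) * (x5 + x2 * x6) + (x7 + x8) ≈ (x0 * x5) * x1 + (x7 + (x2 * (x0 * x1 * x6 + x3 * x4 * (x5 + x2 * x6)) + x8))
  id26 = solve 9 (λ x0 x1 x2 x3 x4 x5 x6 x7 x8 → (x0 :* x1 :+ x2 :* x3 :* x4) :* (x5 :+ x2 :* x6) :+ (x7 :+ x8) := (x0 :* x5) :* x1 :+ (x7 :+ (x2 :* (x0 :* x1 :* x6 :+ x3 :* x4 :* (x5 :+ x2 :* x6)) :+ x8))) refl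

  id27 : ∀ x0 x1 x2 x3 x4 → x0 * (x1 + x2) + x0 * x3 * x4 ≈ x0 * (x1 + (x2 + x3 * x4))
  id27 = solve 5 (λ x0 x1 x2 x3 x4 → x0 :* (x1 :+ x2) :+ x0 :* x3 :* x4 := x0 :* (x1 :+ (x2 :+ x3 :* x4))) refl

  id28 : ∀ x0 x1 x2 x3 x4 x5 x6 x7 x8 → x0 * (x1 * x2 + x3 * (x4 * x5 + x0 * (x2 * x5))) * (x6 * x0 + (x7 * x6 + x8)) ≈ x0 * ((x1 * x2 + x3 * (x4 * x5 + x0 * (x2 * x5))) * (x8 + x6 * (x0 + x7)))
  id28 = solve 9 (λ x0 x1 x2 x3 x4 x5 x6 x7 x8 → x0 :* (x1 :* x2 :+ x3 :* (x4 :* x5 :+ x0 :* (x2 :* x5))) :* (x6 :* x0 :+ (x7 :* x6 :+ x8)) := x0 :* ((x1 :* x2 :+ x3 :* (x4 :* x5 :+ x0 :* (x2 :* x5))) :* (x8 :+ x6 :* (x0 :+ x7)))) refl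

  id29 : ∀ x0 x1 x2 x3 → x0 * x1 + (x2 + x3) * x0 ≈ x0 * (x1 + (x2 + x3))
  id29 = solve 4 (λ x0 x1 x2 x3 → x0 :* x1 :+ (x2 :+ x3) :* x0 := x0 :* (x1 :+ (x2 :+ x3))) refl

  id30 : ∀ x0 x1 x2 x3 x4 x5 x6 x7 → (x0 + x1 * x2) * (x3 + x1 * (x4 * x5)) + (x6 * (x0 + x1 * x2) + x7) ≈ x1 * ((x3 + x6) * x2 + x4 * (x0 * x5 + x1 * (x2 * x5))) + (x0 * x3 + (x6 * x0 + x7))
  id30 = solve 8 (λ x0 x1 x2 x3 x4 x5 x6 x7 → (x0 :+ x1 :* x2) :* (x3 :+ x1 :* (x4 :* x5)) :+ (x6 :* (x0 :+ x1 :* x2) :+ x7) := x1 :* ((x3 :+ x6) :* x2 :+ x4 :* (x0 :* x5 :+ x1 :* (x2 :* x5))) :+ (x0 :* x3 :+ (x6 :* x0 :+ x7))) refl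

  bezout-step : ∀ Z bm x A y B → Z * bm * (x * A + y * B) ≈ A * (Z * bm * x) + y * (Z * (B * bm))
  bezout-step = solve 6 (λ Z bm x A y B → Z :* bm :* (x :* A :+ y :* B) := A :* (Z :* bm :* x) :+ y :* (Z :* (B :* bm))) refl

  form-A : ∀ A p aq uq am B b c bq →
    A * (p * aq + (uq * (am * B) + b * (p * bq))) + c * p * (B * bq)
    ≈ p * (A * aq) + (uq * (A * am * B) + (b * (p * (A * bq)) + c * (p * (B * bq))))
  form-A = solve 9 (λ A p aq uq am B b c bq →
    A :* (p :* aq :+ (uq :* (am :* B) :+ b :* (p :* bq))) :+ c :* p :* (B :* bq)
    := p :* (A :* aq) :+ (uq :* (A :* am :* B) :+ (b :* (p :* (A :* bq)) :+ c :* (p :* (B :* bq))))) refl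

  form-cancel : ∀ A p aq uq a1 B b c bq →
    A * p * (A * aq) + (uq * (A * a1 * B) + (b * (A * p * (A * bq)) + c * (A * p * (B * bq))))
    ≈ A * (p * (A * aq) + (uq * (a1 * B) + (b * (p * (A * bq)) + c * (p * (B * bq)))))
  form-cancel = solve 9 (λ A p aq uq a1 B b c bq →
    A :* p :* (A :* aq) :+ (uq :* (A :* a1 :* B) :+ (b :* (A :* p :* (A :* bq)) :+ c :* (A :* p :* (B :* bq))))
    := A :* (p :* (A :* aq) :+ (uq :* (a1 :* B) :+ (b :* (p :* (A :* bq)) :+ c :* (p :* (B :* bq)))))) refl

  form-split : ∀ p an m b abq c bn → p * an + (m + (b * (p * abq) + c * (p * bn))) ≈ m + p * (an + (b * abq + c * bn))
  form-split = solve 7 (λ p an m b abq c bn → p :* an :+ (m :+ (b :* (p :* abq) :+ c :* (p :* bn))) := m :+ p :* (an :+ (b :* abq :+ c :* bn))) refl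

  pseudo-id : ∀ p pN s w f → p * pN * s ≈ pN * (p * s + w * f) + f * (pN * w)
  pseudo-id = solve 5 (λ p pN s w f → p :* pN :* s := pN :* (p :* s :+ w :* f) :+ f :* (pN :* w)) refl

  id20 : ∀ p pq uq wq z → (p * pq + uq * wq) * z ≈ wq * (uq * z) + p * (pq * z)
  id20 = solve 5 (λ p pq uq wq z → (p :* pq :+ uq :* wq) :* z := wq :* (uq :* z) :+ p :* (pq :* z)) refl

  id21 : ∀ p z y wq s → wq * (p * (z + y)) + p * s ≈ p * (wq * (z + y) + s)
  id21 = solve 5 (λ p z y wq s → wq :* (p :* (z :+ y)) :+ p :* s := p :* (wq :* (z :+ y) :+ s)) refl

  uvk-id : ∀ p g uq vq k → uq * (vq * k) ≈ (p * g + uq * vq) * k + p * (g * k)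
  uvk-id = solve 5 (λ p g uq vq k → uq :* (vq :* k) := (p :* g :+ uq :* vq) :* k :+ p :* (g :* k)) refl

  κ-id : ∀ c l m b k j → c * (l + m + b * (k + j)) ≈ c * (l + b * k) + c * (m + b * j)
  κ-id = solve 6 (λ c l m b k j → c :* (l :+ m :+ b :* (k :+ j)) := c :* (l :+ b :* k) :+ c :* (m :+ b :* j)) refl

  interchange : ∀ a b x y → (a + b) + (x + y) ≈ (a + x) + (b + y)
  interchange = solve 4 (λ a b x y → (a :+ b) :+ (x :+ y) := (a :+ x) :+ (b :+ y)) refl

  N-id : ∀ b x y c s t → b * (x + y) + c * (s + t) ≈ b * x + c * s + (b * y + c * t)
  N-id = solve 6 (λ b x y c s t → b :* (x :+ y) :+ c :* (s :+ t) := b :* x :+ c :* s :+ (b :* y :+ c :* t)) refl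

  tele0 : ∀ c b x k → (c + b * x) * (0# + k * 1#) ≈ c * k * 1# + b * k * (x * 1#)
  tele0 = solve 4 (λ c b x k → (c :+ b :* x) :* (:0 :+ k :* :1) := c :* k :* :1 :+ b :* k :* (x :* :1)) refl

  tele1 : ∀ c b x k w → (c + b * x) * (k * w) ≈ c * k * w + b * k * (x * w)
  tele1 = solve 5 (λ c b x k w → (c :+ b :* x) :* (k :* w) := c :* k :* w :+ b :* k :* (x :* w)) refl

  tele2 : ∀ s b k w l t → (s + b * k * w) + ((l + b * k) * w + t) ≈ (s + l * w) + t
  tele2 = solve 6 (λ s b k w l t → (s :+ b :* k :* w) :+ ((l :+ b :* k) :* w :+ t) := (s :+ l :* w) :+ t) refl

  G-id₁ : ∀ xq p l k x s yq → xq * (p * (l + k) + x * (p * s) + yq * s) ≈ (p * (x * xq) + xq * yq) * s + p * ((l + k) * xq)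
  G-id₁ = solve 7 (λ xq p l k x s yq → xq :* (p :* (l :+ k) :+ x :* (p :* s) :+ yq :* s) := (p :* (x :* xq) :+ xq :* yq) :* s :+ p :* ((l :+ k) :* xq)) refl

  G-id₂ : ∀ p s k xq l → p * (s + k * xq) + p * ((l + k) * xq) ≈ p * (s + l * xq)
  G-id₂ = solve 5 (λ p s k xq l → p :* (s :+ k :* xq) :+ p :* ((l :+ k) :* xq) := p :* (s :+ l :* xq)) refl

  curve-id : ∀ p xn w c bx → (p * xn + w) + p * (c + bx) ≈ p * (xn + (bx + c)) + w
  curve-id = solve 5 (λ p xn w c bx → (p :* xn :+ w) :+ p :* (c :+ bx) := p :* (xn :+ (bx :+ c)) :+ w) refl

  part-id : ∀ p k x xi → p * k * (x * xi) ≈ x * (p * (k * xi))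
  part-id = solve 4 (λ p k x xi → p :* k :* (x :* xi) := x :* (p :* (k :* xi))) refl

  swap-id : ∀ a b c → a * b * c ≈ b * (a * c)
  swap-id = solve 3 (λ a b c → a :* b :* c := b :* (a :* c)) refl

  swap-id₂ : ∀ a b c → a * (b * c) ≈ b * (a * c)
  swap-id₂ = solve 3 (λ a b c → a :* (b :* c) := b :* (a :* c)) refl

  partial0 : ∀ v z c g n → (v + z) * ((0# + c * g * 1#) + n * (v * 1#)) ≈ (c * (z * g) + (c * g * v + z * n * v)) + n * (v * (v * 1#))
  partial0 = solve 5 (λ v z c g n → (v :+ z) :* ((:0 :+ c :* g :* :1) :+ n :* (v :* :1)) := (c :* (z :* g) :+ (c :* g :* v :+ z :* n :* v)) :+ n :* (v :* (v :* :1))) refl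

  z-id : ∀ z b x c y → z * (b * x + c * y) ≈ b * (z * x) + c * (z * y)
  z-id = solve 5 (λ z b x c y → z :* (b :* x :+ c :* y) := b :* (z :* x) :+ c :* (z :* y)) refl

  partial1 : ∀ c g0 g1 v b t → (c * g0 + (c * g1 * v + (b * g0 + c * g1) * v)) + t ≈ (c * g0 + b * g0 * v) + t
  partial1 = solve 6 (λ c g0 g1 v b t → (c :* g0 :+ (c :* g1 :* v :+ (b :* g0 :+ c :* g1) :* v)) :+ t := (c :* g0 :+ b :* g0 :* v) :+ t) refl

  partial2 : ∀ v z n w → (v + z) * (n * w) ≈ n * (v * w) + z * n * w
  partial2 = solve 4 (λ v z n w → (v :+ z) :* (n :* w) := n :* (v :* w) :+ z :* n :* w) refl

  partial3 : ∀ s n w t → (s + n * w) + (t + n * w) ≈ s + t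
  partial3 = solve 4 (λ s n w t → (s :+ n :* w) :+ (t :+ n :* w) := s :+ t) refl

  num₁ : ∀ z zz b c g h e t → (z * zz) * ((b * g + c * h) + z * e + t) ≈ (b * (z * (zz * g)) + c * ((z * zz) * h)) + ((z * (z * zz)) * e + (z * zz) * t)
  num₁ = solve 8 (λ z zz b c g h e t → (z :* zz) :* ((b :* g :+ c :* h) :+ z :* e :+ t) := (b :* (z :* (zz :* g)) :+ c :* ((z :* zz) :* h)) :+ ((z :* (z :* zz)) :* e :+ (z :* zz) :* t)) refl

  num₂ : ∀ z zz b c X s uq → (b * (z * (X * s)) + c * (X * s)) + ((z * (z * zz)) * (X * s) + (z * zz) * (uq * s)) ≈ s * (X * (z * (z * zz) + (b * z + c)) + uq * (z * zz))
  num₂ = solve 7 (λ z zz b c X s uq → (b :* (z :* (X :* s)) :+ c :* (X :* s)) :+ ((z :* (z :* zz)) :* (X :* s) :+ (z :* zz) :* (uq :* s)) := s :* (X :* (z :* (z :* zz) :+ (b :* z :+ c)) :+ uq :* (z :* zz))) refl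

  num₃ : ∀ c e b v n w z → (c * e + b * e * v + n * w) + (v + z) * (e * w) ≈ e * (v * w + (b * v + c)) + (n + z * e) * w
  num₃ = solve 7 (λ c e b v n w z → (c :* e :+ b :* e :* v :+ n :* w) :+ (v :+ z) :* (e :* w) := e :* (v :* w :+ (b :* v :+ c)) :+ (n :+ z :* e) :* w) refl

  num₄ : ∀ X s t uq w → X * s * t + uq * s * w ≈ s * (X * t + uq * w)
  num₄ = solve 5 (λ X s t uq w → X :* s :* t :+ uq :* s :* w := s :* (X :* t :+ uq :* w)) refl

  term-id : ∀ w ub va ui vj → (w * (ub * va)) * (ui * vj) ≈ w * (ui * ub) * (va * vj)
  term-id = solve 5 (λ w ub va ui vj → (w :* (ub :* va)) :* (ui :* vj) := w :* (ui :* ub) :* (va :* vj)) refl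

  aux-id₁ : ∀ s w t f k → s * (w * t + f * k) ≈ (s * w) * t + f * (s * k)
  aux-id₁ = solve 5 (λ s w t f k → s :* (w :* t :+ f :* k) := (s :* w) :* t :+ f :* (s :* k)) refl

  aux-id₂ : ∀ h k t s → (h * k) * t + h * s ≈ h * (k * t + s)
  aux-id₂ = solve 4 (λ h k t s → (h :* k) :* t :+ h :* s := h :* (k :* t :+ s)) refl

  pow-id : ∀ w ui ub va vj → w * (ui * ub) * (va * vj) ≈ w * ui * va * (ub * vj)
  pow-id = solve 5 (λ w ui ub va vj → w :* (ui :* ub) :* (va :* vj) := w :* ui :* va :* (ub :* vj)) refl

  alg1 : ∀ x y → x ≈ (x + y) + y
  alg1 = solve 2 (λ x y → x := (x :+ y) :+ y) refl

  alg2 : ∀ x y → (x + y) * (x + y) ≈ (x * x) + (y * y)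
  alg2 = solve 2 (λ x y → (x :+ y) :* (x :+ y) := (x :* x) :+ (y :* y)) refl

  alg3 : ∀ a p r s → a * p + (a * r + s) ≈ a * (p + r) + s
  alg3 = solve 4 (λ a p r s → a :* p :+ (a :* r :+ s) := a :* (p :+ r) :+ s) refl

  alg4 : ∀ a b s x y → (a + b) + s * (x + y) ≈ (a + s * x) + (b + s * y)
  alg4 = solve 5 (λ a b s x y → (a :+ b) :+ s :* (x :+ y) := (a :+ s :* x) :+ (b :+ s :* y)) refl

  alg5 : ∀ x a s y → x * a + s * (x * y) ≈ x * (a + s * y)
  alg5 = solve 4 (λ x a s y → x :* a :+ s :* (x :* y) := x :* (a :+ s :* y)) refl

  alg6 : ∀ a q s p → a * q + (0# + s * (p * q)) ≈ (a + s * p) * q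
  alg6 = solve 4 (λ a q s p → a :* q :+ (:0 :+ s :* (p :* q)) := (a :+ s :* p) :* q) refl

  alg7 : ∀ a b d → a + d ≈ (a + b) + (b + d)
  alg7 = solve 3 (λ a b d → a :+ d := (a :+ b) :+ (b :+ d)) refl

  alg8 : ∀ a b d e → (a + d) + (b + e) ≈ (a + b) + (d + e)
  alg8 = solve 4 (λ a b d e → (a :+ d) :+ (b :+ e) := (a :+ b) :+ (d :+ e)) refl

  alg9 : ∀ x y u v → x * u + y * v ≈ (x + y) * u + y * (u + v)
  alg9 = solve 4 (λ x y u v → x :* u :+ y :* v := (x :+ y) :* u :+ y :* (u :+ v)) refl

  alg10 : ∀ h k u y l → h * k * u + y * (h * l) ≈ h * (k * u + y * l)
  alg10 = solve 5 (λ h k u y l → h :* k :* u :+ y :* (h :* l) := h :* (k :* u :+ y :* l)) refl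

  alg11 : ∀ a y b → a * y * b ≈ a * (b * y)
  alg11 = solve 3 (λ a y b → a :* y :* b := a :* (b :* y)) refl

  alg12 : ∀ s B r k v → (s * B + r) + k * (v * B) ≈ (s + k * v) * B + r
  alg12 = solve 5 (λ s B r k v → (s :* B :+ r) :+ k :* (v :* B) := (s :+ k :* v) :* B :+ r) refl

  alg13 : ∀ s g a b → s * (g * a) + g * b ≈ g * (s * a + b)
  alg13 = solve 4 (λ s g a b → s :* (g :* a) :+ g :* b := g :* (s :* a :+ b)) refl

  alg14 : ∀ s a b x y → y * (s * a + b) + (x + y * s) * a ≈ x * a + y * b
  alg14 = solve 5 (λ s a b x y → y :* (s :* a :+ b) :+ (x :+ y :* s) :* a := x :* a :+ y :* b) refl

  alg15 : ∀ g b w a → g * b * (w * a) ≈ b * w * (g * a)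
  alg15 = solve 4 (λ g b w a → g :* b :* (w :* a) := b :* w :* (g :* a)) refl

  alg16 : ∀ p q v x y → p + q + v * (x + y) ≈ p + v * x + (q + v * y)
  alg16 = solve 5 (λ p q v x y → p :+ q :+ v :* (x :+ y) := p :+ v :* x :+ (q :+ v :* y)) refl

  alg17 : ∀ p w b i → p * ((w + b) * i) ≈ ((p * w + b * p)) * i
  alg17 = solve 4 (λ p w b i → p :* ((w :+ b) :* i) := ((p :* w :+ b :* p)) :* i) refl

  alg18 : ∀ a c p i j → (a * c) * ((p * i) * j) ≈ (p * (a * i)) * (c * j)
  alg18 = solve 5 (λ a c p i j → (a :* c) :* ((p :* i) :* j) := (p :* (a :* i)) :* (c :* j)) refl

  alg19 : ∀ a k p w → (a * (k * p)) * w ≈ (a * k) * (p * w)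
  alg19 = solve 4 (λ a k p w → (a :* (k :* p)) :* w := (a :* k) :* (p :* w)) refl

  alg20 : ∀ tq uq t u tqQ w tQ b c → (((tq * uq) * (t * u) + (tqQ * w) * tQ) + b * (t * u) * tq) + c * (tq * t) ≈ (tq * t) * (uq * u + (b * u + c)) + (tqQ * tQ) * w
  alg20 = solve 9 (λ tq uq t u tqQ w tQ b c → (((tq :* uq) :* (t :* u) :+ (tqQ :* w) :* tQ) :+ b :* (t :* u) :* tq) :+ c :* (tq :* t) := (tq :* t) :* (uq :* u :+ (b :* u :+ c)) :+ (tqQ :* tQ) :* w) refl

  alg21 : ∀ x → 1# * 1# + 0# * 0# ≈ 1#
  alg21 = solve 1 (λ x → :1 :* :1 :+ :0 :* :0 := :1) refl

  alg22 : ∀ x → 0# * 0# + 1# * 1# ≈ 1#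
  alg22 = solve 1 (λ x → :0 :* :0 :+ :1 :* :1 := :1) refl

  alg23 : ∀ s t u → s * u * s + t * u * t ≈ (s * s + t * t) * u
  alg23 = solve 3 (λ s t u → s :* u :* s :+ t :* u :* t := (s :* s :+ t :* t) :* u) refl

  alg24 : ∀ a b p aQ bQ w → (a * p + aQ * w) + (b * p + bQ * w) ≈ (a + b) * p + (aQ + bQ) * w
  alg24 = solve 6 (λ a b p aQ bQ w → (a :* p :+ aQ :* w) :+ (b :* p :+ bQ :* w) := (a :+ b) :* p :+ (aQ :+ bQ) :* w) refl

  alg25 : ∀ T p TQ w → (T + 1#) * p + (TQ + 1#) * w ≈ (T * p + TQ * w) + (p + w)
  alg25 = solve 4 (λ T p TQ w → (T :+ :1) :* p :+ (TQ :+ :1) :* w := (T :* p :+ TQ :* w) :+ (p :+ w)) refl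

  alg26 : ∀ t → (t + 1#) * (t + 1#) + t * t ≈ 1#
  alg26 = solve 1 (λ t → (t :+ :1) :* (t :+ :1) :+ t :* t := :1) refl

  alg27 : ∀ tq t → (tq + 1#) * (t + 1#) + tq * t ≈ (tq + t) + 1#
  alg27 = solve 2 (λ tq t → (tq :+ :1) :* (t :+ :1) :+ tq :* t := (tq :+ t) :+ :1) refl

  alg28 : ∀ s p r → s * p * r ≈ r * s * p
  alg28 = solve 3 (λ s p r → s :* p :* r := r :* s :* p) refl

  alg29 : ∀ s r → s * (r * r) ≈ r * (r * s)
  alg29 = solve 2 (λ s r → s :* (r :* r) := r :* (r :* s)) refl

  alg30 : ∀ y m → y * m * (y * m) ≈ (m * m) * (y * y)
  alg30 = solve 2 (λ y m → y :* m :* (y :* m) := (m :* m) :* (y :* y)) refl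

  alg31 : ∀ s m → m * (s * m) ≈ s * (m * m)
  alg31 = solve 2 (λ s m → m :* (s :* m) := s :* (m :* m)) refl

  alg32 : ∀ a s m y → a * (s * m * y) ≈ (a * s) * (y * m)
  alg32 = solve 4 (λ a s m y → a :* (s :* m :* y) := (a :* s) :* (y :* m)) refl

  alg33 : ∀ a aQ x xQ → a * (aQ * x + xQ) ≈ a * xQ + (a * aQ) * x
  alg33 = solve 4 (λ a aQ x xQ → a :* (aQ :* x :+ xQ) := a :* xQ :+ (a :* aQ) :* x) refl

  alg34 : ∀ r s tq t → r * s * tq + s * t ≈ s * (r * tq + t)
  alg34 = solve 4 (λ r s tq t → r :* s :* tq :+ s :* t := s :* (r :* tq :+ t)) refl

  alg35 : ∀ a s r tqQ tQ t → a * (s * (r * tqQ + tQ)) ≈ s * ((r * (a * tqQ + t)) + (a * tQ + r * t))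
  alg35 = solve 6 (λ a s r tqQ tQ t → a :* (s :* (r :* tqQ :+ tQ)) := s :* ((r :* (a :* tqQ :+ t)) :+ (a :* tQ :+ r :* t))) refl

  alg36 : ∀ at rt t → (at + t) + (at + rt) ≈ rt + t
  alg36 = solve 3 (λ at rt t → (at :+ t) :+ (at :+ rt) := rt :+ t) refl

  alg37 : ∀ B s r tq t → B * (s * (r * tq + t)) ≈ s * ((r * B) * tq + B * t)
  alg37 = solve 5 (λ B s r tq t → B :* (s :* (r :* tq :+ t)) := s :* ((r :* B) :* tq :+ B :* t)) refl

  alg38 : ∀ s a tQ t tqQ tq → s * ((a * tQ + t) * tq + (a * tqQ + tq) * t) ≈ s * a * (tqQ * t + tQ * tq)
  alg38 = solve 6 (λ s a tQ t tqQ tq → s :* ((a :* tQ :+ t) :* tq :+ (a :* tqQ :+ tq) :* t) := s :* a :* (tqQ :* t :+ tQ :* tq)) refl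

  alg39 : ∀ p pQ a aQ → (p * pQ) * (a * aQ) ≈ (a * p) * (aQ * pQ)
  alg39 = solve 4 (λ p pQ a aQ → (p :* pQ) :* (a :* aQ) := (a :* p) :* (aQ :* pQ)) refl

  alg40 : ∀ g a b x y w → g * a * (x * w) + g * w * (x * a + y * b) ≈ g * b * (w * y)
  alg40 = solve 6 (λ g a b x y w → g :* a :* (x :* w) :+ g :* w :* (x :* a :+ y :* b) := g :* b :* (w :* y)) refl

  alg41 : ∀ c d p q v e → c * d + (p * q + v * (e * q + p * d)) ≈ (p + v * e) * q + (c + v * p) * d
  alg41 = solve 6 (λ c d p q v e → c :* d :+ (p :* q :+ v :* (e :* q :+ p :* d)) := (p :+ v :* e) :* q :+ (c :+ v :* p) :* d) refl

-- Frobenius, finite sums, homomorphisms and domains in characteristic two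

module C2 {c ℓ} (R : CR2 c ℓ) where
  open CR2 R public
  open Algebra.Properties.CommutativeSemiring.Exp commutativeSemiring public
    using (_^_; ^-congˡ; ^-congʳ; ^-homo-*; ^-assocʳ; ^-distrib-*)

  self : ∀ x → x + x ≈ 0#
  self x = trans (+-cong (sym (*-identityʳ x)) (sym (*-identityʳ x)))
             (trans (sym (distribˡ x 1# 1#)) (trans (*-congˡ two) (zeroʳ x)))

  sum-0⇒≈ : ∀ {x y} → x + y ≈ 0# → x ≈ y
  sum-0⇒≈ {x} {y} e = trans (Ids.alg1 R x y) (trans (+-congʳ e) (+-identityˡ y))

  ≈⇒sum-0 : ∀ {x y} → x ≈ y → x + y ≈ 0#
  ≈⇒sum-0 {x} {y} e = trans (+-congʳ e) (self y)

  +-0 : ∀ {x y} → x ≈ 0# → y ≈ 0# → x + y ≈ 0#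
  +-0 p q = trans (+-cong p q) (+-identityˡ 0#)

  *-0ˡ : ∀ {x} y → x ≈ 0# → x * y ≈ 0#
  *-0ˡ y p = trans (*-congʳ p) (zeroˡ y)

  *-0ʳ : ∀ x {y} → y ≈ 0# → x * y ≈ 0#
  *-0ʳ x p = trans (*-congˡ p) (zeroʳ x)

  ^1 : ∀ x → x ^ 1 ≈ x
  ^1 x = *-identityʳ x

  1^ : ∀ n → 1# ^ n ≈ 1#
  1^ zero = refl
  1^ (suc n) = trans (*-identityˡ _) (1^ n)

  0^ : ∀ n → 0 < n → 0# ^ n ≈ 0#
  0^ (suc n) _ = zeroˡ _

  ^-swap : ∀ x m n → (x ^ m) ^ n ≈ (x ^ n) ^ m
  ^-swap x m n = trans (^-assocʳ x m n) (trans (^-congʳ x (ℕ.*-comm m n)) (sym (^-assocʳ x n m)))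

  frob : ∀ k x y → (x + y) ^ (2 ℕ.^ k) ≈ x ^ (2 ℕ.^ k) + y ^ (2 ℕ.^ k)
  frob zero x y = trans (^1 _) (+-cong (sym (^1 x)) (sym (^1 y)))
  frob (suc k) x y = trans (sq (x + y)) (trans (^-congˡ (2 ℕ.^ k) (Ids.alg2 R x y))
                     (trans (frob k (x * x) (y * y)) (+-cong (sym (sq x)) (sym (sq y)))))
    where
    sq : ∀ z → z ^ (2 ℕ.^ suc k) ≈ (z * z) ^ (2 ℕ.^ k)
    sq z = trans (sym (^-assocʳ z 2 (2 ℕ.^ k))) (^-congˡ (2 ℕ.^ k) (*-congˡ (^1 z)))

  ∑ : ℕ → (ℕ → Carrier) → Carrier
  ∑ zero f = 0#
  ∑ (suc n) f = ∑ n f + f n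

  ∑-cong : ∀ n {f g : ℕ → Carrier} → (∀ i → i < n → f i ≈ g i) → ∑ n f ≈ ∑ n g
  ∑-cong zero h = refl
  ∑-cong (suc n) h = +-cong (∑-cong n (λ i i<n → h i (ℕ.m<n⇒m<1+n i<n))) (h n (ℕ.n<1+n n))

  ∑-0 : ∀ n {f : ℕ → Carrier} → (∀ i → i < n → f i ≈ 0#) → ∑ n f ≈ 0#
  ∑-0 zero h = refl
  ∑-0 (suc n) h = +-0 (∑-0 n (λ i i<n → h i (ℕ.m<n⇒m<1+n i<n))) (h n (ℕ.n<1+n n))

  ∑-+ : ∀ n (f g : ℕ → Carrier) → ∑ n (λ i → f i + g i) ≈ ∑ n f + ∑ n g
  ∑-+ zero f g = sym (+-identityˡ 0#)
  ∑-+ (suc n) f g = trans (+-congʳ (∑-+ n f g))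
    (Ids.interchange R _ _ _ _)

  ∑-*ˡ : ∀ n a (f : ℕ → Carrier) → ∑ n (λ i → a * f i) ≈ a * ∑ n f
  ∑-*ˡ zero a f = sym (zeroʳ a)
  ∑-*ˡ (suc n) a f = trans (+-congʳ (∑-*ˡ n a f)) (sym (distribˡ a _ _))

  ∑-*ʳ : ∀ n a (f : ℕ → Carrier) → ∑ n (λ i → f i * a) ≈ ∑ n f * a
  ∑-*ʳ n a f = trans (∑-cong n (λ i _ → *-comm (f i) a)) (trans (∑-*ˡ n a f) (*-comm a _))

  ∑-head : ∀ n (f : ℕ → Carrier) → ∑ (suc n) f ≈ f 0 + ∑ n (λ i → f (suc i))
  ∑-head zero f = trans (+-identityˡ _) (sym (+-identityʳ _))
  ∑-head (suc n) f = trans (+-congʳ (∑-head n f)) (+-assoc _ _ _)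

  ∑-split : ∀ m n (f : ℕ → Carrier) → ∑ (m ℕ.+ n) f ≈ ∑ m f + ∑ n (λ i → f (m ℕ.+ i))
  ∑-split m zero f = trans (reflexive (≡.cong (λ j → ∑ j f) (ℕ.+-identityʳ m))) (sym (+-identityʳ _))
  ∑-split m (suc n) f = trans (reflexive (≡.cong (λ j → ∑ j f) (ℕ.+-suc m n)))
                          (trans (+-congʳ (∑-split m n f)) (+-assoc _ _ _))

  ∑-blocks : ∀ B m (f : ℕ → Carrier) → ∑ (B ℕ.* m) f ≈ ∑ B (λ β → ∑ m (λ α → f (m ℕ.* β ℕ.+ α)))
  ∑-blocks zero m f = refl
  ∑-blocks (suc B) m f = begin
    ∑ (m ℕ.+ B ℕ.* m) f  ≡⟨ ≡.cong (λ j → ∑ j f) (ℕ.+-comm m (B ℕ.* m)) ⟩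
    ∑ (B ℕ.* m ℕ.+ m) f  ≈⟨ ∑-split (B ℕ.* m) m f ⟩
    ∑ (B ℕ.* m) f + ∑ m (λ α → f (B ℕ.* m ℕ.+ α))
      ≈⟨ +-cong (∑-blocks B m f) (∑-cong m (λ α _ → reflexive (≡.cong (λ j → f (j ℕ.+ α)) (ℕ.*-comm B m)))) ⟩
    _ ∎ where open Relation.Binary.Reasoning.Setoid setoid

  ∑-swap : ∀ m n (f : ℕ → ℕ → Carrier) → ∑ m (λ i → ∑ n (f i)) ≈ ∑ n (λ j → ∑ m (λ i → f i j))
  ∑-swap zero n f = sym (∑-0 n (λ _ _ → refl))
  ∑-swap (suc m) n f = trans (+-congʳ (∑-swap m n f)) (sym (∑-+ n _ _))

  ∑-frob : ∀ k n (f : ℕ → Carrier) → ∑ n f ^ (2 ℕ.^ k) ≈ ∑ n (λ i → f i ^ (2 ℕ.^ k))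
  ∑-frob k zero f = 0^ _ (ℕ.m^n>0 2 k)
  ∑-frob k (suc n) f = trans (frob k _ _) (+-congʳ (∑-frob k n f))

record Hom {a ℓ₁ b ℓ₂} (A : CR2 a ℓ₁) (B : CR2 b ℓ₂) : Set (a ⊔ ℓ₁ ⊔ b ⊔ ℓ₂) where
  private
    module A = C2 A
    module B = C2 B
  field
    ⟦_⟧ : A.Carrier → B.Carrier
    ⟦⟧-cong : ∀ {x y} → x A.≈ y → ⟦ x ⟧ B.≈ ⟦ y ⟧
    ⟦⟧-+ : ∀ x y → ⟦ x A.+ y ⟧ B.≈ ⟦ x ⟧ B.+ ⟦ y ⟧
    ⟦⟧-* : ∀ x y → ⟦ x A.* y ⟧ B.≈ ⟦ x ⟧ B.* ⟦ y ⟧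
    ⟦⟧-1 : ⟦ A.1# ⟧ B.≈ B.1#

  ⟦⟧-0 : ⟦ A.0# ⟧ B.≈ B.0#
  ⟦⟧-0 = B.trans (⟦⟧-cong (A.sym (A.self A.0#))) (B.trans (⟦⟧-+ A.0# A.0#) (B.self _))

  ⟦⟧-≈0 : ∀ {x} → x A.≈ A.0# → ⟦ x ⟧ B.≈ B.0#
  ⟦⟧-≈0 e = B.trans (⟦⟧-cong e) ⟦⟧-0

  ⟦⟧-^ : ∀ x n → ⟦ x A.^ n ⟧ B.≈ ⟦ x ⟧ B.^ n
  ⟦⟧-^ x zero = ⟦⟧-1
  ⟦⟧-^ x (suc n) = B.trans (⟦⟧-* x _) (B.*-congˡ (⟦⟧-^ x n))

  ⟦⟧-∑ : ∀ n f → ⟦ A.∑ n f ⟧ B.≈ B.∑ n (⟦_⟧ ∘ f)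
  ⟦⟧-∑ zero f = ⟦⟧-0
  ⟦⟧-∑ (suc n) f = B.trans (⟦⟧-+ _ _) (B.+-congʳ (⟦⟧-∑ n f))

id-hom : ∀ {a ℓ} (A : CR2 a ℓ) → Hom A A
id-hom A = record { ⟦_⟧ = id ; ⟦⟧-cong = id ; ⟦⟧-+ = λ _ _ → refl ; ⟦⟧-* = λ _ _ → refl ; ⟦⟧-1 = refl }
  where open CR2 A

_∘h_ : ∀ {a ℓ₁ b ℓ₂ c ℓ₃} {A : CR2 a ℓ₁} {B : CR2 b ℓ₂} {C : CR2 c ℓ₃} → Hom B C → Hom A B → Hom A C
_∘h_ {C = C} g f = record
  { ⟦_⟧ = g.⟦_⟧ ∘ f.⟦_⟧ ; ⟦⟧-cong = g.⟦⟧-cong ∘ f.⟦⟧-cong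
  ; ⟦⟧-+ = λ x y → trans (g.⟦⟧-cong (f.⟦⟧-+ x y)) (g.⟦⟧-+ _ _)
  ; ⟦⟧-* = λ x y → trans (g.⟦⟧-cong (f.⟦⟧-* x y)) (g.⟦⟧-* _ _)
  ; ⟦⟧-1 = trans (g.⟦⟧-cong f.⟦⟧-1) g.⟦⟧-1 }
  where
  open CR2 C using (trans)
  module g = Hom g
  module f = Hom f

¬¬LEM : ∀ {a} (A : Set a) → ¬ ¬ (A ⊎ ¬ A)
¬¬LEM A h = h (inj₂ (λ x → h (inj₁ x)))

-- Equality is asked to be stable rather than decidable, since the quotient ring that supplies a
-- root of P has an equality defined by a double negation. Classical case distinctions remain
-- available through `by-cases` whenever the conclusion is an equation.
record Domain {c ℓ} (R : CR2 c ℓ) : Set (c ⊔ ℓ) where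
  open C2 R
  field
    stable : ∀ {x y} → ¬ ¬ (x ≈ y) → x ≈ y
    0≉1 : ¬ 0# ≈ 1#
    noZeroDiv : ∀ {x y} → x * y ≈ 0# → ¬ x ≈ 0# → y ≈ 0#

  by-cases : ∀ {p} {P : Set p} {x y : Carrier} → (P → x ≈ y) → (¬ P → x ≈ y) → x ≈ y
  by-cases {P = P} f g = stable (λ h → ¬¬LEM P λ { (inj₁ p) → h (f p) ; (inj₂ np) → h (g np) })

  cancel : ∀ {x y z} → ¬ x ≈ 0# → x * y ≈ x * z → y ≈ z
  cancel nx e = sum-0⇒≈ (noZeroDiv (trans (distribˡ _ _ _) (≈⇒sum-0 e)) nx)

  *-≉0 : ∀ {x y} → ¬ x ≈ 0# → ¬ y ≈ 0# → ¬ x * y ≈ 0#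
  *-≉0 nx ny e = ny (noZeroDiv e nx)

  ^-≉0 : ∀ {x} n → ¬ x ≈ 0# → ¬ x ^ n ≈ 0#
  ^-≉0 zero nx e = 0≉1 (sym e)
  ^-≉0 (suc n) nx e = ^-≉0 n nx (noZeroDiv e nx)

  ^-≈0 : ∀ {x} n → x ^ n ≈ 0# → x ≈ 0#
  ^-≈0 n e = stable (λ nx → ^-≉0 n nx e)

-- Formal power series: order and degree

module Series {c ℓ} (R : CR2 c ℓ) where
  open C2 R

  Ser : Set c
  Ser = ℕ → Carrier

  tail : Ser → Ser
  tail a n = a (suc n)

  infix 4 _≋_
  _≋_ : Ser → Ser → Set ℓ
  a ≋ b = ∀ n → a n ≈ b n

  infixl 7 _·_
  _·_ : Carrier → Ser → Ser
  (x · b) n = x * b n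

  0s 1s X : Ser
  0s _ = 0#
  1s zero = 1#
  1s (suc n) = 0#
  X zero = 0#
  X (suc n) = 1s n

  cst : Carrier → Ser
  cst x zero = x
  cst x (suc n) = 0#

  Ord : ℕ → Ser → Set ℓ
  Ord N a = ∀ i → i < N → a i ≈ 0#

  drop : ℕ → Ser → Ser
  drop N a i = a (N ℕ.+ i)

  Dg : ℕ → Ser → Set ℓ
  Dg d a = ∀ i → d ≤ i → a i ≈ 0#

  HasDeg : ℕ → Ser → Set ℓ
  HasDeg d a = Dg (suc d) a × ¬ a d ≈ 0#

  infixl 6 _⊕_
  infixl 7 _⊛_
  opaque
    _⊕_ : Ser → Ser → Ser
    (a ⊕ b) n = a n + b n

    _⊛_ : Ser → Ser → Ser
    (a ⊛ b) zero = a 0 * b 0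
    (a ⊛ b) (suc n) = a 0 * b (suc n) + (tail a ⊛ b) n

    ⊛-cong : ∀ {a b x y} → a ≋ b → x ≋ y → (a ⊛ x) ≋ (b ⊛ y)
    ⊛-cong p r zero = *-cong (p 0) (r 0)
    ⊛-cong p r (suc n) = +-cong (*-cong (p 0) (r (suc n))) (⊛-cong (p ∘ suc) r n)

    0⊛ : ∀ a b → a ≋ 0s → (a ⊛ b) ≋ 0s
    0⊛ a b p zero = *-0ˡ _ (p 0)
    0⊛ a b p (suc n) = +-0 (*-0ˡ _ (p 0)) (0⊛ _ b (p ∘ suc) n)

    ⊛-distribʳ : ∀ a b x → ((a ⊕ b) ⊛ x) ≋ ((a ⊛ x) ⊕ (b ⊛ x))
    ⊛-distribʳ a b x zero = distribʳ _ _ _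
    ⊛-distribʳ a b x (suc n) = trans (+-cong (distribʳ _ _ _) (⊛-distribʳ (tail a) (tail b) x n))
      (Ids.interchange R _ _ _ _)

    ⊛-distribˡ : ∀ x a b → (x ⊛ (a ⊕ b)) ≋ ((x ⊛ a) ⊕ (x ⊛ b))
    ⊛-distribˡ x a b zero = distribˡ _ _ _
    ⊛-distribˡ x a b (suc n) = trans (+-cong (distribˡ _ _ _) (⊛-distribˡ (tail x) a b n))
      (Ids.interchange R _ _ _ _)

    ·-⊛ : ∀ x a b → ((x · a) ⊛ b) ≋ (x · (a ⊛ b))
    ·-⊛ x a b zero = *-assoc _ _ _
    ·-⊛ x a b (suc n) = trans (+-cong (*-assoc _ _ _) (·-⊛ x (tail a) b n)) (sym (distribˡ _ _ _))

    ⊛-suc : ∀ a b n → (a ⊛ b) (suc n) ≈ (a ⊛ tail b) n + a (suc n) * b 0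
    ⊛-suc a b zero = refl
    ⊛-suc a b (suc n) = trans (+-congˡ (⊛-suc (tail a) b n)) (sym (+-assoc _ _ _))

    ⊛-comm : ∀ a b → (a ⊛ b) ≋ (b ⊛ a)
    ⊛-comm a b zero = *-comm _ _
    ⊛-comm a b (suc n) = trans (+-cong (*-comm _ _) (⊛-comm (tail a) b n))
                           (trans (+-comm _ _) (sym (⊛-suc b a n)))

    ⊛-assoc : ∀ a b x → ((a ⊛ b) ⊛ x) ≋ (a ⊛ (b ⊛ x))
    ⊛-assoc a b x zero = *-assoc _ _ _
    ⊛-assoc a b x (suc n) = begin
      a 0 * b 0 * x (suc n) + (tail (a ⊛ b) ⊛ x) n
        ≈⟨ +-cong (*-assoc _ _ _) (trans (⊛-distribʳ (a 0 · tail b) (tail a ⊛ b) x n) (+-cong (·-⊛ _ _ _ n) (⊛-assoc (tail a) b x n))) ⟩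
      a 0 * (b 0 * x (suc n)) + (a 0 * (tail b ⊛ x) n + (tail a ⊛ (b ⊛ x)) n)
        ≈⟨ Ids.alg3 R _ _ _ _ ⟩
      a 0 * (b 0 * x (suc n) + (tail b ⊛ x) n) + (tail a ⊛ (b ⊛ x)) n ∎
      where open Relation.Binary.Reasoning.Setoid setoid

    1⊛ : ∀ a → (1s ⊛ a) ≋ a
    1⊛ a zero = *-identityˡ _
    1⊛ a (suc n) = trans (+-cong (*-identityˡ _) (0⊛ _ a (λ _ → refl) n)) (+-identityʳ _)

    ⊕-at : ∀ a b n → (a ⊕ b) n ≈ a n + b n
    ⊕-at a b n = refl

    ⊛-at0 : ∀ a b → (a ⊛ b) 0 ≈ a 0 * b 0
    ⊛-at0 a b = refl

    ⊕-cong : ∀ {a b x y} → a ≋ b → x ≋ y → (a ⊕ x) ≋ (b ⊕ y)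
    ⊕-cong p r n = +-cong (p n) (r n)

    ⊕-assoc : ∀ a b x → (a ⊕ b ⊕ x) ≋ (a ⊕ (b ⊕ x))
    ⊕-assoc a b x n = +-assoc _ _ _

    ⊕-comm : ∀ a b → (a ⊕ b) ≋ (b ⊕ a)
    ⊕-comm a b n = +-comm _ _

    ⊕-idˡ : ∀ a → (0s ⊕ a) ≋ a
    ⊕-idˡ a n = +-identityˡ _

    ⊕-self : ∀ a → (a ⊕ a) ≋ 0s
    ⊕-self a n = self _

    cst⊛ : ∀ x a → (cst x ⊛ a) ≋ (x · a)
    cst⊛ x a zero = refl
    cst⊛ x a (suc n) = trans (+-congˡ (0⊛ _ a (λ _ → refl) n)) (+-identityʳ _)

    cst-+ : ∀ x y → cst (x + y) ≋ (cst x ⊕ cst y)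
    cst-+ x y zero = refl
    cst-+ x y (suc n) = sym (+-identityˡ _)

    cst-* : ∀ x y → cst (x * y) ≋ (cst x ⊛ cst y)
    cst-* x y zero = refl
    cst-* x y (suc n) = sym (+-0 (zeroʳ _) (0⊛ _ (cst y) (λ _ → refl) n))

  -- _≋_ as a record, so that the two sides can be inferred
  record _≃_ (a b : Ser) : Set ℓ where
    constructor mk
    field at : a ≋ b
  open _≃_ public

  opaque
    ≃-refl : ∀ {a} → a ≃ a
    ≃-refl = mk λ _ → refl

    ≃-sym : ∀ {a b} → a ≃ b → b ≃ a
    ≃-sym p = mk λ n → sym (at p n)

    ≃-trans : ∀ {a b x} → a ≃ b → b ≃ x → a ≃ x
    ≃-trans p r = mk λ n → trans (at p n) (at r n)

    ⊕-cong′ : ∀ {a b x y} → a ≃ b → x ≃ y → (a ⊕ x) ≃ (b ⊕ y)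
    ⊕-cong′ p r = mk (⊕-cong (at p) (at r))

    ⊛-cong′ : ∀ {a b x y} → a ≃ b → x ≃ y → (a ⊛ x) ≃ (b ⊛ y)
    ⊛-cong′ p r = mk (⊛-cong (at p) (at r))

  PS : CR2 c ℓ
  PS = mkCR2 Ser _≃_ _⊕_ _⊛_ 0s 1s
    (record { refl = ≃-refl ; sym = ≃-sym ; trans = ≃-trans }) ⊕-cong′ ⊛-cong′
    (λ a b x → mk (⊕-assoc a b x)) (λ a b → mk (⊕-comm a b))
    (λ a → mk (⊕-idˡ a)) (λ a → mk (⊕-self a)) (λ a b x → mk (⊛-assoc a b x))
    (λ a b → mk (⊛-comm a b)) (λ a → mk (1⊛ a)) (λ x a b → mk (⊛-distribˡ x a b))

  private module S = C2 PS

  cst-hom : Hom R PS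
  cst-hom = record
    { ⟦_⟧ = cst
    ; ⟦⟧-cong = λ e → mk λ { zero → e ; (suc n) → refl }
    ; ⟦⟧-+ = λ x y → mk (cst-+ x y)
    ; ⟦⟧-* = λ x y → mk (cst-* x y)
    ; ⟦⟧-1 = mk λ { zero → refl ; (suc n) → refl } }

  opaque
    unfolding _⊕_ _⊛_

    X⊛-0 : ∀ a → (X ⊛ a) 0 ≈ 0#
    X⊛-0 a = zeroˡ _

    X⊛-suc : ∀ a n → (X ⊛ a) (suc n) ≈ a n
    X⊛-suc a n = trans (+-cong (zeroˡ _) (1⊛ a n)) (+-identityˡ _)

    X^⊛ : ∀ k a i → ((X S.^ k) ⊛ a) (k ℕ.+ i) ≈ a i
    X^⊛ zero a i = 1⊛ a i
    X^⊛ (suc k) a i = trans (⊛-assoc X (X S.^ k) a (suc k ℕ.+ i)) (trans (X⊛-suc ((X S.^ k) ⊛ a) (k ℕ.+ i)) (X^⊛ k a i))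

    X^⊛-< : ∀ k a i → i < k → ((X S.^ k) ⊛ a) i ≈ 0#
    X^⊛-< (suc k) a zero _ = trans (⊛-assoc X (X S.^ k) a 0) (X⊛-0 ((X S.^ k) ⊛ a))
    X^⊛-< (suc k) a (suc i) (s≤s l) = trans (⊛-assoc X (X S.^ k) a (suc i)) (trans (X⊛-suc ((X S.^ k) ⊛ a) i) (X^⊛-< k a i l))

    Ord-⊕ : ∀ {N a b} → Ord N a → Ord N b → Ord N (a ⊕ b)
    Ord-⊕ p r i l = +-0 (p i l) (r i l)

    Ord-⊛ : ∀ {N a} b → Ord N a → Ord N (a ⊛ b)
    Ord-⊛ b p zero l = *-0ˡ _ (p 0 l)
    Ord-⊛ {suc N} {a} b p (suc i) (s≤s l) =
      +-0 (*-0ˡ _ (p 0 z<s)) (Ord-⊛ {N} {tail a} b (λ j j<N → p (suc j) (s<s j<N)) i l)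

    Ord-⊛ʳ : ∀ {N a} b → Ord N a → Ord N (b ⊛ a)
    Ord-⊛ʳ {a = a} b p i l = trans (⊛-comm b a i) (Ord-⊛ b p i l)

    Ord-cong : ∀ {N a b} → a ≋ b → Ord N a → Ord N b
    Ord-cong e p i l = trans (sym (e i)) (p i l)

    Ord-≤ : ∀ {N M a} → M ≤ N → Ord N a → Ord M a
    Ord-≤ M≤N p i l = p i (ℕ.<-≤-trans l M≤N)

    Ord-X^ : ∀ N a → Ord N ((X S.^ N) ⊛ a)
    Ord-X^ N a i l = X^⊛-< N a i l

    Ord-factor : ∀ N a → Ord N a → a ≋ ((X S.^ N) ⊛ drop N a)
    Ord-factor N a p i with i ℕ.<? N
    ... | yes i<N = trans (p i i<N) (sym (X^⊛-< N _ i i<N))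
    ... | no i≮N with ℕ.m≤n⇒∃[o]m+o≡n (ℕ.≮⇒≥ i≮N)
    ... | j , ≡.refl = sym (X^⊛ N (drop N a) j)

    ⊛-low : ∀ n a b → Ord n b → (a ⊛ b) n ≈ a 0 * b n
    ⊛-low zero a b p = refl
    ⊛-low (suc n) a b p = trans (+-congˡ (Ord-⊛ʳ {suc n} (tail a) p n (ℕ.n<1+n n))) (+-identityʳ _)

    Dg-≤ : ∀ {d e a} → d ≤ e → Dg d a → Dg e a
    Dg-≤ d≤e p i l = p i (ℕ.≤-trans d≤e l)

    Dg-cong : ∀ {d a b} → a ≋ b → Dg d a → Dg d b
    Dg-cong e p i l = trans (sym (e i)) (p i l)

    Dg-⊛ : ∀ {d e a b} → Dg (suc d) a → Dg e b → Dg (d ℕ.+ e) (a ⊛ b)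
    Dg-⊛ {d} {zero} {a} {b} p r i _ = trans (⊛-comm a b i) (0⊛ b a (λ j → r j z≤n) i)
    Dg-⊛ {zero} {suc e} p r (suc i) l =
      +-0 (*-0ʳ _ (r (suc i) l)) (0⊛ _ _ (λ j → p (suc j) (s≤s z≤n)) i)
    Dg-⊛ {suc d} {suc e} {a} p r (suc i) (s≤s l) =
      +-0 (*-0ʳ _ (r (suc i) (ℕ.≤-trans (ℕ.m≤n+m (suc e) d) (ℕ.m≤n⇒m≤1+n l))))
          (Dg-⊛ {d} {suc e} {tail a} (λ j d<j → p (suc j) (s≤s d<j)) r i l)

    ⊛-top : ∀ d e {a b} → Dg (suc d) a → Dg (suc e) b → (a ⊛ b) (d ℕ.+ e) ≈ a d * b e
    ⊛-top zero zero p r = refl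
    ⊛-top zero (suc e) p r = trans (+-congˡ (0⊛ _ _ (λ j → p (suc j) (s≤s z≤n)) e)) (+-identityʳ _)
    ⊛-top (suc d) e {a} p r = trans (+-cong (*-0ʳ _ (r _ (s≤s (ℕ.m≤n+m e d)))) (⊛-top d e {tail a} (λ j d<j → p (suc j) (s≤s d<j)) r)) (+-identityˡ _)

    Dg-1s : Dg 1 1s
    Dg-1s (suc i) _ = refl

    Dg-X : Dg 2 X
    Dg-X (suc (suc i)) _ = refl
    Dg-X (suc zero) (s≤s ())

    Dg-^ : ∀ {d a} m → Dg (suc d) a → Dg (suc (m ℕ.* d)) (a S.^ m)
    Dg-^ zero p = Dg-1s
    Dg-^ {d} {a} (suc m) p = Dg-cong {b = a S.^ suc m} (λ _ → refl)
      (Dg-≤ {a = a ⊛ (a S.^ m)} (ℕ.≤-reflexive (ℕ.+-suc d (m ℕ.* d))) (Dg-⊛ p (Dg-^ m p)))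

    Dg-X^ : ∀ m → Dg (suc m) (X S.^ m)
    Dg-X^ m = Dg-≤ {a = X S.^ m} (s≤s (ℕ.≤-reflexive (ℕ.*-identityʳ m))) (Dg-^ m Dg-X)

    Dg-lower : ∀ {d a} → Dg (suc d) a → a d ≈ 0# → Dg d a
    Dg-lower {d} p z i d≤i with ℕ.m≤n⇒m<n∨m≡n d≤i
    ... | inj₁ d<i = p i d<i
    ... | inj₂ ≡.refl = z

  module _ (D : Domain R) where
    open Domain D

    opaque
      unfolding _⊕_ _⊛_

      -- Let coefficient i of a be nonzero and the product zero. If a 0 = 0, pass to the tails of a
      -- and of the product; otherwise the coefficients of b vanish one after the other. The index i
      -- bounds the number of steps, so the order of a never has to be determined.
      Ser-domain : Domain PS
      Ser-domain = record
        { stable = λ h → mk λ n → stable (λ k → h (λ e → k (at e n)))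
        ; 0≉1 = λ e → 0≉1 (at e 0)
        ; noZeroDiv = λ {a} {b} e na → mk λ n → stable (λ k → na (mk λ i → stable (λ nai → k (go i a b nai (at e) n)))) }
        where
        base : ∀ a b → ¬ a 0 ≈ 0# → (a ⊛ b) ≋ 0s → ∀ N → Ord N b
        base a b na e zero i ()
        base a b na e (suc N) i (s≤s i≤N) with ℕ.m≤n⇒m<n∨m≡n i≤N
        ... | inj₁ i<N = base a b na e N i i<N
        ... | inj₂ ≡.refl = noZeroDiv (trans (sym (⊛-low i a b (base a b na e i))) (e i)) na
        go : ∀ i a b → ¬ a i ≈ 0# → (a ⊛ b) ≋ 0s → b ≋ 0s
        go zero a b na e n = base a b na e (suc n) n (ℕ.n<1+n n)
        go (suc i) a b na e n = by-cases {P = a 0 ≈ 0#}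
          (λ a0 → go i (tail a) b na (λ m → trans (sym (trans (+-congʳ (*-0ˡ _ a0)) (+-identityˡ _))) (e (suc m))) n)
          (λ na0 → go zero a b na0 e n)

      HasDeg-⊛ : ∀ {d e a b} → HasDeg d a → HasDeg e b → HasDeg (d ℕ.+ e) (a ⊛ b)
      HasDeg-⊛ {d} {e} {a} {b} (p , np) (r , nr) =
        Dg-≤ {a = a ⊛ b} (ℕ.≤-reflexive (ℕ.+-suc d e)) (Dg-⊛ p r) ,
        λ z → *-≉0 np nr (trans (sym (⊛-top d e {a} {b} p r)) z)

      -- Coefficient d + m of the product is the leading coefficient of a times coefficient m of b,
      -- so a known degree bound on b can be lowered one by one until it reaches e.
      Dg-factor : ∀ {d e a b} m → HasDeg d a → Dg m b → Dg (d ℕ.+ e) (a ⊛ b) → Dg e b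
      Dg-factor zero h p r i l = p i z≤n
      Dg-factor {d} {e} {a} {b} (suc m) h p r with e ℕ.≤? m
      ... | no e≰m = Dg-≤ {a = b} (ℕ.≰⇒> e≰m) p
      ... | yes e≤m = Dg-factor {d} {e} {a} {b} m h (Dg-lower {a = b} p
              (noZeroDiv (trans (sym (⊛-top d m {a} {b} (proj₁ h) p)) (r (d ℕ.+ m) (ℕ.+-monoʳ-≤ d e≤m))) (proj₂ h))) r

      HasDeg-cong : ∀ {d a b} → a ≋ b → HasDeg d a → HasDeg d b
      HasDeg-cong {d} {a} {b} e (p , np) = Dg-cong {a = a} {b} e p , λ z → np (trans (e d) z)

      -- Whether the top coefficient vanishes cannot be decided here, so the exact degree exists
      -- only up to double negation.
      ¬¬HasDeg : ∀ m {a} → Dg m a → ¬ a ≋ 0s → ¬ ¬ (∃ λ d → d < m × HasDeg d a)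
      ¬¬HasDeg zero p na k = na (λ i → p i z≤n)
      ¬¬HasDeg (suc m) {a} p na k = ¬¬LEM (a m ≈ 0#) λ
        { (inj₁ z) → ¬¬HasDeg m (Dg-lower {a = a} p z) na (λ { (d , d<m , h) → k (d , ℕ.m<n⇒m<1+n d<m , h) })
        ; (inj₂ nz) → k (m , ℕ.n<1+n m , p , nz) }

-- Univariate polynomials, evaluation and degree

module Poly {c ℓ} (R : CR2 c ℓ) where
  open C2 R
  private module Sr = Series R
  open Sr using (Ser; _≋_; _⊕_; _⊛_; _·_; tail)

  Pl : Set c
  Pl = List Carrier

  coef : Pl → Ser
  coef [] _ = 0#
  coef (a ∷ p) zero = a
  coef (a ∷ p) (suc n) = coef p n

  scale : Carrier → Pl → Pl
  scale x = map (x *_)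

  infixl 6 _⊞_
  infixl 7 _⊠_
  opaque
    unfolding _⊕_ _⊛_

    _⊞_ : Pl → Pl → Pl
    [] ⊞ q = q
    (a ∷ p) ⊞ [] = a ∷ p
    (a ∷ p) ⊞ (b ∷ q) = (a + b) ∷ (p ⊞ q)

    _⊠_ : Pl → Pl → Pl
    [] ⊠ q = []
    (a ∷ p) ⊠ q = scale a q ⊞ (0# ∷ (p ⊠ q))

    coef-⊞ : ∀ p q → coef (p ⊞ q) ≋ (coef p ⊕ coef q)
    coef-⊞ [] q n = sym (+-identityˡ _)
    coef-⊞ (a ∷ p) [] n = sym (+-identityʳ _)
    coef-⊞ (a ∷ p) (b ∷ q) zero = refl
    coef-⊞ (a ∷ p) (b ∷ q) (suc n) = coef-⊞ p q n

    coef-scale : ∀ x p → coef (scale x p) ≋ (x · coef p)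
    coef-scale x [] n = sym (zeroʳ x)
    coef-scale x (a ∷ p) zero = refl
    coef-scale x (a ∷ p) (suc n) = coef-scale x p n

    coef-⊠ : ∀ p q → coef (p ⊠ q) ≋ (coef p ⊛ coef q)
    coef-⊠ [] q n = sym (Sr.0⊛ (coef []) (coef q) (λ _ → refl) n)
    coef-⊠ (a ∷ p) q zero = trans (coef-⊞ (scale a q) _ 0) (trans (+-identityʳ _) (coef-scale a q 0))
    coef-⊠ (a ∷ p) q (suc n) = trans (coef-⊞ (scale a q) _ (suc n)) (+-cong (coef-scale a q (suc n)) (coef-⊠ p q n))

  coef-⊞′ : ∀ p q n → coef (p ⊞ q) n ≈ coef p n + coef q n
  coef-⊞′ p q n = trans (coef-⊞ p q n) (Sr.⊕-at (coef p) (coef q) n)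

  -- Lists may carry trailing zeros, so equality compares the coefficient sequences.
  record _≈P_ (p q : Pl) : Set ℓ where
    constructor mk
    field at : coef p ≋ coef q
  open _≈P_ public

  opaque
    ≈P-refl : ∀ {p} → p ≈P p
    ≈P-refl = mk λ _ → refl

    ≈P-sym : ∀ {p q} → p ≈P q → q ≈P p
    ≈P-sym e = mk λ n → sym (at e n)

    ≈P-trans : ∀ {p q s} → p ≈P q → q ≈P s → p ≈P s
    ≈P-trans e f = mk λ n → trans (at e n) (at f n)

    ⊞-cong : ∀ {x y u v} → x ≈P y → u ≈P v → (x ⊞ u) ≈P (y ⊞ v)
    ⊞-cong {x} {y} {u} {v} e f = mk λ n → trans (coef-⊞′ x u n) (trans (+-cong (at e n) (at f n)) (sym (coef-⊞′ y v n)))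

    ⊠-cong : ∀ {x y u v} → x ≈P y → u ≈P v → (x ⊠ u) ≈P (y ⊠ v)
    ⊠-cong {x} {y} {u} {v} e f = mk λ n → trans (coef-⊠ x u n) (trans (Sr.⊛-cong (at e) (at f) n) (sym (coef-⊠ y v n)))

    ⊞-assoc : ∀ x y z → (x ⊞ y ⊞ z) ≈P (x ⊞ (y ⊞ z))
    ⊞-assoc x y z = mk λ n → trans (coef-⊞′ (x ⊞ y) z n) (trans (+-congʳ (coef-⊞′ x y n)) (trans (+-assoc _ _ _)
       (trans (+-congˡ (sym (coef-⊞′ y z n))) (sym (coef-⊞′ x (y ⊞ z) n)))))

    ⊞-comm : ∀ x y → (x ⊞ y) ≈P (y ⊞ x)
    ⊞-comm x y = mk λ n → trans (coef-⊞′ x y n) (trans (+-comm _ _) (sym (coef-⊞′ y x n)))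

    ⊞-idˡ : ∀ x → ([] ⊞ x) ≈P x
    ⊞-idˡ x = mk λ n → trans (coef-⊞′ [] x n) (+-identityˡ _)

    ⊞-self : ∀ x → (x ⊞ x) ≈P []
    ⊞-self x = mk λ n → trans (coef-⊞′ x x n) (self _)

    ⊠-assoc : ∀ x y z → (x ⊠ y ⊠ z) ≈P (x ⊠ (y ⊠ z))
    ⊠-assoc x y z = mk λ n → trans (coef-⊠ (x ⊠ y) z n) (trans (Sr.⊛-cong (coef-⊠ x y) (λ _ → refl) n)
       (trans (Sr.⊛-assoc (coef x) (coef y) (coef z) n)
       (trans (Sr.⊛-cong {coef x} (λ _ → refl) (λ m → sym (coef-⊠ y z m)) n) (sym (coef-⊠ x (y ⊠ z) n)))))

    ⊠-comm : ∀ x y → (x ⊠ y) ≈P (y ⊠ x)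
    ⊠-comm x y = mk λ n → trans (coef-⊠ x y n) (trans (Sr.⊛-comm (coef x) (coef y) n) (sym (coef-⊠ y x n)))

    ⊠-idˡ : ∀ x → ((1# ∷ []) ⊠ x) ≈P x
    ⊠-idˡ x = mk λ n → trans (coef-⊠ (1# ∷ []) x n) (trans (Sr.⊛-cong {coef (1# ∷ [])} {Sr.1s} (λ { zero → refl ; (suc _) → refl }) (λ _ → refl) n) (Sr.1⊛ (coef x) n))

    ⊠-distribˡ : ∀ x y z → (x ⊠ (y ⊞ z)) ≈P ((x ⊠ y) ⊞ (x ⊠ z))
    ⊠-distribˡ x y z = mk λ n → trans (coef-⊠ x (y ⊞ z) n) (trans (Sr.⊛-cong {coef x} (λ _ → refl) (coef-⊞ y z) n)
       (trans (Sr.⊛-distribˡ (coef x) (coef y) (coef z) n)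
       (trans (Sr.⊕-cong (λ m → sym (coef-⊠ x y m)) (λ m → sym (coef-⊠ x z m)) n) (sym (coef-⊞ (x ⊠ y) (x ⊠ z) n)))))

  PolyR : CR2 c ℓ
  PolyR = mkCR2 Pl _≈P_ _⊞_ _⊠_ [] (1# ∷ [])
    (record { refl = ≈P-refl ; sym = ≈P-sym ; trans = ≈P-trans }) ⊞-cong ⊠-cong ⊞-assoc ⊞-comm ⊞-idˡ ⊞-self ⊠-assoc ⊠-comm ⊠-idˡ ⊠-distribˡ

  module P = C2 PolyR

  C : Carrier → Pl
  C x = x ∷ []

  V : Pl
  V = 0# ∷ 1# ∷ []

  opaque
    unfolding _⊞_

    C-+ : ∀ x y → C (x + y) P.≈ C x P.+ C y
    C-+ x y = P.refl

    ∷-+ : ∀ a p b q → (a ∷ p) P.+ (b ∷ q) P.≈ (a + b) ∷ (p P.+ q)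
    ∷-+ a p b q = P.refl

    ∷-* : ∀ a p q → (a ∷ p) P.* q P.≈ scale a q P.+ (0# ∷ (p P.* q))
    ∷-* a p q = P.refl

    C-* : ∀ x y → C (x * y) P.≈ C x P.* C y
    C-* x y = mk λ { zero → sym (+-identityʳ _) ; (suc n) → refl }

  C-hom : Hom R PolyR
  C-hom = record
    { ⟦_⟧ = C ; ⟦⟧-cong = λ e → mk λ { zero → e ; (suc n) → refl } ; ⟦⟧-+ = C-+
    ; ⟦⟧-* = C-* ; ⟦⟧-1 = P.refl }

  coef-C : ∀ x → coef (C x) ≋ Sr.cst x
  coef-C x zero = refl
  coef-C x (suc n) = refl

  coef-V : coef V ≋ Sr.X
  coef-V zero = refl
  coef-V (suc zero) = refl
  coef-V (suc (suc n)) = refl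

  coef-C⊠ : ∀ x p → coef (C x ⊠ p) ≋ (x · coef p)
  coef-C⊠ x p n = trans (coef-⊠ (C x) p n) (trans (Sr.⊛-cong {b = Sr.cst x} (coef-C x) (λ _ → refl) n) (Sr.cst⊛ x (coef p) n))

  coef-V^ : ∀ k → coef (V P.^ k) ≋ (C2._^_ Sr.PS Sr.X k)
  coef-V^ zero zero = refl
  coef-V^ zero (suc n) = refl
  coef-V^ (suc k) n = trans (coef-⊠ V (V P.^ k) n) (Sr.⊛-cong {b = Sr.X} coef-V (coef-V^ k) n)

  coef-V⊠ : ∀ p n → coef (V ⊠ p) (suc n) ≈ coef p n
  coef-V⊠ p n = trans (coef-⊠ V p (suc n)) (trans (Sr.⊛-cong {b = Sr.X} coef-V (λ _ → refl) (suc n)) (Sr.X⊛-suc (coef p) n))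

  coef-V⊠0 : ∀ p → coef (V ⊠ p) 0 ≈ 0#
  coef-V⊠0 p = trans (coef-⊠ V p 0) (trans (Sr.⊛-at0 (coef V) (coef p)) (zeroˡ _))

  coef-V^⊠ : ∀ k p i → coef ((V P.^ k) ⊠ p) (k ℕ.+ i) ≈ coef p i
  coef-V^⊠ k p i = trans (coef-⊠ (V P.^ k) p _) (trans (Sr.⊛-cong (coef-V^ k) (λ _ → refl) (k ℕ.+ i)) (Sr.X^⊛ k (coef p) i))

  coef-V^⊠-< : ∀ k p i → i < k → coef ((V P.^ k) ⊠ p) i ≈ 0#
  coef-V^⊠-< k p i l = trans (coef-⊠ (V P.^ k) p i) (trans (Sr.⊛-cong (coef-V^ k) (λ _ → refl) i) (Sr.X^⊛-< k (coef p) i l))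

  coef-∑ : ∀ n f i → coef (P.∑ n f) i ≈ ∑ n (λ j → coef (f j) i)
  coef-∑ zero f i = refl
  coef-∑ (suc n) f i = trans (coef-⊞′ (P.∑ n f) (f n) i) (+-congʳ (coef-∑ n f i))

  cons-≈ : ∀ a p → (a ∷ p) P.≈ (C a P.+ V P.* p)
  cons-≈ a p = mk λ { zero → sym (trans (coef-⊞′ (C a) (V ⊠ p) 0) (trans (+-congˡ (coef-V⊠0 p)) (+-identityʳ _)))
                    ; (suc n) → sym (trans (coef-⊞′ (C a) (V ⊠ p) (suc n)) (trans (+-congˡ (coef-V⊠ p n)) (+-identityˡ _))) }

  tab : ℕ → (ℕ → Carrier) → Pl
  tab zero g = []
  tab (suc m) g = g 0 ∷ tab m (g ∘ suc)

  coef-tab : ∀ m g i → i < m → coef (tab m g) i ≡ g i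
  coef-tab (suc m) g zero _ = ≡.refl
  coef-tab (suc m) g (suc i) (s≤s l) = coef-tab m (g ∘ suc) i l

  coef-tab-≥ : ∀ m g → Sr.Dg m (coef (tab m g))
  coef-tab-≥ zero g i _ = refl
  coef-tab-≥ (suc m) g (suc i) (s≤s l) = coef-tab-≥ m (g ∘ suc) i l

  tab-cong : ∀ m {g g′ : ℕ → Carrier} → (∀ i → g i ≈ g′ i) → tab m g P.≈ tab m g′
  tab-cong zero h = P.refl
  tab-cong (suc m) h = mk λ { zero → h 0 ; (suc i) → at (tab-cong m (h ∘ suc)) i }

  tab-+ : ∀ m (g g′ : ℕ → Carrier) → tab m (λ i → g i + g′ i) P.≈ tab m g P.+ tab m g′
  tab-+ zero g g′ = P.sym (P.+-identityˡ [])
  tab-+ (suc m) g g′ = P.trans (mk λ { zero → refl ; (suc i) → at (tab-+ m (g ∘ suc) (g′ ∘ suc)) i }) (P.sym (∷-+ (g 0) _ (g′ 0) _))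

  tab-∑ : ∀ m (g : ℕ → Carrier) → tab m g P.≈ P.∑ m (λ i → C (g i) P.* V P.^ i)
  tab-∑ zero g = P.refl
  tab-∑ (suc m) g = P.trans (cons-≈ (g 0) (tab m (g ∘ suc))) (P.trans (P.+-cong (P.sym (P.*-identityʳ (C (g 0))))
      (P.trans (P.*-congˡ (tab-∑ m (g ∘ suc))) (P.trans (P.sym (P.∑-*ˡ m V _)) (P.∑-cong m λ i _ → swap (C (g (suc i))) (V P.^ i)))))
      (P.sym (P.∑-head m _)))
    where
    swap : ∀ a x → V P.* (a P.* x) P.≈ a P.* (V P.* x)
    swap a x = P.trans (P.sym (P.*-assoc V a x)) (P.trans (P.*-congʳ (P.*-comm V a)) (P.*-assoc a V x))

  Dg-length : ∀ p → Sr.Dg (length p) (coef p)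
  Dg-length [] i _ = refl
  Dg-length (a ∷ p) (suc i) (s≤s l) = Dg-length p i l

  Deg< : ℕ → Pl → Set ℓ
  Deg< d p = Sr.Dg d (coef p)

  Deg<-cong : ∀ {d p q} → p P.≈ q → Deg< d p → Deg< d q
  Deg<-cong e h i l = trans (sym (at e i)) (h i l)

  Deg<-≤ : ∀ {d e} p → d ≤ e → Deg< d p → Deg< e p
  Deg<-≤ p d≤e h i l = h i (ℕ.≤-trans d≤e l)

  Deg<-+ : ∀ {d} p q → Deg< d p → Deg< d q → Deg< d (p P.+ q)
  Deg<-+ p q h g i l = trans (coef-⊞′ p q i) (+-0 (h i l) (g i l))

  Deg<-* : ∀ {d e} p q → Deg< (suc d) p → Deg< e q → Deg< (d ℕ.+ e) (p P.* q)
  Deg<-* p q h g i l = trans (coef-⊠ p q i) (Sr.Dg-⊛ {a = coef p} {coef q} h g i l)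

  Deg<-^ : ∀ {d} p m → Deg< (suc d) p → Deg< (suc (m ℕ.* d)) (p P.^ m)
  Deg<-^ p zero h (suc i) _ = refl
  Deg<-^ {d} p (suc m) h = Deg<-≤ (p P.* p P.^ m) (ℕ.≤-reflexive (ℕ.+-suc d (m ℕ.* d))) (Deg<-* p (p P.^ m) h (Deg<-^ p m h))

  Deg<-V^ : ∀ m → Deg< (suc m) (V P.^ m)
  Deg<-V^ m i l = trans (coef-V^ m i) (Sr.Dg-X^ m i l)

  coef-V^-top : ∀ m → coef (V P.^ m) m ≈ 1#
  coef-V^-top m = trans (reflexive (≡.cong (coef (V P.^ m)) (≡.sym (ℕ.+-identityʳ m))))
                    (trans (at (P.sym (P.*-identityʳ (V P.^ m))) _) (coef-V^⊠ m (C 1#) 0))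

  Deg<-C : ∀ x → Deg< 1 (C x)
  Deg<-C x (suc i) _ = refl

  Deg<-∑ : ∀ {d} n f → (∀ i → i < n → Deg< d (f i)) → Deg< d (P.∑ n f)
  Deg<-∑ n f h i l = trans (coef-∑ n f i) (∑-0 n (λ j j<n → h j j<n i l))

  ⊠-top : ∀ d e p q → Deg< (suc d) p → Deg< (suc e) q → coef (p P.* q) (d ℕ.+ e) ≈ coef p d * coef q e
  ⊠-top d e p q h g = trans (coef-⊠ p q _) (Sr.⊛-top d e {coef p} {coef q} h g)

  HasDeg : ℕ → Pl → Set ℓ
  HasDeg d p = Sr.HasDeg d (coef p)

  module Ev {b ℓ′} {S : CR2 b ℓ′} (ι : Hom R S) (s : CR2.Carrier S) where
    private
      module S = C2 S
      module ι = Hom ι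

    ev : Pl → S.Carrier
    ev [] = S.0#
    ev (a ∷ p) = ι.⟦ a ⟧ S.+ s S.* ev p

    ev-0 : ∀ p → coef p ≋ coef [] → ev p S.≈ S.0#
    ev-0 [] e = S.refl
    ev-0 (a ∷ p) e = S.+-0 (ι.⟦⟧-≈0 (e 0)) (S.*-0ʳ s (ev-0 p (e ∘ suc)))

    ev-cong : ∀ p q → coef p ≋ coef q → ev p S.≈ ev q
    ev-cong [] q e = S.sym (ev-0 q (λ n → sym (e n)))
    ev-cong (a ∷ p) [] e = ev-0 (a ∷ p) e
    ev-cong (a ∷ p) (b ∷ q) e = S.+-cong (ι.⟦⟧-cong (e 0)) (S.*-congˡ (ev-cong p q (e ∘ suc)))

    opaque
      unfolding _⊞_

      ev-⊞ : ∀ p q → ev (p ⊞ q) S.≈ ev p S.+ ev q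
      ev-⊞ [] q = S.sym (S.+-identityˡ _)
      ev-⊞ (a ∷ p) [] = S.sym (S.+-identityʳ _)
      ev-⊞ (a ∷ p) (b ∷ q) = S.trans (S.+-cong (ι.⟦⟧-+ a b) (S.*-congˡ (ev-⊞ p q)))
        (Ids.alg4 S _ _ _ _ _)

      ev-scale : ∀ x p → ev (scale x p) S.≈ ι.⟦ x ⟧ S.* ev p
      ev-scale x [] = S.sym (S.zeroʳ _)
      ev-scale x (a ∷ p) = S.trans (S.+-cong (ι.⟦⟧-* x a) (S.*-congˡ (ev-scale x p)))
        (Ids.alg5 S _ _ _ _)

      ev-⊠ : ∀ p q → ev (p ⊠ q) S.≈ ev p S.* ev q
      ev-⊠ [] q = S.sym (S.zeroˡ _)
      ev-⊠ (a ∷ p) q = S.trans (ev-⊞ (scale a q) (0# ∷ (p ⊠ q)))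
        (S.trans (S.+-cong (ev-scale a q) (S.+-cong ι.⟦⟧-0 (S.*-congˡ (ev-⊠ p q))))
        (Ids.alg6 S _ _ _ _))

    ev-hom : Hom PolyR S
    ev-hom = record
      { ⟦_⟧ = ev ; ⟦⟧-cong = λ {p} {q} e → ev-cong p q (at e) ; ⟦⟧-+ = ev-⊞ ; ⟦⟧-* = ev-⊠
      ; ⟦⟧-1 = S.trans (S.+-cong ι.⟦⟧-1 (S.zeroʳ s)) (S.+-identityʳ _) }

    ev-C : ∀ a → ev (C a) S.≈ ι.⟦ a ⟧
    ev-C a = S.trans (S.+-congˡ (S.zeroʳ s)) (S.+-identityʳ _)

    ev-V : ev V S.≈ s
    ev-V = S.trans (S.+-cong ι.⟦⟧-0 (S.*-congˡ (S.trans (ev-C 1#) ι.⟦⟧-1))) (S.trans (S.+-identityˡ _) (S.*-identityʳ s))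

    ev-tab : ∀ m g → ev (tab m g) S.≈ S.∑ m (λ i → ι.⟦ g i ⟧ S.* s S.^ i)
    ev-tab zero g = S.refl
    ev-tab (suc m) g = S.trans (S.+-cong (S.sym (S.*-identityʳ _)) (S.trans (S.*-congˡ (ev-tab m (g ∘ suc)))
        (S.trans (S.sym (S.∑-*ˡ m s _)) (S.∑-cong m (λ i _ → Ids.swap-id₂ S _ _ _)))))
        (S.sym (S.∑-head m _))

    ev-bound : ∀ p m → Deg< m p → ev p S.≈ S.∑ m (λ i → ι.⟦ coef p i ⟧ S.* s S.^ i)
    ev-bound p m h = S.trans (ev-cong p (tab m (coef p)) eq) (ev-tab m (coef p))
      where
      eq : coef p ≋ coef (tab m (coef p))
      eq i with i ℕ.<? m
      ... | yes l = sym (reflexive (coef-tab m (coef p) i l))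
      ... | no ¬l = trans (h i (ℕ.≮⇒≥ ¬l)) (sym (coef-tab-≥ m (coef p) i (ℕ.≮⇒≥ ¬l)))

  hom-unique : ∀ {b ℓ′} {S : CR2 b ℓ′} (φ ψ : Hom PolyR S) → let module S = CR2 S in
    (∀ a → Hom.⟦_⟧ φ (C a) S.≈ Hom.⟦_⟧ ψ (C a)) → Hom.⟦_⟧ φ V S.≈ Hom.⟦_⟧ ψ V → ∀ p → Hom.⟦_⟧ φ p S.≈ Hom.⟦_⟧ ψ p
  hom-unique {S = S} φ ψ hC hV [] = C2.trans S (Hom.⟦⟧-0 φ) (C2.sym S (Hom.⟦⟧-0 ψ))
  hom-unique {S = S} φ ψ hC hV (a ∷ p) = trans′ (φ.⟦⟧-cong (cons-≈ a p)) (trans′ (step φ)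
    (trans′ (S.+-cong (hC a) (S.*-cong hV (hom-unique φ ψ hC hV p))) (S.sym (trans′ (ψ.⟦⟧-cong (cons-≈ a p)) (step ψ)))))
    where
    module S = C2 S
    module φ = Hom φ
    module ψ = Hom ψ
    trans′ = S.trans
    step : (χ : Hom PolyR S) → Hom.⟦_⟧ χ (C a P.+ V P.* p) S.≈ Hom.⟦_⟧ χ (C a) S.+ Hom.⟦_⟧ χ V S.* Hom.⟦_⟧ χ p
    step χ = S.trans (Hom.⟦⟧-+ χ _ _) (S.+-congˡ (Hom.⟦⟧-* χ _ _))

  module _ (D : Domain R) where
    private module SD = Domain (Sr.Ser-domain D)
    open Domain D using (stable; 0≉1)

    Poly-domain : Domain PolyR
    Poly-domain = record
      { stable = λ h → mk λ n → stable (λ k → h (λ e → k (at e n)))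
      ; 0≉1 = λ e → 0≉1 (at e 0)
      ; noZeroDiv = λ {p} {q} e np → mk (Sr.at (SD.noZeroDiv {coef p} {coef q}
          (Sr.mk λ n → trans (sym (coef-⊠ p q n)) (at e n)) (λ z → np (mk (Sr.at z))))) }

    HasDeg-* : ∀ {d e} p q → HasDeg d p → HasDeg e q → HasDeg (d ℕ.+ e) (p P.* q)
    HasDeg-* p q h g = Sr.HasDeg-cong D (λ n → sym (coef-⊠ p q n)) (Sr.HasDeg-⊛ D {a = coef p} {coef q} h g)

    ¬¬HasDeg : ∀ p → ¬ p P.≈ P.0# → ¬ ¬ (∃ λ d → HasDeg d p)
    ¬¬HasDeg p np k = Sr.¬¬HasDeg D (length p) {coef p} (Dg-length p) (λ z → np (mk z)) (λ { (d , _ , h) → k (d , h) })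

    Deg<-factor : ∀ {d} e p q → HasDeg d p → Deg< (d ℕ.+ e) (p P.* q) → Deg< e q
    Deg<-factor {d} e p q h g = Sr.Dg-factor D {d} {e} {coef p} {coef q} (length q) h (Dg-length q)
      (λ i l → trans (sym (coef-⊠ p q i)) (g i l))

    HasDeg-^ : ∀ {d} p m → HasDeg d p → HasDeg (m ℕ.* d) (p P.^ m)
    HasDeg-^ p zero h = (λ { (suc i) _ → refl }) , λ e → 0≉1 (sym e)
    HasDeg-^ p (suc m) h = HasDeg-* p (p P.^ m) h (HasDeg-^ p m h)

  coef-V^-≢ : ∀ m i → ¬ i ≡ m → coef (V P.^ m) i ≈ 0#
  coef-V^-≢ m i i≢m with i ℕ.<? m
  ... | yes l = trans (at (P.sym (P.*-identityʳ (V P.^ m))) i) (coef-V^⊠-< m P.1# i l)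
  ... | no ¬l = Deg<-V^ m i (ℕ.≤∧≢⇒< (ℕ.≮⇒≥ ¬l) (λ e → i≢m (≡.sym e)))

  drop : ℕ → Pl → Pl
  drop zero p = p
  drop (suc k) [] = []
  drop (suc k) (a ∷ p) = drop k p

  coef-drop : ∀ k p i → coef (drop k p) i ≡ coef p (k ℕ.+ i)
  coef-drop zero p i = ≡.refl
  coef-drop (suc k) [] i = ≡.refl
  coef-drop (suc k) (a ∷ p) i = coef-drop k p i

-- Fields, quotients, the Euclidean algorithm and adjunction of a root

record Field {c ℓ} (R : CR2 c ℓ) : Set (c ⊔ ℓ) where
  open C2 R
  field
    domain : Domain R
    -- The double negation is forced by the quotient field, where an inverse is read off a Bézout
    -- identity whose computation tests leading coefficients for zero.
    inv : ∀ x → ¬ x ≈ 0# → ¬ ¬ (∃ λ y → x * y ≈ 1#)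

module Quotient {c ℓ} (R : CR2 c ℓ) (h : CR2.Carrier R) where
  open C2 R

  -- Congruence modulo h. The double negation around the cofactor makes this equality stable, as
  -- `Domain` demands.
  record _≈Q_ (a b : Carrier) : Set (c ⊔ ℓ) where
    constructor mk
    field un : ¬ ¬ (∃ λ k → a + b ≈ h * k)
  open _≈Q_ public

  lift : ∀ {a b} → a ≈ b → a ≈Q b
  lift e = mk λ k → k (0# , trans (≈⇒sum-0 e) (sym (zeroʳ h)))

  QuotR : CR2 c (c ⊔ ℓ)
  QuotR = mkCR2 Carrier _≈Q_ _+_ _*_ 0# 1#
    (record { refl = lift refl
            ; sym = λ p → mk λ z → un p λ { (k , e) → z (k , trans (+-comm _ _) e) }
            ; trans = λ p r → mk λ z → un p λ { (k , e) → un r λ { (l , f) → z (k + l ,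
                trans (Ids.alg7 R _ _ _) (trans (+-cong e f) (sym (distribˡ h k l)))) } } })
    (λ p r → mk λ z → un p λ { (k , e) → un r λ { (l , f) → z (k + l ,
        trans (Ids.alg8 R _ _ _ _) (trans (+-cong e f) (sym (distribˡ h k l)))) } })
    (λ {x} {y} {u} {v} p r → mk λ z → un p λ { (k , e) → un r λ { (l , f) → z (k * u + y * l ,
        trans (Ids.alg9 R x y u v)
        (trans (+-cong (*-congʳ e) (*-congˡ f)) (Ids.alg10 R h k u y l))) } })
    (λ _ _ _ → lift (+-assoc _ _ _)) (λ _ _ → lift (+-comm _ _)) (λ _ → lift (+-identityˡ _)) (λ _ → lift (self _))
    (λ _ _ _ → lift (*-assoc _ _ _)) (λ _ _ → lift (*-comm _ _)) (λ _ → lift (*-identityˡ _)) (λ _ _ _ → lift (distribˡ _ _ _))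

  proj : Hom R QuotR
  proj = record { ⟦_⟧ = id ; ⟦⟧-cong = lift ; ⟦⟧-+ = λ _ _ → lift refl ; ⟦⟧-* = λ _ _ → lift refl ; ⟦⟧-1 = lift refl }

  ≈0Q : ∀ {a} → a ≈Q 0# → ¬ ¬ (∃ λ k → a ≈ h * k)
  ≈0Q p z = un p λ { (k , e) → z (k , trans (sym (+-identityʳ _)) e) }

  0Q : ∀ {a} k → a ≈ h * k → a ≈Q 0#
  0Q k e = mk λ z → z (k , trans (+-identityʳ _) e)

  stableQ : ∀ {a b} → ¬ ¬ (a ≈Q b) → a ≈Q b
  stableQ nn = mk λ z → nn λ p → un p z

module Euclid {c ℓ} (K : CR2 c ℓ) (F : Field K) where
  open C2 K
  open Field F
  open Domain domain
  open Poly K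
  private
    module PD = Domain (Poly-domain domain)

  infix 4 _∣_
  _∣_ : Pl → Pl → Set (c ⊔ ℓ)
  p ∣ q = ∃ λ k → q P.≈ p P.* k

  division : ∀ d B y → Deg< (suc d) B → coef B d * y ≈ 1# → ∀ e A → Deg< e A →
    ∃₂ λ s r → A P.≈ s P.* B P.+ r × Deg< d r
  division d B y hB hy zero A hA = [] , A , P.sym (P.trans (P.+-congʳ (P.zeroˡ B)) (P.+-identityˡ A)) , λ i _ → hA i z≤n
  division d B y hB hy (suc e) A hA with d ℕ.≤? e
  ... | no d≰e = [] , A , P.sym (P.trans (P.+-congʳ (P.zeroˡ B)) (P.+-identityˡ A)) , Deg<-≤ A (ℕ.≰⇒> d≰e) hA
  ... | yes d≤e with ℕ.m≤n⇒∃[o]m+o≡n d≤e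
  ... | m , ≡.refl = extend (division d B y hB hy (d ℕ.+ m) A′ hA′)
    where
    a = coef A (d ℕ.+ m)
    M = C (a * y) P.* (V P.^ m P.* B)
    A′ = A P.+ M
    coefM : ∀ i → coef M i ≈ (a * y) * coef (V P.^ m P.* B) i
    coefM = coef-C⊠ (a * y) (V P.^ m P.* B)
    hM : Deg< (suc (d ℕ.+ m)) M
    hM i l = trans (coefM i) (*-0ʳ _ (Deg<-* (V P.^ m) B (Deg<-V^ m) hB i
               (ℕ.≤-trans (ℕ.≤-reflexive (≡.trans (ℕ.+-suc m d) (≡.cong suc (ℕ.+-comm m d)))) l)))
    topM : coef M (d ℕ.+ m) ≈ a
    topM = trans (coefM _) (trans (*-congˡ (trans (reflexive (≡.cong (coef (V P.^ m P.* B)) (ℕ.+-comm d m))) (coef-V^⊠ m B d)))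
             (trans (Ids.alg11 K _ _ _) (trans (*-congˡ hy) (*-identityʳ a))))
    hA′ : Deg< (d ℕ.+ m) A′
    hA′ = Series.Dg-lower K {a = coef A′} (Deg<-+ A M hA hM) (trans (coef-⊞′ A M _) (≈⇒sum-0 (sym topM)))
    extend : (∃₂ λ s r → A′ P.≈ s P.* B P.+ r × Deg< d r) → ∃₂ λ s r → A P.≈ s P.* B P.+ r × Deg< d r
    extend (s , r , e′ , hr) = s P.+ C (a * y) P.* V P.^ m , r ,
      P.trans (Ids.alg1 PolyR A M) (P.trans (P.+-congʳ e′)
      (Ids.alg12 PolyR s B r (C (a * y)) (V P.^ m))) , hr

  record Bezout (A B : Pl) : Set (c ⊔ ℓ) where
    field
      g A′ B′ x y : Pl
      A≈ : A P.≈ g P.* A′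
      B≈ : B P.≈ g P.* B′
      unit : x P.* A′ P.+ y P.* B′ P.≈ P.1#

  -- Euclid's algorithm, by recursion on a degree bound for B: the bound drops either because
  -- coefficient d is zero or by one division with remainder. The cofactors `A′` and `B′` are
  -- carried along, so that coprimality is expressed by a combination of them equal to 1.
  bezout : ∀ d A B → Deg< d B → ¬ ¬ Bezout A B
  bezout zero A B hB k = k (record { g = A ; A′ = P.1# ; B′ = [] ; x = P.1# ; y = []
    ; A≈ = P.sym (P.*-identityʳ A) ; B≈ = P.trans (mk λ i → hB i z≤n) (P.sym (P.zeroʳ A))
    ; unit = P.trans (P.+-congˡ (P.zeroˡ [])) (P.trans (P.+-identityʳ (P.1# P.* P.1#)) (P.*-identityˡ P.1#)) })
  bezout (suc d) A B hB k = ¬¬LEM (coef B d ≈ 0#) λ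
    { (inj₁ z) → bezout d A B (Series.Dg-lower K {a = coef B} hB z) k
    ; (inj₂ nz) → inv _ nz λ { (w , hw) → step (division d B w hB hw (length A) A (Dg-length A)) } }
    where
    step : (∃₂ λ s r → A P.≈ s P.* B P.+ r × Deg< d r) → ⊥
    step (s , r , e , hr) = bezout d B r hr λ b → let open Bezout b in k (record
      { g = g ; A′ = s P.* A′ P.+ B′ ; B′ = A′ ; x = y ; y = x P.+ y P.* s
      ; A≈ = P.trans e (P.trans (P.+-cong (P.*-congˡ A≈) B≈)
          (Ids.alg13 PolyR s g A′ B′))
      ; B≈ = A≈
      ; unit = P.trans (Ids.alg14 PolyR s A′ B′ x y) unit })

  minimal : ∀ {p} (Pr : ℕ → Set p) → ∀ n → Pr n → ¬ ¬ (∃ λ d → Pr d × (∀ d′ → d′ < d → ¬ Pr d′))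
  minimal Pr = <-rec (λ n → Pr n → ¬ ¬ (∃ λ d → Pr d × (∀ d′ → d′ < d → ¬ Pr d′)))
    λ n rec pn k → k (n , pn , λ d′ l pd → rec l pd k)

  0<1×HasDeg0 : ∀ {p} → HasDeg 0 p → p P.≈ C (coef p 0)
  0<1×HasDeg0 (h , _) = mk λ { zero → refl ; (suc i) → h (suc i) (s≤s z≤n) }

record Extension {c ℓ} (K : CR2 c ℓ) (p : Poly.Pl K) : Set (lsuc (c ⊔ ℓ)) where
  field
    L : CR2 c (c ⊔ ℓ)
    L-field : Field L
    ι : Hom K L
    root : CR2.Carrier L
    is-root : CR2._≈_ L (Poly.Ev.ev K ι root p) (CR2.0# L)

module Kronecker {c ℓ} (K : CR2 c ℓ) (F : Field K) where
  open C2 K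
  open Field F
  open Domain domain
  open Poly K
  open Euclid K F
  private
    module PD = Domain (Poly-domain domain)

  -- A nonconstant divisor ϖ of p of least degree has no proper factor, so K[V]/ϖ is a field, and in
  -- it the class of V is a root of p.
  extension : ∀ n p → HasDeg (suc n) p → ¬ ¬ Extension K p
  extension n p hp k = minimal (λ d → ∃ λ ϖ → HasDeg d ϖ × 0 < d × ϖ ∣ p) (suc n)
      (p , hp , z<s , P.1# , P.sym (P.*-identityʳ p)) build
    where
    build : (∃ λ d → (∃ λ ϖ → HasDeg d ϖ × 0 < d × ϖ ∣ p) × (∀ d′ → d′ < d → ¬ (∃ λ ϖ → HasDeg d′ ϖ × 0 < d′ × ϖ ∣ p))) → ⊥
    build (d , (ϖ , hϖ , 0<d , m , p≈) , least) = k (record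
      { L = QuotR ; L-field = record { domain = dom ; inv = inverse } ; ι = ιL ; root = V ; is-root = rt })
      where
      open Quotient PolyR ϖ
      module L = C2 QuotR

      inverse : ∀ a → ¬ a L.≈ L.0# → ¬ ¬ (∃ λ y → a L.* y L.≈ L.1#)
      inverse a na z = bezout (suc d) a ϖ (proj₁ hϖ) go
        where
        -- Here ϖ = g·`B′` with g a common divisor of a and ϖ. If g is constant, the Bézout identity
        -- inverts a; if `B′` is constant, ϖ divides a and a is zero in the quotient; otherwise g is
        -- a nonconstant divisor of p of smaller degree than ϖ.
        go : Bezout a ϖ → ⊥
        go b = ¬¬HasDeg domain g (λ g0 → proj₂ hϖ (trans (at (P.trans B≈ (P.*-0ˡ B′ g0)) d) refl)) λ
          { (zero , hg) → inv (coef g 0) (proj₂ hg) λ { (w , hw) → z (x P.* C w , mk λ zz → zz (C w P.* y ,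
               eqn w hw hg)) }
          ; (suc e , hg) → ¬¬HasDeg domain B′ (λ b0 → proj₂ hϖ (at (P.trans B≈ (P.*-0ʳ g b0)) d)) λ
            { (zero , hb) → inv (coef B′ 0) (proj₂ hb) λ { (w , hw) → na (0Q (C w P.* A′)
                 (P.trans A≈ (P.sym (P.trans (P.*-congʳ (P.trans B≈ (P.*-congˡ (0<1×HasDeg0 {B′} hb))))
                   (P.trans (Ids.alg15 PolyR g (C (coef B′ 0)) (C w) A′)
                     (P.trans (P.*-congʳ (P.trans (P.sym (Hom.⟦⟧-* C-hom (coef B′ 0) w)) (Hom.⟦⟧-cong C-hom hw))) (P.*-identityˡ _))))))) }
            ; (suc f , hb) → least (suc e) (lt hg hb) (g , hg , z<s , B′ P.* m , P.trans p≈ (P.trans (P.*-congʳ B≈) (P.*-assoc g B′ m))) } }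
          where
          open Bezout b
          lt : ∀ {e f} → HasDeg (suc e) g → HasDeg (suc f) B′ → suc e < d
          lt {e} {f} hg hb with suc e ℕ.<? d
          ... | yes l = l
          ... | no ¬l = ⊥-elim (proj₂ hgb (trans (sym (at B≈ (suc e ℕ.+ suc f)))
                  (proj₁ hϖ _ (ℕ.≤-<-trans (ℕ.≮⇒≥ ¬l) (ℕ.m<m+n (suc e) z<s)))))
            where hgb = HasDeg-* domain g B′ hg hb
          eqn : ∀ w → coef g 0 * w ≈ 1# → HasDeg 0 g → a P.* (x P.* C w) P.+ P.1# P.≈ ϖ P.* (C w P.* y)
          eqn w hw hg = P.trans (P.+-cong (P.*-congʳ A≈) (P.trans (P.sym unit) (P.trans (P.sym (P.*-identityˡ _)) (P.*-congʳ (P.sym gw)))))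
             (P.trans (Ids.alg40 PolyR g A′ B′ x y (C w))
             (P.*-congʳ (P.sym B≈)))
            where
            gw : g P.* C w P.≈ P.1#
            gw = P.trans (P.*-congʳ (0<1×HasDeg0 {g} hg)) (P.trans (P.sym (Hom.⟦⟧-* C-hom _ w)) (Hom.⟦⟧-cong C-hom hw))

      dom : Domain QuotR
      dom = record
        { stable = stableQ
        ; 0≉1 = λ e → ≈0Q (L.sym e) λ { (l , e1) → ¬¬HasDeg domain l (λ l0 → PD.0≉1 (P.sym (P.trans e1 (P.*-0ʳ ϖ l0)))) λ
            { (f , hl) → proj₂ (HasDeg-* domain ϖ l hϖ hl) (trans (sym (at e1 (d ℕ.+ f))) (Deg<-C 1# _ (ℕ.≤-trans 0<d (ℕ.m≤m+n d f)))) } }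
        ; noZeroDiv = λ {a} {b} e na → stableQ λ nb → inverse a na λ { (y , ye) → nb
            (L.trans (L.sym (L.trans (L.*-congʳ (L.trans (L.*-comm y a) ye)) (L.*-identityˡ b))) (L.trans (L.*-assoc y a b) (L.*-0ʳ y e))) } }

      ιL : Hom K QuotR
      ιL = proj ∘h C-hom

      rt : Ev.ev ιL V p L.≈ L.0#
      -- Evaluation at the class of V agrees with the projection K[V] → K[V]/ϖ, both being
      -- determined by their values on constants and on V; and p is a multiple of ϖ.
      rt = L.trans (hom-unique (Ev.ev-hom ιL V) proj (λ a → Ev.ev-C ιL V a) (Ev.ev-V ιL V) p) (0Q m p≈)

-- The curve, separability of P, and the absence of factors linear in v

module Derivative {c ℓ} (K : CR2 c ℓ) where
  open C2 K
  open Poly K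

  D : Pl → Pl
  D [] = []
  D (a ∷ p) = p P.+ (0# ∷ D p)

  shift-≈ : ∀ p → (0# ∷ p) P.≈ V P.* p
  shift-≈ p = P.trans (cons-≈ 0# p) (P.trans (P.+-congʳ {x = V P.* p} (mk λ { zero → refl ; (suc _) → refl })) (P.+-identityˡ _))

  D-cons : ∀ a p → D (a ∷ p) P.≈ p P.+ V P.* D p
  D-cons a p = P.+-congˡ {p} (shift-≈ (D p))

  D-0 : ∀ p → p P.≈ [] → D p P.≈ []
  D-0 [] e = P.refl
  D-0 (a ∷ p) e = P.trans (D-cons a p) (P.+-0 p≈0 (P.*-0ʳ V (D-0 p p≈0)))
    where
    p≈0 : p P.≈ []
    p≈0 = mk λ n → at e (suc n)

  D-cong : ∀ p q → p P.≈ q → D p P.≈ D q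
  D-cong [] q e = P.sym (D-0 q (P.sym e))
  D-cong (a ∷ p) [] e = D-0 (a ∷ p) e
  D-cong (a ∷ p) (b ∷ q) e = P.trans (D-cons a p) (P.trans (P.+-cong pq (P.*-congˡ (D-cong p q pq))) (P.sym (D-cons b q)))
    where
    pq : p P.≈ q
    pq = mk λ n → at e (suc n)

  D-+ : ∀ p q → D (p P.+ q) P.≈ D p P.+ D q
  D-+ [] q = P.trans (D-cong _ _ (P.+-identityˡ q)) (P.sym (P.+-identityˡ (D q)))
  D-+ (a ∷ p) [] = P.trans (D-cong _ _ (P.+-identityʳ (a ∷ p))) (P.sym (P.+-identityʳ _))
  D-+ (a ∷ p) (b ∷ q) = P.trans (D-cong _ _ (∷-+ a p b q)) $ P.trans (D-cons (a + b) (p P.+ q)) (P.trans (P.+-congˡ (P.*-congˡ (D-+ p q)))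
    (P.trans (Ids.alg16 PolyR p q V (D p) (D q))
      (P.+-cong (P.sym (D-cons a p)) (P.sym (D-cons b q)))))

  D-scale : ∀ x p → D (scale x p) P.≈ C x P.* D p
  D-scale x [] = P.sym (P.zeroʳ (C x))
  D-scale x (a ∷ p) = P.trans (D-cons (x * a) (scale x p)) (P.trans (P.+-cong (mk λ n → trans (coef-scale x p n) (sym (coef-C⊠ x p n))) (P.*-congˡ (D-scale x p)))
    (P.trans (Ids.alg5 PolyR (C x) p V (D p)) (P.*-congˡ (P.sym (D-cons a p)))))

  D-* : ∀ p q → D (p P.* q) P.≈ D p P.* q P.+ p P.* D q
  D-* [] q = P.trans (D-cong _ _ (P.zeroˡ q)) (P.sym (P.+-0 (P.zeroˡ q) (P.zeroˡ (D q))))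
  D-* (a ∷ p) q = P.trans (D-cong _ _ (∷-* a p q)) $ P.trans (D-+ (scale a q) (0# ∷ (p P.* q))) (P.trans (P.+-cong (D-scale a q)
      (P.trans (D-cons 0# (p P.* q)) (P.+-congˡ (P.*-congˡ (D-* p q)))))
    (P.trans (Ids.alg41 PolyR (C a) (D q) p q V (D p))
      (P.+-cong (P.*-congʳ (P.sym (D-cons a p))) (P.*-congʳ (P.sym (cons-≈ a p))))))

  -- The derivative of A² is 2·A·A′ = 0, so squares behave as constants for `D`. This is how
  -- separability will exclude square factors of P.
  D-sq : ∀ A q → D (A P.* A P.* q) P.≈ A P.* A P.* D q
  D-sq A q = P.trans (D-* (A P.* A) q) (P.trans (P.+-congʳ (P.*-0ˡ q (P.trans (D-* A A) (P.≈⇒sum-0 (P.*-comm (D A) A))))) (P.+-identityˡ _))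

-- The curve P(u)·P′(v) + u^q·v^q = 0 with P = u^(q+1) + b·u + c and P′ = v^(q+1) + b′·v + c′.
record Coefficients (κ ℓ : Level) : Set (lsuc (κ ⊔ ℓ)) where
  field
    K : CR2 κ ℓ
    q₂ : ℕ
    b c b′ c′ : CR2.Carrier K

module Curve {κ ℓ} (𝒞 : Coefficients κ ℓ) where
  open Coefficients 𝒞
  open C2 K
  module B₁ = Poly K
  module B₂ = Poly B₁.PolyR
  module P₁ = B₁.P
  module P₂ = B₂.P

  q n : ℕ
  q = suc (suc q₂)
  n = suc q

  u : B₁.Pl
  u = B₁.V

  v : B₂.Pl
  v = B₂.V

  P : B₁.Pl
  P = u P₁.^ n P₁.+ (B₁.C b P₁.* u P₁.+ B₁.C c)

  ν : B₁.Pl → B₂.Pl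
  ν = B₂.C

  f̂ f : B₂.Pl
  f̂ = v P₂.^ n P₂.+ (ν (B₁.C b′) P₂.* v P₂.+ ν (B₁.C c′))
  f = ν P P₂.* f̂ P₂.+ ν (u P₁.^ q) P₂.* v P₂.^ q

  coef-P : ∀ i → B₁.coef P i ≈ B₁.coef (u P₁.^ n) i + (b * B₁.coef u i + B₁.coef (B₁.C c) i)
  coef-P i = trans (B₁.coef-⊞′ (u P₁.^ n) _ i) (+-congˡ (trans (B₁.coef-⊞′ (B₁.C b P₁.* u) (B₁.C c) i) (+-congʳ (B₁.coef-C⊠ b u i))))

  Deg-P : B₁.Deg< (suc n) P
  Deg-P i l = trans (coef-P i) (+-0 (B₁.Deg<-V^ n i l) (+-0 (*-0ʳ b (Deg-u i l)) (B₁.Deg<-C c i (ℕ.≤-trans (s≤s z≤n) l))))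
    where
    Deg-u : B₁.Deg< (suc n) u
    Deg-u (suc (suc i)) _ = refl
    Deg-u (suc zero) (s≤s ())

  P-top : B₁.coef P n ≈ 1#
  P-top = trans (coef-P n) (trans (+-cong (B₁.coef-V^-top n) (+-0 (zeroʳ b) refl)) (+-identityʳ 1#))

  f̂-coef : ∀ i → B₂.coef f̂ i P₁.≈ B₂.coef (v P₂.^ n) i P₁.+ (B₁.C b′ P₁.* B₂.coef v i P₁.+ B₂.coef (ν (B₁.C c′)) i)
  f̂-coef i = P₁.trans (B₂.coef-⊞′ (v P₂.^ n) _ i) (P₁.+-congˡ (P₁.trans (B₂.coef-⊞′ _ (ν (B₁.C c′)) i) (P₁.+-congʳ (B₂.coef-C⊠ (B₁.C b′) v i))))

  f-coef : ∀ i → B₂.coef f i P₁.≈ P P₁.* B₂.coef f̂ i P₁.+ u P₁.^ q P₁.* B₂.coef (v P₂.^ q) i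
  f-coef i = P₁.trans (B₂.coef-⊞′ _ _ i) (P₁.+-cong (B₂.coef-C⊠ P f̂ i) (B₂.coef-C⊠ (u P₁.^ q) (v P₂.^ q) i))

  private
    0P = P₁.0#

  f̂-0 : B₂.coef f̂ 0 P₁.≈ B₁.C c′
  f̂-0 = P₁.trans (f̂-coef 0) (P₁.trans (P₁.+-cong (B₂.coef-V^-≢ n 0 (λ ())) (P₁.+-congʳ (P₁.zeroʳ (B₁.C b′))))
          (P₁.trans (P₁.+-identityˡ _) (P₁.+-identityˡ _)))

  f̂-1 : B₂.coef f̂ 1 P₁.≈ B₁.C b′
  f̂-1 = P₁.trans (f̂-coef 1) (P₁.trans (P₁.+-cong (B₂.coef-V^-≢ n 1 (λ ())) (P₁.+-congʳ (P₁.*-identityʳ (B₁.C b′))))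
          (P₁.trans (P₁.+-identityˡ _) (P₁.+-identityʳ _)))

  f̂-mid : ∀ i → ¬ suc (suc i) ≡ n → B₂.coef f̂ (suc (suc i)) P₁.≈ P₁.0#
  f̂-mid i i≢ = P₁.trans (f̂-coef _) (P₁.+-0 (B₂.coef-V^-≢ n _ i≢) (P₁.+-0 (P₁.zeroʳ (B₁.C b′)) P₁.refl))

  f̂-n : B₂.coef f̂ n P₁.≈ P₁.1#
  f̂-n = P₁.trans (f̂-coef n) (P₁.trans (P₁.+-cong (B₂.coef-V^-top n) (P₁.+-0 (P₁.zeroʳ (B₁.C b′)) P₁.refl)) (P₁.+-identityʳ _))

  f-0 : B₂.coef f 0 P₁.≈ B₁.C c′ P₁.* P
  f-0 = P₁.trans (f-coef 0) (P₁.trans (P₁.+-cong (P₁.trans (P₁.*-congˡ f̂-0) (P₁.*-comm P _)) (P₁.*-0ʳ (u P₁.^ q) (B₂.coef-V^-≢ q 0 (λ ())))) (P₁.+-identityʳ _))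

  f-1 : B₂.coef f 1 P₁.≈ B₁.C b′ P₁.* P
  f-1 = P₁.trans (f-coef 1) (P₁.trans (P₁.+-cong (P₁.trans (P₁.*-congˡ f̂-1) (P₁.*-comm P _)) (P₁.*-0ʳ (u P₁.^ q) (B₂.coef-V^-≢ q 1 (λ ())))) (P₁.+-identityʳ _))

  f-mid : ∀ i → ¬ suc (suc i) ≡ n → ¬ suc (suc i) ≡ q → B₂.coef f (suc (suc i)) P₁.≈ P₁.0#
  f-mid i i≢n i≢q = P₁.trans (f-coef _) (P₁.+-0 (P₁.*-0ʳ P (f̂-mid i i≢n)) (P₁.*-0ʳ (u P₁.^ q) (B₂.coef-V^-≢ q _ i≢q)))

  f-q : B₂.coef f q P₁.≈ u P₁.^ q
  f-q = P₁.trans (f-coef q) (P₁.trans (P₁.+-cong (P₁.*-0ʳ P (f̂-mid q₂ (λ e → ℕ.1+n≢n (≡.sym e)))) (P₁.*-congˡ (B₂.coef-V^-top q)))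
          (P₁.trans (P₁.+-identityˡ _) (P₁.*-identityʳ _)))

  f-n : B₂.coef f n P₁.≈ P
  f-n = P₁.trans (f-coef n) (P₁.trans (P₁.+-cong (P₁.*-congˡ f̂-n) (P₁.*-0ʳ (u P₁.^ q) (B₂.coef-V^-≢ q n ℕ.1+n≢n)))
          (P₁.trans (P₁.+-identityʳ _) (P₁.*-identityʳ _)))

  Deg-f : B₂.Deg< (suc n) f
  Deg-f (suc (suc i)) l = f-mid i (λ e → ℕ.<⇒≢ l (≡.sym e)) (λ e → ℕ.<⇒≢ (ℕ.<-trans (ℕ.n<1+n q) l) (≡.sym e))
  Deg-f (suc zero) (s≤s ())

record CurveData (κ ℓ : Level) : Set (lsuc (κ ⊔ ℓ)) where
  field
    coefficients : Coefficients κ ℓ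
  open Coefficients coefficients public
  field
    F : Field K
    r₀ : ℕ
    q≡ : suc (suc q₂) ≡ 2 ℕ.^ suc r₀
    ci ci′ : CR2.Carrier K
    c-inv : CR2._≈_ K (CR2._*_ K c ci) (CR2.1# K)
    c′-inv : CR2._≈_ K (CR2._*_ K c′ ci′) (CR2.1# K)

module CurveField {κ ℓ} (𝒟 : CurveData κ ℓ) where
  open CurveData 𝒟
  open C2 K
  open Field F
  open Domain domain
  open Curve coefficients public
  open Euclid K F using (_∣_; bezout; Bezout; 0<1×HasDeg0)
  open Derivative K
  private
    module D₁ = Domain (B₁.Poly-domain domain)
    Ch = B₁.C-hom
    module Ch = Hom Ch

  P≉0 : ¬ P P₁.≈ P₁.0#
  P≉0 e = 0≉1 (trans (sym (B₁.at e n)) P-top)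

  HasDeg-P : B₁.HasDeg n P
  HasDeg-P = Deg-P , λ e → 0≉1 (trans (sym e) P-top)

  unit≉0 : ∀ {x y} → x * y ≈ 1# → ¬ x ≈ 0#
  unit≉0 e x0 = 0≉1 (trans (sym (*-0ˡ _ x0)) e)

  C-inv : ∀ {x y} → x * y ≈ 1# → B₁.C x P₁.* B₁.C y P₁.≈ P₁.1#
  C-inv e = P₁.trans (P₁.sym (Ch.⟦⟧-* _ _)) (Ch.⟦⟧-cong e)

  -- Multiplying x·A + y·B = 1 by Z·B^m shows that A divides Z·B^m as soon as it divides Z·B^(m+1);
  -- the powers of B are stripped one at a time.
  coprime-cancel : ∀ {A B x y} → x P₁.* A P₁.+ y P₁.* B P₁.≈ P₁.1# → ∀ m Y Z →
    A P₁.* Y P₁.≈ Z P₁.* B P₁.^ m → A ∣ Z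
  coprime-cancel {A} {B} {x} {y} h zero Y Z e = Y , P₁.sym (P₁.trans e (P₁.*-identityʳ Z))
  coprime-cancel {A} {B} {x} {y} h (suc m) Y Z e = coprime-cancel h m (w P₁.* x P₁.+ y P₁.* Y) Z (P₁.sym (begin
    w ≈⟨ P₁.*-identityʳ w ⟨
    w P₁.* P₁.1# ≈⟨ P₁.*-congˡ h ⟨
    w P₁.* (x P₁.* A P₁.+ y P₁.* B) ≈⟨ Ids.bezout-step B₁.PolyR Z (B P₁.^ m) x A y B ⟩
    A P₁.* (w P₁.* x) P₁.+ y P₁.* (Z P₁.* B P₁.^ suc m) ≈⟨ P₁.+-congˡ (P₁.*-congˡ e) ⟨
    A P₁.* (w P₁.* x) P₁.+ y P₁.* (A P₁.* Y) ≈⟨ Ids.id1 B₁.PolyR A w x y Y ⟩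
    A P₁.* (w P₁.* x P₁.+ y P₁.* Y) ∎))
    where
    open Relation.Binary.Reasoning.Setoid P₁.setoid
    w = Z P₁.* B P₁.^ m

  D-C : ∀ x → D (B₁.C x) P₁.≈ P₁.0#
  D-C x = P₁.trans (D-cons x []) (P₁.trans (P₁.+-identityˡ _) (P₁.zeroʳ B₁.V))

  D-u : D u P₁.≈ P₁.1#
  D-u = P₁.trans (D-cons 0# (1# ∷ [])) (P₁.trans (P₁.+-congˡ (P₁.*-0ʳ B₁.V (D-C 1#))) (P₁.+-identityʳ _))

  D-u^q : D (u P₁.^ q) P₁.≈ P₁.0#
  D-u^q = P₁.trans (D-cong _ _ (P₁.trans (P₁.^-congʳ u (≡.trans q≡ (≡.cong (h ℕ.+_) (ℕ.+-identityʳ h)))) (P₁.^-homo-* u h h)))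
            (P₁.trans (D-* (u P₁.^ h) (u P₁.^ h)) (P₁.≈⇒sum-0 (P₁.*-comm _ _)))
    where h = 2 ℕ.^ r₀

  -- separability of P
  P+uDP : P P₁.+ u P₁.* D P P₁.≈ B₁.C c
  P+uDP = P₁.trans (P₁.+-congˡ {P} (P₁.*-congˡ {u} DP))
    (Ids.id2 B₁.PolyR u (u P₁.^ q) (B₁.C b) (B₁.C c))
    where
    DP : D P P₁.≈ u P₁.^ q P₁.+ B₁.C b
    DP = P₁.trans (D-+ (u P₁.^ n) _) (P₁.+-cong
      (P₁.trans (D-* u (u P₁.^ q)) (P₁.trans (P₁.+-cong (P₁.trans (P₁.*-congʳ D-u) (P₁.*-identityˡ _)) (P₁.*-0ʳ u D-u^q)) (P₁.+-identityʳ _)))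
      (P₁.trans (D-+ (B₁.C b P₁.* u) (B₁.C c)) (P₁.trans (P₁.+-cong
        (P₁.trans (D-* (B₁.C b) u) (P₁.trans (P₁.+-cong (P₁.*-0ˡ u (D-C b)) (P₁.trans (P₁.*-congˡ D-u) (P₁.*-identityʳ _))) (P₁.+-identityˡ _)))
        (D-C c)) (P₁.+-identityʳ _))))

  -- This is B^n·f(u, A/B): the curve equation with the rational function A/B put for v and
  -- denominators cleared.
  Form : B₁.Pl → B₁.Pl → B₁.Pl
  Form A B = P P₁.* A P₁.^ n P₁.+ (u P₁.^ q P₁.* (A P₁.^ q P₁.* B) P₁.+
    (B₁.C b′ P₁.* (P P₁.* (A P₁.* B P₁.^ q)) P₁.+ B₁.C c′ P₁.* (P P₁.* B P₁.^ n)))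

  -- No rational function v = A/B of u satisfies the curve equation, so f has no factor linear in v.
  -- Every term of `Form A B` except c′·P·B^n carries a factor A, hence A divides P; after
  -- cancelling one A the same argument gives A² | P. Separability then makes A constant, and a
  -- comparison of degrees in u ends the proof.
  module NoSection (A B x y : B₁.Pl) (cop : x P₁.* A P₁.+ y P₁.* B P₁.≈ P₁.1#)
    (B≉0 : ¬ B P₁.≈ P₁.0#) (E : Form A B P₁.≈ P₁.0#) where

    -- `P₀` stands for P and A^(m+1) for A^q, so that the argument can be repeated after one factor
    -- A has been cancelled, with the exponent of A lowered by one.
    divides : ∀ m P₀ → (P₀ P₁.* A P₁.^ n P₁.+ (u P₁.^ q P₁.* (A P₁.^ suc m P₁.* B) P₁.+
       (B₁.C b′ P₁.* (P₀ P₁.* (A P₁.* B P₁.^ q)) P₁.+ B₁.C c′ P₁.* (P₀ P₁.* B P₁.^ n)))) P₁.≈ P₁.0# → A ∣ P₀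
    divides m P₀ e = B₁.C ci′ P₁.* proj₁ dv , P₁.trans (P₁.sym (P₁.*-identityˡ P₀)) (P₁.trans (P₁.*-congʳ (P₁.sym (C-inv c′-inv)))
        (P₁.trans (Ids.swap-id B₁.PolyR (B₁.C c′) (B₁.C ci′) P₀)
        (P₁.trans (P₁.*-congˡ (proj₂ dv)) (Ids.swap-id₂ B₁.PolyR (B₁.C ci′) A (proj₁ dv)))))
      where
      dv : A ∣ B₁.C c′ P₁.* P₀
      dv = coprime-cancel cop n (P₀ P₁.* A P₁.^ q P₁.+ (u P₁.^ q P₁.* (A P₁.^ m P₁.* B) P₁.+ B₁.C b′ P₁.* (P₀ P₁.* B P₁.^ q))) (B₁.C c′ P₁.* P₀)
        (P₁.sum-0⇒≈ (P₁.trans (Ids.form-A B₁.PolyR A P₀ (A P₁.^ q) (u P₁.^ q) (A P₁.^ m) B (B₁.C b′) (B₁.C c′) (B P₁.^ q)) e))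

    A∣P : A ∣ P
    A∣P = divides (suc q₂) P E

    P₁′ : B₁.Pl
    P₁′ = proj₁ A∣P

    A≉0 : ¬ A P₁.≈ P₁.0#
    A≉0 a0 = P≉0 (P₁.trans (proj₂ A∣P) (P₁.*-0ˡ P₁′ a0))

    A∣P₁′ : A ∣ P₁′
    A∣P₁′ = divides q₂ P₁′ (D₁.noZeroDiv (P₁.trans (P₁.sym (P₁.trans
        (P₁.+-cong (P₁.*-congʳ (proj₂ A∣P)) (P₁.+-congˡ (P₁.+-cong (P₁.*-congˡ (P₁.*-congʳ (proj₂ A∣P))) (P₁.*-congˡ (P₁.*-congʳ (proj₂ A∣P))))))
        (Ids.form-cancel B₁.PolyR A P₁′ (A P₁.^ q) (u P₁.^ q) (A P₁.^ (suc q₂)) B (B₁.C b′) (B₁.C c′) (B P₁.^ q)))) E) A≉0)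

    P₂′ : B₁.Pl
    P₂′ = proj₁ A∣P₁′

    P≈A² : P P₁.≈ A P₁.* A P₁.* P₂′
    P≈A² = P₁.trans (proj₂ A∣P) (P₁.trans (P₁.*-congˡ (proj₂ A∣P₁′)) (P₁.sym (P₁.*-assoc A A P₂′)))

    -- Put P = A²·`P₂′` into P + u·P′ = c. Squares are constants for the derivation, so A² factors
    -- out of the left side and divides the unit c.
    A-unit : A P₁.* (A P₁.* (P₂′ P₁.+ u P₁.* D P₂′)) P₁.≈ B₁.C c
    A-unit = P₁.trans (P₁.trans (Ids.id5 B₁.PolyR A P₂′ u (D P₂′))
      (P₁.+-cong (P₁.sym P≈A²) (P₁.*-congˡ {u} (P₁.sym (P₁.trans (D-cong _ _ P≈A²) (D-sq A P₂′)))))) P+uDP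

    Deg-A : ¬ ¬ (B₁.HasDeg 0 A)
    Deg-A z = B₁.¬¬HasDeg domain A A≉0 λ { (d , hd) → B₁.¬¬HasDeg domain E′ E′≉0 λ { (e , he) → go d hd e he } }
      where
      E′ = A P₁.* (P₂′ P₁.+ u P₁.* D P₂′)
      Cc≉0 : ¬ B₁.C c P₁.≈ P₁.0#
      Cc≉0 z0 = unit≉0 c-inv (B₁.at z0 0)
      E′≉0 : ¬ E′ P₁.≈ P₁.0#
      E′≉0 z0 = Cc≉0 (P₁.trans (P₁.sym A-unit) (P₁.*-0ʳ A z0))
      go : ∀ d → B₁.HasDeg d A → ∀ e → B₁.HasDeg e E′ → ⊥
      go zero hd e he = z hd
      go (suc d) hd e he = proj₂ (B₁.HasDeg-* domain A E′ hd he) (trans (B₁.at A-unit (suc d ℕ.+ e)) (B₁.Deg<-C c (suc d ℕ.+ e) (s≤s z≤n)))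

    Deg-C* : ∀ {d} x p → B₁.Deg< d p → B₁.Deg< d (B₁.C x P₁.* p)
    Deg-C* x p h i l = trans (B₁.coef-C⊠ x p i) (*-0ʳ x (h i l))

    absurd : ⊥
    absurd = Deg-A λ hA → B₁.¬¬HasDeg domain B B≉0 λ { (e , hB) → go hA e hB }
      where
      Deg-A^ : B₁.HasDeg 0 A → ∀ m → B₁.Deg< 1 (A P₁.^ m)
      Deg-A^ hA m = B₁.Deg<-≤ (A P₁.^ m) (s≤s (ℕ.≤-reflexive (ℕ.*-zeroʳ m))) (B₁.Deg<-^ A m (proj₁ hA))
      go : B₁.HasDeg 0 A → ∀ e → B₁.HasDeg e B → ⊥
      -- For constant A and B the equation reads P·`κp` = `μ` with `κp` constant and `μ` of degree
      -- at most q < n = deg P. Hence `κp` = 0 and `μ` = 0, although `μ` is u^q times a nonzero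
      -- constant.
      go hA zero hB = D₁.*-≉0 (D₁.^-≉0 q (λ e → 0≉1 (trans (sym (B₁.at e 1)) refl))) (D₁.*-≉0 (D₁.^-≉0 q A≉0) B≉0)
          (P₁.trans (P₁.sum-0⇒≈ (P₁.trans (P₁.sym eq) E)) (P₁.*-0ʳ P κ≈0))
        where
        κp = A P₁.^ n P₁.+ (B₁.C b′ P₁.* (A P₁.* B P₁.^ q) P₁.+ B₁.C c′ P₁.* B P₁.^ n)
        μ = u P₁.^ q P₁.* (A P₁.^ q P₁.* B)
        eq : Form A B P₁.≈ μ P₁.+ P P₁.* κp
        eq = Ids.form-split B₁.PolyR P (A P₁.^ n) μ (B₁.C b′) (A P₁.* B P₁.^ q) (B₁.C c′) (B P₁.^ n)
        Deg-B^ : ∀ m → B₁.Deg< 1 (B P₁.^ m)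
        Deg-B^ m = B₁.Deg<-≤ (B P₁.^ m) (s≤s (ℕ.≤-reflexive (ℕ.*-zeroʳ m))) (B₁.Deg<-^ B m (proj₁ hB))
        Deg-κ : B₁.Deg< 1 κp
        Deg-κ = B₁.Deg<-+ (A P₁.^ n) _ (Deg-A^ hA n) (B₁.Deg<-+ (B₁.C b′ P₁.* (A P₁.* B P₁.^ q)) _
          (Deg-C* b′ _ (B₁.Deg<-* A (B P₁.^ q) (proj₁ hA) (Deg-B^ q))) (Deg-C* c′ _ (Deg-B^ n)))
        Deg-μ : B₁.Deg< n μ
        Deg-μ = B₁.Deg<-≤ μ (ℕ.≤-reflexive (ℕ.+-comm q 1)) (B₁.Deg<-* (u P₁.^ q) _ (B₁.Deg<-V^ q) (B₁.Deg<-* (A P₁.^ q) B (Deg-A^ hA q) (proj₁ hB)))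
        κ₀ : B₁.coef κp 0 ≈ 0#
        κ₀ = trans (sym (*-identityˡ _)) (trans (*-congʳ (sym P-top)) (trans (sym (B₁.⊠-top n 0 P κp Deg-P Deg-κ))
               (trans (reflexive (≡.cong (B₁.coef (P P₁.* κp)) (ℕ.+-identityʳ n)))
               (trans (sym (B₁.at (P₁.sum-0⇒≈ (P₁.trans (P₁.sym eq) E)) n)) (Deg-μ n ℕ.≤-refl)))))
        κ≈0 : κp P₁.≈ P₁.0#
        κ≈0 = B₁.mk λ { zero → κ₀ ; (suc i) → Deg-κ (suc i) (s≤s z≤n) }
      -- For B of positive degree the term c′·P·B^n exceeds all the others in degree, so it cannot
      -- be cancelled.
      go hA (suc e) hB = *-≉0 (unit≉0 c′-inv) (proj₂ hPB) (trans (sym (B₁.coef-C⊠ c′ _ top))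
          (trans (B₁.at (P₁.sum-0⇒≈ (P₁.trans (P₁.sym eq) E)) top) (low top ℕ.≤-refl)))
        where
        top = n ℕ.+ n ℕ.* suc e
        hPB : B₁.HasDeg top (P P₁.* B P₁.^ n)
        hPB = B₁.HasDeg-* domain P (B P₁.^ n) HasDeg-P (B₁.HasDeg-^ domain B n hB)
        t₁ = P P₁.* A P₁.^ n
        t₂ = u P₁.^ q P₁.* (A P₁.^ q P₁.* B)
        t₃ = B₁.C b′ P₁.* (P P₁.* (A P₁.* B P₁.^ q))
        eq : Form A B P₁.≈ B₁.C c′ P₁.* (P P₁.* B P₁.^ n) P₁.+ (t₁ P₁.+ (t₂ P₁.+ t₃))
        eq = Ids.id6 B₁.PolyR t₁ t₂ t₃ _
        l₁ : n ℕ.+ 1 ≤ top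
        l₁ = ℕ.+-monoʳ-≤ n (s≤s z≤n)
        l₂ : q ℕ.+ suc (suc e) ≤ top
        l₂ = ℕ.≤-trans (ℕ.+-monoʳ-≤ q (ℕ.≤-trans (s≤s (ℕ.m≤m+n (suc e) (q ℕ.* suc e))) ℕ.≤-refl)) (ℕ.≤-reflexive (ℕ.+-suc q (n ℕ.* suc e)))
        l₃ : n ℕ.+ (0 ℕ.+ suc (q ℕ.* suc e)) ≤ top
        l₃ = ℕ.+-monoʳ-≤ n (s≤s (ℕ.m≤n+m (q ℕ.* suc e) e))
        low : B₁.Deg< top (t₁ P₁.+ (t₂ P₁.+ t₃))
        low = B₁.Deg<-+ t₁ _ (B₁.Deg<-≤ t₁ l₁ (B₁.Deg<-* P (A P₁.^ n) Deg-P (Deg-A^ hA n)))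
          (B₁.Deg<-+ t₂ t₃ (B₁.Deg<-≤ t₂ l₂ (B₁.Deg<-* (u P₁.^ q) _ (B₁.Deg<-V^ q) (B₁.Deg<-* (A P₁.^ q) B (Deg-A^ hA q) (proj₁ hB))))
            (Deg-C* b′ (P P₁.* (A P₁.* B P₁.^ q)) (B₁.Deg<-≤ (P P₁.* (A P₁.* B P₁.^ q)) l₃ (B₁.Deg<-* P (A P₁.* B P₁.^ q) Deg-P (B₁.Deg<-* A (B P₁.^ q) (proj₁ hA) (B₁.Deg<-^ B q (proj₁ hB)))))))

module Elimination {κ ℓ} (𝒟 : CurveData κ ℓ) where
  open CurveData 𝒟
  open C2 K
  open Field F
  open Domain domain
  open CurveField 𝒟
  open Euclid K F using (_∣_; bezout; Bezout)
  private
    module D₁ = Domain (B₁.Poly-domain domain)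

  module _ (r : B₂.Pl) (hr : B₂.Deg< n r) where
    row : ℕ → B₁.Pl
    row = B₂.coef r

    rq α β : B₁.Pl
    rq = row q
    β = rq P₁.* P
    α = rq P₁.* u P₁.^ q P₁.+ P P₁.* row (suc q₂)

    -- The two coefficients of `lam` are solved for so that the coefficients of v^n and v^q in
    -- r·`lam` + rq²·f cancel. On the curve r̃ agrees with r·`lam`, but its degree in v has dropped
    -- below q.
    lam r̃ : B₂.Pl
    lam = ν β P₂.* v P₂.+ ν α
    r̃ = r P₂.* lam P₂.+ ν (rq P₁.* rq) P₂.* f

    rlam : r P₂.* lam P₂.≈ ν β P₂.* (v P₂.* r) P₂.+ ν α P₂.* r
    rlam = Ids.id7 B₂.PolyR r (ν β) v (ν α)

    r̃-coef : ∀ i → B₂.coef r̃ i P₁.≈ (β P₁.* B₂.coef (v P₂.* r) i P₁.+ α P₁.* row i) P₁.+ rq P₁.* rq P₁.* B₂.coef f i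
    r̃-coef i = P₁.trans (B₂.coef-⊞′ (r P₂.* lam) _ i) (P₁.+-cong
      (P₁.trans (B₂.at rlam i) (P₁.trans (B₂.coef-⊞′ _ _ i) (P₁.+-cong (B₂.coef-C⊠ β (v P₂.* r) i) (B₂.coef-C⊠ α r i))))
      (B₂.coef-C⊠ (rq P₁.* rq) f i))

    r̃-suc : ∀ i → B₂.coef r̃ (suc i) P₁.≈ (β P₁.* row i P₁.+ α P₁.* row (suc i)) P₁.+ rq P₁.* rq P₁.* B₂.coef f (suc i)
    r̃-suc i = P₁.trans (r̃-coef (suc i)) (P₁.+-congʳ (P₁.+-congʳ (P₁.*-congˡ (B₂.coef-V⊠ r i))))

    r̃-deg : B₂.Deg< q r̃
    r̃-deg (suc i) l with ℕ.<-cmp (suc i) n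
    r̃-deg (suc i) l | tri< (s≤s si≤q) _ _ with ℕ.≤-antisym si≤q l
    ... | ≡.refl = P₁.trans (r̃-suc (suc q₂)) (P₁.trans (P₁.+-congˡ (P₁.*-congˡ f-q))
          (Ids.id8 B₁.PolyR rq P (u P₁.^ q) (row (suc q₂))))
    r̃-deg (suc i) l | tri≈ _ ≡.refl _ = P₁.trans (r̃-suc q) (P₁.trans (P₁.+-cong (P₁.+-congˡ (P₁.*-congˡ (hr n ℕ.≤-refl))) (P₁.*-congˡ f-n))
          (Ids.id9 B₁.PolyR rq P α))
    r̃-deg (suc i) l | tri> _ _ n<si@(s≤s n≤i) = P₁.trans (r̃-suc i) (P₁.+-0 (P₁.+-0 (P₁.*-0ʳ β (hr i n≤i)) (P₁.*-0ʳ α (hr (suc i) (ℕ.<⇒≤ n<si))))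
          (P₁.*-0ʳ (rq P₁.* rq) (Deg-f (suc i) n<si)))

    r̃-rows : ∀ M → (∀ i → B₁.Deg< (suc M) (row i)) → ∀ i → B₁.Deg< (suc (n ℕ.+ (M ℕ.+ M))) (B₂.coef r̃ i)
    r̃-rows M h i = B₁.Deg<-cong (P₁.sym (r̃-coef i)) (B₁.Deg<-+ _ _ (B₁.Deg<-+ _ _ (t β (B₂.coef (v P₂.* r) i) hβ (hvr i)) (t α (row i) hα (h i))) t₃)
      where
      hβ : B₁.Deg< (suc (n ℕ.+ M)) β
      hβ = B₁.Deg<-≤ β (ℕ.≤-reflexive (≡.trans (ℕ.+-suc M n) (≡.cong suc (ℕ.+-comm M n)))) (B₁.Deg<-* rq P (h q) Deg-P)
      hα : B₁.Deg< (suc (n ℕ.+ M)) α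
      hα = B₁.Deg<-+ (rq P₁.* u P₁.^ q) (P P₁.* row (suc q₂))
        (B₁.Deg<-≤ (rq P₁.* u P₁.^ q) (ℕ.≤-trans (ℕ.≤-reflexive (≡.trans (ℕ.+-suc M q) (≡.cong suc (ℕ.+-comm M q)))) (ℕ.n≤1+n _)) (B₁.Deg<-* rq (u P₁.^ q) (h q) (B₁.Deg<-V^ q)))
        (B₁.Deg<-≤ (P P₁.* row (suc q₂)) (ℕ.≤-reflexive (ℕ.+-suc n M)) (B₁.Deg<-* P (row (suc q₂)) Deg-P (h (suc q₂))))
      hvr : ∀ i → B₁.Deg< (suc M) (B₂.coef (v P₂.* r) i)
      hvr zero = B₁.Deg<-cong (P₁.sym (B₂.coef-V⊠0 r)) (λ _ _ → refl)
      hvr (suc i) = B₁.Deg<-cong (P₁.sym (B₂.coef-V⊠ r i)) (h i)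
      t : ∀ x y → B₁.Deg< (suc (n ℕ.+ M)) x → B₁.Deg< (suc M) y → B₁.Deg< (suc (n ℕ.+ (M ℕ.+ M))) (x P₁.* y)
      t x y hx hy = B₁.Deg<-≤ (x P₁.* y) (ℕ.≤-reflexive (≡.trans (ℕ.+-suc (n ℕ.+ M) M) (≡.cong suc (ℕ.+-assoc n M M)))) (B₁.Deg<-* x y hx hy)
      hf̂ : ∀ i → B₁.Deg< 1 (B₂.coef f̂ i)
      hf̂ i = B₁.Deg<-cong (P₁.sym (f̂-coef i)) (B₁.Deg<-+ _ _ (cV n i) (B₁.Deg<-+ _ _
             (B₁.Deg<-* (B₁.C b′) _ (B₁.Deg<-C b′) (cv i)) (cC i)))
        where
        cV : ∀ m i → B₁.Deg< 1 (B₂.coef (v P₂.^ m) i)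
        cV m i with i ℕ.≟ m
        ... | yes ≡.refl = B₁.Deg<-cong (P₁.sym (B₂.coef-V^-top m)) (B₁.Deg<-C 1#)
        ... | no i≢m = B₁.Deg<-cong (P₁.sym (B₂.coef-V^-≢ m i i≢m)) (λ _ _ → refl)
        cv : ∀ i → B₁.Deg< 1 (B₂.coef v i)
        cv zero j _ = refl
        cv (suc zero) = B₁.Deg<-C 1#
        cv (suc (suc i)) j _ = refl
        cC : ∀ i → B₁.Deg< 1 (B₂.coef (ν (B₁.C c′)) i)
        cC zero = B₁.Deg<-C c′
        cC (suc i) j _ = refl
      hf : ∀ i → B₁.Deg< (suc n) (B₂.coef f i)
      hf i = B₁.Deg<-cong (P₁.sym (f-coef i)) (B₁.Deg<-+ _ _ (B₁.Deg<-≤ (P P₁.* B₂.coef f̂ i) (ℕ.≤-reflexive (ℕ.+-comm n 1)) (B₁.Deg<-* P (B₂.coef f̂ i) Deg-P (hf̂ i))) (cq i))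
        where
        cq : ∀ i → B₁.Deg< (suc n) (u P₁.^ q P₁.* B₂.coef (v P₂.^ q) i)
        cq i with i ℕ.≟ q
        ... | yes ≡.refl = B₁.Deg<-cong (P₁.sym (P₁.trans (P₁.*-congˡ (B₂.coef-V^-top q)) (P₁.*-identityʳ _)))
                (B₁.Deg<-≤ (u P₁.^ q) (ℕ.n≤1+n n) (B₁.Deg<-V^ q))
        ... | no i≢q = B₁.Deg<-cong (P₁.sym (P₁.*-0ʳ (u P₁.^ q) (B₂.coef-V^-≢ q i i≢q))) (λ _ _ → refl)
      t₃ : B₁.Deg< (suc (n ℕ.+ (M ℕ.+ M))) (rq P₁.* rq P₁.* B₂.coef f i)
      t₃ = B₁.Deg<-≤ (rq P₁.* rq P₁.* B₂.coef f i) (ℕ.≤-reflexive (≡.trans (ℕ.+-suc (M ℕ.+ M) n) (≡.cong suc (ℕ.+-comm (M ℕ.+ M) n))))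
             (B₁.Deg<-* (rq P₁.* rq) (B₂.coef f i) (B₁.Deg<-≤ (rq P₁.* rq) (ℕ.≤-reflexive (ℕ.+-suc M M)) (B₁.Deg<-* rq rq (h q) (h q))) (hf i))

    -- a vanishing r̃ would split the linear factor lam off f
    module _ (z : r̃ P₂.≈ P₂.0#) where
      private
        a2 = α P₁.^ q₂
        b2 = β P₁.^ q₂

      h0 : α P₁.* row 0 P₁.≈ rq P₁.* rq P₁.* (B₁.C c′ P₁.* P)
      h0 = P₁.sum-0⇒≈ (P₁.trans (P₁.sym (P₁.trans (r̃-coef 0) (P₁.+-cong (P₁.trans (P₁.+-congʳ (P₁.*-0ʳ β (B₂.coef-V⊠0 r))) (P₁.+-identityˡ _)) (P₁.*-congˡ f-0)))) (B₂.at z 0))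

      h1 : β P₁.* row 0 P₁.+ α P₁.* row 1 P₁.≈ rq P₁.* rq P₁.* (B₁.C b′ P₁.* P)
      h1 = P₁.sum-0⇒≈ (P₁.trans (P₁.sym (P₁.trans (r̃-suc 0) (P₁.+-congˡ (P₁.*-congˡ f-1)))) (B₂.at z 1))

      hq : β P₁.* row (suc q₂) P₁.+ α P₁.* rq P₁.≈ rq P₁.* rq P₁.* u P₁.^ q
      hq = P₁.sum-0⇒≈ (P₁.trans (P₁.sym (P₁.trans (r̃-suc (suc q₂)) (P₁.+-congˡ (P₁.*-congˡ f-q)))) (B₂.at z q))

      hm : ∀ j → j < q₂ → β P₁.* row (suc j) P₁.≈ α P₁.* row (suc (suc j))
      hm j l = P₁.sum-0⇒≈ (P₁.trans (P₁.sym (P₁.trans (r̃-suc (suc j)) (P₁.trans (P₁.+-congˡ (P₁.*-0ʳ (rq P₁.* rq) (f-mid j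
                 (λ e → ℕ.<⇒≢ (s<s (s<s (ℕ.<-trans l (ℕ.n<1+n q₂)))) e) (λ e → ℕ.<⇒≢ (s<s (s<s l)) e)))) (P₁.+-identityʳ _)))) (B₂.at z (suc (suc j))))

      -- Between v and v^q the coefficients of f vanish, so the corresponding rows of r form a
      -- geometric progression with ratio β/α.
      chain : ∀ j → j ≤ q₂ → row 1 P₁.* β P₁.^ j P₁.≈ row (suc j) P₁.* α P₁.^ j
      chain zero _ = P₁.refl
      chain (suc j) l = P₁.trans (Ids.swap-id₂ B₁.PolyR (row 1) β (β P₁.^ j))
        (P₁.trans (P₁.*-congˡ (chain j (ℕ.<⇒≤ l))) (P₁.trans (Ids.id10 B₁.PolyR β (row (suc j)) (α P₁.^ j))
        (P₁.trans (P₁.*-congʳ (hm j l)) (Ids.id11 B₁.PolyR α (row (suc (suc j))) (α P₁.^ j)))))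

      -- Up to powers of β this says f(u, α/β) = 0. The coefficients of rq²·f inside `Form` are
      -- replaced by those of r·`lam`; everything cancels except the two ends of the geometric
      -- progression, and these agree by `chain`.
      form-0 : rq P₁.* rq P₁.* Form α β P₁.≈ P₁.0#
      form-0 = begin
        rq P₁.* rq P₁.* Form α β
          ≈⟨ Ids.id12 B₁.PolyR rq P α a2 (u P₁.^ q) β (B₁.C b′) (B₁.C c′) b2 ⟩
        rq P₁.* β P₁.* (α P₁.* (α P₁.* (α P₁.* a2))) P₁.+ ((rq P₁.* rq P₁.* u P₁.^ q) P₁.* (α P₁.* (α P₁.* a2) P₁.* β) P₁.+
          ((rq P₁.* rq P₁.* (B₁.C b′ P₁.* P)) P₁.* (α P₁.* (β P₁.* (β P₁.* b2))) P₁.+ (rq P₁.* rq P₁.* (B₁.C c′ P₁.* P)) P₁.* (β P₁.* (β P₁.* (β P₁.* b2)))))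
          ≈⟨ P₁.+-congˡ (P₁.+-cong (P₁.*-congʳ (P₁.sym hq)) (P₁.+-cong (P₁.*-congʳ (P₁.sym h1)) (P₁.*-congʳ (P₁.sym h0)))) ⟩
        rq P₁.* β P₁.* (α P₁.* (α P₁.* (α P₁.* a2))) P₁.+ ((β P₁.* row (suc q₂) P₁.+ α P₁.* rq) P₁.* (α P₁.* (α P₁.* a2) P₁.* β) P₁.+
          ((β P₁.* row 0 P₁.+ α P₁.* row 1) P₁.* (α P₁.* (β P₁.* (β P₁.* b2))) P₁.+ (α P₁.* row 0) P₁.* (β P₁.* (β P₁.* (β P₁.* b2)))))
          ≈⟨ Ids.id13 B₁.PolyR rq β α a2 b2 (row (suc q₂)) (row 0) (row 1) ⟩
        α P₁.* α P₁.* (β P₁.* β) P₁.* (row 1 P₁.* b2 P₁.+ row (suc q₂) P₁.* a2)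
          ≈⟨ P₁.*-0ʳ _ (P₁.≈⇒sum-0 (chain q₂ ℕ.≤-refl)) ⟩
        P₁.0# ∎
        where open Relation.Binary.Reasoning.Setoid P₁.setoid

      Form-scale : ∀ g A B → Form (g P₁.* A) (g P₁.* B) P₁.≈ g P₁.^ n P₁.* Form A B
      Form-scale g A B = P₁.trans (P₁.+-cong (P₁.*-congˡ (P₁.^-distrib-* g A n)) (P₁.+-cong (P₁.*-congˡ (P₁.*-congʳ (P₁.^-distrib-* g A q)))
          (P₁.+-cong (P₁.*-congˡ (P₁.*-congˡ (P₁.*-congˡ (P₁.^-distrib-* g B q)))) (P₁.*-congˡ (P₁.*-congˡ (P₁.^-distrib-* g B n))))))
        (Ids.id14 B₁.PolyR P g (g P₁.^ q) A (A P₁.^ q) (u P₁.^ q) B (B₁.C b′) (B P₁.^ q) (B₁.C c′))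

      -- If the top row were nonzero, α/β in lowest terms would be a rational function on the curve,
      -- which `NoSection` excludes.
      rq≈0 : rq P₁.≈ P₁.0#
      rq≈0 = D₁.stable λ nrq → bezout _ α β (B₁.Dg-length β) λ bz → let open Bezout bz in
        let B≉ : ¬ B′ P₁.≈ P₁.0#
            B≉ e = D₁.*-≉0 nrq P≉0 (P₁.trans B≈ (P₁.*-0ʳ g e))
            g≉ : ¬ g P₁.≈ P₁.0#
            g≉ e = D₁.*-≉0 nrq P≉0 (P₁.trans B≈ (P₁.*-0ˡ B′ e))
            fz : Form α β P₁.≈ P₁.0#
            fz = D₁.noZeroDiv form-0 (D₁.*-≉0 nrq nrq)
        in NoSection.absurd A′ B′ x y unit B≉ (D₁.noZeroDiv (P₁.trans (P₁.sym (Form-scale g A′ B′))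
             (P₁.trans (P₁.sym (Form-cong A≈ B≈)) fz)) (D₁.^-≉0 n g≉))
        where
        Form-cong : ∀ {A B A₁ B₁} → A P₁.≈ A₁ → B P₁.≈ B₁ → Form A B P₁.≈ Form A₁ B₁
        Form-cong e e′ = P₁.+-cong (P₁.*-congˡ (P₁.^-congˡ n e)) (P₁.+-cong (P₁.*-congˡ (P₁.*-cong (P₁.^-congˡ q e) e′))
           (P₁.+-cong (P₁.*-congˡ (P₁.*-congˡ (P₁.*-cong e (P₁.^-congˡ q e′)))) (P₁.*-congˡ (P₁.*-congˡ (P₁.^-congˡ n e′)))))

-- Polynomials that vanish on a branch ramified over the u-line

divmod-unique : ∀ q {κ l κ′ l′} → l < q → l′ < q → q ℕ.* κ ℕ.+ l ≡ q ℕ.* κ′ ℕ.+ l′ → κ ≡ κ′ × l ≡ l′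
divmod-unique q {κ} {l} {κ′} {l′} hl hl′ e with ℕ.<-cmp κ κ′
... | tri≈ _ ≡.refl _ = ≡.refl , ℕ.+-cancelˡ-≡ (q ℕ.* κ) l l′ e
... | tri< κ<κ′ _ _ = ⊥-elim (ℕ.<⇒≢ (lt κ κ′ l l′ hl κ<κ′) e)
  where
  lt : ∀ a b x y → x < q → a < b → q ℕ.* a ℕ.+ x < q ℕ.* b ℕ.+ y
  lt a b x y hx a<b = ℕ.<-≤-trans (ℕ.+-monoʳ-< (q ℕ.* a) hx) (ℕ.≤-trans (ℕ.≤-reflexive (≡.trans (ℕ.+-comm _ q) (≡.sym (ℕ.*-suc q a)))) (ℕ.≤-trans (ℕ.*-monoʳ-≤ q a<b) (ℕ.m≤m+n _ y)))
... | tri> _ _ κ>κ′ = ⊥-elim (ℕ.<⇒≢ (lt κ′ κ l′ l hl′ κ>κ′) (≡.sym e))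
  where
  lt : ∀ a b x y → x < q → a < b → q ℕ.* a ℕ.+ x < q ℕ.* b ℕ.+ y
  lt a b x y hx a<b = ℕ.<-≤-trans (ℕ.+-monoʳ-< (q ℕ.* a) hx) (ℕ.≤-trans (ℕ.≤-reflexive (≡.trans (ℕ.+-comm _ q) (≡.sym (ℕ.*-suc q a)))) (ℕ.≤-trans (ℕ.*-monoʳ-≤ q a<b) (ℕ.m≤m+n _ y)))

-- Substituting u + π for u expands a polynomial around π; in characteristic two this substitution
-- is its own inverse.
module Shift {κ ℓ} (K : CR2 κ ℓ) (π : CR2.Carrier K) where
  open C2 K
  open Poly K

  V+π : Pl
  V+π = V P.+ C π

  open Ev C-hom V+π public renaming (ev to σ; ev-hom to σ-hom)

  σσ : ∀ p → σ (σ p) P.≈ p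
  σσ = hom-unique (σ-hom ∘h σ-hom) (id-hom PolyR)
    (λ a → P.trans (Hom.⟦⟧-cong σ-hom (ev-C a)) (ev-C a))
    (P.trans (Hom.⟦⟧-cong σ-hom ev-V) (P.trans (ev-⊞ V (C π)) (P.trans (P.+-cong ev-V (ev-C π))
      (P.trans (P.+-assoc V (C π) (C π)) (P.trans (P.+-congˡ (P.self (C π))) (P.+-identityʳ V))))))

  σ-≈0 : ∀ p → σ p P.≈ P.0# → p P.≈ P.0#
  σ-≈0 p e = P.trans (P.sym (σσ p)) (Hom.⟦⟧-≈0 σ-hom e)

  Deg-σ : ∀ M p → Deg< M p → Deg< M (σ p)
  Deg-σ M p h = Deg<-cong (P.sym (ev-bound p M h)) (Deg<-∑ M (λ i → C (coef p i) P.* V+π P.^ i) λ i i<M →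
    Deg<-≤ (C (coef p i) P.* V+π P.^ i) (ℕ.≤-trans (s≤s (ℕ.≤-reflexive (ℕ.*-identityʳ i))) i<M) (Deg<-* (C (coef p i)) (V+π P.^ i) (Deg<-C _) (Deg<-^ V+π i d2)))
    where
    d2 : Deg< 2 V+π
    d2 = Deg<-+ V (C π) (λ { (suc (suc i)) _ → refl ; (suc zero) (s≤s ()) }) (Deg<-≤ (C π) (s≤s z≤n) (Deg<-C π))

module SingleSum {κ ℓ} (K : CR2 κ ℓ) where
  open C2 K

  ∑-single : ∀ n (f : ℕ → Carrier) k → k < n → (∀ i → i < n → ¬ i ≡ k → f i ≈ 0#) → ∑ n f ≈ f k
  ∑-single (suc n) f k k<n h with k ℕ.≟ n
  ... | yes ≡.refl = trans (+-congʳ (∑-0 n (λ i i<n → h i (ℕ.m<n⇒m<1+n i<n) (ℕ.<⇒≢ i<n)))) (+-identityˡ _)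
  ... | no k≢n = trans (+-cong (∑-single n f k (ℕ.≤∧≢⇒< (ℕ.≤-pred k<n) k≢n) (λ i i<n → h i (ℕ.m<n⇒m<1+n i<n)))
                   (h n (ℕ.n<1+n n) (λ e → k≢n (≡.sym e)))) (+-identityʳ _)

  open Series K
  private module S = C2 PS

  ∑-at : ∀ n f i → (S.∑ n f) i ≈ ∑ n (λ j → f j i)
  ∑-at zero f i = refl
  ∑-at (suc n) f i = trans (⊕-at (S.∑ n f) (f n) i) (+-congʳ (∑-at n f i))

  ^-at0 : ∀ a m → (a S.^ m) 0 ≈ a 0 ^ m
  ^-at0 a zero = refl
  ^-at0 a (suc m) = trans (⊛-at0 a (a S.^ m)) (*-congˡ (^-at0 a m))

-- A parametrised branch with v = t as local parameter, on which u - π vanishes to order exactly q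
-- because `W` starts with a nonzero constant.
record BranchData (κ ℓ : Level) : Set (lsuc (κ ⊔ ℓ)) where
  field
    K : CR2 κ ℓ
    D : Domain K
    q : ℕ
    π : CR2.Carrier K
    U W : ℕ → CR2.Carrier K
    W0≉0 : ¬ CR2._≈_ K (W 0) (CR2.0# K)
    U≈ : CR2._≈_ (Series.PS K) U (CR2._+_ (Series.PS K) (Series.cst K π) (CR2._*_ (Series.PS K) (C2._^_ (Series.PS K) (Series.X K) q) W))

module PlaceB {κ ℓ} (ℬ : BranchData κ ℓ) where
  open BranchData ℬ
  open C2 K
  open Domain D
  open Series K
  private
    module S = C2 PS
    module B₁ = Poly K
    module B₂ = Poly B₁.PolyR
    module P₁ = B₁.P
    module P₂ = B₂.P
  open Shift K π using (σ; σ-hom; σ-≈0; Deg-σ; V+π) renaming (ev-C to σ-C; ev-V to σ-V)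
  open SingleSum K

  module E₁ = B₁.Ev cst-hom U
  module E₂ = B₂.Ev E₁.ev-hom X

  θ₁ : B₁.Pl → Ser
  θ₁ = E₁.ev

  θ : B₂.Pl → Ser
  θ = E₂.ev

  θ-hom : Hom B₂.PolyR PS
  θ-hom = E₂.ev-hom

  private
    Y = X S.^ q S.* W
    module EY = B₁.Ev cst-hom Y

  θ₁-σ : ∀ p → θ₁ p S.≈ EY.ev (σ p)
  θ₁-σ = B₁.hom-unique E₁.ev-hom (EY.ev-hom ∘h σ-hom)
    (λ a → S.trans (E₁.ev-C a) (S.sym (S.trans (Hom.⟦⟧-cong EY.ev-hom (σ-C a)) (EY.ev-C a))))
    (S.trans E₁.ev-V (S.trans U≈ (S.sym (S.trans (Hom.⟦⟧-cong EY.ev-hom σ-V) (S.trans (EY.ev-⊞ B₁.V (B₁.C π))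
      (S.trans (S.+-cong EY.ev-V (EY.ev-C π)) (S.+-comm _ _)))))))

  module _ (r : B₂.Pl) (hr : B₂.Deg< q r) (M : ℕ) (hM : ∀ i → B₁.Deg< M (B₂.coef r i)) where
    s : ℕ → ℕ → Carrier
    s l κ = B₁.coef (σ (B₂.coef r l)) κ

    term : ℕ → ℕ → Ser
    term l κ = X S.^ (q ℕ.* κ ℕ.+ l) S.* W S.^ κ

    expand : ∀ m → θ r m ≈ ∑ q (λ l → ∑ M (λ κ → s l κ * term l κ m))
    expand m = trans (at (E₂.ev-bound r q hr) m) (trans (∑-at q _ m) (∑-cong q λ l _ →
      trans (at (inner l) m) (trans (∑-at M _ m) (∑-cong M λ κ _ → cst⊛ (s l κ) (term l κ) m))))
      where
      inner : ∀ l → θ₁ (B₂.coef r l) S.* X S.^ l S.≈ S.∑ M (λ κ → cst (s l κ) S.* term l κ)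
      inner l = S.trans (S.*-congʳ (S.trans (θ₁-σ (B₂.coef r l)) (EY.ev-bound (σ (B₂.coef r l)) M (Deg-σ M (B₂.coef r l) (hM l)))))
        (S.trans (S.sym (S.∑-*ʳ M (X S.^ l) _)) (S.∑-cong M λ κ _ → S.trans (S.*-assoc (cst (s l κ)) (Y S.^ κ) (X S.^ l)) (S.*-congˡ {cst (s l κ)}
          (S.trans (S.*-congʳ {X S.^ l} (S.trans (S.^-distrib-* (X S.^ q) W κ) (S.*-congʳ {W S.^ κ} (S.^-assocʳ X q κ))))
          (S.trans (Ids.id15 PS (X S.^ (q ℕ.* κ)) (W S.^ κ) (X S.^ l))
            (S.*-congʳ {W S.^ κ} (S.sym (S.^-homo-* X (q ℕ.* κ) l))))))))

    -- Strong induction on the order m. Terms of order below m are zero by induction, terms of order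
    -- above m do not reach coefficient m, and uniqueness of division by q leaves a single term of
    -- order m.
    s-0 : ∀ N → q ℕ.* M ≤ N → Ord N (θ r) → ∀ m κ l → κ < M → l < q → q ℕ.* κ ℕ.+ l ≡ m → s l κ ≈ 0#
    s-0 N hN o = <-rec _ λ { m rec κ l κ<M l<q ≡.refl → noZeroDiv {W 0 ^ κ}
        (trans (*-comm _ _) (trans (sym (trans (expand m) (trans (single-l m κ l κ<M l<q ≡.refl rec) (trans (single-κ m κ l κ<M l<q ≡.refl rec) (coef-term κ l)))))
          (o m (idx κ<M l<q)))) (^-≉0 κ W0≉0) }
      where
      idx : ∀ {κ l} → κ < M → l < q → q ℕ.* κ ℕ.+ l < N
      idx {κ} {l} κ<M l<q = ℕ.<-≤-trans (ℕ.+-monoʳ-< (q ℕ.* κ) l<q) (ℕ.≤-trans (ℕ.≤-reflexive (≡.trans (ℕ.+-comm _ q) (≡.sym (ℕ.*-suc q κ)))) (ℕ.≤-trans (ℕ.*-monoʳ-≤ q κ<M) hN))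
      coef-term : ∀ κ l → s l κ * term l κ (q ℕ.* κ ℕ.+ l) ≈ s l κ * W 0 ^ κ
      coef-term κ l = *-congˡ (trans (reflexive (≡.cong (term l κ) (≡.sym (ℕ.+-identityʳ _)))) (trans (X^⊛ (q ℕ.* κ ℕ.+ l) (W S.^ κ) 0) (^-at0 W κ)))
      Rec : ℕ → Set ℓ
      Rec m = ∀ {m′} → m′ < m → ∀ κ l → κ < M → l < q → q ℕ.* κ ℕ.+ l ≡ m′ → s l κ ≈ 0#
      other : ∀ m κ l → l < q → q ℕ.* κ ℕ.+ l ≡ m → Rec m → ∀ κ′ l′ → κ′ < M → l′ < q → ¬ (κ ≡ κ′ × l ≡ l′) → s l′ κ′ * term l′ κ′ m ≈ 0#
      other m κ l l<q e rec κ′ l′ κ′<M l′<q ne with ℕ.<-cmp (q ℕ.* κ′ ℕ.+ l′) m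
      ... | tri< lt _ _ = *-0ˡ _ (rec lt κ′ l′ κ′<M l′<q ≡.refl)
      ... | tri≈ _ eq _ = ⊥-elim (ne (divmod-unique q l<q l′<q (≡.trans e (≡.sym eq))))
      ... | tri> _ _ gt = *-0ʳ _ (X^⊛-< (q ℕ.* κ′ ℕ.+ l′) (W S.^ κ′) m gt)
      single-l : ∀ m κ l → κ < M → l < q → q ℕ.* κ ℕ.+ l ≡ m → Rec m →
        ∑ q (λ l′ → ∑ M (λ κ′ → s l′ κ′ * term l′ κ′ m)) ≈ ∑ M (λ κ′ → s l κ′ * term l κ′ m)
      single-l m κ l κ<M l<q e rec = ∑-single q _ l l<q λ l′ l′<q ne → ∑-0 M λ κ′ κ′<M → other m κ l l<q e rec κ′ l′ κ′<M l′<q (λ p → ne (≡.sym (proj₂ p)))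
      single-κ : ∀ m κ l → κ < M → l < q → q ℕ.* κ ℕ.+ l ≡ m → Rec m → ∑ M (λ κ′ → s l κ′ * term l κ′ m) ≈ s l κ * term l κ m
      single-κ m κ l κ<M l<q e rec = ∑-single M _ κ κ<M λ κ′ κ′<M ne → other m κ l l<q e rec κ′ l κ′<M l<q (λ p → ne (≡.sym (proj₁ p)))

    -- On the branch (u - π)^κ·v^l has order exactly q·κ + l, and for l < q these orders are
    -- pairwise different. A combination of them with κ < M that vanishes to order q·M must
    -- therefore be zero.
    vanish : ∀ N → q ℕ.* M ≤ N → Ord N (θ r) → r P₂.≈ P₂.0#
    vanish N hN o = B₂.mk λ l → go l
      where
      go : ∀ l → B₂.coef r l P₁.≈ P₁.0#
      go l with l ℕ.<? q
      ... | no ¬l = hr l (ℕ.≮⇒≥ ¬l)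
      ... | yes l<q = σ-≈0 _ (B₁.mk λ κ → g κ)
        where
        g : ∀ κ → s l κ ≈ 0#
        g κ with κ ℕ.<? M
        ... | yes κ<M = s-0 N hN o _ κ l κ<M l<q ≡.refl
        ... | no ¬κ = Deg-σ M (B₂.coef r l) (hM l) κ (ℕ.≮⇒≥ ¬κ)

record PlaceData (κ ℓ : Level) : Set (lsuc (κ ⊔ ℓ)) where
  field
    curveData : CurveData κ ℓ
  open CurveData curveData public
  field
    π : CR2.Carrier K
    U W : ℕ → CR2.Carrier K
    W0≉0 : ¬ CR2._≈_ K (W 0) (CR2.0# K)
    U≈ : CR2._≈_ (Series.PS K) U (CR2._+_ (Series.PS K) (Series.cst K π) (CR2._*_ (Series.PS K) (C2._^_ (Series.PS K) (Series.X K) (suc (suc q₂))) W))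

  branch : BranchData κ ℓ
  branch = record { K = K ; D = Field.domain F ; q = suc (suc q₂) ; π = π ; U = U ; W = W ; W0≉0 = W0≉0 ; U≈ = U≈ }

module Place {κ ℓ} (𝒫 : PlaceData κ ℓ) where
  open PlaceData 𝒫
  open C2 K
  open Field F
  open Domain domain
  open Series K using (Ord; Ord-⊕; Ord-⊛; Ord-cong; PS; Ord-≤)
  open CurveField curveData
  open PlaceB branch using (θ; θ-hom; vanish) public
  open Elimination curveData
  private
    module D₁ = Domain (B₁.Poly-domain domain)
    module S = C2 PS
    module θ = Hom θ-hom

  module _ (fU : θ f S.≈ S.0#) where

    -- Allows one more power of v than `vanish`: that lemma applies to r̃ and makes it zero, so the
    -- top row of r is zero by `rq≈0` and `vanish` applies to r itself. The required order grows
    -- because the rows of r̃ reach degree n + 2·M.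
    vanish-q : ∀ M r → B₂.Deg< n r → (∀ i → B₁.Deg< (suc M) (B₂.coef r i)) →
      ∀ N → q ℕ.* suc (n ℕ.+ (M ℕ.+ M)) ≤ N → Ord N (θ r) → r P₂.≈ P₂.0#
    vanish-q M r hr hM N hN o = vanish r hr′ (suc M) hM N (ℕ.≤-trans (ℕ.*-monoʳ-≤ q (s≤s (ℕ.≤-trans (ℕ.m≤m+n M M) (ℕ.m≤n+m _ n)))) hN) o
      where
      z : r̃ r hr P₂.≈ P₂.0#
      z = vanish (r̃ r hr) (r̃-deg r hr) _ (r̃-rows r hr M hM) N hN
        (Ord-cong (Series.at (S.sym (S.trans (θ.⟦⟧-+ (r P₂.* lam r hr) _) (S.+-cong (θ.⟦⟧-* r (lam r hr)) (θ.⟦⟧-* (ν (rq r hr P₁.* rq r hr)) f)))))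
          (Ord-⊕ (Ord-⊛ (θ (lam r hr)) o) (λ i _ → Series.at (S.*-0ʳ (θ (ν (rq r hr P₁.* rq r hr))) fU) i)))
      hr′ : B₂.Deg< q r
      hr′ = Series.Dg-lower B₁.PolyR {a = B₂.coef r} hr (rq≈0 r hr z)

    rows-bound : ∀ (p : B₂.Pl) → ∃ λ M → ∀ i → B₁.Deg< (suc M) (B₂.coef p i)
    rows-bound [] = 0 , λ i j _ → refl
    rows-bound (a ∷ p) with rows-bound p
    ... | M , h = length a ℕ.+ M , λ { zero → B₁.Deg<-≤ a (ℕ.m≤n⇒m≤1+n (ℕ.m≤m+n _ M)) (B₁.Dg-length a)
                                     ; (suc i) → B₁.Deg<-≤ (B₂.coef p i) (s≤s (ℕ.m≤n+m M _)) (h i) }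

    vanish-exact : ∀ r → B₂.Deg< n r → θ r S.≈ S.0# → r P₂.≈ P₂.0#
    vanish-exact r hr e = vanish-q (proj₁ (rows-bound r)) r hr (proj₂ (rows-bound r)) _ ℕ.≤-refl (λ i _ → Series.at e i)

    νP : B₂.Pl
    νP = ν P

    -- Division by f as a polynomial in v. Its leading coefficient P is not a unit, so a power of P
    -- multiplies the dividend.
    Pseudo : B₂.Pl → Set _
    Pseudo S = ∃ λ N → ∃₂ λ k ρ → νP P₂.^ N P₂.* S P₂.≈ f P₂.* k P₂.+ ρ × B₂.Deg< n ρ

    pseudo-step : ∀ S w → Pseudo (νP P₂.* S P₂.+ w P₂.* f) → Pseudo S
    pseudo-step S w (N , k , ρ , e , hρ) = suc N , k P₂.+ νP P₂.^ N P₂.* w , ρ ,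
      P₂.trans (Ids.pseudo-id B₂.PolyR νP (νP P₂.^ N) S w f) (P₂.trans (P₂.+-congʳ e) (Ids.id17 B₂.PolyR f k ρ (νP P₂.^ N P₂.* w))) , hρ

    pseudo : ∀ m S → B₂.Deg< (m ℕ.+ n) S → Pseudo S
    pseudo zero S h = 0 , P₂.0# , S , P₂.trans (P₂.*-identityˡ S) (P₂.sym (P₂.trans (P₂.+-congʳ (P₂.zeroʳ f)) (P₂.+-identityˡ S))) , h
    pseudo (suc m) S h = pseudo-step S w (pseudo m S′ h′)
      where
      t = B₂.coef S (m ℕ.+ n)
      w = ν t P₂.* v P₂.^ m
      S′ = νP P₂.* S P₂.+ w P₂.* f
      c₁ : ∀ i → B₂.coef S′ i P₁.≈ P P₁.* B₂.coef S i P₁.+ t P₁.* B₂.coef (v P₂.^ m P₂.* f) i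
      c₁ i = P₁.trans (B₂.coef-⊞′ (νP P₂.* S) (w P₂.* f) i) (P₁.+-cong (B₂.coef-C⊠ P S i)
               (P₁.trans (B₂.at (P₂.*-assoc (ν t) (v P₂.^ m) f) i) (B₂.coef-C⊠ t (v P₂.^ m P₂.* f) i)))
      hS′ : B₂.Deg< (suc (m ℕ.+ n)) S′
      hS′ i l = P₁.trans (c₁ i) (P₁.+-0 (P₁.*-0ʳ P (h i l)) (P₁.*-0ʳ t (B₂.Deg<-* (v P₂.^ m) f (B₂.Deg<-V^ m) Deg-f i
                  (ℕ.≤-trans (ℕ.≤-reflexive (ℕ.+-suc m n)) l))))
      h′ : B₂.Deg< (m ℕ.+ n) S′
      h′ = Series.Dg-lower B₁.PolyR {a = B₂.coef S′} hS′ (P₁.trans (c₁ (m ℕ.+ n)) (P₁.trans (P₁.+-congˡ (P₁.*-congˡ (P₁.trans (B₂.coef-V^⊠ m f n) f-n))) (P₁.≈⇒sum-0 (P₁.*-comm P t))))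

    -- f ≡ u^q·v^q modulo P, and u is invertible modulo P
    module _ (Z k : B₂.Pl) (e : νP P₂.* Z P₂.≈ f P₂.* k) where
      private
        w = u P₁.^ q P₁.+ B₁.C b
        cq = B₁.C c P₁.^ q
        κ⁻ = B₁.C ci P₁.^ q
        vk = v P₂.^ q P₂.* k
        Y = ν (w P₁.^ q) P₂.* (Z P₂.+ f̂ P₂.* k) P₂.+ ν (P P₁.^ suc q₂) P₂.* vk

      -- With w = u^q + b one has u·w = P + c. The q-th power of this equation exhibits w^q/c^q as
      -- the inverse of u^q modulo P.
      uw : (u P₁.^ q) P₁.* w P₁.^ q P₁.≈ P P₁.* P P₁.^ suc q₂ P₁.+ cq
      uw = P₁.trans (P₁.sym (P₁.^-distrib-* u w q)) (P₁.trans (P₁.^-congˡ q (Ids.id18 B₁.PolyR u (u P₁.^ q) (B₁.C b) (B₁.C c)))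
             (P₁.trans (P₁.^-congʳ (P P₁.+ B₁.C c) q≡) (P₁.trans (P₁.frob (suc r₀) P (B₁.C c)) (P₁.+-cong (P₁.^-congʳ P (≡.sym q≡)) (P₁.^-congʳ (B₁.C c) (≡.sym q≡))))))

      uvk : ν (u P₁.^ q) P₂.* vk P₂.≈ νP P₂.* (Z P₂.+ f̂ P₂.* k)
      uvk = P₂.trans (Ids.uvk-id B₂.PolyR νP f̂ (ν (u P₁.^ q)) (v P₂.^ q) k)
          (P₂.trans (P₂.+-congʳ (P₂.sym e)) (P₂.sym (P₂.distribˡ νP Z (f̂ P₂.* k))))

      ν-cq : ν cq P₂.≈ νP P₂.* ν (P P₁.^ suc q₂) P₂.+ ν (u P₁.^ q) P₂.* ν (w P₁.^ q)
      ν-cq = P₂.trans (Hom.⟦⟧-cong B₂.C-hom (P₁.trans (Ids.id19 B₁.PolyR (P P₁.* P P₁.^ suc q₂) cq) (P₁.+-congˡ (P₁.sym uw))))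
            (P₂.trans (B₂.C-+ (P P₁.* P P₁.^ suc q₂) (u P₁.^ q P₁.* w P₁.^ q)) (P₂.+-cong (B₂.C-* P (P P₁.^ suc q₂)) (B₂.C-* (u P₁.^ q) (w P₁.^ q))))

      main : ν cq P₂.* vk P₂.≈ νP P₂.* Y
      main = P₂.trans (P₂.*-congʳ {vk} ν-cq)
          (P₂.trans (Ids.id20 B₂.PolyR νP (ν (P P₁.^ suc q₂)) (ν (u P₁.^ q)) (ν (w P₁.^ q)) vk)
          (P₂.trans (P₂.+-congʳ (P₂.*-congˡ {ν (w P₁.^ q)} uvk))
            (Ids.id21 B₂.PolyR νP Z (f̂ P₂.* k) (ν (w P₁.^ q)) (ν (P P₁.^ suc q₂) P₂.* vk))))

      unit-cq : κ⁻ P₁.* cq P₁.≈ P₁.1#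
      unit-cq = P₁.trans (P₁.sym (P₁.^-distrib-* (B₁.C ci) (B₁.C c) q)) (P₁.trans (P₁.^-congˡ q (P₁.trans (P₁.*-comm (B₁.C ci) (B₁.C c)) (C-inv c-inv))) (P₁.1^ q))

      row-k : ∀ i → cq P₁.* B₂.coef k i P₁.≈ P P₁.* B₂.coef (B₂.drop q Y) i
      row-k i = P₁.trans (P₁.*-congˡ (P₁.sym (B₂.coef-V^⊠ q k i))) (P₁.trans (P₁.sym (B₂.coef-C⊠ cq vk (q ℕ.+ i)))
        (P₁.trans (B₂.at main (q ℕ.+ i)) (P₁.trans (B₂.coef-C⊠ P Y (q ℕ.+ i)) (P₁.*-congˡ (P₁.reflexive (≡.sym (B₂.coef-drop q Y i)))))))

      -- By `main` P divides c^q·v^q·k. Multiplication by v^q merely shifts rows and c^q is a unit,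
      -- so P divides k row by row.
      P-divides : ∃ λ k₁ → k P₂.≈ νP P₂.* k₁
      P-divides = ν κ⁻ P₂.* B₂.drop q Y , B₂.mk λ i →
        P₁.trans (P₁.sym (P₁.*-identityˡ (B₂.coef k i))) (P₁.trans (P₁.*-congʳ (P₁.sym unit-cq))
        (P₁.trans (P₁.*-assoc κ⁻ cq (B₂.coef k i)) (P₁.trans (P₁.*-congˡ (row-k i))
        (P₁.trans (Ids.swap-id₂ B₁.PolyR κ⁻ P (B₂.coef (B₂.drop q Y) i))
          (P₁.sym (P₁.trans (B₂.coef-C⊠ P (ν κ⁻ P₂.* B₂.drop q Y) i) (P₁.*-congˡ (B₂.coef-C⊠ κ⁻ (B₂.drop q Y) i))))))))

    private
      νP-cancel : ∀ {x y} → νP P₂.* x P₂.≈ νP P₂.* y → x P₂.≈ y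
      νP-cancel {x} {y} e = B₂.mk λ i → D₁.cancel P≉0 (P₁.trans (P₁.sym (B₂.coef-C⊠ P x i)) (P₁.trans (B₂.at e i) (B₂.coef-C⊠ P y i)))

    cancel-powers : ∀ N Z k → νP P₂.^ N P₂.* Z P₂.≈ f P₂.* k → ∃ λ k₁ → Z P₂.≈ f P₂.* k₁
    cancel-powers zero Z k e = k , P₂.trans (P₂.sym (P₂.*-identityˡ Z)) e
    cancel-powers (suc N) Z k e = cancel-powers N Z k₁ (νP-cancel (P₂.trans e′ (P₂.trans (P₂.*-congˡ (proj₂ d)) (Ids.swap-id₂ B₂.PolyR f νP k₁))))
      where
      e′ : νP P₂.* (νP P₂.^ N P₂.* Z) P₂.≈ f P₂.* k
      e′ = P₂.trans (P₂.sym (P₂.*-assoc νP (νP P₂.^ N) Z)) e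
      d = P-divides (νP P₂.^ N P₂.* Z) k e′
      k₁ = proj₁ d

    rem-0 : ∀ S N k ρ → νP P₂.^ N P₂.* S P₂.≈ f P₂.* k P₂.+ ρ → B₂.Deg< n ρ → θ S S.≈ S.0# → ρ P₂.≈ P₂.0#
    rem-0 S N k ρ eq hρ e = vanish-exact ρ hρ (S.trans (θ.⟦⟧-cong (P₂.trans (Ids.id23 B₂.PolyR (f P₂.* k) ρ) (P₂.+-congʳ (P₂.sym eq))))
        (S.trans (θ.⟦⟧-+ (νP P₂.^ N P₂.* S) (f P₂.* k)) (S.+-0 (S.trans (θ.⟦⟧-* (νP P₂.^ N) S) (S.*-0ʳ (θ (νP P₂.^ N)) e)) (S.trans (θ.⟦⟧-* f k) (S.*-0ˡ (θ k) fU)))))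

    -- the lowest row of f·k is c′·P times that of k, which is too large in u
    rows-0 : ∀ S k → (∀ i → B₁.Deg< n (B₂.coef S i)) → S P₂.≈ f P₂.* k → ∀ j i → i < j → B₂.coef k i P₁.≈ P₁.0#
    rows-0 S k hS S≈ (suc j) i (s≤s i≤j) with ℕ.m≤n⇒m<n∨m≡n i≤j
    ... | inj₁ i<j = rows-0 S k hS S≈ j i i<j
    ... | inj₂ ≡.refl = B₁.mk λ m → B₁.Deg<-factor domain 0 P (B₂.coef k i) HasDeg-P
          (B₁.Deg<-≤ (P P₁.* B₂.coef k i) (ℕ.m≤m+n n 0) (B₁.Deg<-cong rowi (λ m l → trans (B₁.coef-C⊠ ci′ (B₂.coef S i) m) (*-0ʳ ci′ (hS i m l))))) m z≤n
        where
        open Series B₁.PolyR using (⊛-low)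
        rowi : B₁.C ci′ P₁.* B₂.coef S i P₁.≈ P P₁.* B₂.coef k i
        rowi = P₁.trans (P₁.*-congˡ (P₁.trans (B₂.at S≈ i) (P₁.trans (B₂.coef-⊠ f k i) (P₁.trans (⊛-low i (B₂.coef f) (B₂.coef k) (rows-0 S k hS S≈ i)) (P₁.*-congʳ f-0)))))
          (P₁.trans (Ids.id24 B₁.PolyR (B₁.C ci′) (B₁.C c′) P (B₂.coef k i)) (P₁.trans (P₁.*-congʳ (C-inv c′-inv)) (P₁.*-identityˡ (P P₁.* B₂.coef k i))))

    -- The pseudo-remainder modulo f has degree below n in v and vanishes on the branch, so it is
    -- zero; cancelling the powers of P shows f | S. As f has degree n in u, a multiple of smaller
    -- degree is zero. This is the injectivity later applied to the multiplier `T` and to the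
    -- polynomials `Γ`.
    vanish-u : ∀ S → (∀ i → B₁.Deg< n (B₂.coef S i)) → θ S S.≈ S.0# → S P₂.≈ P₂.0#
    vanish-u S hS e = go (pseudo (length S) S (B₂.Deg<-≤ S (ℕ.m≤m+n (length S) n) (B₂.Dg-length S)))
      where
      go₂ : (∃ λ k → S P₂.≈ f P₂.* k) → S P₂.≈ P₂.0#
      go₂ (k , S≈) = P₂.trans S≈ (P₂.*-0ʳ f (B₂.mk λ i → rows-0 S k hS S≈ (suc i) i ℕ.≤-refl))
      go : Pseudo S → S P₂.≈ P₂.0#
      go (N , k , ρ , eq , hρ) = go₂ (cancel-powers N S k (P₂.trans eq (P₂.trans (P₂.+-congˡ (rem-0 S N k ρ eq hρ e)) (P₂.+-identityʳ (f P₂.* k)))))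

-- Construction of the branch by successive approximation

square-split : ∀ q₂ → suc (q₂ ℕ.+ suc q₂ ℕ.* suc q₂) ℕ.+ suc (suc q₂) ≡ suc (suc q₂) ℕ.* suc (suc q₂)
square-split = solve 1 (λ x → (con 1 :+ (x :+ (con 1 :+ x) :* (con 1 :+ x))) :+ (con 2 :+ x) := (con 2 :+ x) :* (con 2 :+ x)) ≡.refl
  where open +-*-Solver

module Contraction {κ ℓ} (K : CR2 κ ℓ) where
  open C2 K
  open Series K
  private
    module S = C2 PS

  infix 4 _≡[_]_
  _≡[_]_ : Ser → ℕ → Ser → Set ℓ
  a ≡[ N ] b = ∀ i → i < N → a i ≈ b i

  ≡-Ord : ∀ {N a b} → a ≡[ N ] b → Ord N (a ⊕ b)
  ≡-Ord {a = a} {b} h i l = trans (⊕-at a b i) (≈⇒sum-0 (h i l))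

  Ord-≡ : ∀ {N a b} → Ord N (a ⊕ b) → a ≡[ N ] b
  Ord-≡ {a = a} {b} h i l = sum-0⇒≈ (trans (sym (⊕-at a b i)) (h i l))

  ≡-+ : ∀ {N a b x y} → a ≡[ N ] b → x ≡[ N ] y → a S.+ x ≡[ N ] b S.+ y
  ≡-+ {a = a} {b} {x} {y} h g i l = trans (⊕-at a x i) (trans (+-cong (h i l) (g i l)) (sym (⊕-at b y i)))

  ≡-* : ∀ {N a b x y} → a ≡[ N ] b → x ≡[ N ] y → a S.* x ≡[ N ] b S.* y
  ≡-* {N} {a} {b} {x} {y} h g = Ord-≡ (Ord-cong (at (Ids.id25 PS a b x y))
    (Ord-⊕ (Ord-⊛ x (≡-Ord h)) (Ord-⊛ʳ b (≡-Ord g))))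

  ≡-refl : ∀ {N} a → a ≡[ N ] a
  ≡-refl a i l = refl

  ≡-^ : ∀ {N a b} m → a ≡[ N ] b → a S.^ m ≡[ N ] b S.^ m
  ≡-^ zero h = ≡-refl S.1#
  ≡-^ (suc m) h = ≡-* h (≡-^ m h)

  ≡-X : ∀ {N a b} → a ≡[ N ] b → X S.* a ≡[ suc N ] X S.* b
  ≡-X {a = a} {b} h zero l = trans (X⊛-0 a) (sym (X⊛-0 b))
  ≡-X {a = a} {b} h (suc i) (s≤s l) = trans (X⊛-suc a i) (trans (h i l) (sym (X⊛-suc b i)))

  -- Each application of Φ makes one more coefficient agree, so the iterates of zero stabilise
  -- coefficient by coefficient, and coefficient i is final from iterate i + 1 on.
  fixpoint : (Φ : Ser → Ser) → (∀ N a b → a ≡[ N ] b → Φ a ≡[ suc N ] Φ b) → ∃ λ W → W S.≈ Φ W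
  fixpoint Φ contr = W , mk λ i → trans (sym (near (suc i) i (ℕ.n<1+n i))) (contr i (iter i) W (near i) i (ℕ.n<1+n i))
    where
    iter : ℕ → Ser
    iter zero = 0s
    iter (suc j) = Φ (iter j)
    W : Ser
    W i = iter (suc i) i
    next : ∀ j → iter j ≡[ j ] iter (suc j)
    next zero i ()
    next (suc j) = contr j _ _ (next j)
    far : ∀ i d → iter (suc i) i ≈ iter (suc i ℕ.+ d) i
    far i zero = reflexive (≡.cong (λ j → iter j i) (≡.sym (ℕ.+-identityʳ (suc i))))
    far i (suc d) = trans (far i d) (trans (next (suc i ℕ.+ d) i (s≤s (ℕ.m≤m+n i d))) (reflexive (≡.cong (λ j → iter j i) (≡.sym (ℕ.+-suc (suc i) d)))))
    near : ∀ j → iter j ≡[ j ] W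
    near j i i<j with ℕ.m≤n⇒∃[o]m+o≡n i<j
    ... | d , ≡.refl = sym (far i d)

module Hensel {κ ℓ} (𝒟 : CurveData κ ℓ) (π : CR2.Carrier (CurveData.K 𝒟)) where
  open CurveData 𝒟
  open C2 K
  open Field F
  open Domain domain
  open Series K
  open Curve coefficients
  open Contraction K
  private
    module S = C2 PS
    module ch = Hom cst-hom

  module _ (root : π ^ n + (b * π + c) ≈ 0#) where

    -- `a₀` is the derivative of P at π, a unit because π·(π^q + b) = c. `κ₀` is the inverse of
    -- a₀·c′.
    a₀ κ₀ : Carrier
    a₀ = π ^ q + b
    κ₀ = (π * ci) * ci′

    π-unit : π * (a₀ * ci) ≈ 1#
    π-unit = trans (Ids.alg17 K π (π ^ q) b ci)
      (trans (*-congʳ (sum-0⇒≈ (trans (+-assoc _ _ _) root))) c-inv)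

    κ₀-inv : (a₀ * c′) * κ₀ ≈ 1#
    κ₀-inv = trans (Ids.alg18 K a₀ c′ π ci ci′)
      (trans (*-cong π-unit c′-inv) (*-identityˡ 1#))

    p̃ P̃ : Ser
    p̃ = X S.^ q S.+ cst b′
    P̃ = cst c′ S.+ X S.* p̃

    -- Chosen with X·X^e₁ = X^(q²-q) and X·X^e₂ = X^(q²), the powers that remain in the equation
    -- after division by X^q. The factor X set apart is what makes Φ contracting.
    e₁ e₂ : ℕ
    e₁ = q₂ ℕ.+ suc q₂ ℕ.* suc q₂
    e₂ = suc q₂ ℕ.+ suc q₂ ℕ.* q

    -- Substituting u = π + t^q·W and v = t in f and dividing by t^q leaves a₀·c′·W + π^q + t·Ψ(W) =
    -- 0. Solving for the linear term gives W = Φ(W).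
    Ψ Φ : Ser → Ser
    Ψ W = cst a₀ S.* W S.* p̃ S.+ (X S.^ e₁ S.* (cst π S.* W S.^ q S.+ X S.^ q S.* W S.^ n) S.* P̃ S.+ X S.^ e₂ S.* W S.^ q)
    Φ W = cst κ₀ S.* (cst (π ^ q) S.+ X S.* Ψ W)

    Φ-contr : ∀ N a b → a ≡[ N ] b → Φ a ≡[ suc N ] Φ b
    Φ-contr N a b h = ≡-* (≡-refl (cst κ₀)) (≡-+ (≡-refl (cst (π ^ q))) (≡-X
      (≡-+ (≡-* (≡-* (≡-refl (cst a₀)) h) (≡-refl p̃)) (≡-+ (≡-* (≡-* (≡-refl (X S.^ e₁)) (≡-+ (≡-* (≡-refl (cst π)) (≡-^ q h)) (≡-* (≡-refl (X S.^ q)) (≡-^ n h)))) (≡-refl P̃))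
        (≡-* (≡-refl (X S.^ e₂)) (≡-^ q h))))))

    W : Ser
    W = proj₁ (fixpoint Φ Φ-contr)

    W≈ : W S.≈ Φ W
    W≈ = proj₂ (fixpoint Φ Φ-contr)

    U : Ser
    U = cst π S.+ X S.^ q S.* W

    W0≉0 : ¬ W 0 ≈ 0#
    W0≉0 e = 0≉1 (trans (sym e′) one)
      where
      W0 : W 0 ≈ κ₀ * π ^ q
      W0 = trans (at W≈ 0) (trans (cst⊛ κ₀ _ 0) (*-congˡ (trans (⊕-at (cst (π ^ q)) (X S.* Ψ W) 0) (trans (+-congˡ (X⊛-0 (Ψ W))) (+-identityʳ _)))))
      e′ : ((a₀ * c′) * W 0) * (a₀ * ci) ^ q ≈ 0#
      e′ = *-0ˡ _ (*-0ʳ _ e)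
      one : ((a₀ * c′) * W 0) * (a₀ * ci) ^ q ≈ 1#
      one = trans (*-congʳ (*-congˡ W0)) (trans (Ids.alg19 K (a₀ * c′) κ₀ (π ^ q) ((a₀ * ci) ^ q))
        (trans (*-cong κ₀-inv (trans (sym (^-distrib-* π (a₀ * ci) q)) (trans (^-congˡ q π-unit) (1^ q)))) (*-identityˡ 1#)))

    equation : (cst a₀ S.* W S.+ X S.* X S.^ e₁ S.* (cst π S.* W S.^ q S.+ X S.^ q S.* W S.^ n)) S.* P̃ S.+ (cst (π ^ q) S.+ X S.* X S.^ e₂ S.* W S.^ q) S.≈ S.0#
    equation = begin
      (A S.* W S.+ X S.* t₁ S.* Z) S.* (cst c′ S.+ X S.* p̃) S.+ (B S.+ X S.* t₂ S.* W S.^ q)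
        ≈⟨ Ids.id26 PS A W X t₁ Z (cst c′) p̃ B (X S.* t₂ S.* W S.^ q) ⟩
      (A S.* cst c′) S.* W S.+ (B S.+ (X S.* (A S.* W S.* p̃ S.+ t₁ S.* Z S.* P̃) S.+ X S.* t₂ S.* W S.^ q))
        ≈⟨ S.+-cong (S.*-cong (S.sym (ch.⟦⟧-* a₀ c′)) W≈) (S.+-congˡ {B} (Ids.id27 PS X (A S.* W S.* p̃) (t₁ S.* Z S.* P̃) t₂ (W S.^ q))) ⟩
      cst (a₀ * c′) S.* (cst κ₀ S.* (B S.+ X S.* Ψ W)) S.+ (B S.+ X S.* Ψ W)
        ≈⟨ S.+-congʳ (S.trans (S.sym (S.*-assoc (cst (a₀ * c′)) (cst κ₀) _)) (S.trans (S.*-congʳ (S.trans (S.sym (ch.⟦⟧-* (a₀ * c′) κ₀)) (S.trans (ch.⟦⟧-cong κ₀-inv) ch.⟦⟧-1))) (S.*-identityˡ _))) ⟩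
      (B S.+ X S.* Ψ W) S.+ (B S.+ X S.* Ψ W) ≈⟨ S.self _ ⟩
      S.0# ∎
      where
      open Relation.Binary.Reasoning.Setoid S.setoid
      A = cst a₀
      B = cst (π ^ q)
      t₁ = X S.^ e₁
      t₂ = X S.^ e₂
      Z = cst π S.* W S.^ q S.+ X S.^ q S.* W S.^ n

    placeData : PlaceData κ ℓ
    placeData = record { curveData = 𝒟 ; π = π ; U = U ; W = W ; W0≉0 = W0≉0 ; U≈ = S.refl }

    open PlaceB (PlaceData.branch placeData) using (θ; θ-hom; module E₁; module E₂)

    fU : θ f S.≈ S.0#
    fU = begin
      θ f ≈⟨ θ.⟦⟧-+ (ν P P₂.* f̂) _ ⟩
      θ (ν P P₂.* f̂) S.+ θ (ν (u P₁.^ q) P₂.* v P₂.^ q) ≈⟨ S.+-cong (S.trans (θ.⟦⟧-* (ν P) f̂) (S.*-cong θP θf̂)) (S.trans (θ.⟦⟧-* (ν (u P₁.^ q)) (v P₂.^ q)) (S.*-cong θuq (S.trans (θ.⟦⟧-^ v q) (S.^-congˡ q E₂.ev-V)))) ⟩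
      x S.* (A S.* W S.+ t S.* (p S.* W S.^ q S.+ x S.* (W S.* W S.^ q))) S.* (X S.* x S.+ (cst b′ S.* X S.+ cst c′)) S.+ (cst (π ^ q) S.+ x S.* (t S.* W S.^ q)) S.* x
        ≈⟨ Ids.id28 PS x A W t p (W S.^ q) X (cst b′) (cst c′) ⟨+⟩ S.refl ⟩
      x S.* ((A S.* W S.+ t S.* (p S.* W S.^ q S.+ x S.* (W S.* W S.^ q))) S.* P̃) S.+ (cst (π ^ q) S.+ x S.* (t S.* W S.^ q)) S.* x
        ≈⟨ Ids.id29 PS x _ (cst (π ^ q)) (x S.* (t S.* W S.^ q)) ⟩
      x S.* ((A S.* W S.+ t S.* (p S.* W S.^ q S.+ x S.* (W S.* W S.^ q))) S.* P̃ S.+ (cst (π ^ q) S.+ x S.* (t S.* W S.^ q)))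
        ≈⟨ S.*-0ʳ x (S.trans (S.+-congˡ (S.+-congˡ {cst (π ^ q)} (S.trans (S.sym (S.*-assoc x t (W S.^ q))) (S.*-congʳ {W S.^ q} (S.sym xq))))) equation) ⟩
      S.0# ∎
      where
      open Relation.Binary.Reasoning.Setoid S.setoid
      _⟨+⟩_ : ∀ {a b x y} → a S.≈ b → x S.≈ y → a S.+ x S.≈ b S.+ y
      _⟨+⟩_ = S.+-cong
      module θ = Hom θ-hom
      module θ₁ = Hom E₁.ev-hom
      x = X S.^ q
      t = X S.* X S.^ e₁
      A = cst a₀
      p = cst π
      Y = x S.* W
      xq : X S.* X S.^ e₂ S.≈ x S.* t
      xq = S.trans (S.^-congʳ X {q ℕ.* q} (≡.sym (≡.trans (ℕ.+-comm q (suc e₁)) (square-split q₂)))) (S.^-homo-* X q (suc e₁))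
      Yq : Y S.^ q S.≈ x S.* (t S.* W S.^ q)
      Yq = S.trans (S.^-distrib-* x W q) (S.trans (S.*-congʳ {W S.^ q} (S.trans (S.^-assocʳ X q q) xq)) (S.*-assoc x t (W S.^ q)))
      Uq : U S.^ q S.≈ cst (π ^ q) S.+ x S.* (t S.* W S.^ q)
      Uq = S.trans (S.^-congʳ U q≡) (S.trans (S.frob (suc r₀) p Y) (S.trans (S.+-cong (S.^-congʳ p (≡.sym q≡)) (S.^-congʳ Y (≡.sym q≡))) (S.+-cong (S.sym (ch.⟦⟧-^ π q)) Yq)))
      θuq : θ (ν (u P₁.^ q)) S.≈ cst (π ^ q) S.+ x S.* (t S.* W S.^ q)
      θuq = S.trans (E₂.ev-C (u P₁.^ q)) (S.trans (θ₁.⟦⟧-^ u q) (S.trans (S.^-congˡ q E₁.ev-V) Uq))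
      θf̂ : θ f̂ S.≈ X S.* x S.+ (cst b′ S.* X S.+ cst c′)
      θf̂ = S.trans (θ.⟦⟧-+ (v P₂.^ n) _) (S.+-cong (S.trans (θ.⟦⟧-^ v n) (S.^-congˡ n E₂.ev-V)) (S.trans (θ.⟦⟧-+ (ν (B₁.C b′) P₂.* v) _)
        (S.+-cong (S.trans (θ.⟦⟧-* (ν (B₁.C b′)) v) (S.*-cong (S.trans (E₂.ev-C (B₁.C b′)) (E₁.ev-C b′)) E₂.ev-V)) (S.trans (E₂.ev-C (B₁.C c′)) (E₁.ev-C c′)))))
      rootS : p S.* cst (π ^ q) S.+ (cst b S.* p S.+ cst c) S.≈ S.0#
      rootS = S.trans (S.sym (S.trans (ch.⟦⟧-+ _ _) (S.+-cong (ch.⟦⟧-* π (π ^ q)) (S.trans (ch.⟦⟧-+ _ _) (S.+-congʳ (ch.⟦⟧-* b π)))))) (ch.⟦⟧-≈0 root)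
      θP : θ (ν P) S.≈ x S.* (A S.* W S.+ t S.* (p S.* W S.^ q S.+ x S.* (W S.* W S.^ q)))
      θP = begin
        θ (ν P) ≈⟨ S.trans (E₂.ev-C P) (S.trans (θ₁.⟦⟧-+ (u P₁.^ n) _) (S.+-cong (S.trans (θ₁.⟦⟧-^ u n) (S.^-congˡ n E₁.ev-V))
             (S.trans (θ₁.⟦⟧-+ (B₁.C b P₁.* u) (B₁.C c)) (S.+-cong (S.trans (θ₁.⟦⟧-* (B₁.C b) u) (S.*-cong (E₁.ev-C b) E₁.ev-V)) (E₁.ev-C c))))) ⟩
        U S.* U S.^ q S.+ (cst b S.* U S.+ cst c) ≈⟨ S.+-congʳ (S.*-congˡ {U} Uq) ⟩
        (p S.+ x S.* W) S.* (cst (π ^ q) S.+ x S.* (t S.* W S.^ q)) S.+ (cst b S.* (p S.+ x S.* W) S.+ cst c)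
          ≈⟨ Ids.id30 PS p x W (cst (π ^ q)) t (W S.^ q) (cst b) (cst c) ⟩
        x S.* ((cst (π ^ q) S.+ cst b) S.* W S.+ t S.* (p S.* W S.^ q S.+ x S.* (W S.* W S.^ q))) S.+ (p S.* cst (π ^ q) S.+ (cst b S.* p S.+ cst c))
          ≈⟨ S.trans (S.+-congˡ rootS) (S.+-identityʳ _) ⟩
        x S.* ((cst (π ^ q) S.+ cst b) S.* W S.+ t S.* (p S.* W S.^ q S.+ x S.* (W S.* W S.^ q)))
          ≈⟨ S.*-congˡ {x} (S.+-congʳ (S.*-congʳ {W} (S.sym (ch.⟦⟧-+ (π ^ q) b)))) ⟩
        x S.* (A S.* W S.+ t S.* (p S.* W S.^ q S.+ x S.* (W S.* W S.^ q))) ∎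

-- Finite fields: characteristic, Fermat, kernels and zeros of polynomials

funToFin-cong : ∀ {m n} {f g : Fin m → Fin n} → (∀ i → f i ≡ g i) → funToFin f ≡ funToFin g
funToFin-cong {zero} h = ≡.refl
funToFin-cong {suc m} h = ≡.cong₂ combine (h Fin.zero) (funToFin-cong (h ∘ Fin.suc))

module FiniteFieldFacts {c ℓ} (m : ℕ) (F : FiniteField c ℓ (2 ℕ.^ m)) where
  private
    module F = FiniteField F
    module I = Inverse F.card

  N : ℕ
  N = 2 ℕ.^ m

  to : Fin N → F.Carrier
  to = I.to

  from : F.Carrier → Fin N
  from = I.from

  to-from : ∀ x → to (from x) F.≈ x
  to-from = I.strictlyInverseˡ

  from-to : ∀ i → from (to i) ≡ i
  from-to = I.strictlyInverseʳ

  from-inj : ∀ {x y} → from x ≡ from y → x F.≈ y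
  from-inj {x} {y} e = F.trans (F.sym (to-from x)) (F.trans (F.reflexive (≡.cong to e)) (to-from y))

  to-inj : ∀ {i j} → to i F.≈ to j → i ≡ j
  to-inj {i} {j} e = ≡.trans (≡.sym (from-to i)) (≡.trans (I.from-cong e) (from-to j))

  _≟_ : ∀ x y → Dec (x F.≈ y)
  x ≟ y = map′ from-inj I.from-cong (from x Fin.≟ from y)

  noZeroDiv : ∀ {x y} → x F.* y F.≈ F.0# → ¬ x F.≈ F.0# → y F.≈ F.0#
  noZeroDiv {x} {y} e nx with F.inverse x nx
  ... | z , xz = F.trans (F.sym (F.*-identityˡ y)) (F.trans (F.*-congʳ (F.trans (F.sym xz) (F.*-comm x z)))
                  (F.trans (F.*-assoc z x y) (F.trans (F.*-congˡ e) (F.zeroʳ z))))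

  private
    module Σ⁺ = Algebra.Properties.CommutativeMonoid.Sum F.+-commutativeMonoid
    module Π = Algebra.Properties.CommutativeMonoid.Sum F.*-commutativeMonoid
    module Mu = Algebra.Properties.Semiring.Mult F.semiring

  -- translation by 1 permutes the field, so N·1 = 0
  N×1≈0 : N Mu.× F.1# F.≈ F.0#
  N×1≈0 = cancel (F.trans (F.sym (F.trans (Σ⁺.∑-distrib-+ to (replicate N F.1#)) (F.+-congˡ (Σ⁺.sum-replicate N))))
      (F.trans (Σ⁺.sum-cong-≋ (λ i → F.sym (to-from (to i F.+ F.1#)))) (F.sym (Σ⁺.sum-permute to π))))
    where
    cancel : ∀ {s t} → s F.+ t F.≈ s → t F.≈ F.0#
    cancel {s} {t} e = F.trans (F.sym (F.+-identityˡ t)) (F.trans (F.+-congʳ (F.sym (F.-‿inverseˡ s)))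
      (F.trans (F.+-assoc _ _ _) (F.trans (F.+-congˡ e) (F.-‿inverseˡ s))))
    π = permutation (λ i → from (to i F.+ F.1#)) (λ i → from (to i F.+ F.- F.1#))
      (λ i → ≡.trans (I.from-cong (F.trans (F.+-congʳ (to-from _)) (F.trans (F.+-assoc _ _ _) (F.trans (F.+-congˡ (F.-‿inverseˡ F.1#)) (F.+-identityʳ _))))) (from-to i))
      (λ i → ≡.trans (I.from-cong (F.trans (F.+-congʳ (to-from _)) (F.trans (F.+-assoc _ _ _) (F.trans (F.+-congˡ (F.-‿inverseʳ F.1#)) (F.+-identityʳ _))))) (from-to i))

  -- N·1 is the m-th power of 1 + 1 because N = 2^m, and a power of a nonzero element of a field is
  -- nonzero.
  char2 : F.1# F.+ F.1# F.≈ F.0#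
  char2 with (F.1# F.+ F.1#) ≟ F.0#
  ... | yes e = e
  ... | no ne = ⊥-elim (power m N×1≈0)
    where
    two≈ : 2 Mu.× F.1# F.≈ F.1# F.+ F.1#
    two≈ = F.+-congˡ (F.+-identityʳ F.1#)
    power : ∀ j → ¬ (2 ℕ.^ j) Mu.× F.1# F.≈ F.0#
    power zero e = F.0≉1 (F.sym (F.trans (F.sym (F.+-identityʳ _)) e))
    power (suc j) e = power j (noZeroDiv (F.trans (F.sym (Mu.×1-homo-* 2 (2 ℕ.^ j))) e) (λ e2 → ne (F.trans (F.sym two≈) e2)))

  K : CR2 c ℓ
  K = record { ring₀ = F.commRing ; two = char2 }

  open C2 K

  K-domain : Domain K
  K-domain = record
    { stable = λ {x} {y} h → stab (x ≟ y) h
    ; 0≉1 = F.0≉1 ; noZeroDiv = noZeroDiv }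
    where
    stab : ∀ {x y} → Dec (x ≈ y) → ¬ ¬ (x ≈ y) → x ≈ y
    stab (yes e) _ = e
    stab (no ne) h = ⊥-elim (h ne)

  K-field : Field K
  K-field = record { domain = K-domain ; inv = λ x nx k → k (F.inverse x nx) }

  open Domain K-domain using (*-≉0; ^-≉0; cancel)

  pow≈^ : ∀ x j → F.pow x j ≈ x ^ j
  pow≈^ x zero = refl
  pow≈^ x (suc j) = *-congˡ (pow≈^ x j)

  -- Multiplication by a nonzero x permutes the nonzero elements and so preserves their product,
  -- whence x^(N-1) = 1. To run the product over all indices, `g` puts 1 in place of 0, and `h` is
  -- the factor gained at each index: x, except 1 at the index of 0.
  fermat : ∀ x → x ^ N ≈ x
  fermat x with x ≟ 0#
  ... | yes x0 = trans (^-congˡ N x0) (trans (0^ N (ℕ.m^n>0 2 m)) (sym x0))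
  ... | no nx = go N ≡.refl
    where
    g h : Carrier → Carrier
    g y with y ≟ 0#
    ... | yes _ = 1#
    ... | no _ = y
    h y with y ≟ 0#
    ... | yes _ = 1#
    ... | no _ = x
    g≉0 : ∀ y → ¬ g y ≈ 0#
    g≉0 y e with y ≟ 0#
    ... | yes _ = F.0≉1 (sym e)
    ... | no ny = ny e
    g-mul : ∀ y → g (to (from (x * y))) ≈ h y * g y
    g-mul y with to (from (x * y)) ≟ 0# | y ≟ 0#
    ... | yes _ | yes _ = sym (*-identityˡ 1#)
    ... | no n1 | yes y0 = ⊥-elim (n1 (trans (to-from _) (*-0ʳ x y0)))
    ... | yes e | no ny = ⊥-elim (*-≉0 nx ny (trans (sym (to-from _)) e))
    ... | no _ | no _ = to-from _
    x⁻ = proj₁ (F.inverse x nx)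
    x⁻x : x⁻ * x ≈ 1#
    x⁻x = trans (*-comm _ _) (proj₂ (F.inverse x nx))
    π = permutation (λ i → from (x * to i)) (λ i → from (x⁻ * to i))
      (λ i → ≡.trans (I.from-cong (trans (*-congˡ (to-from _)) (trans (sym (*-assoc _ _ _)) (trans (*-congʳ (proj₂ (F.inverse x nx))) (*-identityˡ _))))) (from-to i))
      (λ i → ≡.trans (I.from-cong (trans (*-congˡ (to-from _)) (trans (sym (*-assoc _ _ _)) (trans (*-congʳ x⁻x) (*-identityˡ _))))) (from-to i))
    Π≉0 : ∀ n (f : Fin n → Carrier) → (∀ i → ¬ f i ≈ 0#) → ¬ Π.sum f ≈ 0#
    Π≉0 zero f hf e = F.0≉1 (sym e)
    Π≉0 (suc n) f hf e = *-≉0 (hf Fin.zero) (Π≉0 n (f ∘ Fin.suc) (hf ∘ Fin.suc)) e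
    Πh : Π.sum (h ∘ to) ≈ 1#
    Πh = cancel (Π≉0 N (g ∘ to) (g≉0 ∘ to)) (trans (*-comm _ _) (trans (sym (Π.∑-distrib-+ (h ∘ to) (g ∘ to)))
      (trans (Π.sum-cong-≋ (λ i → sym (g-mul (to i)))) (trans (sym (Π.sum-permute (g ∘ to) π)) (sym (*-identityʳ _))))))
    h-0 : h (to (from 0#)) ≈ 1#
    h-0 with to (from 0#) ≟ 0#
    ... | yes _ = refl
    ... | no n0 = ⊥-elim (n0 (to-from 0#))
    h-≢ : ∀ i → ¬ i ≡ from 0# → h (to i) ≈ x
    h-≢ i ne with to i ≟ 0#
    ... | yes e = ⊥-elim (ne (to-inj (trans e (sym (to-from 0#)))))
    ... | no _ = refl
    -- The exponent is exposed as a successor so that the index of 0 can be removed from the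
    -- product, leaving N - 1 factors x.
    go : ∀ N′ → N′ ≡ N → x ^ N′ ≈ x
    go zero e = ⊥-elim (ℕ.<-irrefl e (ℕ.m^n>0 2 m))
    go (suc n) e = trans (*-congˡ (body e)) (*-identityʳ x)
      where
      body : suc n ≡ N → x ^ n ≈ 1#
      body e = trans (trans (sym (Π.sum-replicate n)) (Π.sum-cong-≋ (λ j → sym (h-≢ (cs (punchIn i₀ j)) (ne j)))))
         (trans (sym (*-identityˡ _)) (trans (*-congʳ (sym (trans (reflexive (≡.cong (h ∘ to) (cs-i₀))) h-0))) (trans (sym (Π.sum-remove {i = i₀} (h ∘ to ∘ cs))) (trans (cast-sum e) Πh))))
        where
        cs : Fin (suc n) → Fin N
        cs = ≡.subst Fin e
        i₀ = ≡.subst Fin (≡.sym e) (from 0#)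
        cs-i₀ : cs i₀ ≡ from 0#
        cs-i₀ = ≡.subst-subst-sym e
        ne : ∀ j → ¬ cs (punchIn i₀ j) ≡ from 0#
        ne j eq = Fin.punchInᵢ≢i i₀ j (≡.trans (≡.sym (≡.subst-sym-subst e)) (≡.cong (≡.subst Fin (≡.sym e)) eq))
        cast-sum : ∀ {a b} (e : a ≡ b) {f : Fin b → Carrier} → Π.sum (f ∘ ≡.subst Fin e) ≈ Π.sum f
        cast-sum ≡.refl = refl

  -- Pigeonhole in the role of Gaussian elimination: N^n arguments have only N^k possible values, so
  -- two of them collide, and their sum, which is also their difference, is a nonzero element of the
  -- kernel.
  kernel : ∀ {n k} → k < n → (φ : (Fin n → Carrier) → Fin k → Carrier) →
    (∀ {x y} → (∀ i → x i ≈ y i) → ∀ j → φ x j ≈ φ y j) → (∀ x y j → φ (λ i → x i + y i) j ≈ φ x j + φ y j) →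
    ∃ λ x → (¬ (∀ i → x i ≈ 0#)) × (∀ j → φ x j ≈ 0#)
  kernel {n} {k} k<n φ φ-cong φ-+ with Fin.pigeonhole (ℕ.^-monoʳ-< N (1<N k<n) k<n) code
    where
    vec : Fin (N ℕ.^ n) → Fin n → Carrier
    vec i j = to (finToFun i j)
    code : Fin (N ℕ.^ n) → Fin (N ℕ.^ k)
    code i = funToFin (λ j → from (φ (vec i) j))
    1<N : k < n → 1 < N
    1<N _ with 1 ℕ.<? N
    ... | yes l = l
    ... | no ¬l = ⊥-elim (F.0≉1 (from-inj (same N (ℕ.≮⇒≥ ¬l) (from 0#) (from 1#))))
      where
      same : ∀ M → M ≤ 1 → (i j : Fin M) → i ≡ j
      same (suc zero) _ Fin.zero Fin.zero = ≡.refl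
      same (suc (suc _)) (s≤s ()) _ _
  ... | i , j , i<j , e = (λ a → to (finToFun i a) + to (finToFun j a)) , nz , λ b → trans (φ-+ _ _ b) (≈⇒sum-0 (from-inj (pt b)))
    where
    vec : Fin (N ℕ.^ n) → Fin n → Carrier
    vec i j = to (finToFun i j)
    pt : ∀ b → from (φ (vec i) b) ≡ from (φ (vec j) b)
    pt b = ≡.trans (≡.sym (Fin.finToFun-funToFin (λ j′ → from (φ (vec i) j′)) b)) (≡.trans (≡.cong (λ z → finToFun z b) e) (Fin.finToFun-funToFin (λ j′ → from (φ (vec j) j′)) b))
    nz : ¬ (∀ a → to (finToFun i a) + to (finToFun j a) ≈ 0#)
    nz h = Fin.<⇒≢ i<j (≡.trans (≡.sym (Fin.funToFin-finToFin {n} i)) (≡.trans (funToFin-cong (λ a → to-inj (sum-0⇒≈ (h a)))) (Fin.funToFin-finToFin {n} j)))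

  module Pl = Poly K
  open Euclid K K-field using (division)

  evalAt : Carrier → Hom Pl.PolyR K
  evalAt a = Pl.Ev.ev-hom (id-hom K) a

  roots-bound : ∀ d p → Pl.Deg< d p → (a : Fin d → Carrier) → (∀ i j → a i ≈ a j → i ≡ j) →
    (∀ i → Hom.⟦_⟧ (evalAt (a i)) p ≈ 0#) → p Pl.P.≈ Pl.P.0#
  roots-bound zero p h a inj z = Pl.mk λ i → h i z≤n
  roots-bound (suc d) p h a inj z = go (division 1 B 1# hB (trans (*-identityʳ _) B1) (suc d) p h)
    where
    a₀ = a Fin.zero
    B = Pl.V Pl.P.+ Pl.C a₀
    hB : Pl.Deg< 2 B
    hB = Pl.Deg<-+ Pl.V (Pl.C a₀) (λ { (suc (suc i)) _ → refl ; (suc zero) (s≤s ()) }) (Pl.Deg<-≤ (Pl.C a₀) (s≤s z≤n) (Pl.Deg<-C a₀))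
    B1 : Pl.coef B 1 ≈ 1#
    B1 = trans (Pl.coef-⊞′ Pl.V (Pl.C a₀) 1) (+-identityʳ 1#)
    evB : ∀ x → Hom.⟦_⟧ (evalAt x) B ≈ x + a₀
    evB x = trans (Hom.⟦⟧-+ (evalAt x) Pl.V (Pl.C a₀)) (+-cong (Pl.Ev.ev-V (id-hom K) x) (Pl.Ev.ev-C (id-hom K) x a₀))
    go : (∃₂ λ s r → p Pl.P.≈ s Pl.P.* B Pl.P.+ r × Pl.Deg< 1 r) → p Pl.P.≈ Pl.P.0#
    go (s , r , e , hr) = Pl.P.trans e (Pl.P.+-0 (Pl.P.*-0ˡ B s≈0) r≈0)
      where
      ev-p : ∀ x → Hom.⟦_⟧ (evalAt x) p ≈ Hom.⟦_⟧ (evalAt x) s * (x + a₀) + Pl.coef r 0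
      ev-p x = trans (Hom.⟦⟧-cong (evalAt x) e) (trans (Hom.⟦⟧-+ (evalAt x) (s Pl.P.* B) r) (+-cong
        (trans (Hom.⟦⟧-* (evalAt x) s B) (*-congˡ (evB x)))
        (trans (Hom.⟦⟧-cong (evalAt x) {r} {Pl.C (Pl.coef r 0)} (Pl.mk λ { zero → refl ; (suc i) → hr (suc i) (s≤s z≤n) })) (Pl.Ev.ev-C (id-hom K) x _))))
      r0 : Pl.coef r 0 ≈ 0#
      r0 = trans (sym (trans (ev-p a₀) (trans (+-congʳ (*-0ʳ _ (self a₀))) (+-identityˡ _)))) (z Fin.zero)
      r≈0 : r Pl.P.≈ Pl.P.0#
      r≈0 = Pl.mk λ { zero → r0 ; (suc i) → hr (suc i) (s≤s z≤n) }
      hs : Pl.Deg< d s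
      hs = Pl.Deg<-factor K-domain {1} d B s (hB , λ e1 → F.0≉1 (trans (sym e1) B1))
        (Pl.Deg<-cong (Pl.P.trans e (Pl.P.trans (Pl.P.+-congˡ r≈0) (Pl.P.trans (Pl.P.+-identityʳ _) (Pl.P.*-comm s B)))) h)
      s≈0 : s Pl.P.≈ Pl.P.0#
      s≈0 = roots-bound d s hs (a ∘ Fin.suc) (λ i j e′ → Fin.suc-injective (inj _ _ e′))
        (λ i → noZeroDiv (trans (*-comm _ _) (trans (sym (trans (ev-p (a (Fin.suc i))) (trans (+-congˡ r0) (+-identityʳ _)))) (z (Fin.suc i))))
          (λ e0 → zero≢suc (inj _ _ (sym (sum-0⇒≈ e0)))))
        where
        zero≢suc : ∀ {n} {i : Fin n} → ¬ Fin.zero ≡ Fin.suc i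
        zero≢suc ()

  vanishing : ∀ p → Pl.Deg< N p → (∀ x → Hom.⟦_⟧ (evalAt x) p ≈ 0#) → p Pl.P.≈ Pl.P.0#
  vanishing p h z = roots-bound N p h to (λ i j → to-inj) (λ i → z (to i))

-- From a point of the curve to a failure of the APN property

module Conjugation {c ℓ} (k : ℕ) (F : FiniteField c ℓ (2 ℕ.^ (2 ℕ.* k))) where
  open FiniteFieldFacts (2 ℕ.* k) F using (N; K; fermat)
  open C2 K

  QQ≡N : 2 ℕ.^ k ℕ.* 2 ℕ.^ k ≡ N
  QQ≡N = ≡.trans (≡.sym (ℕ.^-distribˡ-+-* 2 k k)) (≡.cong (2 ℕ.^_) (≡.cong (k ℕ.+_) (≡.sym (ℕ.+-identityʳ k))))

  conj-conj : ∀ x → (x ^ (2 ℕ.^ k)) ^ (2 ℕ.^ k) ≈ x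
  conj-conj x = trans (^-assocʳ x (2 ℕ.^ k) (2 ℕ.^ k)) (trans (^-congʳ x QQ≡N) (fermat x))

sum<product : ∀ {q Q} → 1 < q → 1 < Q → Q ℕ.+ q < q ℕ.* Q ℕ.+ 1
sum<product {suc (suc a)} {suc (suc b)} _ _ = ℕ.≤-trans (ℕ.m≤m+n _ (a ℕ.* b ℕ.+ b ℕ.+ a)) (ℕ.≤-reflexive
  (solve 2 (λ a b → (con 1 :+ ((con 2 :+ b) :+ (con 2 :+ a))) :+ (a :* b :+ b :+ a) := (con 2 :+ a) :* (con 2 :+ b) :+ con 1) ≡.refl a b))
  where open +-*-Solver
sum<product {suc (suc a)} {suc zero} _ (s≤s ())
sum<product {suc zero} (s≤s ()) _

module APNLemmas {c ℓ} (k r : ℕ) (F : FiniteField c ℓ (2 ℕ.^ (2 ℕ.* k))) where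
  private module F = FiniteField F
  open FiniteFieldFacts (2 ℕ.* k) F public
  open Conjugation k F public using (conj-conj)
  open C2 K
  open Domain K-domain using (*-≉0; ^-≉0; cancel; stable)

  q Q : ℕ
  q = 2 ℕ.^ r
  Q = 2 ℕ.^ k

  pow-0 : ∀ {x} j → x ≈ 0# → 0 < j → F.pow x j ≈ 0#
  pow-0 {x} j x0 0<j = trans (pow≈^ x j) (trans (^-congˡ j x0) (0^ j 0<j))

  -- for c = 0 the function vanishes on {0} × F
  not-APN-0 : 1 ≤ k → ∀ b → ¬ F.APN (F.fbcr k b 0# r)
  not-APN-0 1≤k b apn = distinct (apn (0# , 1#) (λ e → F.0≉1 (sym (proj₂ e))) F.0V (z i₀) (z i₁) (z i₂) (sol i₀) (sol i₁) (sol i₂))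
    where
    2<N : 2 < N
    2<N = ℕ.<-≤-trans (s≤s (s≤s (s≤s z≤n))) (ℕ.^-monoʳ-≤ 2 (ℕ.*-monoʳ-≤ 2 1≤k))
    0<N : 0 < N
    0<N = ℕ.<-trans z<s 2<N
    1<N : 1 < N
    1<N = ℕ.<-trans (s<s z<s) 2<N
    i₀ i₁ i₂ : Fin N
    i₀ = fromℕ< 0<N
    i₁ = fromℕ< 1<N
    i₂ = fromℕ< 2<N
    z : Fin N → F.V
    z i = 0# , to i
    f-0 : ∀ x y → x ≈ 0# → F._≈V_ (F.fbcr k b 0# r (x , y)) F.0V
    f-0 x y x0 = *-0ˡ y x0 , +-0 (+-0 (+-0 (pow-0 (q ℕ.+ 1) x0 (ℕ.≤-trans (s≤s z≤n) (ℕ.m≤n+m 1 q)))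
      (*-0ˡ _ (pow-0 (2 ℕ.^ (r ℕ.+ k)) x0 (ℕ.m^n>0 2 (r ℕ.+ k))))) (*-0ˡ _ (*-0ʳ b x0))) (zeroˡ _)
    sol : ∀ i → F._≈V_ (F._+V_ (F.fbcr k b 0# r (F._+V_ (z i) (0# , 1#))) (F.fbcr k b 0# r (z i))) F.0V
    sol i = +-0 (proj₁ e₁) (proj₁ e₂) , +-0 (proj₂ e₁) (proj₂ e₂)
      where
      e₁ = f-0 (0# + 0#) (to i + 1#) (+-identityˡ 0#)
      e₂ = f-0 0# (to i) refl
    ne : ∀ {a b} (l : a < N) (l′ : b < N) → ¬ a ≡ b → ¬ to (fromℕ< l) ≈ to (fromℕ< l′)
    ne l l′ a≢b e = a≢b (≡.trans (≡.sym (Fin.toℕ-fromℕ< l)) (≡.trans (≡.cong Fin.toℕ (to-inj e)) (Fin.toℕ-fromℕ< l′)))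
    distinct : (F._≈V_ (z i₀) (z i₁)) ⊎ (F._≈V_ (z i₀) (z i₂)) ⊎ (F._≈V_ (z i₁) (z i₂)) → ⊥
    distinct (inj₁ e) = ne 0<N 1<N (λ ()) (proj₂ e)
    distinct (inj₂ (inj₁ e)) = ne 0<N 2<N (λ ()) (proj₂ e)
    distinct (inj₂ (inj₂ e)) = ne 1<N 2<N (λ ()) (proj₂ e)

  ^Q+ : ∀ x y → (x + y) ^ Q ≈ x ^ Q + y ^ Q
  ^Q+ = frob k

  ^q+ : ∀ x y → (x + y) ^ q ≈ x ^ q + y ^ q
  ^q+ = frob r

  module _ (b c : Carrier) where

    P : Carrier → Carrier
    P u = u ^ q * u + (b * u + c)

    f₂ : Carrier → Carrier → Carrier
    f₂ x y = proj₂ (F.fbcr k b c r (x , y))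

    -- At τ·(u,1) every term scales by τ^(q+1), except the one with conjugates, which scales by the
    -- conjugate (τ^(q+1))^Q.
    f-line : ∀ u τ x y → x ≈ τ * u → y ≈ τ → f₂ x y ≈ (τ ^ q * τ) * P u + (τ ^ q * τ) ^ Q * (u ^ q) ^ Q
    f-line u τ x y ex ey = begin
      f₂ x y
        ≈⟨ +-cong (+-cong (+-cong (pw x (q ℕ.+ 1)) (*-cong (pw x (2 ℕ.^ (r ℕ.+ k))) (pw y Q))) (*-congˡ (pw y q))) (*-congˡ (pw y (q ℕ.+ 1))) ⟩
      ((x ^ (q ℕ.+ 1) + x ^ (2 ℕ.^ (r ℕ.+ k)) * y ^ Q) + b * x * y ^ q) + c * y ^ (q ℕ.+ 1)
        ≈⟨ +-cong (+-cong (+-cong (s1 ex) (*-cong (s2 ex) (^-congˡ Q ey))) (*-cong (*-congˡ ex) (^-congˡ q ey))) (*-congˡ (s1′ ey)) ⟩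
      (((τ ^ q * u ^ q) * (τ * u) + ((τ ^ q) ^ Q * (u ^ q) ^ Q) * τ ^ Q) + b * (τ * u) * τ ^ q) + c * (τ ^ q * τ)
        ≈⟨ Ids.alg20 K (τ ^ q) (u ^ q) τ u ((τ ^ q) ^ Q) ((u ^ q) ^ Q) (τ ^ Q) b c ⟩
      (τ ^ q * τ) * P u + ((τ ^ q) ^ Q * τ ^ Q) * (u ^ q) ^ Q ≈⟨ +-congˡ (*-congʳ (^-distrib-* (τ ^ q) τ Q)) ⟨
      (τ ^ q * τ) * P u + (τ ^ q * τ) ^ Q * (u ^ q) ^ Q ∎
      where
      open Relation.Binary.Reasoning.Setoid setoid
      pw = pow≈^
      s1 : ∀ {x} → x ≈ τ * u → x ^ (q ℕ.+ 1) ≈ (τ ^ q * u ^ q) * (τ * u)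
      s1 {x} e = trans (^-homo-* x q 1) (*-cong (trans (^-congˡ q e) (^-distrib-* τ u q)) (trans (^1 x) e))
      s1′ : ∀ {y} → y ≈ τ → y ^ (q ℕ.+ 1) ≈ τ ^ q * τ
      s1′ {y} e = trans (^-homo-* y q 1) (*-cong (^-congˡ q e) (trans (^1 y) e))
      s2 : ∀ {x} → x ≈ τ * u → x ^ (2 ℕ.^ (r ℕ.+ k)) ≈ (τ ^ q) ^ Q * (u ^ q) ^ Q
      s2 {x} e = trans (^-congʳ x (ℕ.^-distribˡ-+-* 2 r k)) (trans (sym (^-assocʳ x q Q)) (trans (^-congˡ Q (trans (^-congˡ q e) (^-distrib-* τ u q))) (^-distrib-* (τ ^ q) (u ^ q) Q)))

    -- In direction (u,1) the difference of the function at τ·(u,1) is (u, Δ·P(u) + Δ^Q·u^(qQ)) with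
    -- Δ = τ^q + τ + 1. For τ = 0 and τ = 1 this has Δ = 1, and the hypothesis on t says that τ = t
    -- gives the same value. Since t^q + t ≠ 0, t is neither 0 nor 1.
    line-not-APN : ∀ u t → ¬ t ^ q + t ≈ 0# → (t ^ q + t) * P u ≈ (t ^ q + t) ^ Q * (u ^ q) ^ Q → ¬ F.APN (F.fbcr k b c r)
    line-not-APN u t T≉0 e apn = [ (λ h → F.0≉1 (proj₂ h)) , [ (λ h → t≉0 (sym (proj₂ h))) , (λ h → t≉1 (sym (proj₂ h))) ]′ ]′
        (apn (u , 1#) (λ h → F.0≉1 (sym (proj₂ h))) (u , P u + (u ^ q) ^ Q) (0# , 0#) (u , 1#) (t * u , t)
          (sol 0# 1# (trans (+-identityˡ u) (sym (*-identityˡ u))) (+-identityˡ 1#) (sym (zeroˡ u)) refl (simp 0# 1# (trans (+-cong one (zeroʳ _)) (+-identityʳ 1#)) (Ids.alg21 K 0#)))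
          (sol 1# 0# (trans (self u) (sym (zeroˡ u))) (self 1#) (sym (*-identityˡ u)) refl (simp 1# 0# (trans (+-cong (zeroʳ _) one) (+-identityˡ 1#)) (Ids.alg22 K 0#)))
          (sol t (t + 1#) (trans (+-congˡ (sym (*-identityˡ u))) (sym (distribʳ u t 1#))) refl refl refl Δt))
      where
      w = (u ^ q) ^ Q
      one : 1# ^ q * 1# ≈ 1#
      one = trans (*-identityʳ _) (1^ q)
      t≉0 : ¬ t ≈ 0#
      t≉0 h = T≉0 (+-0 (trans (^-congˡ q h) (0^ q (ℕ.m^n>0 2 r))) h)
      t≉1 : ¬ t ≈ 1#
      t≉1 h = T≉0 (≈⇒sum-0 (trans (^-congˡ q h) (trans (1^ q) (sym h))))
      Δ : Carrier → Carrier → Carrier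
      Δ τ τ′ = τ′ ^ q * τ′ + τ ^ q * τ
      sol : ∀ τ τ′ {x y x′ y′} → x′ ≈ τ′ * u → y′ ≈ τ′ → x ≈ τ * u → y ≈ τ →
        (Δ τ τ′ * P u + Δ τ τ′ ^ Q * w ≈ P u + w) × (τ′ * τ′ + τ * τ ≈ 1#) →
        F._≈V_ (F._+V_ (F.fbcr k b c r (x′ , y′)) (F.fbcr k b c r (x , y))) (u , P u + w)
      sol τ τ′ {x} {y} {x′} {y′} ex′ ey′ ex ey (h , h1) =
        trans (+-cong (*-cong ex′ ey′) (*-cong ex ey)) (trans (Ids.alg23 K τ′ τ u) (trans (*-congʳ h1) (*-identityˡ u))) ,
        trans (+-cong (f-line u τ′ x′ y′ ex′ ey′) (f-line u τ x y ex ey))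
          (trans (Ids.alg24 K _ _ (P u) _ _ w)
          (trans (+-congˡ (*-congʳ (sym (^Q+ _ _)))) h))
      simp : ∀ {δ : Set ℓ} τ τ′ → Δ τ τ′ ≈ 1# → δ → (Δ τ τ′ * P u + Δ τ τ′ ^ Q * w ≈ P u + w) × δ
      simp τ τ′ h d = +-cong (trans (*-congʳ h) (*-identityˡ _)) (trans (*-congʳ (trans (^-congˡ Q h) (1^ Q))) (*-identityˡ w)) , d
      Δt : (Δ t (t + 1#) * P u + Δ t (t + 1#) ^ Q * w ≈ P u + w) × ((t + 1#) * (t + 1#) + t * t ≈ 1#)
      Δt = trans (+-cong (*-congʳ eqΔ) (*-congʳ (trans (^-congˡ Q eqΔ) (trans (^Q+ _ _) (+-congˡ (1^ Q))))))
             (trans (Ids.alg25 K (t ^ q + t) (P u) ((t ^ q + t) ^ Q) w)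
               (trans (+-congʳ (≈⇒sum-0 e)) (+-identityˡ _))) ,
           Ids.alg26 K t
        where
        eqΔ : Δ t (t + 1#) ≈ (t ^ q + t) + 1#
        eqΔ = trans (+-congʳ (*-congʳ (trans (^q+ t 1#) (+-congˡ (1^ q))))) (Ids.alg27 K (t ^ q) t)

  -- solving s^(q-1) = ρ, using that q - 1 is prime to N - 1
  module _ (coprime : gcd r (2 ℕ.* k) ≡ 1) where

    iterate-fermat : ∀ x j → x ^ (2 ℕ.^ (j ℕ.* (2 ℕ.* k))) ≈ x
    iterate-fermat x zero = ^1 x
    iterate-fermat x (suc j) = trans (^-congʳ x (ℕ.^-distribˡ-+-* 2 (2 ℕ.* k) (j ℕ.* (2 ℕ.* k))))
      (trans (sym (^-assocʳ x N (2 ℕ.^ (j ℕ.* (2 ℕ.* k))))) (trans (^-congˡ (2 ℕ.^ (j ℕ.* (2 ℕ.* k))) (fermat x)) (iterate-fermat x j)))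

    module _ (ρ : Carrier) (ρ≉0 : ¬ ρ ≈ 0#) (ρQ : ρ ^ Q ≈ ρ) where
      -- The power of ρ with exponent 1 + q + ... + q^(i-1), so that its (q - 1)-st power is ρ^(q^i
      -- - 1).
      σ : ℕ → Carrier
      σ zero = 1#
      σ (suc i) = ρ * σ i ^ q

      σ≉0 : ∀ i → ¬ σ i ≈ 0#
      σ≉0 zero e = F.0≉1 (sym e)
      σ≉0 (suc i) = *-≉0 ρ≉0 (^-≉0 q (σ≉0 i))

      σQ : ∀ i → σ i ^ Q ≈ σ i
      σQ zero = 1^ Q
      σQ (suc i) = trans (^-distrib-* ρ (σ i ^ q) Q) (*-cong ρQ (trans (^-swap (σ i) q Q) (^-congˡ q (σQ i))))

      σ-power : ∀ i → σ i ^ q * ρ ≈ σ i * ρ ^ (2 ℕ.^ (i ℕ.* r))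
      σ-power zero = *-cong (1^ q) (sym (^1 ρ))
      σ-power (suc i) = begin
        (ρ * σ i ^ q) ^ q * ρ ≈⟨ *-congʳ (trans (^-congˡ q (*-comm _ _)) (^-congˡ q (σ-power i))) ⟩
        (σ i * ρ ^ (2 ℕ.^ (i ℕ.* r))) ^ q * ρ ≈⟨ *-congʳ (^-distrib-* (σ i) (ρ ^ (2 ℕ.^ (i ℕ.* r))) q) ⟩
        (σ i ^ q * (ρ ^ (2 ℕ.^ (i ℕ.* r))) ^ q) * ρ ≈⟨ Ids.alg28 K _ _ _ ⟩
        ρ * σ i ^ q * (ρ ^ (2 ℕ.^ (i ℕ.* r))) ^ q ≈⟨ *-congˡ (trans (^-assocʳ ρ (2 ℕ.^ (i ℕ.* r)) q) (^-congʳ ρ (≡.trans (ℕ.*-comm (2 ℕ.^ (i ℕ.* r)) q) (≡.sym (ℕ.^-distribˡ-+-* 2 r (i ℕ.* r)))))) ⟩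
        ρ * σ i ^ q * ρ ^ (2 ℕ.^ (r ℕ.+ i ℕ.* r)) ∎
        where open Relation.Binary.Reasoning.Setoid setoid

      power-root : ∃ λ s → s ^ q ≈ ρ * s × s ^ Q ≈ s × ¬ s ≈ 0#
      power-root with Bézout.identity (≡.subst (λ d → GCD′ d) coprime (gcd-GCD r (2 ℕ.* k)))
        where
        open import Data.Nat.GCD using (GCD)
        GCD′ = GCD r (2 ℕ.* k)
      -- Here i·r = 1 + j·2k, so ρ^(q^i) = ρ² and `σ i` itself has (q - 1)-st power ρ.
      ... | Bézout.+- i j eq = σ i , cancel ρ≉0 (trans (*-comm _ _) (trans (σ-power i) (trans (*-congˡ sq) (Ids.alg29 K (σ i) ρ)))) , σQ i , σ≉0 i
        where
        sq : ρ ^ (2 ℕ.^ (i ℕ.* r)) ≈ ρ * ρ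
        sq = trans (^-congʳ ρ (≡.trans (≡.cong (2 ℕ.^_) (≡.sym eq)) (ℕ.*-comm 2 (2 ℕ.^ (j ℕ.* (2 ℕ.* k))))))
          (trans (sym (^-assocʳ ρ (2 ℕ.^ (j ℕ.* (2 ℕ.* k))) 2)) (trans (*-congˡ (^1 _)) (*-cong (iterate-fermat ρ j) (iterate-fermat ρ j))))
      -- Here 1 + i·r = j·2k, so ρ^(q^i) is the square root `μ` of ρ, and `σ i` has (q - 1)-st power
      -- 1/`μ`. The square of its inverse is the required root.
      ... | Bézout.-+ i j eq = y * y , trans (^-distrib-* y y q) (trans (*-cong yq yq) (trans (Ids.alg30 K y μ) (*-congʳ μμ))) ,
           trans (^-distrib-* y y Q) (*-cong yQ yQ) , *-≉0 y≉0 y≉0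
        where
        μ = ρ ^ (2 ℕ.^ (i ℕ.* r))
        y = proj₁ (F.inverse (σ i) (σ≉0 i))
        sy : σ i * y ≈ 1#
        sy = proj₂ (F.inverse (σ i) (σ≉0 i))
        μ≉0 : ¬ μ ≈ 0#
        μ≉0 = ^-≉0 (2 ℕ.^ (i ℕ.* r)) ρ≉0
        y≉0 : ¬ y ≈ 0#
        y≉0 e = F.0≉1 (trans (sym (*-0ʳ _ e)) sy)
        μμ : μ * μ ≈ ρ
        μμ = trans (*-congˡ (sym (^1 μ))) (trans (^-assocʳ ρ (2 ℕ.^ (i ℕ.* r)) 2) (trans (^-congʳ ρ (≡.trans (ℕ.*-comm (2 ℕ.^ (i ℕ.* r)) 2) (≡.cong (2 ℕ.^_) eq))) (iterate-fermat ρ j)))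
        σμ : σ i ^ q * μ ≈ σ i
        σμ = cancel μ≉0 (trans (trans (Ids.alg31 K _ μ) (*-congˡ μμ)) (trans (σ-power i) (*-comm _ _)))
        inv-pow : ∀ e → y ^ e * σ i ^ e ≈ 1#
        inv-pow e = trans (sym (^-distrib-* y (σ i) e)) (trans (^-congˡ e (trans (*-comm _ _) sy)) (1^ e))
        yq : y ^ q ≈ y * μ
        yq = trans (sym (*-identityʳ _)) (trans (*-congˡ (sym sy)) (trans (*-congˡ (*-congʳ (sym σμ)))
          (trans (Ids.alg32 K (y ^ q) (σ i ^ q) μ y) (trans (*-congʳ (inv-pow q)) (*-identityˡ _)))))
        yQ : y ^ Q ≈ y
        yQ = trans (sym (*-identityʳ _)) (trans (*-congˡ (sym sy)) (trans (*-congˡ (*-congʳ (sym (σQ i))))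
          (trans (sym (*-assoc _ _ _)) (trans (*-congʳ (inv-pow Q)) (*-identityˡ y)))))

    -- Twisted traces of τ and τ^q: for α of norm one both are fixed by x ↦ α·x^Q, so their quotient
    -- lies in the subfield of elements with x^Q = x.
    A B : Carrier → Carrier → Carrier
    A α τ = α * τ ^ Q + τ
    B α τ = α * (τ ^ q) ^ Q + τ ^ q

    -- Up to a nonzero factor this is `B` times the element T = t^q + t constructed in `third`, so
    -- it detects whether T is nonzero.
    E : Carrier → Carrier
    E τ = (τ ^ q) ^ Q * τ + τ ^ Q * τ ^ q

    -- a point of the curve gives a third solution on a line
    module _ (α : Carrier) (αα : α * α ^ Q ≈ 1#) (τ : Carrier) where
      private
        A′ B′ E′ : Carrier
        A′ = A α τ
        B′ = B α τ
        E′ = E τ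

      twist : ∀ x → α * (α * x ^ Q + x) ^ Q ≈ α * x ^ Q + x
      twist x = trans (*-congˡ (trans (^Q+ _ _) (+-congʳ (trans (^-distrib-* α (x ^ Q) Q) (*-congˡ (conj-conj x))))))
        (trans (Ids.alg33 K α (α ^ Q) x (x ^ Q)) (+-congˡ (trans (*-congʳ αα) (*-identityˡ x))))

      -- Put ρ = A/B and choose s in the subfield with s^q = ρ·s. For t = s·τ one finds T + α·T^Q =
      -- s·(ρ·B + A) = 0. The point of s is to absorb the quotient A/B without disturbing
      -- conjugation.
      third : ¬ A′ ≈ 0# → ¬ B′ ≈ 0# → ¬ E′ ≈ 0# → ∃ λ t → ¬ t ^ q + t ≈ 0# × t ^ q + t ≈ α * (t ^ q + t) ^ Q
      third A≉0 B≉0 E≉0 = scale (A′ * proj₁ B⁻¹) (trans (*-assoc _ _ _) (trans (*-congˡ (trans (*-comm _ _) (proj₂ B⁻¹))) (*-identityʳ A′)))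
        where
        Third : Set _
        Third = ∃ λ t → ¬ t ^ q + t ≈ 0# × t ^ q + t ≈ α * (t ^ q + t) ^ Q
        B⁻¹ : ∃ λ y → B′ * y ≈ 1#
        B⁻¹ = F.inverse B′ B≉0
        scale : ∀ ρ → ρ * B′ ≈ A′ → Third
        scale ρ ρB = from-root (power-root ρ (λ e → A≉0 (trans (sym ρB) (*-0ˡ B′ e))) ρQ)
          where
          ρQ : ρ ^ Q ≈ ρ
          ρQ = cancel B≉0 (trans (*-comm _ _) (trans (*-congˡ (sym (twist (τ ^ q)))) (trans (Ids.swap-id₂ K (ρ ^ Q) α (B′ ^ Q))
            (trans (*-congˡ (trans (sym (^-distrib-* ρ B′ Q)) (^-congˡ Q ρB))) (trans (twist τ) (trans (sym ρB) (*-comm ρ B′)))))))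
          from-root : (∃ λ s → s ^ q ≈ ρ * s × s ^ Q ≈ s × ¬ s ≈ 0#) → Third
          from-root (s , sq , sQ , s≉0) = s * τ , T≉0 , T≈
            where
            T : Carrier
            T = (s * τ) ^ q + s * τ
            T1 : T ≈ s * (ρ * τ ^ q + τ)
            T1 = trans (+-congʳ (trans (^-distrib-* s τ q) (*-congʳ sq))) (Ids.alg34 K ρ s (τ ^ q) τ)
            TQ : T ^ Q ≈ s * (ρ * (τ ^ q) ^ Q + τ ^ Q)
            TQ = trans (^-congˡ Q T1) (trans (^-distrib-* s _ Q) (*-cong sQ (trans (^Q+ _ _) (+-congʳ (trans (^-distrib-* ρ _ Q) (*-congʳ ρQ))))))
            T≈ : T ≈ α * T ^ Q
            T≈ = trans T1 (sym (trans (*-congˡ TQ) (trans (Ids.alg35 K α s ρ ((τ ^ q) ^ Q) (τ ^ Q) (τ ^ q))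
              (*-congˡ (trans (+-congʳ ρB) (Ids.alg36 K (α * τ ^ Q) (ρ * τ ^ q) τ))))))
            BT : B′ * T ≈ s * α * E′
            BT = trans (*-congˡ T1) (trans (Ids.alg37 K B′ s ρ (τ ^ q) τ)
              (trans (*-congˡ (+-congʳ (*-congʳ ρB))) (Ids.alg38 K s α (τ ^ Q) τ ((τ ^ q) ^ Q) (τ ^ q))))
            T≉0 : ¬ T ≈ 0#
            T≉0 e = *-≉0 (*-≉0 s≉0 (λ a0 → F.0≉1 (trans (sym (*-0ˡ _ a0)) αα))) E≉0 (trans (sym BT) (*-0ʳ B′ e))

    module _ (q-pos : 1 ≤ r) (small : 2 ℕ.* q ℕ.+ 2 ≤ Q) where
      1<q : 1 < q
      1<q = ℕ.<-≤-trans (s≤s (s≤s z≤n)) (ℕ.^-monoʳ-≤ 2 q-pos)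

      1<Q : 1 < Q
      1<Q = ℕ.<-≤-trans (s≤s (s≤s z≤n)) (ℕ.≤-trans (ℕ.m≤n+m 2 (2 ℕ.* q)) small)

      HasDeg-+ : ∀ {d} p p′ → Pl.HasDeg d p → Pl.Deg< d p′ → Pl.HasDeg d (p Pl.P.+ p′)
      HasDeg-+ {d} p p′ h h′ = Pl.Deg<-+ p p′ (proj₁ h) (Pl.Deg<-≤ p′ (ℕ.n≤1+n d) h′) ,
        λ e → proj₂ h (trans (sym (trans (Pl.coef-⊞′ p p′ d) (trans (+-congˡ (h′ d ℕ.≤-refl)) (+-identityʳ _)))) e)

      HasDeg-C*V^ : ∀ a d → ¬ a ≈ 0# → Pl.HasDeg d (Pl.C a Pl.P.* Pl.V Pl.P.^ d)
      HasDeg-C*V^ a d na = (λ i l → trans (Pl.coef-C⊠ a _ i) (*-0ʳ a (Pl.Deg<-V^ d i l))) ,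
        λ e → na (trans (sym (trans (Pl.coef-C⊠ a _ d) (trans (*-congˡ (Pl.coef-V^-top d)) (*-identityʳ a)))) e)

      module _ (α : Carrier) (α≉0 : ¬ α ≈ 0#) where
        p₁ p₂ p₃ : Pl.Pl
        p₁ = Pl.C α Pl.P.* Pl.V Pl.P.^ Q Pl.P.+ Pl.V Pl.P.^ 1
        p₂ = Pl.C α Pl.P.* Pl.V Pl.P.^ (q ℕ.* Q) Pl.P.+ Pl.V Pl.P.^ q
        p₃ = Pl.C 1# Pl.P.* Pl.V Pl.P.^ (q ℕ.* Q ℕ.+ 1) Pl.P.+ Pl.V Pl.P.^ (Q ℕ.+ q)

        q<qQ : q < q ℕ.* Q
        q<qQ = ℕ.<-≤-trans (ℕ.m<m*n q 2 (s≤s (s≤s z≤n))) (ℕ.*-monoʳ-≤ q 1<Q)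
          where instance _ = ℕ.>-nonZero (ℕ.m^n>0 2 r)

        Q+q< : Q ℕ.+ q < q ℕ.* Q ℕ.+ 1
        Q+q< = sum<product 1<q 1<Q

        degree : suc ((Q ℕ.+ q ℕ.* Q) ℕ.+ (q ℕ.* Q ℕ.+ 1)) ≤ N
        degree = begin
          suc ((Q ℕ.+ q ℕ.* Q) ℕ.+ (q ℕ.* Q ℕ.+ 1)) ≡⟨ solve′ q Q ⟩
          (2 ℕ.* q ℕ.+ 1) ℕ.* Q ℕ.+ 2 ≤⟨ ℕ.+-monoʳ-≤ ((2 ℕ.* q ℕ.+ 1) ℕ.* Q) 1<Q ⟩
          (2 ℕ.* q ℕ.+ 1) ℕ.* Q ℕ.+ Q ≡⟨ ℕ.+-comm _ Q ⟩
          suc (2 ℕ.* q ℕ.+ 1) ℕ.* Q ≤⟨ ℕ.*-monoˡ-≤ Q (ℕ.≤-trans (ℕ.≤-reflexive (≡.sym (ℕ.+-suc (2 ℕ.* q) 1))) small) ⟩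
          Q ℕ.* Q ≡⟨ ℕ.^-distribˡ-+-* 2 k k ⟨
          2 ℕ.^ (k ℕ.+ k) ≡⟨ ≡.cong (λ j → 2 ℕ.^ (k ℕ.+ j)) (ℕ.+-identityʳ k) ⟨
          N ∎
          where
          open ℕ.≤-Reasoning
          solve′ : ∀ q Q → suc ((Q ℕ.+ q ℕ.* Q) ℕ.+ (q ℕ.* Q ℕ.+ 1)) ≡ (2 ℕ.* q ℕ.+ 1) ℕ.* Q ℕ.+ 2
          solve′ = S.solve 2 (λ q Q → S.con 1 S.:+ ((Q S.:+ q S.:* Q) S.:+ (q S.:* Q S.:+ S.con 1)) S.:= (S.con 2 S.:* q S.:+ S.con 1) S.:* Q S.:+ S.con 2) ≡.refl
            where module S = +-*-Solver

        -- As a polynomial in τ the product has degree Q + q·Q + (q·Q + 1), which is below N = Q²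
        -- because 2q + 2 ≤ Q. It therefore does not vanish on the whole field.
        avoid : ¬ (∀ τ → A α τ * B α τ * E τ ≈ 0#)
        avoid h = proj₂ hp (Pl.at (vanishing p (Pl.Deg<-≤ p degree (proj₁ hp)) (λ τ → trans (ev-p τ) (h τ))) _)
          where
          p = p₁ Pl.P.* p₂ Pl.P.* p₃
          hp : Pl.HasDeg ((Q ℕ.+ q ℕ.* Q) ℕ.+ (q ℕ.* Q ℕ.+ 1)) p
          hp = Pl.HasDeg-* K-domain (p₁ Pl.P.* p₂) p₃ (Pl.HasDeg-* K-domain p₁ p₂
                 (HasDeg-+ _ (Pl.V Pl.P.^ 1) (HasDeg-C*V^ α Q α≉0) (Pl.Deg<-≤ (Pl.V Pl.P.^ 1) 1<Q (Pl.Deg<-V^ 1)))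
                 (HasDeg-+ _ (Pl.V Pl.P.^ q) (HasDeg-C*V^ α (q ℕ.* Q) α≉0) (Pl.Deg<-≤ (Pl.V Pl.P.^ q) q<qQ (Pl.Deg<-V^ q))))
                 (HasDeg-+ _ (Pl.V Pl.P.^ (Q ℕ.+ q)) (HasDeg-C*V^ 1# (q ℕ.* Q ℕ.+ 1) (λ e → F.0≉1 (sym e))) (Pl.Deg<-≤ (Pl.V Pl.P.^ (Q ℕ.+ q)) Q+q< (Pl.Deg<-V^ (Q ℕ.+ q))))
          ev-mono : ∀ τ a d d′ → Hom.⟦_⟧ (evalAt τ) (Pl.C a Pl.P.* Pl.V Pl.P.^ d Pl.P.+ Pl.V Pl.P.^ d′) ≈ a * τ ^ d + τ ^ d′
          ev-mono τ a d d′ = trans (E.⟦⟧-+ (Pl.C a Pl.P.* Pl.V Pl.P.^ d) (Pl.V Pl.P.^ d′)) (+-cong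
              (trans (E.⟦⟧-* (Pl.C a) (Pl.V Pl.P.^ d)) (*-cong (Pl.Ev.ev-C (id-hom K) τ a) (vp d))) (vp d′))
            where
            module E = Hom (evalAt τ)
            vp : ∀ d → E.⟦_⟧ (Pl.V Pl.P.^ d) ≈ τ ^ d
            vp d = trans (E.⟦⟧-^ Pl.V d) (^-congˡ d (Pl.Ev.ev-V (id-hom K) τ))
          ev-p : ∀ τ → Hom.⟦_⟧ (evalAt τ) p ≈ A α τ * B α τ * E τ
          ev-p τ = trans (Hom.⟦⟧-* (evalAt τ) (p₁ Pl.P.* p₂) p₃) (*-cong (trans (Hom.⟦⟧-* (evalAt τ) p₁ p₂) (*-cong
            (trans (ev-mono τ α Q 1) (+-congˡ (^1 τ)))
            (trans (ev-mono τ α (q ℕ.* Q) q) (+-congʳ (*-congˡ (sym (^-assocʳ τ q Q)))))))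
            (trans (ev-mono τ 1# (q ℕ.* Q ℕ.+ 1) (Q ℕ.+ q)) (+-cong (trans (*-identityˡ _) (trans (^-homo-* τ (q ℕ.* Q) 1) (*-cong (sym (^-assocʳ τ q Q)) (^1 τ)))) (^-homo-* τ Q q))))

      twisted-root : ∀ α → α * α ^ Q ≈ 1# → ¬ ¬ (∃ λ t → ¬ t ^ q + t ≈ 0# × t ^ q + t ≈ α * (t ^ q + t) ^ Q)
      twisted-root α αα none = avoid α (λ z → F.0≉1 (trans (sym (*-0ˡ (α ^ Q) z)) αα)) λ τ → stable λ n → none
        (third α αα τ (λ z → n (*-0ˡ (E τ) (*-0ˡ (B α τ) z))) (λ z → n (*-0ˡ (E τ) (*-0ʳ (A α τ) z))) (λ z → n (*-0ʳ (A α τ * B α τ) z)))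

      -- For α = u^(qQ)/P(u) the curve equation says that α has norm one, and T = α·T^Q is then the
      -- condition that `line-not-APN` asks for. If P(u) were zero, the equation would force u = 0,
      -- but P(0) = c.
      point-not-APN : ∀ b c → ¬ c ≈ 0# → ∀ u → P b c u * P b c u ^ Q + u ^ q * (u ^ q) ^ Q ≈ 0# → ¬ F.APN (F.fbcr k b c r)
      point-not-APN b c c≉0 u e apn = finish (w * proj₁ Pu⁻¹) (trans (*-assoc _ _ _) (trans (*-congˡ (trans (*-comm _ _) (proj₂ Pu⁻¹))) (*-identityʳ w)))
        where
        Pu w : Carrier
        Pu = P b c u
        w = (u ^ q) ^ Q
        e′ : Pu * Pu ^ Q ≈ u ^ q * w
        e′ = sum-0⇒≈ e
        Pu≉0 : ¬ Pu ≈ 0#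
        Pu≉0 z = c≉0 (trans (sym (+-identityˡ c)) (trans (+-congʳ (sym (*-0ʳ b u≈0))) (trans (sym (+-identityˡ _)) (trans (+-congʳ (sym (*-0ʳ (u ^ q) u≈0))) z))))
          where
          uq≈0 : u ^ q ≈ 0#
          uq≈0 = stable λ nu → *-≉0 nu (^-≉0 Q nu) (trans (sym e′) (*-0ˡ _ z))
          u≈0 : u ≈ 0#
          u≈0 = Domain.^-≈0 K-domain q uq≈0
        Pu⁻¹ : ∃ λ y → Pu * y ≈ 1#
        Pu⁻¹ = F.inverse Pu Pu≉0
        finish : ∀ α → α * Pu ≈ w → ⊥
        finish α αP = twisted-root α αα λ { (t , T≉0 , T≈) → line-not-APN b c u t T≉0 (trans (*-congʳ T≈)
            (trans (Ids.swap-id K α ((t ^ q + t) ^ Q) Pu) (*-congˡ αP))) apn }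
          where
          αα : α * α ^ Q ≈ 1#
          αα = cancel (*-≉0 Pu≉0 (^-≉0 Q Pu≉0)) (trans (Ids.alg39 K Pu (Pu ^ Q) α (α ^ Q))
            (trans (*-cong αP (trans (sym (^-distrib-* α Pu Q)) (trans (^-congˡ Q αP) (conj-conj (u ^ q))))) (trans (*-comm w _) (trans (sym e′) (sym (*-identityʳ _))))))

-- Division by powers of x on the conjugate curve

-- Multiplication by p₀/x^q on the lattice ⊕_{i≤q} K[y]·x^i of functions on the curve
-- p₀(y)·(x^(q+1) + b₂·x + c₂) + x^q·y^q = 0.
record LatticeData (κ ℓ : Level) : Set (lsuc (κ ⊔ ℓ)) where
  field
    K : CR2 κ ℓ
    q₂ ε : ℕ
    b₂ c₂ c₂i b̄ c̄ : CR2.Carrier K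
    c₂-inv : CR2._≈_ K (CR2._*_ K c₂ c₂i) (CR2.1# K)
    p₀ : List (CR2.Carrier K)

module Lattice {c ℓ} (ℒ : LatticeData c ℓ) where
  open LatticeData ℒ
  open C2 K
  open Poly K

  q n : ℕ
  q = suc (suc q₂)
  n = suc q

  Λ : Set c
  Λ = ℕ → Pl

  infix 4 _≐_
  _≐_ : Λ → Λ → Set ℓ
  l ≐ l′ = ∀ i → l i P.≈ l′ i

  infixl 6 _∔_
  _∔_ : Λ → Λ → Λ
  (l ∔ l′) i = l i P.+ l′ i

  κ : Λ → Λ
  κ l zero = C c₂i P.* l zero
  κ l (suc i) = C c₂i P.* (l (suc i) P.+ C b₂ P.* κ l i)

  G₁ G₂ G : Λ → Λ
  G₁ l zero = p₀ P.* (l q P.+ C b₂ P.* κ l (suc q₂))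
  G₁ l (suc m) = p₀ P.* κ l m
  G₂ l m with m ℕ.<? q
  ... | yes _ = V P.^ q P.* κ l m
  ... | no _ = P.0#
  G l m = G₁ l m P.+ G₂ l m

  κ-cong : ∀ {l l′} → l ≐ l′ → κ l ≐ κ l′
  κ-cong h zero = P.*-congˡ (h 0)
  κ-cong h (suc i) = P.*-congˡ (P.+-cong (h (suc i)) (P.*-congˡ (κ-cong h i)))

  κ-+ : ∀ l l′ → κ (l ∔ l′) ≐ κ l ∔ κ l′
  κ-+ l l′ zero = P.distribˡ _ _ _
  κ-+ l l′ (suc i) = P.trans (P.*-congˡ (P.+-congˡ (P.*-congˡ (κ-+ l l′ i)))) (Ids.κ-id PolyR (C c₂i) (l (suc i)) (l′ (suc i)) (C b₂) (κ l i) (κ l′ i))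

  G-cong : ∀ {l l′} → l ≐ l′ → G l ≐ G l′
  G-cong {l} {l′} h m = P.+-cong (g₁ m) (g₂ m)
    where
    g₁ : G₁ l ≐ G₁ l′
    g₁ zero = P.*-congˡ (P.+-cong (h q) (P.*-congˡ (κ-cong h (suc q₂))))
    g₁ (suc m) = P.*-congˡ (κ-cong h m)
    g₂ : G₂ l ≐ G₂ l′
    g₂ m with m ℕ.<? q
    ... | yes _ = P.*-congˡ (κ-cong h m)
    ... | no _ = P.refl

  G-+ : ∀ l l′ → G (l ∔ l′) ≐ G l ∔ G l′
  G-+ l l′ m = P.trans (P.+-cong (g₁ m) (g₂ m)) (Ids.interchange PolyR (G₁ l m) (G₁ l′ m) (G₂ l m) (G₂ l′ m))
    where
    g₁ : G₁ (l ∔ l′) ≐ G₁ l ∔ G₁ l′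
    g₁ zero = P.trans (P.*-congˡ (P.+-congˡ (P.*-congˡ (κ-+ l l′ (suc q₂))))) (Ids.κ-id PolyR p₀ (l q) (l′ q) (C b₂) (κ l (suc q₂)) (κ l′ (suc q₂)))
    g₁ (suc m) = P.trans (P.*-congˡ (κ-+ l l′ m)) (P.distribˡ _ _ _)
    g₂ : G₂ (l ∔ l′) ≐ G₂ l ∔ G₂ l′
    g₂ m with m ℕ.<? q
    ... | yes _ = P.trans (P.*-congˡ (κ-+ l l′ m)) (P.distribˡ _ _ _)
    ... | no _ = P.sym (P.+-identityˡ P.0#)

  Degs : ℕ → Λ → Set ℓ
  Degs d l = ∀ i → Deg< d (l i)

  private
    Deg-C* : ∀ {d} x p → Deg< d p → Deg< d (C x P.* p)
    Deg-C* x p h i le = trans (coef-C⊠ x p i) (*-0ʳ x (h i le))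

  κ-deg : ∀ {d l} → Degs d l → Degs d (κ l)
  κ-deg {l = l} h zero = Deg-C* c₂i (l 0) (h 0)
  κ-deg {l = l} h (suc i) = Deg-C* c₂i (l (suc i) P.+ C b₂ P.* κ l i) (Deg<-+ (l (suc i)) (C b₂ P.* κ l i) (h (suc i)) (Deg-C* b₂ (κ l i) (κ-deg h i)))

  G-deg : Deg< (suc n) p₀ → ∀ {d l} → Degs d l → Degs (n ℕ.+ d) (G l)
  G-deg hp {d} {l} h m = Deg<-+ (G₁ l m) (G₂ l m) (d₁ m) (d₂ m)
    where
    d₁ : Degs (n ℕ.+ d) (G₁ l)
    d₁ zero = Deg<-* p₀ (l q P.+ C b₂ P.* κ l (suc q₂)) hp (Deg<-+ (l q) (C b₂ P.* κ l (suc q₂)) (h q) (Deg-C* b₂ (κ l (suc q₂)) (κ-deg h (suc q₂))))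
    d₁ (suc m) = Deg<-* p₀ (κ l m) hp (κ-deg h m)
    d₂ : Degs (n ℕ.+ d) (G₂ l)
    d₂ m with m ℕ.<? q
    ... | yes _ = Deg<-≤ (V P.^ q P.* κ l m) (ℕ.n≤1+n _) (Deg<-* (V P.^ q) (κ l m) (Deg<-V^ q) (κ-deg h m))
    ... | no _ = λ _ _ → refl

  iter : ℕ → Λ → Λ
  iter zero l = l
  iter (suc j) l = G (iter j l)

  iter-cong : ∀ j {l l′} → l ≐ l′ → iter j l ≐ iter j l′
  iter-cong zero h = h
  iter-cong (suc j) h = G-cong (iter-cong j h)

  iter-+ : ∀ j l l′ → iter j (l ∔ l′) ≐ iter j l ∔ iter j l′
  iter-+ zero l l′ i = P.refl
  iter-+ (suc j) l l′ i = P.trans (G-cong (iter-+ j l l′) i) (G-+ (iter j l) (iter j l′) i)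

  iter-iter : ∀ i j l → iter (i ℕ.+ j) l ≡ iter i (iter j l)
  iter-iter zero j l = ≡.refl
  iter-iter (suc i) j l = ≡.cong G (iter-iter i j l)

  iter-deg : Deg< (suc n) p₀ → ∀ j {d l} → Degs d l → Degs (j ℕ.* n ℕ.+ d) (iter j l)
  iter-deg hp zero h = h
  iter-deg hp (suc j) {d} {l} h i = Deg<-≤ (iter (suc j) l i) (ℕ.≤-reflexive (≡.sym (ℕ.+-assoc n (j ℕ.* n) d))) (G-deg hp (iter-deg hp j h) i)

  -- g i = p₀^R·x^(-R·i)·C for R = ε·q
  g : ℕ → Λ → Λ
  g i l m = p₀ P.^ (ε ℕ.* (q ℕ.∸ i)) P.* iter (ε ℕ.* i) l m

  -- Coefficients, times the function l, of the quotient of p₀^R·(X^n + b̄·X + c̄) + u^q·X^q by X -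
  -- z with z = x^R. Those below X^q are found from the constant term upwards, where each division
  -- by z turns `g i` into `g (suc i)`; the top one is p₀^R.
  N : ℕ → Λ → Λ
  N zero l m = C c̄ P.* g 1 l m
  N (suc j) l m with suc j ℕ.<? q
  ... | yes _ = C b̄ P.* g (suc j) l m P.+ C c̄ P.* g (suc (suc j)) l m
  ... | no _ = g 0 l m

  N-top : ∀ l → N q l ≐ g 0 l
  N-top l m with q ℕ.<? q
  ... | yes q<q = ⊥-elim (ℕ.<-irrefl ≡.refl q<q)
  ... | no _ = P.refl

  g-cong : ∀ i {l l′} → l ≐ l′ → g i l ≐ g i l′
  g-cong i h m = P.*-congˡ (iter-cong (ε ℕ.* i) h m)

  g-+ : ∀ i l l′ → g i (l ∔ l′) ≐ g i l ∔ g i l′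
  g-+ i l l′ m = P.trans (P.*-congˡ (iter-+ (ε ℕ.* i) l l′ m)) (P.distribˡ _ _ _)

  N-cong : ∀ j {l l′} → l ≐ l′ → N j l ≐ N j l′
  N-cong zero h m = P.*-congˡ (g-cong 1 h m)
  N-cong (suc j) h m with suc j ℕ.<? q
  ... | yes _ = P.+-cong (P.*-congˡ (g-cong (suc j) h m)) (P.*-congˡ (g-cong (suc (suc j)) h m))
  ... | no _ = g-cong 0 h m

  N-+ : ∀ j l l′ → N j (l ∔ l′) ≐ N j l ∔ N j l′
  N-+ zero l l′ m = P.trans (P.*-congˡ (g-+ 1 l l′ m)) (P.distribˡ _ _ _)
  N-+ (suc j) l l′ m with suc j ℕ.<? q
  ... | yes _ = P.trans (P.+-cong (P.*-congˡ (g-+ (suc j) l l′ m)) (P.*-congˡ (g-+ (suc (suc j)) l l′ m)))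
                 (Ids.N-id PolyR (C b̄) (g (suc j) l m) (g (suc j) l′ m) (C c̄) (g (suc (suc j)) l m) (g (suc (suc j)) l′ m))
  ... | no _ = g-+ 0 l l′ m

  g-deg : Deg< (suc n) p₀ → ∀ i → i ≤ q → ∀ {d l} → Degs d l → Degs (ε ℕ.* q ℕ.* n ℕ.+ d) (g i l)
  g-deg hp i i≤q {d} {l} h m = Deg<-≤ (g i l m) (ℕ.≤-reflexive eq)
      (Deg<-* (p₀ P.^ (ε ℕ.* (q ℕ.∸ i))) (iter (ε ℕ.* i) l m) (Deg<-^ p₀ (ε ℕ.* (q ℕ.∸ i)) hp) (iter-deg hp (ε ℕ.* i) h m))
    where
    open ≡.≡-Reasoning
    eq : ε ℕ.* (q ℕ.∸ i) ℕ.* n ℕ.+ (ε ℕ.* i ℕ.* n ℕ.+ d) ≡ ε ℕ.* q ℕ.* n ℕ.+ d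
    eq = begin
      ε ℕ.* (q ℕ.∸ i) ℕ.* n ℕ.+ (ε ℕ.* i ℕ.* n ℕ.+ d) ≡⟨ ℕ.+-assoc _ (ε ℕ.* i ℕ.* n) d ⟨
      ε ℕ.* (q ℕ.∸ i) ℕ.* n ℕ.+ ε ℕ.* i ℕ.* n ℕ.+ d ≡⟨ ≡.cong (ℕ._+ d) (ℕ.*-distribʳ-+ n (ε ℕ.* (q ℕ.∸ i)) (ε ℕ.* i)) ⟨
      (ε ℕ.* (q ℕ.∸ i) ℕ.+ ε ℕ.* i) ℕ.* n ℕ.+ d ≡⟨ ≡.cong (λ t → t ℕ.* n ℕ.+ d) (ℕ.*-distribˡ-+ ε (q ℕ.∸ i) i) ⟨
      ε ℕ.* (q ℕ.∸ i ℕ.+ i) ℕ.* n ℕ.+ d ≡⟨ ≡.cong (λ t → ε ℕ.* t ℕ.* n ℕ.+ d) (ℕ.m∸n+n≡m i≤q) ⟩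
      ε ℕ.* q ℕ.* n ℕ.+ d ∎

  N-deg : Deg< (suc n) p₀ → ∀ j {d l} → Degs d l → Degs (ε ℕ.* q ℕ.* n ℕ.+ d) (N j l)
  N-deg hp zero {d} {l} h m = Deg-C* c̄ (g 1 l m) (g-deg hp 1 (s≤s z≤n) h m)
  N-deg hp (suc j) {d} {l} h m with suc j ℕ.<? q
  ... | yes j<q = Deg<-+ (C b̄ P.* g (suc j) l m) (C c̄ P.* g (suc (suc j)) l m)
                   (Deg-C* b̄ (g (suc j) l m) (g-deg hp (suc j) (ℕ.<⇒≤ j<q) h m)) (Deg-C* c̄ (g (suc (suc j)) l m) (g-deg hp (suc (suc j)) j<q h m))
  ... | no _ = g-deg hp 0 z≤n h m

  module Point {a ℓ′} (S : CR2 a ℓ′) (ι : Hom K S) (x y : CR2.Carrier S) where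
    private
      module S = C2 S
      module ι = Hom ι
      module E = Ev ι y
    module e = Hom E.ev-hom

    p : S.Carrier
    p = E.ev p₀

    φ : Λ → S.Carrier
    φ l = S.∑ n (λ i → E.ev (l i) S.* x S.^ i)

    sκ : Λ → ℕ → S.Carrier
    sκ l m = S.∑ m (λ i → E.ev (κ l i) S.* x S.^ i)

    ec = ι.⟦ c₂ ⟧
    eb = ι.⟦ b₂ ⟧

    cc : ec S.* ι.⟦ c₂i ⟧ S.≈ S.1#
    cc = S.trans (S.sym (ι.⟦⟧-* c₂ c₂i)) (S.trans (ι.⟦⟧-cong c₂-inv) ι.⟦⟧-1)

    cκ0 : ∀ l → ec S.* E.ev (κ l 0) S.≈ E.ev (l 0)
    cκ0 l = S.trans (S.*-congˡ (S.trans (e.⟦⟧-* (C c₂i) (l 0)) (S.*-congʳ (E.ev-C c₂i)))) (S.trans (S.sym (S.*-assoc _ _ _)) (S.trans (S.*-congʳ cc) (S.*-identityˡ _)))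

    cκ : ∀ l i → ec S.* E.ev (κ l (suc i)) S.≈ E.ev (l (suc i)) S.+ eb S.* E.ev (κ l i)
    cκ l i = S.trans (S.*-congˡ (S.trans (e.⟦⟧-* (C c₂i) _) (S.*-congʳ (E.ev-C c₂i)))) (S.trans (S.sym (S.*-assoc _ _ _)) (S.trans (S.*-congʳ cc) (S.trans (S.*-identityˡ _)
      (S.trans (e.⟦⟧-+ (l (suc i)) (C b₂ P.* κ l i)) (S.+-congˡ (S.trans (e.⟦⟧-* (C b₂) (κ l i)) (S.*-congʳ (E.ev-C b₂))))))))

    telescope : ∀ l m → (ec S.+ eb S.* x) S.* sκ l (suc m) S.≈ S.∑ (suc m) (λ i → E.ev (l i) S.* x S.^ i) S.+ eb S.* E.ev (κ l m) S.* x S.^ suc m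
    telescope l zero = S.trans (Ids.tele0 S ec eb x (E.ev (κ l 0))) (S.+-congʳ (S.trans (S.*-congʳ (cκ0 l)) (S.sym (S.+-identityˡ _))))
    telescope l (suc m) = S.trans (S.distribˡ _ _ _) (S.trans (S.+-cong (telescope l m) (Ids.tele1 S ec eb x (E.ev (κ l (suc m))) (x S.^ suc m)))
      (S.trans (S.+-congˡ (S.+-congʳ (S.*-congʳ (cκ l m)))) (Ids.tele2 S _ eb (E.ev (κ l m)) (x S.^ suc m) (E.ev (l (suc m))) _)))

    φ-G : p S.* (x S.^ n S.+ (eb S.* x S.+ ec)) S.+ x S.^ q S.* y S.^ q S.≈ S.0# → ∀ l → x S.^ q S.* φ (G l) S.≈ p S.* φ l
    φ-G curve l = begin
      x S.^ q S.* φ (G l) ≈⟨ S.*-congˡ φG ⟩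
      x S.^ q S.* (p S.* (E.ev (l q) S.+ eb S.* kl) S.+ x S.* (p S.* s) S.+ y S.^ q S.* s) ≈⟨ Ids.G-id₁ S (x S.^ q) p (E.ev (l q)) (eb S.* kl) x s (y S.^ q) ⟩
      (p S.* (x S.* x S.^ q) S.+ x S.^ q S.* y S.^ q) S.* s S.+ p S.* ((E.ev (l q) S.+ eb S.* kl) S.* x S.^ q) ≈⟨ S.+-congʳ (S.*-congʳ cv) ⟩
      p S.* (ec S.+ eb S.* x) S.* s S.+ p S.* ((E.ev (l q) S.+ eb S.* kl) S.* x S.^ q) ≈⟨ S.+-congʳ (S.trans (S.*-assoc _ _ _) (S.*-congˡ (telescope l (suc q₂)))) ⟩
      p S.* (S.∑ q (λ i → E.ev (l i) S.* x S.^ i) S.+ eb S.* kl S.* x S.^ q) S.+ p S.* ((E.ev (l q) S.+ eb S.* kl) S.* x S.^ q) ≈⟨ Ids.G-id₂ S p _ (eb S.* kl) (x S.^ q) (E.ev (l q)) ⟩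
      p S.* φ l ∎
      where
      open Relation.Binary.Reasoning.Setoid S.setoid
      s = sκ l q
      kl = E.ev (κ l (suc q₂))
      cv : p S.* (x S.* x S.^ q) S.+ x S.^ q S.* y S.^ q S.≈ p S.* (ec S.+ eb S.* x)
      cv = S.sum-0⇒≈ (S.trans (Ids.curve-id S p (x S.* x S.^ q) (x S.^ q S.* y S.^ q) ec (eb S.* x)) curve)
      φG : φ (G l) S.≈ p S.* (E.ev (l q) S.+ eb S.* kl) S.+ x S.* (p S.* s) S.+ y S.^ q S.* s
      φG = S.trans (S.∑-cong n (λ i _ → S.trans (S.*-congʳ (e.⟦⟧-+ (G₁ l i) (G₂ l i))) (S.distribʳ _ _ _))) (S.trans (S.∑-+ n _ _) (S.+-cong part₁ part₂))
        where
        part₁ : S.∑ n (λ i → E.ev (G₁ l i) S.* x S.^ i) S.≈ p S.* (E.ev (l q) S.+ eb S.* kl) S.+ x S.* (p S.* s)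
        part₁ = S.trans (S.∑-head q _) (S.+-cong
          (S.trans (S.*-identityʳ _) (S.trans (e.⟦⟧-* p₀ _) (S.*-congˡ (S.trans (e.⟦⟧-+ (l q) _) (S.+-congˡ (S.trans (e.⟦⟧-* (C b₂) _) (S.*-congʳ (E.ev-C b₂))))))))
          (S.trans (S.∑-cong q (λ i _ → S.trans (S.*-congʳ (e.⟦⟧-* p₀ (κ l i))) (Ids.part-id S p (E.ev (κ l i)) x (x S.^ i)))) (S.trans (S.∑-*ˡ q x _) (S.*-congˡ (S.∑-*ˡ q p _)))))
        part₂ : S.∑ n (λ i → E.ev (G₂ l i) S.* x S.^ i) S.≈ y S.^ q S.* s
        part₂ = S.trans (S.+-cong (S.trans (S.∑-cong q low) (S.∑-*ˡ q (y S.^ q) _)) high) (S.+-identityʳ _)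
          where
          low : ∀ i → i < q → E.ev (G₂ l i) S.* x S.^ i S.≈ y S.^ q S.* (E.ev (κ l i) S.* x S.^ i)
          low i i<q with i ℕ.<? q
          ... | yes _ = S.trans (S.*-congʳ (S.trans (e.⟦⟧-* (V P.^ q) (κ l i)) (S.*-congʳ (S.trans (e.⟦⟧-^ V q) (S.^-congˡ q E.ev-V))))) (S.*-assoc _ _ _)
          ... | no ¬l = ⊥-elim (¬l i<q)
          high : E.ev (G₂ l q) S.* x S.^ q S.≈ S.0#
          high with q ℕ.<? q
          ... | yes q<q = ⊥-elim (ℕ.<-irrefl ≡.refl q<q)
          ... | no _ = S.zeroˡ _

    module OnCurve (curve : p S.* (x S.^ n S.+ (eb S.* x S.+ ec)) S.+ x S.^ q S.* y S.^ q S.≈ S.0#)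
      (u v : S.Carrier) where

      φ-iter : ∀ j l → x S.^ (q ℕ.* j) S.* φ (iter j l) S.≈ p S.^ j S.* φ l
      φ-iter zero l = S.*-congʳ (S.^-congʳ x (ℕ.*-zeroʳ q))
      φ-iter (suc j) l = S.trans (S.*-congʳ (S.trans (S.^-congʳ x (ℕ.*-suc q j)) (S.^-homo-* x q (q ℕ.* j))))
        (S.trans (Ids.swap-id S (x S.^ q) (x S.^ (q ℕ.* j)) (φ (G (iter j l)))) (S.trans (S.*-congˡ (φ-G curve (iter j l)))
        (S.trans (Ids.swap-id₂ S (x S.^ (q ℕ.* j)) p (φ (iter j l))) (S.trans (S.*-congˡ (φ-iter j l)) (S.sym (S.*-assoc p (p S.^ j) (φ l)))))))

      φ-* : ∀ s l → φ (λ m → s P.* l m) S.≈ E.ev s S.* φ l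
      φ-* s l = S.trans (S.∑-cong n (λ i _ → S.trans (S.*-congʳ (e.⟦⟧-* s (l i))) (S.*-assoc _ _ _))) (S.∑-*ˡ n (E.ev s) _)

      φ-+ : ∀ l l′ → φ (l ∔ l′) S.≈ φ l S.+ φ l′
      φ-+ l l′ = S.trans (S.∑-cong n (λ i _ → S.trans (S.*-congʳ (e.⟦⟧-+ (l i) (l′ i))) (S.distribʳ _ _ _))) (S.∑-+ n _ _)

      φ-cong : ∀ {l l′} → l ≐ l′ → φ l S.≈ φ l′
      φ-cong h = S.∑-cong n (λ i _ → S.*-congʳ (e.⟦⟧-cong (h i)))

      z : S.Carrier
      z = x S.^ (q ℕ.* ε)

      bs = ι.⟦ b̄ ⟧
      cs = ι.⟦ c̄ ⟧

      module _ (l : Λ) where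
        γ : ℕ → S.Carrier
        γ i = φ (g i l)

        γ-step : ∀ i → i < q → z S.* γ (suc i) S.≈ γ i
        γ-step i i<q = begin
          z S.* γ (suc i) ≈⟨ S.*-congˡ (S.trans (φ-* _ (iter (ε ℕ.* suc i) l)) (S.*-congˡ (S.reflexive (≡.cong φ (≡.trans (≡.cong (λ j → iter j l) (ℕ.*-suc ε i)) (iter-iter ε (ε ℕ.* i) l)))))) ⟩
          z S.* (E.ev (p₀ P.^ (ε ℕ.* (q ℕ.∸ suc i))) S.* φ (iter ε l′)) ≈⟨ Ids.swap-id₂ S z _ _ ⟩
          E.ev (p₀ P.^ (ε ℕ.* (q ℕ.∸ suc i))) S.* (z S.* φ (iter ε l′)) ≈⟨ S.*-cong (e.⟦⟧-^ p₀ (ε ℕ.* (q ℕ.∸ suc i))) (φ-iter ε l′) ⟩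
          p S.^ (ε ℕ.* (q ℕ.∸ suc i)) S.* (p S.^ ε S.* φ l′) ≈⟨ S.trans (S.sym (S.*-assoc _ _ _)) (S.*-congʳ (S.trans (S.sym (S.^-homo-* p (ε ℕ.* (q ℕ.∸ suc i)) ε)) (S.^-congʳ p ex))) ⟩
          p S.^ (ε ℕ.* (q ℕ.∸ i)) S.* φ l′ ≈⟨ S.trans (φ-* _ l′) (S.*-congʳ (e.⟦⟧-^ p₀ (ε ℕ.* (q ℕ.∸ i)))) ⟨
          γ i ∎
          where
          open Relation.Binary.Reasoning.Setoid S.setoid
          l′ = iter (ε ℕ.* i) l
          ex : ε ℕ.* (q ℕ.∸ suc i) ℕ.+ ε ≡ ε ℕ.* (q ℕ.∸ i)
          ex = ≡.trans (ℕ.+-comm _ ε) (≡.trans (≡.sym (ℕ.*-suc ε (q ℕ.∸ suc i))) (≡.cong (ε ℕ.*_) (≡.sym (ℕ.+-∸-assoc 1 i<q))))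

        γ-down : ∀ i → i ≤ q → z S.^ i S.* γ i S.≈ γ 0
        γ-down zero _ = S.*-identityˡ _
        γ-down (suc i) i<q = S.trans (Ids.swap-id S z (z S.^ i) (γ (suc i))) (S.trans (S.*-congˡ (γ-step i i<q)) (γ-down i (ℕ.<⇒≤ i<q)))

        ν : ℕ → S.Carrier
        ν j = φ (N j l)

        Num : S.Carrier
        Num = S.∑ n (λ j → ν j S.* v S.^ j)

        ν-0 : ν 0 S.≈ cs S.* γ 1
        ν-0 = S.trans (φ-* (C c̄) (g 1 l)) (S.*-congʳ (E.ev-C c̄))

        ν-mid : ∀ j → suc j < q → ν (suc j) S.≈ bs S.* γ (suc j) S.+ cs S.* γ (suc (suc j))
        ν-mid j j<q = S.trans (φ-cong mid) (S.trans (φ-+ (λ m → C b̄ P.* g (suc j) l m) (λ m → C c̄ P.* g (suc (suc j)) l m)) (S.+-cong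
            (S.trans (φ-* (C b̄) (g (suc j) l)) (S.*-congʳ (E.ev-C b̄))) (S.trans (φ-* (C c̄) (g (suc (suc j)) l)) (S.*-congʳ (E.ev-C c̄)))))
          where
          mid : N (suc j) l ≐ (λ m → C b̄ P.* g (suc j) l m) ∔ (λ m → C c̄ P.* g (suc (suc j)) l m)
          mid m with suc j ℕ.<? q
          ... | yes _ = P.refl
          ... | no ¬l = ⊥-elim (¬l j<q)

        ν-q : ν q S.≈ γ 0
        ν-q = φ-cong (N-top l)

        -- The product telescopes: z·ν(j+1) = ν(j) for j ≥ 1, so only the two lowest terms and the
        -- last one survive.
        partial : ∀ m → suc m < q → (v S.+ z) S.* S.∑ (suc (suc m)) (λ j → ν j S.* v S.^ j)
          S.≈ (cs S.* γ 0 S.+ bs S.* γ 0 S.* v) S.+ ν (suc m) S.* v S.^ suc (suc m)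
        partial zero h = S.trans (S.*-congˡ (S.+-congʳ (S.+-congˡ (S.*-congʳ ν-0))))
          (S.trans (Ids.partial0 S v z cs (γ 1) (ν 1)) (S.trans (S.+-congʳ (S.+-cong (S.*-congˡ (γ-step 0 z<s)) (S.+-congˡ (S.*-congʳ (S.trans (S.*-congˡ (ν-mid 0 h)) (S.trans (Ids.z-id S z bs (γ 1) cs (γ 2)) (S.+-cong (S.*-congˡ (γ-step 0 z<s)) (S.*-congˡ (γ-step 1 h)))))))))
            (Ids.partial1 S cs (γ 0) (γ 1) v bs _)))
        partial (suc m) h = S.trans (S.distribˡ _ _ _) (S.trans (S.+-congʳ (partial m (ℕ.<-trans (ℕ.n<1+n _) h)))
          (S.trans (S.+-congˡ (Ids.partial2 S v z (ν (suc (suc m))) (v S.^ suc (suc m))))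
          (S.trans (S.+-congˡ (S.+-congˡ (S.*-congʳ zν))) (Ids.partial3 S _ (ν (suc m)) (v S.^ suc (suc m)) _))))
          where
          zν : z S.* ν (suc (suc m)) S.≈ ν (suc m)
          zν = S.trans (S.*-congˡ (ν-mid (suc m) h)) (S.trans (Ids.z-id S z bs _ cs _) (S.trans (S.+-cong (S.*-congˡ (γ-step (suc m) (ℕ.<-trans (ℕ.n<1+n _) h))) (S.*-congˡ (γ-step (suc (suc m)) h)))
            (S.sym (ν-mid m (ℕ.<-trans (ℕ.n<1+n _) h)))))

        -- The coefficients found from below fit the top one because z is a root, which is `claim`.
        -- Hence (v + z)·`Num` is φ(l) times the value of the polynomial at v, and v is a root as
        -- well.
        Num-vanishes : (∀ {s} → z S.* s S.≈ S.0# → s S.≈ S.0#) →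
          p S.^ (ε ℕ.* q) S.* (z S.^ n S.+ (bs S.* z S.+ cs)) S.+ u S.^ q S.* z S.^ q S.≈ S.0# →
          p S.^ (ε ℕ.* q) S.* (v S.^ n S.+ (bs S.* v S.+ cs)) S.+ u S.^ q S.* v S.^ q S.≈ S.0# →
          (v S.+ z) S.* Num S.≈ S.0#
        Num-vanishes cancel-z at-z at-v = begin
          (v S.+ z) S.* Num ≈⟨ S.distribˡ _ _ _ ⟩
          (v S.+ z) S.* S.∑ q (λ j → ν j S.* v S.^ j) S.+ (v S.+ z) S.* (ν q S.* v S.^ q) ≈⟨ S.+-cong (partial q₂ (ℕ.n<1+n _)) (S.*-congˡ (S.*-congʳ ν-q)) ⟩
          _ ≈⟨ Ids.num₃ S cs (γ 0) bs v (ν (suc q₂)) (v S.^ q) z ⟩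
          γ 0 S.* (v S.^ n S.+ (bs S.* v S.+ cs)) S.+ (ν (suc q₂) S.+ z S.* γ 0) S.* v S.^ q ≈⟨ S.+-cong (S.*-congʳ γ-0) (S.*-congʳ (S.sum-0⇒≈ (cancel-z^ q claim))) ⟩
          p S.^ (ε ℕ.* q) S.* φ l S.* (v S.^ n S.+ (bs S.* v S.+ cs)) S.+ u S.^ q S.* φ l S.* v S.^ q ≈⟨ Ids.num₄ S _ (φ l) _ (u S.^ q) (v S.^ q) ⟩
          φ l S.* _ ≈⟨ S.*-0ʳ (φ l) at-v ⟩
          S.0# ∎
          where
          open Relation.Binary.Reasoning.Setoid S.setoid
          γ-0 : γ 0 S.≈ p S.^ (ε ℕ.* q) S.* φ l
          γ-0 = S.trans (φ-* _ (iter (ε ℕ.* 0) l)) (S.*-cong (e.⟦⟧-^ p₀ (ε ℕ.* q)) (S.reflexive (≡.cong (λ j → φ (iter j l)) (ℕ.*-zeroʳ ε))))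
          cancel-z^ : ∀ j {s} → z S.^ j S.* s S.≈ S.0# → s S.≈ S.0#
          cancel-z^ zero h = S.trans (S.sym (S.*-identityˡ _)) h
          cancel-z^ (suc j) h = cancel-z^ j (cancel-z (S.trans (S.sym (S.*-assoc _ _ _)) h))
          -- Multiplied by z^q in order to clear the inverse powers of z hidden in the γ; z is not a
          -- zero divisor.
          claim : z S.^ q S.* ((ν (suc q₂) S.+ z S.* γ 0) S.+ u S.^ q S.* φ l) S.≈ S.0#
          claim = begin
            _ ≈⟨ S.*-congˡ (S.+-congʳ (S.+-congʳ (ν-mid q₂ (ℕ.n<1+n _)))) ⟩
            _ ≈⟨ Ids.num₁ S z (z S.^ suc q₂) bs cs (γ (suc q₂)) (γ q) (γ 0) (u S.^ q S.* φ l) ⟩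
            _ ≈⟨ S.+-cong (S.+-cong (S.*-congˡ (S.*-congˡ (S.trans (γ-down (suc q₂) (ℕ.n≤1+n _)) γ-0))) (S.*-congˡ (S.trans (γ-down q ℕ.≤-refl) γ-0))) (S.+-congʳ (S.*-congˡ γ-0)) ⟩
            _ ≈⟨ Ids.num₂ S z (z S.^ suc q₂) bs cs (p S.^ (ε ℕ.* q)) (φ l) (u S.^ q) ⟩
            φ l S.* _ ≈⟨ S.*-0ʳ (φ l) at-z ⟩
            S.0# ∎

-- Indexing of coefficient arrays, kernels, and conjugation of the curve equation

split : ∀ {p} {Pr : Set p} {i m} → (i < m → Pr) → (m ≤ i → Pr) → Pr
split {i = i} {m} f g with i ℕ.<? m
... | yes l = f l
... | no ¬l = g (ℕ.≮⇒≥ ¬l)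

grid : ∀ {p} (Pr : ℕ → Set p) A B → (∀ i j → i < A → j < B → Pr (B ℕ.* i ℕ.+ j)) → ∀ t → t < A ℕ.* B → Pr t
grid Pr (suc A) B h t t< with t ℕ.<? A ℕ.* B
... | yes l = grid Pr A B (λ i j i< → h i j (ℕ.m<n⇒m<1+n i<)) t l
... | no ¬l = ≡.subst Pr (≡.trans (≡.cong (ℕ._+ (t ℕ.∸ A ℕ.* B)) (ℕ.*-comm B A)) (ℕ.m+[n∸m]≡n (ℕ.≮⇒≥ ¬l)))
  (h A (t ℕ.∸ A ℕ.* B) (ℕ.n<1+n A) (ℕ.+-cancelˡ-< (A ℕ.* B) _ _ (≡.subst₂ _<_ (≡.sym (ℕ.m+[n∸m]≡n (ℕ.≮⇒≥ ¬l))) (ℕ.+-comm B (A ℕ.* B)) t<)))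

ungrid : ∀ {p} (Pr : ℕ → ℕ → Set p) A B .{{_ : ℕ.NonZero B}} → (∀ t → t < A ℕ.* B → Pr (t / B) (t % B)) → ∀ i j → i < A → j < B → Pr i j
ungrid Pr A B h i j i< j< = ≡.subst₂ Pr quot rem (h t t<)
  where
  t = i ℕ.* B ℕ.+ j
  t< : t < A ℕ.* B
  t< = ℕ.<-≤-trans (ℕ.+-monoʳ-< (i ℕ.* B) j<) (ℕ.≤-trans (ℕ.≤-reflexive (ℕ.+-comm (i ℕ.* B) B)) (ℕ.*-monoˡ-≤ B i<))
  quot : t / B ≡ i
  quot = ≡.trans (+-distrib-/-∣ˡ j (n∣m*n i)) (≡.trans (≡.cong₂ ℕ._+_ (m*n/n≡m i B) (m<n⇒m/n≡0 j<)) (ℕ.+-identityʳ i))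
  rem : t % B ≡ j
  rem = ≡.trans (≡.cong (_% B) (ℕ.+-comm (i ℕ.* B) j)) (≡.trans ([m+kn]%n≡m%n j i B) (m<n⇒m%n≡m j<))

module KernelℕIndexed {c ℓ} (m : ℕ) (F : FiniteField c ℓ (2 ℕ.^ m)) where
  open FiniteFieldFacts m F using (K; kernel)
  open C2 K

  extend : ∀ {n} → (Fin n → Carrier) → ℕ → Carrier
  extend {n} x i with i ℕ.<? n
  ... | yes l = x (fromℕ< l)
  ... | no _ = 0#

  extend-cong : ∀ {n} {x y : Fin n → Carrier} → (∀ i → x i ≈ y i) → ∀ i → extend x i ≈ extend y i
  extend-cong {n} h i with i ℕ.<? n
  ... | yes l = h (fromℕ< l)
  ... | no _ = refl

  extend-+ : ∀ {n} (x y : Fin n → Carrier) i → extend (λ j → x j + y j) i ≈ extend x i + extend y i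
  extend-+ {n} x y i with i ℕ.<? n
  ... | yes l = refl
  ... | no _ = sym (+-identityˡ 0#)

  extend-toℕ : ∀ {n} (x : Fin n → Carrier) i → extend x (toℕ i) ≈ x i
  extend-toℕ {n} x i with toℕ i ℕ.<? n
  ... | yes l = reflexive (≡.cong x (Fin.fromℕ<-toℕ i l))
  ... | no ¬l = ⊥-elim (¬l (Fin.toℕ<n i))

  kernelℕ : ∀ {n k} → k < n → (φ : (ℕ → Carrier) → ℕ → Carrier) →
    (∀ {x y} → (∀ i → x i ≈ y i) → ∀ j → φ x j ≈ φ y j) → (∀ x y j → φ (λ i → x i + y i) j ≈ φ x j + φ y j) →
    ∃ λ x → (¬ (∀ i → i < n → x i ≈ 0#)) × (∀ j → j < k → φ x j ≈ 0#)
  kernelℕ {n} {k} k<n φ φ-cong φ-+ = go (kernel k<n (λ x j → φ (extend x) (toℕ j))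
      (λ h j → φ-cong (extend-cong h) (toℕ j)) (λ x y j → trans (φ-cong (extend-+ x y) (toℕ j)) (φ-+ (extend x) (extend y) (toℕ j))))
    where
    go : (∃ λ x → (¬ (∀ i → x i ≈ 0#)) × (∀ (j : Fin k) → φ (extend {n} x) (toℕ j) ≈ 0#)) →
      ∃ λ x → (¬ (∀ i → i < n → x i ≈ 0#)) × (∀ j → j < k → φ x j ≈ 0#)
    go (x , nz , zs) = extend x , (λ h → nz (λ i → trans (sym (extend-toℕ x i)) (h (toℕ i) (Fin.toℕ<n i)))) ,
        λ j l → trans (reflexive (≡.cong (φ (extend x)) (≡.sym (Fin.toℕ-fromℕ< l)))) (zs (fromℕ< l))

module CurveForm {c ℓ} (S : CR2 c ℓ) where
  open C2 S

  form : ℕ → Carrier → Carrier → Carrier → Carrier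
  form n b c x = x ^ n + (b * x + c)

  form-cong : ∀ n {b b′ c c′ x x′} → b ≈ b′ → c ≈ c′ → x ≈ x′ → form n b c x ≈ form n b′ c′ x′
  form-cong n eb ec ex = +-cong (^-congˡ n ex) (+-cong (*-cong eb ex) ec)

  form-frob : ∀ e n b c x → form n b c x ^ (2 ℕ.^ e) ≈ form n (b ^ (2 ℕ.^ e)) (c ^ (2 ℕ.^ e)) (x ^ (2 ℕ.^ e))
  form-frob e n b c x = trans (frob e _ _) (+-cong (^-swap x n (2 ℕ.^ e)) (trans (frob e _ _) (+-congʳ (^-distrib-* b x (2 ℕ.^ e)))))

  curve : ℕ → ℕ → (b c b̄ c̄ u v : Carrier) → Carrier
  curve n q b c b̄ c̄ u v = form n b c u * form n b̄ c̄ v + u ^ q * v ^ q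

  curve-cong : ∀ n q {b b′ c c′ d d′ e e′ u u′ v v′} → b ≈ b′ → c ≈ c′ → d ≈ d′ → e ≈ e′ → u ≈ u′ → v ≈ v′ → curve n q b c d e u v ≈ curve n q b′ c′ d′ e′ u′ v′
  curve-cong n q eb ec ed ee eu ev = +-cong (*-cong (form-cong n eb ec eu) (form-cong n ed ee ev)) (*-cong (^-congˡ q eu) (^-congˡ q ev))

  curve-frob : ∀ e n q b c b̄ c̄ u v → curve n q b c b̄ c̄ u v ^ (2 ℕ.^ e) ≈
    curve n q (b ^ (2 ℕ.^ e)) (c ^ (2 ℕ.^ e)) (b̄ ^ (2 ℕ.^ e)) (c̄ ^ (2 ℕ.^ e)) (u ^ (2 ℕ.^ e)) (v ^ (2 ℕ.^ e))
  curve-frob e n q b c b̄ c̄ u v = trans (frob e _ _) (+-cong (trans (^-distrib-* _ _ (2 ℕ.^ e)) (*-cong (form-frob e n b c u) (form-frob e n b̄ c̄ v)))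
    (trans (^-distrib-* _ _ (2 ℕ.^ e)) (*-cong (^-swap u q (2 ℕ.^ e)) (^-swap v q (2 ℕ.^ e)))))

module CurveFormHom {a ℓ₁ b ℓ₂} {A : CR2 a ℓ₁} {B : CR2 b ℓ₂} (h : Hom A B) where
  private
    module A = CurveForm A
    module B = CurveForm B
    module H = Hom h
  open C2 B

  form-hom : ∀ n b c x → H.⟦ A.form n b c x ⟧ ≈ B.form n H.⟦ b ⟧ H.⟦ c ⟧ H.⟦ x ⟧
  form-hom n b c x = trans (H.⟦⟧-+ _ _) (+-cong (H.⟦⟧-^ x n) (trans (H.⟦⟧-+ _ _) (+-congʳ (H.⟦⟧-* b x))))

  curve-hom : ∀ n q b c b̄ c̄ u v → H.⟦ A.curve n q b c b̄ c̄ u v ⟧ ≈ B.curve n q H.⟦ b ⟧ H.⟦ c ⟧ H.⟦ b̄ ⟧ H.⟦ c̄ ⟧ H.⟦ u ⟧ H.⟦ v ⟧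
  curve-hom n q b c b̄ c̄ u v = trans (H.⟦⟧-+ _ _) (+-cong (trans (H.⟦⟧-* _ _) (*-cong (form-hom n b c u) (form-hom n b̄ c̄ v)))
    (trans (H.⟦⟧-* _ _) (*-cong (H.⟦⟧-^ u q) (H.⟦⟧-^ v q))))

-- The auxiliary polynomial

record Setting (κ₀ ℓ : Level) : Set (lsuc (κ₀ ⊔ ℓ)) where
  field
    k : ℕ
    F : FiniteField κ₀ ℓ (2 ℕ.^ (2 ℕ.* k))
    r₀ q₂ eR eR′ ε A′ : ℕ
    1≤k : 1 ≤ k
    q≡ : suc (suc q₂) ≡ 2 ℕ.^ suc r₀
    -- The lattice only admits steps of x^(-q), and powers of z = x^R have to be divided out, so q
    -- must divide R.
    εq : ε ℕ.* suc (suc q₂) ≡ 2 ℕ.^ eR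
    -- Excluding q residues modulo R lowers the v-degree of the auxiliary polynomial by q·R′, which
    -- pays for the u-degree q·R′ brought in by the powers x^i.
    A+q : suc A′ ℕ.+ suc (suc q₂) ≡ 2 ℕ.^ eR
    k≡ : eR ℕ.+ eR′ ≡ k
    b c ci : FiniteField.Carrier F
    c-inv : FiniteField._≈_ F (FiniteField._*_ F c ci) (FiniteField.1# F)

  A : ℕ
  A = suc A′

  RR′ : 2 ℕ.^ eR ℕ.* 2 ℕ.^ eR′ ≡ 2 ℕ.^ k
  RR′ = ≡.trans (≡.sym (ℕ.^-distribˡ-+-* 2 eR eR′)) (≡.cong (2 ℕ.^_) k≡)

module System {κ₀ ℓ} (𝒮 : Setting κ₀ ℓ) where
  open Setting 𝒮
  open FiniteFieldFacts (2 ℕ.* k) F using (K; K-domain; module Pl)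
  open Conjugation k F using (conj-conj)
  open KernelℕIndexed (2 ℕ.* k) F using (kernelℕ)
  open C2 K
  open Domain K-domain using (0≉1)

  R R′ Q B : ℕ
  R = 2 ℕ.^ eR
  R′ = 2 ℕ.^ eR′
  Q = 2 ℕ.^ k
  -- Equal to n + q: the factor p₀^R adds n·R to the degree in y and the unknown l stays below q·R,
  -- which makes B blocks of length R.
  B = suc (suc (suc q₂) ℕ.+ suc (suc q₂))

  b̄ c̄ : Carrier
  b̄ = b ^ Q
  c̄ = c ^ Q

  p₀ : Pl.Pl
  p₀ = CurveForm.form Pl.PolyR (suc (suc (suc q₂))) (Pl.C (b̄ ^ R′)) (Pl.C (c̄ ^ R′)) Pl.V

  c₂-inv : c ^ R′ * ci ^ R′ ≈ 1#
  c₂-inv = trans (sym (^-distrib-* c ci R′)) (trans (^-congˡ R′ c-inv) (1^ R′))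

  lattice : LatticeData κ₀ ℓ
  lattice = record { K = K ; q₂ = q₂ ; ε = ε ; b₂ = b ^ R′ ; c₂ = c ^ R′ ; c₂i = ci ^ R′ ; b̄ = b̄ ; c̄ = c̄ ; c₂-inv = c₂-inv ; p₀ = p₀ }

  open Lattice lattice

  private module D = Domain (Pl.Poly-domain K-domain)

  coef-p₀ : ∀ i → Pl.coef p₀ i ≈ Pl.coef (Pl.V Pl.P.^ n) i + ((b̄ ^ R′) * Pl.coef Pl.V i + Pl.coef (Pl.C (c̄ ^ R′)) i)
  coef-p₀ i = trans (Pl.coef-⊞′ (Pl.V Pl.P.^ n) _ i) (+-congˡ (trans (Pl.coef-⊞′ (Pl.C (b̄ ^ R′) Pl.P.* Pl.V) (Pl.C (c̄ ^ R′)) i) (+-congʳ (Pl.coef-C⊠ _ Pl.V i))))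

  p₀-deg : Pl.Deg< (suc n) p₀
  p₀-deg i l = trans (coef-p₀ i) (+-0 (Pl.Deg<-V^ n i l) (+-0 (*-0ʳ _ (h i l)) (Pl.Deg<-C _ i (ℕ.≤-trans (s≤s z≤n) l))))
    where
    h : Pl.Deg< (suc n) Pl.V
    h (suc (suc i)) _ = refl
    h (suc zero) (s≤s ())

  p₀≉0 : ¬ p₀ Pl.P.≈ Pl.P.0#
  p₀≉0 e = 0≉1 (trans (sym (Pl.at e n)) (trans (coef-p₀ n) (trans (+-cong (Pl.coef-V^-top n) (+-0 (zeroʳ _) refl)) (+-identityʳ 1#))))

  unknown : (ℕ → Carrier) → Λ
  unknown x i = Pl.tab (R ℕ.* q) (λ e → x ((R ℕ.* q) ℕ.* i ℕ.+ e))

  -- The vanishing of the coefficients at exponents ≡ A, …, R - 1 (mod R) keeps the v-degree of the assembled polynomial small enough.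
  record Solution : Set (κ₀ ⊔ ℓ) where
    field
      l : Λ
      gap : ∀ i j β α → i < n → j < n → β < B → α < q → Pl.coef (N j l i) (R ℕ.* β ℕ.+ (A ℕ.+ α)) ≈ 0#
      deg : ∀ i j → Pl.Deg< (B ℕ.* R) (N j l i)
      nonzero : ¬ (∀ i j β α → i < n → j < n → β < B → α < A → Pl.coef (N j l i) (R ℕ.* β ℕ.+ α) ≈ 0#)

  -- The coefficient of y^(R·β+α). For y = v^R′ and u = v^Q this power of y is u^β·v^(R′·α), so
  -- block and offset become exponents of u and v.
  w : Solution → ℕ → ℕ → ℕ → ℕ → Carrier
  w sol i j β α = let open Solution sol in Pl.coef (N j l i) (R ℕ.* β ℕ.+ α)

  opaque
    assembled : ∀ {a ℓ′} (S : CR2 a ℓ′) → Solution → (Carrier → CR2.Carrier S) → CR2.Carrier S → CR2.Carrier S → CR2.Carrier S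
    assembled S sol s U V = S.∑ n λ j → S.∑ n λ i → S.∑ B λ β → S.∑ A λ α → s (w sol i j β α) S.* U S.^ (R′ ℕ.* i ℕ.+ β) S.* V S.^ (R′ ℕ.* α ℕ.+ j)
      where module S = C2 S

    assembled-≈ : ∀ {a ℓ′} (S : CR2 a ℓ′) (sol : Solution) (s : Carrier → CR2.Carrier S) U V → let module S = C2 S in
      assembled S sol s U V S.≈ S.∑ n λ j → S.∑ n λ i → S.∑ B λ β → S.∑ A λ α → s (w sol i j β α) S.* U S.^ (R′ ℕ.* i ℕ.+ β) S.* V S.^ (R′ ℕ.* α ℕ.+ j)
    assembled-≈ S sol s U V = CR2.refl S

  -- The n components of l have R·q free coefficients each, against n·n·B·q gap conditions. A
  -- nonzero l yields nonzero coefficients because `N q l` is p₀^R·l.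
  solution : n ℕ.* (n ℕ.* (B ℕ.* q)) < n ℕ.* (R ℕ.* q) → Solution
  solution fewer = record
    { l = l ; gap = gap ; deg = deg ; nonzero = nonzero }
    where
    cond : (ℕ → Carrier) → ℕ → ℕ → ℕ → ℕ → Carrier
    cond x i j β α = Pl.coef (N j (unknown x) i) (R ℕ.* β ℕ.+ (A ℕ.+ α))
    d₁ d₂ d₃ d₄ : ℕ → ℕ
    d₁ t = t / (n ℕ.* (B ℕ.* q))
    d₂ t = t % (n ℕ.* (B ℕ.* q)) / (B ℕ.* q)
    d₃ t = t % (n ℕ.* (B ℕ.* q)) % (B ℕ.* q) / q
    d₄ t = t % (n ℕ.* (B ℕ.* q)) % (B ℕ.* q) % q
    N-cong′ : ∀ {x y} → (∀ i → x i ≈ y i) → ∀ i j → N j (unknown x) i Pl.P.≈ N j (unknown y) i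
    N-cong′ h i j = N-cong j (λ i′ → Pl.tab-cong (R ℕ.* q) (λ e → h _)) i
    N-+′ : ∀ x y i j → N j (unknown (λ t → x t + y t)) i Pl.P.≈ N j (unknown x) i Pl.P.+ N j (unknown y) i
    N-+′ x y i j = Pl.P.trans (N-cong j (λ i′ → Pl.tab-+ (R ℕ.* q) _ _) i) (N-+ j (unknown x) (unknown y) i)
    cond-cong : ∀ {x y} → (∀ i → x i ≈ y i) → ∀ i j β α → cond x i j β α ≈ cond y i j β α
    cond-cong h i j β α = Pl.at (N-cong′ h i j) (R ℕ.* β ℕ.+ (A ℕ.+ α))
    cond-+ : ∀ x y i j β α → cond (λ t → x t + y t) i j β α ≈ cond x i j β α + cond y i j β α
    cond-+ x y i j β α = trans (Pl.at (N-+′ x y i j) _) (Pl.coef-⊞′ (N j (unknown x) i) (N j (unknown y) i) (R ℕ.* β ℕ.+ (A ℕ.+ α)))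
    ker : ∃ λ x → (¬ (∀ i → i < n ℕ.* (R ℕ.* q) → x i ≈ 0#)) × (∀ t → t < n ℕ.* (n ℕ.* (B ℕ.* q)) → cond x (d₁ t) (d₂ t) (d₃ t) (d₄ t) ≈ 0#)
    ker = kernelℕ fewer (λ x t → cond x (d₁ t) (d₂ t) (d₃ t) (d₄ t)) (λ h t → cond-cong h (d₁ t) (d₂ t) (d₃ t) (d₄ t)) (λ x y t → cond-+ x y (d₁ t) (d₂ t) (d₃ t) (d₄ t))
    x : ℕ → Carrier
    x = proj₁ ker
    l : Λ
    l = unknown x
    gap : ∀ i j β α → i < n → j < n → β < B → α < q → cond x i j β α ≈ 0#
    gap i j β α i< j< β< α< = ungrid (λ β α → cond x i j β α ≈ 0#) B q (λ t t< → ungrid (λ j t → cond x i j (t / q) (t % q) ≈ 0#) n (B ℕ.* q)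
      (λ t′ t′< → ungrid (λ i t → cond x i (t / (B ℕ.* q)) (t % (B ℕ.* q) / q) (t % (B ℕ.* q) % q) ≈ 0#) n (n ℕ.* (B ℕ.* q)) (proj₂ (proj₂ ker)) i t′ i< t′<) j t j< t<) β α β< α<
    deg : ∀ i j → Pl.Deg< (B ℕ.* R) (N j l i)
    deg i j = Pl.Deg<-≤ (N j l i) (ℕ.≤-reflexive size) (N-deg p₀-deg j {R ℕ.* q} {l} (λ i′ → Pl.coef-tab-≥ (R ℕ.* q) _) i)
      where
      size : ε ℕ.* q ℕ.* n ℕ.+ R ℕ.* q ≡ B ℕ.* R
      size = ≡.trans (≡.cong (λ t → t ℕ.* n ℕ.+ R ℕ.* q) εq) (≡.trans (≡.sym (ℕ.*-distribˡ-+ R n q)) (ℕ.*-comm R (n ℕ.+ q)))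
    nonzero : ¬ (∀ i j β α → i < n → j < n → β < B → α < A → Pl.coef (N j l i) (R ℕ.* β ℕ.+ α) ≈ 0#)
    nonzero h = proj₁ (proj₂ ker) (grid (λ t → x t ≈ 0#) n (R ℕ.* q) λ i e i< e< → trans (reflexive (≡.sym (Pl.coef-tab (R ℕ.* q) _ e e<))) (Pl.at (l≈0 i i<) e))
      where
      row : ∀ i j β α → i < n → j < n → β < B → α < R → Pl.coef (N j l i) (R ℕ.* β ℕ.+ α) ≈ 0#
      row i j β α i< j< β< α< = split (λ α<A → h i j β α i< j< β< α<A) λ A≤α → trans (reflexive (≡.cong (λ t → Pl.coef (N j l i) (R ℕ.* β ℕ.+ t)) (≡.sym (ℕ.m+[n∸m]≡n A≤α)))) (gap i j β (α ℕ.∸ A) i< j< β<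
           (ℕ.+-cancelˡ-< A _ _ (≡.subst₂ _<_ (≡.sym (ℕ.m+[n∸m]≡n A≤α)) (≡.sym A+q) α<)))
      N≈0 : ∀ i → i < n → N q l i Pl.P.≈ Pl.P.0#
      N≈0 i i< = Pl.mk λ e → at e
        where
        at : ∀ e → Pl.coef (N q l i) e ≈ 0#
        at e = split (λ e< → grid (λ t → Pl.coef (N q l i) t ≈ 0#) B R (λ β α β< α< → row i q β α i< (ℕ.n<1+n q) β< α<) e e<) (deg i q e)
      l≈0 : ∀ i → i < n → l i Pl.P.≈ Pl.P.0#
      l≈0 i i< = D.noZeroDiv {p₀ Pl.P.^ (ε ℕ.* q)} (Pl.P.trans (Pl.P.*-congˡ (Pl.P.reflexive (≡.cong (λ j → iter j l i) (≡.sym (ℕ.*-zeroʳ ε))))) (Pl.P.trans (Pl.P.sym (N-top l i)) (N≈0 i i<))) (D.^-≉0 (ε ℕ.* q) p₀≉0)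

  -- With u = v^Q the R′-th power of the curve equation is the lattice equation in x = u^R′ and y =
  -- v^R′. Moreover p₀(y)^R = P̄(v)^Q = P(u) and x^R = u^Q, so the polynomial divided in `N` is
  -- f(u,X). The ring is left open since this is applied to K[V] modulo h.
  module AtPoint {a ℓ′} (S : CR2 a ℓ′) (ι : Hom K S) (v : CR2.Carrier S) (sol : Solution) where
    private
      module S = C2 S
      module ι = Hom ι
    open Solution sol
    open CurveForm S

    u x y : S.Carrier
    u = v S.^ Q
    y = v S.^ R′
    x = u S.^ R′

    open Point S ι x y
    open Pl.Ev ι y using (ev; ev-hom; ev-C; ev-V; ev-bound)

    term : ℕ → ℕ → ℕ → ℕ → S.Carrier
    term i j β α = ι.⟦ w sol i j β α ⟧ S.* u S.^ (R′ ℕ.* i ℕ.+ β) S.* v S.^ (R′ ℕ.* α ℕ.+ j)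

    module _ (on-curve : curve n q ι.⟦ b ⟧ ι.⟦ c ⟧ ι.⟦ b̄ ⟧ ι.⟦ c̄ ⟧ u v S.≈ S.0#) (cancel-v : ∀ {s} → v S.* s S.≈ S.0# → s S.≈ S.0#) where

      p-power : p S.≈ form n ι.⟦ b̄ ⟧ ι.⟦ c̄ ⟧ v S.^ R′
      p-power = S.trans (CurveFormHom.form-hom ev-hom n (Pl.C (b̄ ^ R′)) (Pl.C (c̄ ^ R′)) Pl.V)
        (S.trans (form-cong n (S.trans (ev-C _) (ι.⟦⟧-^ b̄ R′)) (S.trans (ev-C _) (ι.⟦⟧-^ c̄ R′)) ev-V) (S.sym (form-frob eR′ n ι.⟦ b̄ ⟧ ι.⟦ c̄ ⟧ v)))

      on-curve₂ : p S.* (x S.^ n S.+ (eb S.* x S.+ ec)) S.+ x S.^ q S.* y S.^ q S.≈ S.0#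
      on-curve₂ = begin
        p S.* form n eb ec x S.+ x S.^ q S.* y S.^ q
          ≈⟨ S.+-congʳ (S.trans (S.*-comm _ _) (S.*-cong (form-cong n (ι.⟦⟧-^ b R′) (ι.⟦⟧-^ c R′) S.refl) (S.trans p-power (form-frob eR′ n ι.⟦ b̄ ⟧ ι.⟦ c̄ ⟧ v)))) ⟩
        _ ≈⟨ curve-frob eR′ n q ι.⟦ b ⟧ ι.⟦ c ⟧ ι.⟦ b̄ ⟧ ι.⟦ c̄ ⟧ u v ⟨
        curve n q ι.⟦ b ⟧ ι.⟦ c ⟧ ι.⟦ b̄ ⟧ ι.⟦ c̄ ⟧ u v S.^ R′ ≈⟨ S.^-congˡ R′ on-curve ⟩
        S.0# S.^ R′ ≈⟨ S.0^ R′ (ℕ.m^n>0 2 eR′) ⟩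
        S.0# ∎
        where open Relation.Binary.Reasoning.Setoid S.setoid

      open OnCurve on-curve₂ u v

      ι-conj : ∀ t → ι.⟦ t ^ Q ⟧ S.^ Q S.≈ ι.⟦ t ⟧
      ι-conj t = S.trans (S.sym (ι.⟦⟧-^ (t ^ Q) Q)) (ι.⟦⟧-cong (conj-conj t))

      p-R : p S.^ (ε ℕ.* q) S.≈ form n ι.⟦ b ⟧ ι.⟦ c ⟧ u
      p-R = begin
        p S.^ (ε ℕ.* q) ≈⟨ S.trans (S.^-congʳ p εq) (S.^-congˡ R p-power) ⟩
        (form n ι.⟦ b̄ ⟧ ι.⟦ c̄ ⟧ v S.^ R′) S.^ R ≈⟨ S.trans (S.^-assocʳ _ R′ R) (S.^-congʳ _ (≡.trans (ℕ.*-comm R′ R) RR′)) ⟩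
        form n ι.⟦ b̄ ⟧ ι.⟦ c̄ ⟧ v S.^ Q ≈⟨ form-frob k n ι.⟦ b̄ ⟧ ι.⟦ c̄ ⟧ v ⟩
        _ ≈⟨ form-cong n (ι-conj b) (ι-conj c) S.refl ⟩
        form n ι.⟦ b ⟧ ι.⟦ c ⟧ u ∎
        where open Relation.Binary.Reasoning.Setoid S.setoid

      z-power : z S.≈ u S.^ Q
      z-power = S.trans (S.^-congʳ x (≡.trans (ℕ.*-comm q ε) εq)) (S.trans (S.^-assocʳ u R′ R) (S.^-congʳ u (≡.trans (ℕ.*-comm R′ R) RR′)))

      at-v : p S.^ (ε ℕ.* q) S.* (v S.^ n S.+ (bs S.* v S.+ cs)) S.+ u S.^ q S.* v S.^ q S.≈ S.0#
      at-v = S.trans (S.+-congʳ (S.*-congʳ p-R)) on-curve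

      -- Raising f(u,v) = 0 to the Q-th power exchanges P with its conjugate and (u,v) with (u^Q,u),
      -- which gives f(u,u^Q) = 0.
      at-z : p S.^ (ε ℕ.* q) S.* (z S.^ n S.+ (bs S.* z S.+ cs)) S.+ u S.^ q S.* z S.^ q S.≈ S.0#
      at-z = begin
        p S.^ (ε ℕ.* q) S.* form n bs cs z S.+ u S.^ q S.* z S.^ q
          ≈⟨ S.+-cong (S.trans (S.*-comm _ _) (S.*-cong (form-cong n (ι.⟦⟧-^ b Q) (ι.⟦⟧-^ c Q) z-power) p-R)) (S.trans (S.*-comm _ _) (S.*-congʳ (S.^-congˡ q z-power))) ⟩
        curve n q (ι.⟦ b ⟧ S.^ Q) (ι.⟦ c ⟧ S.^ Q) ι.⟦ b ⟧ ι.⟦ c ⟧ (u S.^ Q) u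
          ≈⟨ curve-cong n q S.refl S.refl (ι-conj b) (ι-conj c) S.refl S.refl ⟨
        _ ≈⟨ curve-frob k n q ι.⟦ b ⟧ ι.⟦ c ⟧ ι.⟦ b̄ ⟧ ι.⟦ c̄ ⟧ u v ⟨
        curve n q ι.⟦ b ⟧ ι.⟦ c ⟧ ι.⟦ b̄ ⟧ ι.⟦ c̄ ⟧ u v S.^ Q ≈⟨ S.^-congˡ Q on-curve ⟩
        S.0# S.^ Q ≈⟨ S.0^ Q (ℕ.m^n>0 2 k) ⟩
        S.0# ∎
        where open Relation.Binary.Reasoning.Setoid S.setoid

      cancel-v^ : ∀ m {s} → v S.^ m S.* s S.≈ S.0# → s S.≈ S.0#
      cancel-v^ zero h = S.trans (S.sym (S.*-identityˡ _)) h
      cancel-v^ (suc m) h = cancel-v^ m (cancel-v (S.trans (S.sym (S.*-assoc _ _ _)) h))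

      z-v : z S.≈ v S.^ (Q ℕ.* Q)
      z-v = S.trans z-power (S.^-assocʳ v Q Q)

      ev-blocks : ∀ i j → i < n → j < n → ev (N j l i) S.≈ S.∑ B (λ β → S.∑ A (λ α → ι.⟦ w sol i j β α ⟧ S.* y S.^ (R ℕ.* β ℕ.+ α)))
      ev-blocks i j i< j< = S.trans (ev-bound (N j l i) (B ℕ.* R) (deg i j)) (S.trans (S.∑-blocks B R _) (S.∑-cong B λ β β< →
        S.trans (S.reflexive (≡.cong (λ m → S.∑ m (λ α → ι.⟦ w sol i j β α ⟧ S.* y S.^ (R ℕ.* β ℕ.+ α))) (≡.sym A+q))) (S.trans (S.∑-split A q _)
        (S.trans (S.+-congˡ (S.∑-0 q (λ α α< → S.*-0ˡ _ (ι.⟦⟧-≈0 (gap i j β α i< j< β< α<))))) (S.+-identityʳ _)))))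

      term-≈ : ∀ i j β α → (ι.⟦ w sol i j β α ⟧ S.* y S.^ (R ℕ.* β ℕ.+ α)) S.* (x S.^ i S.* v S.^ j) S.≈ term i j β α
      term-≈ i j β α = begin
        _ ≈⟨ S.*-cong (S.*-congˡ (S.trans (S.^-homo-* y (R ℕ.* β) α) (S.*-cong y-β (S.^-assocʳ v R′ α)))) (S.*-congʳ (S.^-assocʳ u R′ i)) ⟩
        _ ≈⟨ Ids.term-id S ι.⟦ w sol i j β α ⟧ (u S.^ β) (v S.^ (R′ ℕ.* α)) (u S.^ (R′ ℕ.* i)) (v S.^ j) ⟩
        _ ≈⟨ S.*-cong (S.*-congˡ (S.sym (S.^-homo-* u (R′ ℕ.* i) β))) (S.sym (S.^-homo-* v (R′ ℕ.* α) j)) ⟩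
        term i j β α ∎
        where
        open Relation.Binary.Reasoning.Setoid S.setoid
        y-β : y S.^ (R ℕ.* β) S.≈ u S.^ β
        y-β = S.trans (S.sym (S.^-assocʳ y R β)) (S.^-congˡ β (S.trans (S.^-assocʳ v R′ R) (S.^-congʳ v (≡.trans (ℕ.*-comm R′ R) RR′))))

      Num≈ : Num l S.≈ assembled S sol ι.⟦_⟧ u v
      Num≈ = S.trans (S.∑-cong n λ j j< → S.trans (S.sym (S.∑-*ʳ n (v S.^ j) _)) (S.∑-cong n λ i i< → S.trans (S.*-assoc _ _ _)
        (S.trans (S.*-congʳ (ev-blocks i j i< j<)) (S.trans (S.sym (S.∑-*ʳ B _ _)) (S.∑-cong B λ β _ → S.trans (S.sym (S.∑-*ʳ A _ _)) (S.∑-cong A λ α _ → term-≈ i j β α))))))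
        (S.sym (assembled-≈ S sol ι.⟦_⟧ u v))

      relation : (v S.+ v S.^ (Q ℕ.* Q)) S.* assembled S sol ι.⟦_⟧ u v S.≈ S.0#
      relation = S.trans (S.*-cong (S.+-congˡ (S.sym z-v)) (S.sym Num≈))
        (Num-vanishes l (λ h → cancel-v^ (Q ℕ.* Q) (S.trans (S.*-congʳ (S.sym z-v)) h)) at-z at-v)

-- Elimination of u and the comparison of degree with number of zeros

module RowDegree {κ ℓ} (K : CR2 κ ℓ) where
  open C2 K
  private
    module B₁ = Poly K
    module B₂ = Poly B₁.PolyR
    module P₁ = B₁.P
    module P₂ = B₂.P

  Rows : ℕ → B₂.Pl → Set ℓ
  Rows d p = ∀ j → B₁.Deg< d (B₂.coef p j)

  Rows-cong : ∀ {d p p′} → p P₂.≈ p′ → Rows d p → Rows d p′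
  Rows-cong e h j = B₁.Deg<-cong (B₂.at e j) (h j)

  Rows-≤ : ∀ {d e} p → d ≤ e → Rows d p → Rows e p
  Rows-≤ p l h j = B₁.Deg<-≤ (B₂.coef p j) l (h j)

  Rows-+ : ∀ {d} p p′ → Rows d p → Rows d p′ → Rows d (p P₂.+ p′)
  Rows-+ p p′ h h′ j = B₁.Deg<-cong (P₁.sym (B₂.coef-⊞′ p p′ j)) (B₁.Deg<-+ (B₂.coef p j) (B₂.coef p′ j) (h j) (h′ j))

  Rows-C : ∀ {d} p → B₁.Deg< d p → Rows d (B₂.C p)
  Rows-C p h zero = h
  Rows-C p h (suc j) _ _ = refl

  Rows-V : ∀ {d} p → Rows d p → Rows d (B₂.V P₂.* p)
  Rows-V p h zero = B₁.Deg<-cong (P₁.sym (B₂.coef-V⊠0 p)) (λ _ _ → refl)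
  Rows-V p h (suc j) = B₁.Deg<-cong (P₁.sym (B₂.coef-V⊠ p j)) (h j)

  Rows-V^ : ∀ m → Rows 1 (B₂.V P₂.^ m)
  Rows-V^ zero = Rows-C P₁.1# (B₁.Deg<-C 1#)
  Rows-V^ (suc m) = Rows-V (B₂.V P₂.^ m) (Rows-V^ m)

  Rows-* : ∀ {d e} p p′ → Rows (suc d) p → Rows e p′ → Rows (d ℕ.+ e) (p P₂.* p′)
  Rows-* [] p′ h h′ = Rows-cong (P₂.sym (P₂.zeroˡ p′)) (λ _ _ _ → refl)
  Rows-* {d} {e} (a ∷ p) p′ h h′ = Rows-cong (P₂.sym (P₂.trans (P₂.*-congʳ (B₂.cons-≈ a p)) (P₂.trans (P₂.distribʳ p′ (B₂.C a) (B₂.V P₂.* p)) (P₂.+-congˡ (P₂.*-assoc B₂.V p p′)))))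
    (Rows-+ (B₂.C a P₂.* p′) (B₂.V P₂.* (p P₂.* p′)) first (Rows-V (p P₂.* p′) (Rows-* p p′ (h ∘ suc) h′)))
    where
    first : Rows (d ℕ.+ e) (B₂.C a P₂.* p′)
    first j = B₁.Deg<-cong (P₁.sym (B₂.coef-C⊠ a p′ j)) (B₁.Deg<-* a (B₂.coef p′ j) (h 0) (h′ j))

  Rows-tab : ∀ {d} m (g : ℕ → B₁.Pl) → (∀ j → B₁.Deg< d (g j)) → Rows d (B₂.tab m g)
  Rows-tab zero g h _ _ _ = refl
  Rows-tab (suc m) g h zero = h 0
  Rows-tab (suc m) g h (suc j) = Rows-tab m (g ∘ suc) (h ∘ suc) j

  table : ℕ → ℕ → (ℕ → Carrier) → B₂.Pl
  table m m′ x = B₂.tab m (λ j → B₁.tab m′ (λ i → x (m′ ℕ.* j ℕ.+ i)))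

  table-cong : ∀ m m′ {x y} → (∀ i → x i ≈ y i) → table m m′ x P₂.≈ table m m′ y
  table-cong m m′ e = B₂.tab-cong m (λ j → B₁.tab-cong m′ (λ i → e (m′ ℕ.* j ℕ.+ i)))

  table-+ : ∀ m m′ x y → table m m′ (λ i → x i + y i) P₂.≈ table m m′ x P₂.+ table m m′ y
  table-+ m m′ x y = P₂.trans (B₂.tab-cong m (λ j → B₁.tab-+ m′ (λ i → x (m′ ℕ.* j ℕ.+ i)) (λ i → y (m′ ℕ.* j ℕ.+ i))))
    (B₂.tab-+ m (λ j → B₁.tab m′ (λ i → x (m′ ℕ.* j ℕ.+ i))) (λ j → B₁.tab m′ (λ i → y (m′ ℕ.* j ℕ.+ i))))

  table-rows : ∀ m m′ x → Rows m′ (table m m′ x)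
  table-rows m m′ x = Rows-tab m (λ j → B₁.tab m′ (λ i → x (m′ ℕ.* j ℕ.+ i))) (λ j → B₁.coef-tab-≥ m′ (λ i → x (m′ ℕ.* j ℕ.+ i)))

  table-deg : ∀ m m′ x → B₂.Deg< m (table m m′ x)
  table-deg m m′ x = B₂.coef-tab-≥ m (λ j → B₁.tab m′ (λ i → x (m′ ℕ.* j ℕ.+ i)))

  table-≈0 : ∀ m m′ x → table m m′ x P₂.≈ P₂.0# → ∀ t → t < m ℕ.* m′ → x t ≈ 0#
  table-≈0 m m′ x e = grid (λ t → x t ≈ 0#) m m′ λ j i j< i< → trans (reflexive (≡.sym (≡.trans
    (≡.cong (λ p → B₁.coef p i) (B₂.coef-tab m (λ j → B₁.tab m′ (λ i → x (m′ ℕ.* j ℕ.+ i))) j j<)) (B₁.coef-tab m′ (λ i → x (m′ ℕ.* j ℕ.+ i)) i i<)))) (B₁.at (B₂.at e j) i)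

module Auxiliary {κ₀ ℓ} (𝒮 : Setting κ₀ ℓ) where
  open Setting 𝒮
  open FiniteFieldFacts (2 ℕ.* k) F using (N; K; K-domain; fermat; noZeroDiv; evalAt; vanishing)
  open Conjugation k F using (QQ≡N; conj-conj)
  open KernelℕIndexed (2 ℕ.* k) F using (kernelℕ)
  open C2 K
  open Domain K-domain using (0≉1)

  Q : ℕ
  Q = 2 ℕ.^ k

  b̄ c̄ : Carrier
  b̄ = b ^ Q
  c̄ = c ^ Q

  coefficients conjugate : Coefficients κ₀ ℓ
  coefficients = record { K = K ; q₂ = q₂ ; b = b ; c = c ; b′ = b̄ ; c′ = c̄ }
  conjugate = record { K = K ; q₂ = q₂ ; b = b̄ ; c = c̄ ; b′ = b ; c′ = c }

  open Curve coefficients public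
  open RowDegree K public

  h : B₁.Pl
  h = CurveForm.curve B₁.PolyR n q (B₁.C b) (B₁.C c) (B₁.C b̄) (B₁.C c̄) (B₁.V P₁.^ Q) B₁.V

  ev₁-hom : Hom B₁.PolyR B₁.PolyR
  ev₁-hom = B₁.Ev.ev-hom B₁.C-hom (B₁.V P₁.^ Q)

  ev₂-hom : Hom B₂.PolyR B₁.PolyR
  ev₂-hom = B₂.Ev.ev-hom ev₁-hom B₁.V

  private
    module E₁ = B₁.Ev B₁.C-hom (B₁.V P₁.^ Q)
    module E₂ = B₂.Ev ev₁-hom B₁.V
    module e₁ = Hom E₁.ev-hom
    module e₂ = Hom ev₂-hom

  ev₂ : B₂.Pl → B₁.Pl
  ev₂ = E₂.ev

  ev₂-f : ev₂ f P₁.≈ h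
  ev₂-f = P₁.trans (e₂.⟦⟧-+ (ν P P₂.* f̂) (ν (u P₁.^ q) P₂.* v P₂.^ q)) (P₁.+-cong
    (P₁.trans (e₂.⟦⟧-* (ν P) f̂) (P₁.*-cong
      (P₁.trans (E₂.ev-C P) (P₁.trans (CurveFormHom.form-hom ev₁-hom n (B₁.C b) (B₁.C c) B₁.V) (CurveForm.form-cong B₁.PolyR n (E₁.ev-C b) (E₁.ev-C c) E₁.ev-V)))
      (P₁.trans (CurveFormHom.form-hom ev₂-hom n (ν (B₁.C b̄)) (ν (B₁.C c̄)) v)
        (CurveForm.form-cong B₁.PolyR n (P₁.trans (E₂.ev-C (B₁.C b̄)) (E₁.ev-C b̄)) (P₁.trans (E₂.ev-C (B₁.C c̄)) (E₁.ev-C c̄)) E₂.ev-V))))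
    (P₁.trans (e₂.⟦⟧-* (ν (u P₁.^ q)) (v P₂.^ q)) (P₁.*-cong (P₁.trans (E₂.ev-C (u P₁.^ q)) (P₁.trans (e₁.⟦⟧-^ u q) (P₁.^-congˡ q E₁.ev-V)))
      (P₁.trans (e₂.⟦⟧-^ v q) (P₁.^-congˡ q E₂.ev-V)))))

  -- P(V^Q) is the Q-th power of the conjugate polynomial, so the first summand of `h` has degree (Q
  -- + 1)·n, while the second has degree at most (Q + 1)·q.
  HasDeg-h : B₁.HasDeg (Q ℕ.* n ℕ.+ n) h
  HasDeg-h = B₁.Deg<-+ t₁ t₂ (proj₁ h₁) (B₁.Deg<-≤ t₂ (ℕ.≤-trans (ℕ.n≤1+n _) small) h₂) ,
      λ e → proj₂ h₁ (trans (sym (trans (B₁.coef-⊞′ t₁ t₂ _) (trans (+-congˡ (h₂ _ (ℕ.≤-pred small))) (+-identityʳ _)))) e)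
    where
    open CurveForm B₁.PolyR
    P̃ = form n (B₁.C b̄) (B₁.C c̄) B₁.V
    t₁ = form n (B₁.C b) (B₁.C c) (B₁.V P₁.^ Q) P₁.* P̃
    t₂ = (B₁.V P₁.^ Q) P₁.^ q P₁.* B₁.V P₁.^ q
    HasDeg-P̃ : B₁.HasDeg n P̃
    HasDeg-P̃ = Deg-P′ , λ e → 0≉1 (trans (sym e) P-top′)
      where open Curve conjugate using () renaming (Deg-P to Deg-P′; P-top to P-top′)
    C-conj : ∀ x → B₁.C (x ^ Q) P₁.^ Q P₁.≈ B₁.C x
    C-conj x = P₁.trans (P₁.sym (Hom.⟦⟧-^ B₁.C-hom (x ^ Q) Q)) (Hom.⟦⟧-cong B₁.C-hom (conj-conj x))
    t₁≈ : P̃ P₁.^ Q P₁.* P̃ P₁.≈ t₁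
    t₁≈ = P₁.*-congʳ (P₁.trans (form-frob k n (B₁.C b̄) (B₁.C c̄) B₁.V) (form-cong n (C-conj b) (C-conj c) P₁.refl))
    h₁ : B₁.HasDeg (Q ℕ.* n ℕ.+ n) t₁
    h₁ = Series.HasDeg-cong K K-domain (B₁.at t₁≈) (B₁.HasDeg-* K-domain (P̃ P₁.^ Q) P̃ (B₁.HasDeg-^ K-domain P̃ Q HasDeg-P̃) HasDeg-P̃)
    h₂ : B₁.Deg< (suc (q ℕ.* Q ℕ.+ q)) t₂
    h₂ = B₁.Deg<-≤ t₂ (ℕ.≤-reflexive (ℕ.+-suc (q ℕ.* Q) q)) (B₁.Deg<-* ((B₁.V P₁.^ Q) P₁.^ q) (B₁.V P₁.^ q) (B₁.Deg<-^ (B₁.V P₁.^ Q) q (B₁.Deg<-V^ Q)) (B₁.Deg<-V^ q))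
    small : suc (suc (q ℕ.* Q ℕ.+ q)) ≤ suc (Q ℕ.* n ℕ.+ n)
    small = s≤s (ℕ.≤-trans (ℕ.≤-reflexive (≡.sym (ℕ.+-suc (q ℕ.* Q) q))) (ℕ.+-monoˡ-≤ n (ℕ.≤-trans (ℕ.m≤n+m (q ℕ.* Q) Q) (ℕ.≤-reflexive (ℕ.*-comm n Q)))))

  head : B₁.Pl → Carrier
  head p = B₁.coef p 0

  ev₂-constant : ∀ E → (∀ j i → B₁.coef (B₂.coef E j) (suc i) ≈ 0#) → ev₂ E P₁.≈ map head E
  ev₂-constant [] hE = P₁.refl
  ev₂-constant (p ∷ E) hE = P₁.trans (P₁.+-cong (P₁.trans (e₁.⟦⟧-cong {p} {B₁.C (head p)} (B₁.mk λ { zero → refl ; (suc i) → hE 0 i })) (E₁.ev-C (head p)))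
    (P₁.*-congˡ (ev₂-constant E (hE ∘ suc)))) (P₁.sym (B₁.cons-≈ (head p) (map head E)))

  coef-map-head : ∀ E j → B₁.coef (map head E) j ≈ B₁.coef (B₂.coef E j) 0
  coef-map-head [] j = refl
  coef-map-head (p ∷ E) zero = refl
  coef-map-head (p ∷ E) (suc j) = coef-map-head E j

  constant-≈0 : ∀ E → (∀ j i → B₁.coef (B₂.coef E j) (suc i) ≈ 0#) → ev₂ E P₁.≈ P₁.0# → E P₂.≈ P₂.0#
  constant-≈0 E hE z = B₂.mk λ j → B₁.mk λ { zero → trans (sym (coef-map-head E j)) (B₁.at (P₁.trans (P₁.sym (ev₂-constant E hE)) z) j) ; (suc i) → hE j i }

  Rows-f : Rows (suc n) f
  Rows-f = Rows-+ (ν P P₂.* f̂) (ν (u P₁.^ q) P₂.* v P₂.^ q)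
      (Rows-≤ (ν P P₂.* f̂) (ℕ.≤-reflexive (ℕ.+-comm n 1)) (Rows-* (ν P) f̂ (Rows-C P Deg-P) hf̂))
      (Rows-≤ (ν (u P₁.^ q) P₂.* v P₂.^ q) (ℕ.≤-trans (ℕ.≤-reflexive (ℕ.+-comm q 1)) (ℕ.n≤1+n _)) (Rows-* (ν (u P₁.^ q)) (v P₂.^ q) (Rows-C (u P₁.^ q) (B₁.Deg<-V^ q)) (Rows-V^ q)))
    where
    hf̂ : Rows 1 f̂
    hf̂ = Rows-+ (v P₂.^ n) (ν (B₁.C b̄) P₂.* v P₂.+ ν (B₁.C c̄)) (Rows-V^ n) (Rows-+ (ν (B₁.C b̄) P₂.* v) (ν (B₁.C c̄))
      (Rows-* (ν (B₁.C b̄)) v (Rows-C (B₁.C b̄) (B₁.Deg<-C b̄)) (Rows-cong (P₂.*-identityʳ v) (Rows-V^ 1))) (Rows-C (B₁.C c̄) (B₁.Deg<-C c̄)))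

  open CurveForm K using () renaming (curve to curveK; curve-cong to curveK-cong)

  eval-h : ∀ x → Hom.⟦_⟧ (evalAt x) h ≈ curveK n q b c b̄ c̄ (x ^ Q) x
  eval-h x = trans (CurveFormHom.curve-hom (evalAt x) n q (B₁.C b) (B₁.C c) (B₁.C b̄) (B₁.C c̄) (B₁.V P₁.^ Q) B₁.V)
    (curveK-cong n q (ev-C b) (ev-C c) (ev-C b̄) (ev-C c̄) (trans (Hom.⟦⟧-^ (evalAt x) B₁.V Q) (^-congˡ Q ev-V)) ev-V)
    where open B₁.Ev (id-hom K) x using (ev-C; ev-V)

  eval-0 : ∀ p → Hom.⟦_⟧ (evalAt 0#) p ≈ B₁.coef p 0
  eval-0 [] = refl
  eval-0 (a ∷ p) = trans (+-congˡ (zeroˡ _)) (+-identityʳ a)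

  h-0 : B₁.coef h 0 ≈ c * c̄
  h-0 = trans (sym (eval-0 h)) (trans (eval-h 0#) (trans (curveK-cong n q refl refl refl refl (0^ Q (ℕ.m^n>0 2 k)) refl)
    (trans (+-cong (*-cong (at-0 b c) (at-0 b̄ c̄)) (trans (*-congʳ (0^ q z<s)) (zeroˡ _))) (+-identityʳ _))))
    where
    at-0 : ∀ b c → CurveForm.form K n b c 0# ≈ c
    at-0 b c = trans (+-cong (0^ n z<s) (trans (+-congʳ (zeroʳ b)) (+-identityˡ c))) (+-identityˡ c)

  module Mod = Quotient B₁.PolyR h
  private
    module D₁ = Domain (B₁.Poly-domain K-domain)
    module D₂ = Domain (B₂.Poly-domain (B₁.Poly-domain K-domain))

  -- h is prime to V since its constant term is a unit
  cancel-V : ¬ c ≈ 0# → ∀ {s} → (B₁.V P₁.* s) Mod.≈Q P₁.0# → s Mod.≈Q P₁.0#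
  cancel-V c≉0 {s} p = Mod.mk λ z → Mod.≈0Q p λ { (κ , e) → Mod.un (Mod.0Q (B₁.drop 1 κ) (reduce κ e)) z }
    where
    open Domain K-domain using (*-≉0; ^-≉0)
    module _ (κ : B₁.Pl) (e : B₁.V P₁.* s P₁.≈ h P₁.* κ) where
      κ-0 : B₁.coef κ 0 ≈ 0#
      κ-0 = noZeroDiv (trans (*-congʳ (sym h-0)) (trans (sym (trans (B₁.coef-⊠ h κ 0) (Series.⊛-at0 K (B₁.coef h) (B₁.coef κ))))
        (trans (sym (B₁.at e 0)) (B₁.coef-V⊠0 s)))) (*-≉0 c≉0 (^-≉0 Q c≉0))
      κ≈ : κ P₁.≈ B₁.V P₁.* B₁.drop 1 κ
      κ≈ = B₁.mk λ { zero → trans κ-0 (sym (B₁.coef-V⊠0 _)) ; (suc i) → sym (trans (B₁.coef-V⊠ (B₁.drop 1 κ) i) (reflexive (B₁.coef-drop 1 κ i))) }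
      reduce : s P₁.≈ h P₁.* B₁.drop 1 κ
      reduce = B₁.mk λ i → trans (sym (B₁.coef-V⊠ s i)) (trans (B₁.at (P₁.trans e (P₁.trans (P₁.*-congˡ κ≈) (Ids.swap-id₂ B₁.PolyR h B₁.V (B₁.drop 1 κ)))) (suc i)) (B₁.coef-V⊠ (h P₁.* B₁.drop 1 κ) i))

  f≉0 : ¬ f P₂.≈ P₂.0#
  f≉0 e = 0≉1 (trans (sym (B₁.at (B₂.at e n) n)) (trans (B₁.at f-n n) P-top))

  1<Q : 1 < Q
  1<Q = ℕ.^-monoʳ-≤ 2 1≤k

  -- The polynomial V^N + V, which vanishes at every element of the field.
  Φ : B₁.Pl
  Φ = B₁.V P₁.+ B₁.V P₁.^ (Q ℕ.* Q)

  Φ≉0 : ¬ Φ P₁.≈ P₁.0#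
  Φ≉0 e = 0≉1 (trans (sym (B₁.at e 1)) (trans (B₁.coef-⊞′ B₁.V (B₁.V P₁.^ (Q ℕ.* Q)) 1)
    (trans (+-congˡ (B₁.coef-V^-≢ (Q ℕ.* Q) 1 (ℕ.<⇒≢ (ℕ.<-≤-trans 1<Q (ℕ.m≤m*n Q Q {{ℕ.>-nonZero (ℕ.<⇒≤ 1<Q)}}))))) (+-identityʳ 1#))))

  module _ (no-point : ∀ x → ¬ curveK n q b c b̄ c̄ (x ^ Q) x ≈ 0#)
    (W : B₂.Pl) (a b′ : ℕ) (small : a ℕ.+ (q ℕ.+ b′) ≤ Q) (W-deg : B₂.Deg< (suc (q ℕ.+ b′)) W) (W-rows : Rows (suc a) W)
    (relation : ¬ ¬ (∃ λ κ → Φ P₁.* ev₂ W P₁.≈ h P₁.* κ)) where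

    private
      d M : ℕ
      -- Modelled on the resultant of `W` and f with respect to u, with `T` and `L` in the place of
      -- its cofactors, of degrees below n and below a in u. This is the least v-degree for `T` at
      -- which the unknowns outnumber the conditions.
      d = a ℕ.* n ℕ.+ q ℕ.* (q ℕ.+ b′)
      M = suc (q ℕ.+ b′ ℕ.+ d)

      T L E : (ℕ → Carrier) → B₂.Pl
      T x = table (suc d) n x
      L x = table (b′ ℕ.+ d) a (λ t → x (suc d ℕ.* n ℕ.+ t))
      E x = W P₂.* T x P₂.+ f P₂.* L x

      E-cong : ∀ {x y} → (∀ i → x i ≈ y i) → E x P₂.≈ E y
      E-cong e = P₂.+-cong (P₂.*-congˡ {W} (table-cong (suc d) n e)) (P₂.*-congˡ {f} (table-cong (b′ ℕ.+ d) a (λ t → e (suc d ℕ.* n ℕ.+ t))))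

      E-+ : ∀ x y → E (λ i → x i + y i) P₂.≈ E x P₂.+ E y
      E-+ x y = P₂.trans (P₂.+-cong (P₂.*-congˡ {W} (table-+ (suc d) n x y)) (P₂.*-congˡ {f} (table-+ (b′ ℕ.+ d) a (λ t → x (suc d ℕ.* n ℕ.+ t)) (λ t → y (suc d ℕ.* n ℕ.+ t))))) (Ids.N-id B₂.PolyR W (T x) (T y) f (L x) (L y))

      cond : (ℕ → Carrier) → ℕ → ℕ → Carrier
      cond x i j = B₁.coef (B₂.coef (E x) j) (suc i)

      cond-cong : ∀ {x y} → (∀ i → x i ≈ y i) → ∀ i j → cond x i j ≈ cond y i j
      cond-cong e i j = B₁.at (B₂.at (E-cong e) j) (suc i)

      cond-+ : ∀ x y i j → cond (λ t → x t + y t) i j ≈ cond x i j + cond y i j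
      cond-+ x y i j = trans (B₁.at (P₁.trans (B₂.at (E-+ x y) j) (B₂.coef-⊞′ (E x) (E y) j)) (suc i)) (B₁.coef-⊞′ (B₂.coef (E x) j) (B₂.coef (E y) j) (suc i))

      count : (a ℕ.+ q) ℕ.* M < suc d ℕ.* n ℕ.+ (b′ ℕ.+ d) ℕ.* a
      count = ℕ.≤-reflexive (solve′ 3 (λ a q b′ → let d = a ⊗ (con 1 ⊕ q) ⊕ q ⊗ (q ⊕ b′) in
          con 1 ⊕ (a ⊕ q) ⊗ (con 1 ⊕ (q ⊕ b′ ⊕ d)) ⊜ (con 1 ⊕ d) ⊗ (con 1 ⊕ q) ⊕ (b′ ⊕ d) ⊗ a) ≡.refl a q b′)
        where open +-*-Solver using (con) renaming (solve to solve′; _:+_ to _⊕_; _:*_ to _⊗_; _:=_ to _⊜_)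

      ker : ∃ λ x → (¬ (∀ i → i < suc d ℕ.* n ℕ.+ (b′ ℕ.+ d) ℕ.* a → x i ≈ 0#)) × (∀ t → t < (a ℕ.+ q) ℕ.* M → cond x (t / M) (t % M) ≈ 0#)
      ker = kernelℕ count (λ x t → cond x (t / M) (t % M)) (λ e t → cond-cong e (t / M) (t % M)) (λ x y t → cond-+ x y (t / M) (t % M))

      x : ℕ → Carrier
      x = proj₁ ker

      T-rows : Rows n (T x)
      T-rows = table-rows (suc d) n x

      L-rows : Rows a (L x)
      L-rows = table-rows (b′ ℕ.+ d) a (λ t → x (suc d ℕ.* n ℕ.+ t))

      E-rows : Rows (suc (a ℕ.+ q)) (E x)
      E-rows = Rows-+ (W P₂.* T x) (f P₂.* L x) (Rows-≤ (W P₂.* T x) (ℕ.≤-reflexive (ℕ.+-suc a q)) (Rows-* W (T x) W-rows T-rows))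
        (Rows-≤ (f P₂.* L x) (ℕ.≤-reflexive (≡.cong suc (ℕ.+-comm q a))) (Rows-* f (L x) Rows-f L-rows))

      E-deg : B₂.Deg< M (E x)
      E-deg = B₂.Deg<-+ (W P₂.* T x) (f P₂.* L x)
        (B₂.Deg<-≤ (W P₂.* T x) (ℕ.≤-reflexive (ℕ.+-suc (q ℕ.+ b′) d)) (B₂.Deg<-* W (T x) W-deg (table-deg (suc d) n x)))
        (B₂.Deg<-≤ (f P₂.* L x) (ℕ.≤-reflexive (≡.cong suc (≡.sym (ℕ.+-assoc q b′ d)))) (B₂.Deg<-* f (L x) Deg-f (table-deg (b′ ℕ.+ d) a (λ t → x (suc d ℕ.* n ℕ.+ t)))))

      E-constant : ∀ j i → B₁.coef (B₂.coef (E x) j) (suc i) ≈ 0#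
      E-constant j i = split (λ i< → split (λ j< → ungrid (λ i j → cond x i j ≈ 0#) (a ℕ.+ q) M (proj₂ (proj₂ ker)) i j i< j<) (λ j≥ → B₁.at (E-deg j j≥) (suc i)))
        (λ i≥ → E-rows j (suc i) (s≤s i≥))

      ρ : B₁.Pl
      ρ = map head (E x)

      ρ≈ : ev₂ (E x) P₁.≈ ρ
      ρ≈ = ev₂-constant (E x) E-constant

      ρ-deg : B₁.Deg< M ρ
      ρ-deg j l = trans (coef-map-head (E x) j) (B₁.at (E-deg j l) 0)

      -- M is 1 + (a + q + b′)·n, the resultant's degree bound plus one, so `small` keeps the degree
      -- of ρ at most Q·n, below that of h.
      M≤ : M ≤ Q ℕ.* n ℕ.+ n
      M≤ = ℕ.≤-trans (ℕ.≤-reflexive eq) (ℕ.≤-trans (s≤s (ℕ.*-monoˡ-≤ n small)) (ℕ.≤-trans (ℕ.≤-reflexive (ℕ.+-comm 1 (Q ℕ.* n))) (ℕ.+-monoʳ-≤ (Q ℕ.* n) (s≤s z≤n))))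
        where
        open +-*-Solver using (con) renaming (solve to solve′; _:+_ to _⊕_; _:*_ to _⊗_; _:=_ to _⊜_)
        eq : M ≡ suc ((a ℕ.+ (q ℕ.+ b′)) ℕ.* n)
        eq = solve′ 3 (λ a q b′ → con 1 ⊕ (q ⊕ b′ ⊕ (a ⊗ (con 1 ⊕ q) ⊕ q ⊗ (q ⊕ b′))) ⊜ con 1 ⊕ (a ⊕ (q ⊕ b′)) ⊗ (con 1 ⊕ q)) ≡.refl a q b′

      multiple : ∀ κ → Φ P₁.* ev₂ W P₁.≈ h P₁.* κ → Φ P₁.* ρ P₁.≈ h P₁.* (κ P₁.* ev₂ (T x) P₁.+ Φ P₁.* ev₂ (L x))
      multiple κ e = begin
        Φ P₁.* ρ ≈⟨ P₁.*-congˡ {Φ} ρ≈ ⟨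
        Φ P₁.* ev₂ (E x) ≈⟨ P₁.*-congˡ {Φ} (P₁.trans (e₂.⟦⟧-+ (W P₂.* T x) (f P₂.* L x)) (P₁.+-cong (e₂.⟦⟧-* W (T x)) (P₁.trans (e₂.⟦⟧-* f (L x)) (P₁.*-congʳ ev₂-f)))) ⟩
        Φ P₁.* (ev₂ W P₁.* ev₂ (T x) P₁.+ h P₁.* ev₂ (L x)) ≈⟨ Ids.aux-id₁ B₁.PolyR Φ (ev₂ W) (ev₂ (T x)) h (ev₂ (L x)) ⟩
        (Φ P₁.* ev₂ W) P₁.* ev₂ (T x) P₁.+ h P₁.* (Φ P₁.* ev₂ (L x)) ≈⟨ P₁.+-congʳ (P₁.*-congʳ e) ⟩
        (h P₁.* κ) P₁.* ev₂ (T x) P₁.+ h P₁.* (Φ P₁.* ev₂ (L x)) ≈⟨ Ids.aux-id₂ B₁.PolyR h κ (ev₂ (T x)) (Φ P₁.* ev₂ (L x)) ⟩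
        _ ∎
        where open Relation.Binary.Reasoning.Setoid P₁.setoid

      Φ-eval : ∀ y → Hom.⟦_⟧ (evalAt y) Φ ≈ 0#
      Φ-eval y = trans (Hom.⟦⟧-+ (evalAt y) B₁.V (B₁.V P₁.^ (Q ℕ.* Q))) (≈⇒sum-0 (trans ev-V (sym (trans (Hom.⟦⟧-^ (evalAt y) B₁.V (Q ℕ.* Q))
        (trans (^-congˡ (Q ℕ.* Q) ev-V) (trans (^-congʳ y QQ≡N) (fermat y)))))))
        where open B₁.Ev (id-hom K) y using (ev-V)

      Φ-deg : B₁.Deg< (suc N) Φ
      Φ-deg = B₁.Deg<-+ B₁.V (B₁.V P₁.^ (Q ℕ.* Q)) (λ { (suc (suc i)) _ → refl ; (suc zero) (s≤s l) → ⊥-elim (ℕ.<⇒≱ (ℕ.m^n>0 2 (2 ℕ.* k)) l) })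
        (B₁.Deg<-≤ (B₁.V P₁.^ (Q ℕ.* Q)) (s≤s (ℕ.≤-reflexive QQ≡N)) (B₁.Deg<-V^ (Q ℕ.* Q)))

      -- the cofactor of h vanishes on all of F but has degree below |F|
      cofactor-0 : ∀ κ → Φ P₁.* ρ P₁.≈ h P₁.* κ → κ P₁.≈ P₁.0#
      cofactor-0 κ e = vanishing κ κ-deg λ y → noZeroDiv (trans (sym (Hom.⟦⟧-* (evalAt y) h κ)) (trans (Hom.⟦⟧-cong (evalAt y) (P₁.sym e))
          (trans (Hom.⟦⟧-* (evalAt y) Φ ρ) (*-0ˡ _ (Φ-eval y))))) (λ z → no-point y (trans (sym (eval-h y)) z))
        where
        κ-deg : B₁.Deg< N κ
        κ-deg = B₁.Deg<-factor K-domain N h κ HasDeg-h (B₁.Deg<-cong e (B₁.Deg<-≤ (Φ P₁.* ρ) (ℕ.≤-trans (ℕ.+-monoʳ-≤ N M≤) (ℕ.≤-reflexive (ℕ.+-comm N _))) (B₁.Deg<-* Φ ρ Φ-deg ρ-deg)))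

      ρ≈0 : ρ P₁.≈ P₁.0#
      ρ≈0 = D₁.stable λ k → relation λ { (κ , e) → k (D₁.noZeroDiv (P₁.trans (multiple κ e) (P₁.*-0ʳ h (cofactor-0 _ (multiple κ e)))) Φ≉0) }

      E≈0 : E x P₂.≈ P₂.0#
      E≈0 = constant-≈0 (E x) E-constant (P₁.trans ρ≈ ρ≈0)

      -- If `T` were zero, f·`L` = 0 would make `L` zero as well, and with them the whole kernel
      -- vector.
      T≉0 : ¬ T x P₂.≈ P₂.0#
      T≉0 e = proj₁ (proj₂ ker) λ t t< → split (table-≈0 (suc d) n x e t)
        (λ l → ≡.subst (λ t → x t ≈ 0#) (ℕ.m+[n∸m]≡n l) (table-≈0 (b′ ℕ.+ d) a (λ t → x (suc d ℕ.* n ℕ.+ t)) L≈0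
          (t ℕ.∸ suc d ℕ.* n) (ℕ.+-cancelˡ-< (suc d ℕ.* n) _ _ (≡.subst (_< suc d ℕ.* n ℕ.+ (b′ ℕ.+ d) ℕ.* a) (≡.sym (ℕ.m+[n∸m]≡n l)) t<))))
        where
        L≈0 : L x P₂.≈ P₂.0#
        L≈0 = D₂.noZeroDiv {f} {L x} (P₂.trans (P₂.sym (P₂.trans (P₂.+-congʳ (P₂.*-0ʳ W e)) (P₂.+-identityˡ (f P₂.* L x)))) E≈0) f≉0

    -- W·T + f·L can be made free of u because T and L have one coefficient more than there are conditions.
    multiplier : ∃₂ λ T L → Rows n T × (¬ T P₂.≈ P₂.0#) × (W P₂.* T P₂.+ f P₂.* L P₂.≈ P₂.0#)
    multiplier = T x , L x , T-rows , T≉0 , E≈0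

-- Descent along the branch

module MapCoefficients {a ℓ₁ b ℓ₂} {A : CR2 a ℓ₁} {B : CR2 b ℓ₂} (ι : Hom A B) where
  private
    module A = Poly A
    module B = Poly B
    module ι = Hom ι
    module E = A.Ev (B.C-hom ∘h ι) B.V
  open C2 B

  map-hom : Hom A.PolyR B.PolyR
  map-hom = E.ev-hom

  map-C : ∀ x → E.ev (A.C x) B.P.≈ B.C ι.⟦ x ⟧
  map-C = E.ev-C

  map-V : E.ev A.V B.P.≈ B.V
  map-V = E.ev-V

  coef-map : ∀ p i → B.coef (E.ev p) i ≈ ι.⟦ A.coef p i ⟧
  coef-map [] i = sym ι.⟦⟧-0
  coef-map (x ∷ p) zero = trans (B.coef-⊞′ (B.C ι.⟦ x ⟧) (B.V B.P.* E.ev p) 0) (trans (+-congˡ (B.coef-V⊠0 (E.ev p))) (+-identityʳ _))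
  coef-map (x ∷ p) (suc i) = trans (B.coef-⊞′ (B.C ι.⟦ x ⟧) (B.V B.P.* E.ev p) (suc i)) (trans (+-identityˡ _) (trans (B.coef-V⊠ (E.ev p) i) (coef-map p i)))

module PowerSum {κ ℓ} (𝒫 : PlaceData κ ℓ) where
  open PlaceData 𝒫
  open C2 K
  open Field F
  open Domain domain
  open Series K
  open Curve coefficients
  open Place 𝒫 using (θ; θ-hom; vanish-q)
  open PlaceB branch using (module E₁; module E₂)
  open RowDegree K
  private
    module S = C2 PS
    module SD = Domain (Ser-domain domain)

  Ord-∑ : ∀ {N} m (f : ℕ → Ser) → (∀ i → i < m → Ord N (f i)) → Ord N (S.∑ m f)
  Ord-∑ zero f h _ _ = refl
  Ord-∑ (suc m) f h = Ord-⊕ (Ord-∑ m f (λ i i< → h i (ℕ.m<n⇒m<1+n i<))) (h m (ℕ.n<1+n m))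

  Ord-^ : ∀ m a → Ord 1 a → Ord m (a S.^ m)
  Ord-^ m a o = Ord-cong (at (S.sym (S.trans (S.^-congˡ m (S.trans (mk (Ord-factor 1 a o)) (S.*-congʳ {drop 1 a} (S.^1 X)))) (S.^-distrib-* X (drop 1 a) m)))) (Ord-X^ m (drop 1 a S.^ m))

  module _ (fU : θ f S.≈ S.0#) (e : ℕ) (big : q ℕ.* suc (n ℕ.+ ((q ℕ.+ q) ℕ.+ (q ℕ.+ q))) ≤ 2 ℕ.^ e) where
    private
      E B : ℕ
      E = 2 ℕ.^ e
      B = suc (q ℕ.+ q)

    power-sum : (ℕ → ℕ → Ser) → Ser
    power-sum γ = S.∑ n (λ j → S.∑ B (λ β → γ j β S.^ E S.* (U S.^ β S.* X S.^ j)))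

    -- modulo X^E a power γ^E is the constant (γ 0)^E
    leading : ∀ γ → power-sum γ S.≈ S.0# → ∀ j β → j < n → β < B → γ j β 0 ≈ 0#
    leading γ h j β j< β< = ^-≈0 E (trans (reflexive (≡.sym (≡.trans (≡.cong (λ p → B₁.coef p β) (B₂.coef-tab n row j j<)) (B₁.coef-tab B (λ β → γ j β 0 ^ E) β β<))))
        (B₁.at (B₂.at r≈0 j) β))
      where
      row : ℕ → B₁.Pl
      row j = B₁.tab B (λ β → γ j β 0 ^ E)
      r : B₂.Pl
      r = B₂.tab n row
      θr : θ r S.≈ S.∑ n (λ j → S.∑ B (λ β → cst (γ j β 0 ^ E) S.* (U S.^ β S.* X S.^ j)))
      θr = S.trans (E₂.ev-tab n row) (S.∑-cong n λ j _ → S.trans (S.*-congʳ (E₁.ev-tab B (λ β → γ j β 0 ^ E)))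
        (S.trans (S.sym (S.∑-*ʳ B (X S.^ j) _)) (S.∑-cong B λ β _ → S.*-assoc _ _ _)))
      diff : ∀ j β → cst (γ j β 0 ^ E) S.* (U S.^ β S.* X S.^ j) S.+ γ j β S.^ E S.* (U S.^ β S.* X S.^ j) S.≈ (cst (γ j β 0) S.+ γ j β) S.^ E S.* (U S.^ β S.* X S.^ j)
      diff j β = S.trans (S.sym (S.distribʳ _ _ _)) (S.*-congʳ (S.sym (S.trans (S.frob e _ _) (S.+-congʳ (S.sym (Hom.⟦⟧-^ cst-hom (γ j β 0) E))))))
      ord-1 : ∀ j β → Ord 1 (cst (γ j β 0) S.+ γ j β)
      ord-1 j β zero _ = trans (⊕-at (cst (γ j β 0)) (γ j β) 0) (self _)
      ord-1 j β (suc i) (s≤s ())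
      ord : Ord E (θ r)
      ord = Ord-cong (at (S.sym (S.trans (S.sym (S.+-identityʳ _)) (S.trans (S.+-cong θr (S.sym h)) (S.trans (S.sym (S.∑-+ n _ _))
          (S.∑-cong n λ j _ → S.trans (S.sym (S.∑-+ B _ _)) (S.∑-cong B λ β _ → diff j β)))))))
        (Ord-∑ n _ λ j _ → Ord-∑ B _ λ β _ → Ord-⊛ (U S.^ β S.* X S.^ j) (Ord-^ E (cst (γ j β 0) S.+ γ j β) (ord-1 j β)))
      -- The polynomial r has degree at most q in v and at most 2q in u, and `big` is the order that
      -- `vanish-q` requires for these degrees.
      r≈0 : r P₂.≈ P₂.0#
      r≈0 = vanish-q fU (q ℕ.+ q) r (B₂.coef-tab-≥ n row) (Rows-tab n row (λ j → B₁.coef-tab-≥ B (λ β → γ j β 0 ^ E))) E big ord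

    -- Dividing every γ by X^m divides the sum by X^(m·E). The quotients again form a vanishing
    -- power sum, so `leading` yields the next coefficient.
    descend : ∀ m γ → power-sum γ S.≈ S.0# → (∀ j β → j < n → β < B → Ord m (γ j β)) → ∀ j β → j < n → β < B → Ord (suc m) (γ j β)
    descend m γ h o j β j< β< i i<m = at-i (ℕ.m≤n⇒m<n∨m≡n (ℕ.≤-pred i<m))
      where
      δ : ℕ → ℕ → Ser
      δ j β = drop m (γ j β)
      factor : power-sum γ S.≈ (X S.^ m) S.^ E S.* power-sum δ
      factor = S.trans (S.∑-cong n λ j j< → S.trans (S.∑-cong B λ β β< → S.trans (S.*-congʳ (S.trans (S.^-congˡ E (mk (Ord-factor m (γ j β) (o j β j< β<)))) (S.^-distrib-* (X S.^ m) (δ j β) E))) (S.*-assoc _ _ _))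
        (S.∑-*ˡ B _ _)) (S.∑-*ˡ n _ _)
      X≉0 : ¬ X S.≈ S.0#
      X≉0 z = 0≉1 (sym (at z 1))
      δ-sum : power-sum δ S.≈ S.0#
      δ-sum = SD.noZeroDiv (S.trans (S.sym factor) h) (SD.^-≉0 E (SD.^-≉0 m X≉0))
      at-i : i < m ⊎ i ≡ m → γ j β i ≈ 0#
      at-i (inj₁ l) = o j β j< β< i l
      at-i (inj₂ ≡.refl) = trans (reflexive (≡.cong (γ j β) (≡.sym (ℕ.+-identityʳ m)))) (leading δ δ-sum j β j< β<)

    all-vanish : ∀ γ → power-sum γ S.≈ S.0# → ∀ j β → j < n → β < B → γ j β S.≈ S.0#
    all-vanish γ h j β j< β< = mk λ i → ord (suc i) j β j< β< i ℕ.≤-refl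
      where
      ord : ∀ m j β → j < n → β < B → Ord m (γ j β)
      ord zero j β _ _ _ ()
      ord (suc m) = descend m γ h (ord m)

module Contradiction {κ₀ ℓ} (𝒮 : Setting κ₀ ℓ) where
  open Setting 𝒮
  open FiniteFieldFacts (2 ℕ.* k) F using (K; K-domain; K-field; fermat)
  open C2 K
  open Domain K-domain using (stable; 0≉1; ^-≈0)
  open System 𝒮 using (R; R′; B; Solution; solution; w; assembled; assembled-≈; module AtPoint)
  open Auxiliary 𝒮

  c≉0 : ¬ c ≈ 0#
  c≉0 z = 0≉1 (trans (sym (*-0ˡ ci z)) c-inv)

  module Assembled (sol : Solution) where

    mono : ℕ → ℕ → ℕ → ℕ → B₂.Pl
    mono i j β α = ν (B₁.C (w sol i j β α) P₁.* u P₁.^ (R′ ℕ.* i ℕ.+ β)) P₂.* v P₂.^ (R′ ℕ.* α ℕ.+ j)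

    opaque
      W : B₂.Pl
      W = P₂.∑ n (λ j → P₂.∑ n (λ i → P₂.∑ B (λ β → P₂.∑ A (mono i j β))))

      W-≈ : W P₂.≈ P₂.∑ n (λ j → P₂.∑ n (λ i → P₂.∑ B (λ β → P₂.∑ A (mono i j β))))
      W-≈ = P₂.refl

    -- One formula for every substitution: it is used modulo h with u = v^Q, and on the branch.
    W-image : ∀ {a ℓ′} {S : CR2 a ℓ′} (ψ : Hom B₂.PolyR S) → let module S = C2 S in
      ∀ (s : Carrier → S.Carrier) U V → (∀ x → Hom.⟦_⟧ ψ (ν (B₁.C x)) S.≈ s x) → Hom.⟦_⟧ ψ (ν u) S.≈ U → Hom.⟦_⟧ ψ v S.≈ V →
      Hom.⟦_⟧ ψ W S.≈ assembled S sol s U V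
    W-image {S = S} ψ s U V hs hU hV = S.trans (ψ.⟦⟧-cong W-≈) $ S.trans (S.trans (ψ.⟦⟧-∑ n _) (S.∑-cong n λ j _ → S.trans (ψ.⟦⟧-∑ n _) (S.∑-cong n λ i _ →
        S.trans (ψ.⟦⟧-∑ B _) (S.∑-cong B λ β _ → S.trans (ψ.⟦⟧-∑ A _) (S.∑-cong A λ α _ → at i j β α))))) (S.sym (assembled-≈ S sol s U V))
      where
      module S = C2 S
      module ψ = Hom ψ
      at : ∀ i j β α → ψ.⟦ mono i j β α ⟧ S.≈ s (w sol i j β α) S.* U S.^ (R′ ℕ.* i ℕ.+ β) S.* V S.^ (R′ ℕ.* α ℕ.+ j)
      at i j β α = S.trans (ψ.⟦⟧-* (ν x) (v P₂.^ m)) (S.*-cong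
          (S.trans (ψ.⟦⟧-cong (B₂.C-* (B₁.C (w sol i j β α)) (u P₁.^ l))) (S.trans (ψ.⟦⟧-* (ν (B₁.C (w sol i j β α))) (ν (u P₁.^ l)))
            (S.*-cong (hs (w sol i j β α)) (S.trans (ψ.⟦⟧-cong (Hom.⟦⟧-^ B₂.C-hom u l)) (S.trans (ψ.⟦⟧-^ (ν u) l) (S.^-congˡ l hU))))))
          (S.trans (ψ.⟦⟧-^ v m) (S.^-congˡ m hV)))
        where
        l m : ℕ
        l = R′ ℕ.* i ℕ.+ β
        m = R′ ℕ.* α ℕ.+ j
        x = B₁.C (w sol i j β α) P₁.* u P₁.^ l

    a b′ : ℕ
    a = R′ ℕ.* q ℕ.+ (q ℕ.+ q)
    b′ = R′ ℕ.* A′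

    W-deg : B₂.Deg< (suc (q ℕ.+ b′)) W
    W-deg = B₂.Deg<-cong (P₂.sym W-≈) $ B₂.Deg<-∑ n _ λ j j< → B₂.Deg<-∑ n _ λ i _ → B₂.Deg<-∑ B _ λ β _ → B₂.Deg<-∑ A (mono i j β) λ α α< →
      B₂.Deg<-≤ (mono i j β α) (s≤s (ℕ.≤-trans (ℕ.+-mono-≤ (ℕ.*-monoʳ-≤ R′ (ℕ.≤-pred α<)) (ℕ.≤-pred j<)) (ℕ.≤-reflexive (ℕ.+-comm b′ q))))
        (B₂.Deg<-* (ν (B₁.C (w sol i j β α) P₁.* u P₁.^ (R′ ℕ.* i ℕ.+ β))) (v P₂.^ (R′ ℕ.* α ℕ.+ j)) (B₂.Deg<-C _) (B₂.Deg<-V^ (R′ ℕ.* α ℕ.+ j)))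

    Rows-∑ : ∀ {d} m g → (∀ i → i < m → Rows d (g i)) → Rows d (P₂.∑ m g)
    Rows-∑ zero g h _ _ _ = refl
    Rows-∑ (suc m) g h = Rows-+ (P₂.∑ m g) (g m) (Rows-∑ m g (λ i i< → h i (ℕ.m<n⇒m<1+n i<))) (h m (ℕ.n<1+n m))

    W-rows : Rows (suc a) W
    W-rows = Rows-cong (P₂.sym W-≈) $ Rows-∑ n _ λ j _ → Rows-∑ n _ λ i i< → Rows-∑ B _ λ β β< → Rows-∑ A (mono i j β) λ α _ →
      Rows-≤ (mono i j β α) (ℕ.≤-trans (ℕ.≤-reflexive (ℕ.+-comm (R′ ℕ.* i ℕ.+ β) 1)) (s≤s (ℕ.+-mono-≤ (ℕ.*-monoʳ-≤ R′ (ℕ.≤-pred i<)) (ℕ.≤-pred β<))))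
        (Rows-* (ν (B₁.C (w sol i j β α) P₁.* u P₁.^ (R′ ℕ.* i ℕ.+ β))) (v P₂.^ (R′ ℕ.* α ℕ.+ j))
          (Rows-C (B₁.C (w sol i j β α) P₁.* u P₁.^ (R′ ℕ.* i ℕ.+ β)) (B₁.Deg<-* (B₁.C (w sol i j β α)) (u P₁.^ (R′ ℕ.* i ℕ.+ β)) (B₁.Deg<-C _) (B₁.Deg<-V^ (R′ ℕ.* i ℕ.+ β))))
          (Rows-V^ (R′ ℕ.* α ℕ.+ j)))

    private
      module Qt = C2 Mod.QuotR
      module π = Hom Mod.proj
      ψ : Hom B₂.PolyR Mod.QuotR
      ψ = Mod.proj ∘h ev₂-hom
      ιQ : Hom K Mod.QuotR
      ιQ = Mod.proj ∘h B₁.C-hom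
      module e₁ = B₁.Ev B₁.C-hom (B₁.V P₁.^ Q)
      module e₂ = B₂.Ev ev₁-hom B₁.V

    -- The class of V modulo h is a generic zero of h, so the identity of `AtPoint` at this element
    -- is a divisibility by h.
    relation : ¬ ¬ (∃ λ κ → Φ P₁.* ev₂ W P₁.≈ h P₁.* κ)
    relation = Mod.≈0Q (Qt.trans step (AtPoint.relation Mod.QuotR ιQ B₁.V sol on-curve (cancel-V c≉0)))
      where
      on-curve : CurveForm.curve Mod.QuotR n q (B₁.C b) (B₁.C c) (B₁.C b̄) (B₁.C c̄) (B₁.V Qt.^ Q) B₁.V Qt.≈ Qt.0#
      on-curve = Qt.trans (CurveForm.curve-cong Mod.QuotR n q Qt.refl Qt.refl Qt.refl Qt.refl (Qt.sym (π.⟦⟧-^ B₁.V Q)) Qt.refl)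
        (Qt.trans (Qt.sym (CurveFormHom.curve-hom Mod.proj n q (B₁.C b) (B₁.C c) (B₁.C b̄) (B₁.C c̄) (B₁.V P₁.^ Q) B₁.V)) (Mod.0Q P₁.1# (P₁.sym (P₁.*-identityʳ h))))
      W-Q : ev₂ W Qt.≈ assembled Mod.QuotR sol (Hom.⟦_⟧ ιQ) (B₁.V Qt.^ Q) B₁.V
      W-Q = W-image ψ (Hom.⟦_⟧ ιQ) (B₁.V Qt.^ Q) B₁.V
        (λ x → Mod.lift (P₁.trans (e₂.ev-C (B₁.C x)) (e₁.ev-C x)))
        (Qt.trans (Mod.lift (P₁.trans (e₂.ev-C u) e₁.ev-V)) (π.⟦⟧-^ B₁.V Q)) (Mod.lift e₂.ev-V)
      Φ-Q : Φ Qt.≈ B₁.V Qt.+ B₁.V Qt.^ (Q ℕ.* Q)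
      Φ-Q = Qt.+-congˡ (π.⟦⟧-^ B₁.V (Q ℕ.* Q))
      step : Φ Qt.* ev₂ W Qt.≈ (B₁.V Qt.+ B₁.V Qt.^ (Q ℕ.* Q)) Qt.* assembled Mod.QuotR sol (Hom.⟦_⟧ ιQ) (B₁.V Qt.^ Q) B₁.V
      step = Qt.*-cong Φ-Q W-Q

    -- An R′-th root: x^(2^(2k)) = x and R′ = 2^eR′ with eR + eR′ = k, so the exponent 2^(eR+k)
    -- undoes R′.
    root : Carrier → Carrier
    root x = x ^ (2 ℕ.^ (eR ℕ.+ k))

    root-R′ : ∀ x → root x ^ R′ ≈ x
    root-R′ x = trans (^-assocʳ x (2 ℕ.^ (eR ℕ.+ k)) R′) (trans (^-congʳ x (≡.trans (≡.sym (ℕ.^-distribˡ-+-* 2 (eR ℕ.+ k) eR′)) (≡.cong (2 ℕ.^_) eq))) (fermat x))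
      where
      eq : eR ℕ.+ k ℕ.+ eR′ ≡ 2 ℕ.* k
      eq = ≡.trans (≡.cong (ℕ._+ eR′) (ℕ.+-comm eR k)) (≡.trans (ℕ.+-assoc k eR eR′) (≡.trans (≡.cong (k ℕ.+_) k≡) (≡.cong (k ℕ.+_) (≡.sym (ℕ.+-identityʳ k)))))

    -- The R′-th root of the part of `W` that multiplies u^β·v^j: raising to the R′-th power turns
    -- root(w)·u^i·v^α into w·u^(R′·i)·v^(R′·α).
    Γ : ℕ → ℕ → B₂.Pl
    Γ j β = B₂.tab A (λ α → B₁.tab n (λ i → root (w sol i j β α)))

    Γ-rows : ∀ j β → Rows n (Γ j β)
    Γ-rows j β = Rows-tab A (λ α → B₁.tab n (λ i → root (w sol i j β α))) (λ α → B₁.coef-tab-≥ n (λ i → root (w sol i j β α)))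

    Γ-≈0 : ∀ j β → Γ j β P₂.≈ P₂.0# → ∀ i α → i < n → α < A → w sol i j β α ≈ 0#
    Γ-≈0 j β e i α i< α< = trans (sym (root-R′ (w sol i j β α))) (trans (^-congˡ R′ (trans (reflexive (≡.sym (≡.trans
      (≡.cong (λ p → B₁.coef p i) (B₂.coef-tab A (λ α → B₁.tab n (λ i → root (w sol i j β α))) α α<)) (B₁.coef-tab n (λ i → root (w sol i j β α)) i i<)))) (B₁.at (B₂.at e α) i))) (0^ R′ (ℕ.m^n>0 2 eR′)))

    module Branch (ext : Extension K P) (T L : B₂.Pl) (T-rows : Rows n T) (T≉0 : ¬ T P₂.≈ P₂.0#) (WT : W P₂.* T P₂.+ f P₂.* L P₂.≈ P₂.0#)
      (big : q ℕ.* suc (n ℕ.+ ((q ℕ.+ q) ℕ.+ (q ℕ.+ q))) ≤ R′) where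
      open Extension ext using (ι; L-field; is-root) renaming (L to 𝕃; root to π₀)
      private
        module 𝕃 = C2 𝕃
        module ι = Hom ι
        module 𝔻 = Domain (Field.domain L-field)
        module Ps = Series 𝕃
        module S = C2 Ps.PS
        module SD = Domain (Ps.Ser-domain (Field.domain L-field))
        module M₁ = MapCoefficients ι
        module M₂ = MapCoefficients M₁.map-hom
        module m₁ = Hom M₁.map-hom
        module m₂ = Hom M₂.map-hom

      ι-inv : ∀ {x y} → x * y ≈ 1# → ι.⟦ x ⟧ 𝕃.* ι.⟦ y ⟧ 𝕃.≈ 𝕃.1#
      ι-inv e = 𝕃.trans (𝕃.sym (ι.⟦⟧-* _ _)) (𝕃.trans (ι.⟦⟧-cong e) ι.⟦⟧-1)

      ι-injective : ∀ x → ι.⟦ x ⟧ 𝕃.≈ 𝕃.0# → x ≈ 0#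
      ι-injective x z = stable λ nx → 𝔻.0≉1 (𝕃.trans (𝕃.sym (𝕃.*-0ˡ _ z)) (ι-inv (proj₂ (FiniteField.inverse F x nx))))

      c̄-inv : c̄ * ci ^ Q ≈ 1#
      c̄-inv = trans (sym (^-distrib-* c ci Q)) (trans (^-congˡ Q c-inv) (1^ Q))

      π-root : π₀ 𝕃.^ n 𝕃.+ (ι.⟦ b ⟧ 𝕃.* π₀ 𝕃.+ ι.⟦ c ⟧) 𝕃.≈ 𝕃.0#
      π-root = 𝕃.trans (𝕃.sym (𝕃.trans (CurveFormHom.form-hom (B₁.Ev.ev-hom ι π₀) n (B₁.C b) (B₁.C c) B₁.V)
        (CurveForm.form-cong 𝕃 n (B₁.Ev.ev-C ι π₀ b) (B₁.Ev.ev-C ι π₀ c) (B₁.Ev.ev-V ι π₀)))) is-root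

      curve𝕃 : CurveData κ₀ (κ₀ ⊔ ℓ)
      curve𝕃 = record
        { coefficients = record { K = 𝕃 ; q₂ = q₂ ; b = ι.⟦ b ⟧ ; c = ι.⟦ c ⟧ ; b′ = ι.⟦ b̄ ⟧ ; c′ = ι.⟦ c̄ ⟧ }
        ; F = L-field ; r₀ = r₀ ; q≡ = q≡ ; ci = ι.⟦ ci ⟧ ; ci′ = ι.⟦ ci ^ Q ⟧ ; c-inv = ι-inv c-inv ; c′-inv = ι-inv c̄-inv }

      private
        module X = Curve (CurveData.coefficients curve𝕃)
        module H = Hensel curve𝕃 π₀

      place : PlaceData κ₀ (κ₀ ⊔ ℓ)
      place = H.placeData π-root

      U : Ps.Ser
      U = H.U π-root

      open Place place using (θ; θ-hom; vanish-u)
      open PlaceB (PlaceData.branch place) using (module E₁; module E₂)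
      open PowerSum place using (power-sum; all-vanish)

      fU : θ X.f S.≈ S.0#
      fU = H.fU π-root

      Θ : Hom B₂.PolyR Ps.PS
      Θ = θ-hom ∘h M₂.map-hom

      private
        module Θ = Hom Θ
        module θ = Hom θ-hom

      map-f : m₂.⟦ f ⟧ X.P₂.≈ X.f
      map-f = X.P₂.trans (m₂.⟦⟧-+ (ν P P₂.* f̂) (ν (u P₁.^ q) P₂.* v P₂.^ q)) (X.P₂.+-cong
        (X.P₂.trans (m₂.⟦⟧-* (ν P) f̂) (X.P₂.*-cong
          (X.P₂.trans (M₂.map-C P) (Hom.⟦⟧-cong X.B₂.C-hom (X.P₁.trans (CurveFormHom.form-hom M₁.map-hom n (B₁.C b) (B₁.C c) B₁.V)
            (CurveForm.form-cong X.B₁.PolyR n (M₁.map-C b) (M₁.map-C c) M₁.map-V))))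
          (X.P₂.trans (CurveFormHom.form-hom M₂.map-hom n (ν (B₁.C b̄)) (ν (B₁.C c̄)) v)
            (CurveForm.form-cong X.B₂.PolyR n (map-νC b̄) (map-νC c̄) M₂.map-V))))
        (X.P₂.trans (m₂.⟦⟧-* (ν (u P₁.^ q)) (v P₂.^ q)) (X.P₂.*-cong
          (X.P₂.trans (M₂.map-C (u P₁.^ q)) (Hom.⟦⟧-cong X.B₂.C-hom (X.P₁.trans (m₁.⟦⟧-^ u q) (X.P₁.^-congˡ q M₁.map-V))))
          (X.P₂.trans (m₂.⟦⟧-^ v q) (X.P₂.^-congˡ q M₂.map-V)))))
        where
        map-νC : ∀ x → m₂.⟦ ν (B₁.C x) ⟧ X.P₂.≈ X.ν (X.B₁.C ι.⟦ x ⟧)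
        map-νC x = X.P₂.trans (M₂.map-C (B₁.C x)) (Hom.⟦⟧-cong X.B₂.C-hom (M₁.map-C x))

      Θ-C : ∀ x → Θ.⟦ ν (B₁.C x) ⟧ S.≈ Ps.cst ι.⟦ x ⟧
      Θ-C x = S.trans (θ.⟦⟧-cong (X.P₂.trans (M₂.map-C (B₁.C x)) (Hom.⟦⟧-cong X.B₂.C-hom (M₁.map-C x)))) (S.trans (E₂.ev-C (X.B₁.C ι.⟦ x ⟧)) (E₁.ev-C ι.⟦ x ⟧))

      Θ-u : Θ.⟦ ν u ⟧ S.≈ U
      Θ-u = S.trans (θ.⟦⟧-cong (X.P₂.trans (M₂.map-C u) (Hom.⟦⟧-cong X.B₂.C-hom M₁.map-V))) (S.trans (E₂.ev-C X.u) E₁.ev-V)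

      Θ-v : Θ.⟦ v ⟧ S.≈ Ps.X
      Θ-v = S.trans (θ.⟦⟧-cong M₂.map-V) E₂.ev-V

      coef₂ : ∀ p j i → X.B₁.coef (X.B₂.coef m₂.⟦ p ⟧ j) i 𝕃.≈ ι.⟦ B₁.coef (B₂.coef p j) i ⟧
      coef₂ p j i = 𝕃.trans (X.B₁.at (M₂.coef-map p j) i) (M₁.coef-map (B₂.coef p j) i)

      Θ-injective : ∀ p → Rows n p → Θ.⟦ p ⟧ S.≈ S.0# → p P₂.≈ P₂.0#
      Θ-injective p h z = B₂.mk λ j → B₁.mk λ i → ι-injective _ (𝕃.trans (𝕃.sym (coef₂ p j i)) (X.B₁.at (X.B₂.at p≈0 j) i))
        where
        p≈0 : m₂.⟦ p ⟧ X.P₂.≈ X.P₂.0#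
        p≈0 = vanish-u fU m₂.⟦ p ⟧ (λ j i l → 𝕃.trans (coef₂ p j i) (ι.⟦⟧-≈0 (h j i l))) z

      -- W·T is a multiple of f and so vanishes on the branch, whereas T, nonzero and of degree at
      -- most q in u, does not.
      ΘW : Θ.⟦ W ⟧ S.≈ S.0#
      ΘW = SD.noZeroDiv (S.trans (S.*-comm Θ.⟦ T ⟧ Θ.⟦ W ⟧) (S.trans (S.sym (Θ.⟦⟧-* W T)) (S.trans (S.sym (S.+-identityʳ _))
        (S.trans (S.+-congˡ (S.sym (S.trans (Θ.⟦⟧-* f L) (S.*-0ˡ Θ.⟦ L ⟧ (S.trans (θ.⟦⟧-cong map-f) fU))))) (S.trans (S.sym (Θ.⟦⟧-+ (W P₂.* T) (f P₂.* L))) (Θ.⟦⟧-≈0 WT))))))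
        (λ z → T≉0 (Θ-injective T T-rows z))

      term : ℕ → ℕ → ℕ → ℕ → Ps.Ser
      term i j β α = Ps.cst ι.⟦ w sol i j β α ⟧ S.* U S.^ (R′ ℕ.* i ℕ.+ β) S.* Ps.X S.^ (R′ ℕ.* α ℕ.+ j)

      Θ-Γ : ∀ j β → Θ.⟦ Γ j β ⟧ S.≈ S.∑ A (λ α → S.∑ n (λ i → Ps.cst ι.⟦ root (w sol i j β α) ⟧ S.* U S.^ i S.* Ps.X S.^ α))
      Θ-Γ j β = S.trans (Θ.⟦⟧-cong (B₂.tab-∑ A (λ α → B₁.tab n (λ i → root (w sol i j β α))))) (S.trans (Θ.⟦⟧-∑ A _) (S.∑-cong A λ α _ →
        S.trans (Θ.⟦⟧-* (ν (B₁.tab n (λ i → root (w sol i j β α)))) (v P₂.^ α)) (S.trans (S.*-cong (inner α) (S.trans (Θ.⟦⟧-^ v α) (S.^-congˡ α Θ-v))) (S.sym (S.∑-*ʳ n (Ps.X S.^ α) _)))))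
        where
        Θν : Hom B₁.PolyR Ps.PS
        Θν = Θ ∘h B₂.C-hom
        module Θν = Hom Θν
        inner : ∀ α → Θν.⟦ B₁.tab n (λ i → root (w sol i j β α)) ⟧ S.≈ S.∑ n (λ i → Ps.cst ι.⟦ root (w sol i j β α) ⟧ S.* U S.^ i)
        inner α = S.trans (Θν.⟦⟧-cong (B₁.tab-∑ n (λ i → root (w sol i j β α)))) (S.trans (Θν.⟦⟧-∑ n _) (S.∑-cong n λ i _ →
          S.trans (Θν.⟦⟧-* (B₁.C (root (w sol i j β α))) (u P₁.^ i)) (S.*-cong (Θ-C (root (w sol i j β α))) (S.trans (Θν.⟦⟧-^ u i) (S.^-congˡ i Θ-u)))))

      term-≈ : ∀ i j β α → (Ps.cst ι.⟦ root (w sol i j β α) ⟧ S.* U S.^ i S.* Ps.X S.^ α) S.^ R′ S.* (U S.^ β S.* Ps.X S.^ j) S.≈ term i j β α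
      term-≈ i j β α = begin
        (Ps.cst ι.⟦ x ⟧ S.* U S.^ i S.* Ps.X S.^ α) S.^ R′ S.* (U S.^ β S.* Ps.X S.^ j)
          ≈⟨ S.*-congʳ (S.trans (S.^-distrib-* _ (Ps.X S.^ α) R′) (S.*-cong (S.trans (S.^-distrib-* (Ps.cst ι.⟦ x ⟧) (U S.^ i) R′) (S.*-cong
               (S.trans (S.sym (Hom.⟦⟧-^ Ps.cst-hom ι.⟦ x ⟧ R′)) (Hom.⟦⟧-cong Ps.cst-hom (𝕃.trans (𝕃.sym (ι.⟦⟧-^ x R′)) (ι.⟦⟧-cong (root-R′ (w sol i j β α))))))
               (swap U i))) (swap Ps.X α))) ⟩
        (Ps.cst ι.⟦ w sol i j β α ⟧ S.* U S.^ (R′ ℕ.* i) S.* Ps.X S.^ (R′ ℕ.* α)) S.* (U S.^ β S.* Ps.X S.^ j)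
          ≈⟨ Ids.pow-id Ps.PS (Ps.cst ι.⟦ w sol i j β α ⟧) (U S.^ (R′ ℕ.* i)) (U S.^ β) (Ps.X S.^ (R′ ℕ.* α)) (Ps.X S.^ j) ⟨
        _ ≈⟨ S.*-cong (S.*-congˡ (S.sym (S.^-homo-* U (R′ ℕ.* i) β))) (S.sym (S.^-homo-* Ps.X (R′ ℕ.* α) j)) ⟩
        term i j β α ∎
        where
        open Relation.Binary.Reasoning.Setoid S.setoid
        x = root (w sol i j β α)
        swap : ∀ y m → (y S.^ m) S.^ R′ S.≈ y S.^ (R′ ℕ.* m)
        swap y m = S.trans (S.^-assocʳ y m R′) (S.^-congʳ y (ℕ.*-comm m R′))

      Γ-sum : power-sum fU eR′ big (λ j β → Θ.⟦ Γ j β ⟧) S.≈ S.0#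
      Γ-sum = S.trans (S.∑-cong n λ j _ → S.trans (S.∑-cong B λ β _ → block j β) (S.sym (S.∑-swap n B _)))
          (S.trans (S.sym (S.trans (W-image Θ (λ x → Ps.cst ι.⟦ x ⟧) U Ps.X Θ-C Θ-u Θ-v) (assembled-≈ Ps.PS sol (λ x → Ps.cst ι.⟦ x ⟧) U Ps.X))) ΘW)
        where
        block : ∀ j β → Θ.⟦ Γ j β ⟧ S.^ R′ S.* (U S.^ β S.* Ps.X S.^ j) S.≈ S.∑ n (λ i → S.∑ A (term i j β))
        block j β = S.trans (S.*-congʳ (S.trans (S.^-congˡ R′ (Θ-Γ j β)) (S.trans (S.∑-frob eR′ A _) (S.∑-cong A λ α _ → S.∑-frob eR′ n _))))
          (S.trans (S.sym (S.∑-*ʳ A _ _)) (S.trans (S.∑-cong A λ α _ → S.trans (S.sym (S.∑-*ʳ n _ _)) (S.∑-cong n λ i _ → term-≈ i j β α)) (S.∑-swap A n _)))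

      absurd : ⊥
      absurd = Solution.nonzero sol λ i j β α i< j< β< α< →
        Γ-≈0 j β (Θ-injective (Γ j β) (Γ-rows j β) (all-vanish fU eR′ big (λ j β → Θ.⟦ Γ j β ⟧) Γ-sum j β j< β<)) i α i< α<

  contradiction : (∀ x → ¬ CurveForm.curve K n q b c b̄ c̄ (x ^ Q) x ≈ 0#) → n ℕ.* (n ℕ.* (B ℕ.* q)) < n ℕ.* (R ℕ.* q) →
    q ℕ.* suc (n ℕ.+ ((q ℕ.+ q) ℕ.+ (q ℕ.+ q))) ≤ R′ → ⊥
  contradiction no-point fewer big = Kronecker.extension K K-field q P (Deg-P , λ e → 0≉1 (trans (sym e) P-top)) λ ext →
      go ext (multiplier no-point W a b′ small W-deg W-rows relation)
    where
    open Assembled (solution fewer)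
    go : Extension K P → (∃₂ λ T L → Rows n T × (¬ T P₂.≈ P₂.0#) × (W P₂.* T P₂.+ f P₂.* L P₂.≈ P₂.0#)) → ⊥
    go ext (T , L , T-rows , T≉0 , WT) = Branch.absurd ext T L T-rows T≉0 WT big
    3q≤R′ : q ℕ.* 3 ≤ R′
    3q≤R′ = ℕ.≤-trans (ℕ.*-monoʳ-≤ q {3} {suc (n ℕ.+ ((q ℕ.+ q) ℕ.+ (q ℕ.+ q)))} (s≤s (s≤s (s≤s z≤n)))) big
    -- The left side equals R′·(R - 1) + 3q: the q residues given up through A = R - q leave one
    -- spare R′, which covers 3q.
    small : a ℕ.+ (q ℕ.+ b′) ≤ Q
    small = ℕ.≤-trans (ℕ.≤-reflexive (solve′ 3 (λ s q A′ → (s ⊗ q ⊕ (q ⊕ q)) ⊕ (q ⊕ s ⊗ A′) ⊜ q ⊗ con 3 ⊕ s ⊗ (A′ ⊕ q)) ≡.refl R′ q A′))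
      (ℕ.≤-trans (ℕ.+-monoˡ-≤ (R′ ℕ.* (A′ ℕ.+ q)) 3q≤R′) (ℕ.≤-reflexive (≡.trans (≡.sym (ℕ.*-suc R′ (A′ ℕ.+ q))) (≡.trans (≡.cong (R′ ℕ.*_) A+q) (≡.trans (ℕ.*-comm R′ R) RR′)))))
      where open +-*-Solver using (con) renaming (solve to solve′; _:+_ to _⊕_; _:*_ to _⊗_; _:=_ to _⊜_)

-- Choice of the parameters and conclusion

module Parameters (k r₀ : ℕ) (bound : 8 ℕ.* (suc r₀ ℕ.+ 1) < 2 ℕ.* k) where
  open +-*-Solver

  r q₂ q eR eR′ ε A′ : ℕ
  r = suc r₀
  q₂ = 2 ℕ.^ r ℕ.∸ 2
  q = suc (suc q₂)
  eR = (r ℕ.+ 2) ℕ.+ r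
  eR′ = k ℕ.∸ eR
  ε = 2 ℕ.^ (r ℕ.+ 2)
  A′ = 2 ℕ.^ eR ℕ.∸ suc q

  q≡ : q ≡ 2 ℕ.^ r
  q≡ = ℕ.m+[n∸m]≡n (ℕ.*-monoʳ-≤ 2 (ℕ.m^n>0 2 r₀))

  ε≡ : ε ≡ 4 ℕ.* q
  ε≡ = ≡.trans (ℕ.^-distribˡ-+-* 2 r 2) (≡.trans (ℕ.*-comm (2 ℕ.^ r) 4) (≡.cong (4 ℕ.*_) (≡.sym q≡)))

  εq : ε ℕ.* q ≡ 2 ℕ.^ eR
  εq = ≡.trans (≡.cong (ε ℕ.*_) q≡) (≡.sym (ℕ.^-distribˡ-+-* 2 (r ℕ.+ 2) r))

  R≡ : 2 ℕ.^ eR ≡ 4 ℕ.* q ℕ.* q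
  R≡ = ≡.trans (≡.sym εq) (≡.cong (ℕ._* q) ε≡)

  A+q : suc A′ ℕ.+ q ≡ 2 ℕ.^ eR
  A+q = ≡.trans (≡.sym (ℕ.+-suc A′ q)) (ℕ.m∸n+n≡m (ℕ.≤-trans (ℕ.≤-trans (ℕ.m≤m+n (suc q) _) (ℕ.≤-reflexive
    (solve 1 (λ t → (con 3 :+ t) :+ (con 13 :+ con 15 :* t :+ con 4 :* t :* t) := con 4 :* (con 2 :+ t) :* (con 2 :+ t)) ≡.refl q₂))) (ℕ.≤-reflexive (≡.sym R≡))))

  -- Both sides of 8·(r+1) < 2k are even, so they differ by at least 2. This gives k ≥ 4r + 5 = (2r
  -- + 2) + (2r + 3), the exponents of 4q² and 8q².
  exponents : eR ℕ.+ (r ℕ.+ r ℕ.+ 3) ≤ k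
  exponents = ℕ.*-cancelˡ-≤ 2 (ℕ.≤-trans (ℕ.≤-reflexive (solve 1 (λ r → con 2 :* ((r :+ con 2 :+ r) :+ (r :+ r :+ con 3)) := con 2 :+ con 8 :* (r :+ con 1)) ≡.refl r)) (even (r ℕ.+ 1) bound))
    where
    even : ∀ m → 8 ℕ.* m < 2 ℕ.* k → 2 ℕ.+ 8 ℕ.* m ≤ 2 ℕ.* k
    even m l = ℕ.≤-trans (ℕ.≤-reflexive (solve 1 (λ m → con 2 :+ con 8 :* m := con 2 :* (con 1 :+ con 4 :* m)) ≡.refl m))
      (ℕ.*-monoʳ-≤ 2 (ℕ.*-cancelˡ-< 2 (4 ℕ.* m) k (ℕ.≤-trans (ℕ.≤-reflexive (≡.cong suc (solve 1 (λ m → con 2 :* (con 4 :* m) := con 8 :* m) ≡.refl m))) l)))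

  k≡ : eR ℕ.+ eR′ ≡ k
  k≡ = ℕ.m+[n∸m]≡n (ℕ.≤-trans (ℕ.m≤m+n eR _) exponents)

  1≤k : 1 ≤ k
  1≤k = ℕ.≤-trans (s≤s z≤n) exponents

  R′≥ : 8 ℕ.* q ℕ.* q ≤ 2 ℕ.^ eR′
  R′≥ = ℕ.≤-trans (ℕ.≤-reflexive (≡.sym eq)) (ℕ.^-monoʳ-≤ 2 (ℕ.+-cancelˡ-≤ eR _ _ (ℕ.≤-trans exponents (ℕ.≤-reflexive (≡.sym k≡)))))
    where
    eq : 2 ℕ.^ (r ℕ.+ r ℕ.+ 3) ≡ 8 ℕ.* q ℕ.* q
    eq = ≡.trans (ℕ.^-distribˡ-+-* 2 (r ℕ.+ r) 3) (≡.trans (≡.cong (ℕ._* 8) (≡.trans (ℕ.^-distribˡ-+-* 2 r r) (≡.cong (λ t → t ℕ.* t) (≡.sym q≡))))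
      (solve 1 (λ q → q :* q :* con 8 := con 8 :* q :* q) ≡.refl q))

  -- The left side is 2q² + 3q + 1. It exceeds 2q² but, for q ≥ 2, not 4q², which decides the power
  -- of two taken for R.
  nB<R : suc q ℕ.* suc (q ℕ.+ q) < 4 ℕ.* q ℕ.* q
  nB<R = ℕ.≤-trans (ℕ.m≤m+n (suc (suc q ℕ.* suc (q ℕ.+ q))) (2 ℕ.* q₂ ℕ.* q₂ ℕ.+ 5 ℕ.* q₂)) (ℕ.≤-reflexive
      (solve 1 (λ t → (con 1 :+ (con 3 :+ t) :* (con 1 :+ ((con 2 :+ t) :+ (con 2 :+ t)))) :+ (con 2 :* t :* t :+ con 5 :* t) := con 4 :* (con 2 :+ t) :* (con 2 :+ t)) ≡.refl q₂))

  fewer : suc q ℕ.* (suc q ℕ.* (suc (q ℕ.+ q) ℕ.* q)) < suc q ℕ.* (2 ℕ.^ eR ℕ.* q)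
  fewer = ℕ.*-monoʳ-< (suc q) (≡.subst₂ _<_ (ℕ.*-assoc (suc q) (suc (q ℕ.+ q)) q) (≡.cong (ℕ._* q) (≡.sym R≡)) (ℕ.*-monoˡ-< q {suc q ℕ.* suc (q ℕ.+ q)} {4 ℕ.* q ℕ.* q} nB<R))

  -- The left side is 5q² + 2q, and 8q² is the first power of two above it.
  big : q ℕ.* suc (suc q ℕ.+ ((q ℕ.+ q) ℕ.+ (q ℕ.+ q))) ≤ 2 ℕ.^ eR′
  big = ℕ.≤-trans (ℕ.≤-trans (ℕ.m≤m+n _ (q ℕ.* (4 ℕ.+ 3 ℕ.* q₂))) (ℕ.≤-reflexive
    (solve 1 (λ t → let q = con 2 :+ t in q :* (con 2 :+ q :+ ((q :+ q) :+ (q :+ q))) :+ q :* (con 4 :+ con 3 :* t) := con 8 :* q :* q) ≡.refl q₂))) R′≥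

  small : 2 ℕ.* 2 ℕ.^ r ℕ.+ 2 ≤ 2 ℕ.^ k
  small = ℕ.≤-trans (≡.subst (λ t → 2 ℕ.* t ℕ.+ 2 ≤ 2 ℕ.^ eR′) q≡ (ℕ.≤-trans (ℕ.≤-trans (ℕ.m≤m+n _ (26 ℕ.+ 30 ℕ.* q₂ ℕ.+ 8 ℕ.* q₂ ℕ.* q₂)) (ℕ.≤-reflexive
      (solve 1 (λ t → let q = con 2 :+ t in con 2 :* q :+ con 2 :+ (con 26 :+ con 30 :* t :+ con 8 :* t :* t) := con 8 :* q :* q) ≡.refl q₂))) R′≥))
    (ℕ.^-monoʳ-≤ 2 (ℕ.m∸n≤m k eR))

module _ {ℓc ℓe : Level} (k : ℕ) (F : FiniteField ℓc ℓe (2 ℕ.^ (2 ℕ.* k))) (r₀ : ℕ) (coprime : gcd (suc r₀) (2 ℕ.* k) ≡ 1)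
  (bound : 8 ℕ.* (suc r₀ ℕ.+ 1) < 2 ℕ.* k) (b c : FiniteField.Carrier F) (c≉0 : ¬ FiniteField._≈_ F c (FiniteField.0# F)) where
  open Parameters k r₀ bound
  open APNLemmas k r F using (K; conj-conj; point-not-APN; P)
  open C2 K
  open CurveForm K
  private
    Q : ℕ
    Q = 2 ℕ.^ k

  -- A zero x of h gives the point u = x^Q, whose conjugate u^Q is x; the two factors of h are then
  -- P(u) and its conjugate.
  curve-point-not-APN : ∀ x → curve (suc q) q b c (b ^ Q) (c ^ Q) (x ^ Q) x ≈ 0# → ¬ FiniteField.APN F (FiniteField.fbcr F k b c r)
  curve-point-not-APN x e = point-not-APN coprime (s≤s z≤n) small b c c≉0 u (trans (+-cong (*-cong Pu (trans (^-congˡ Q Pu) Pu-conj)) (*-cong (uq u) (trans (^-congˡ Q (uq u)) uq-conj))) e)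
    where
    u : Carrier
    u = x ^ Q
    uq : ∀ u → u ^ (2 ℕ.^ r) ≈ u ^ q
    uq u = ^-congʳ u (≡.sym q≡)
    Pu : P b c u ≈ form (suc q) b c u
    Pu = +-congʳ (trans (*-comm _ _) (*-congˡ (uq u)))
    Pu-conj : form (suc q) b c u ^ Q ≈ form (suc q) (b ^ Q) (c ^ Q) x
    Pu-conj = trans (form-frob k (suc q) b c u) (form-cong (suc q) refl refl (conj-conj x))
    uq-conj : (u ^ q) ^ Q ≈ x ^ q
    uq-conj = trans (^-swap u q Q) (^-congˡ q (conj-conj x))

  not-APN : ¬ FiniteField.APN F (FiniteField.fbcr F k b c r)
  not-APN apn = contradiction (λ x e → curve-point-not-APN x e apn) fewer big
    where
    setting : Setting ℓc ℓe
    setting = record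
      { k = k ; F = F ; r₀ = r₀ ; q₂ = q₂ ; eR = eR ; eR′ = eR′ ; ε = ε ; A′ = A′ ; 1≤k = 1≤k ; q≡ = q≡ ; εq = εq ; A+q = A+q ; k≡ = k≡
      ; b = b ; c = c ; ci = proj₁ (FiniteField.inverse F c c≉0) ; c-inv = proj₂ (FiniteField.inverse F c c≉0) }
    open Contradiction setting using (contradiction)

open import Data.Nat using (_+_; _*_; _^_)

theorem4p2 : ∀ {ℓc ℓe : Level} (k : ℕ) → 1 ≤ k → (F : FiniteField ℓc ℓe (2 ^ (2 * k)))
  → ∀ (r : ℕ) → 1 ≤ r → 2 * r < 2 * k → gcd r (2 * k) ≡ 1
  → ((b c : FiniteField.Carrier F) → ¬ (FiniteField._≈_ F c (FiniteField.0# F))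
      → 8 * (r + 1) < 2 * k
      → ¬ FiniteField.APN F (FiniteField.fbcr F k b c r))
    × ((b : FiniteField.Carrier F) → ¬ (FiniteField._≈_ F b (FiniteField.0# F))
      → ¬ FiniteField.APN F (FiniteField.fbcr F k b (FiniteField.0# F) r))
theorem4p2 k 1≤k F (suc r₀) 1≤r r<k coprime =
  (λ b c c≉0 bound → not-APN k F r₀ coprime bound b c c≉0) , λ b _ → APNLemmas.not-APN-0 k (suc r₀) F 1≤k b
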